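{- Let $Q$ be a type $A$ quiver with vertex set $Q_0=\{1,\dots,n\}$, $n\ge 2$, such that every arrow of $Q$ lies in an oriented $3$-cycle of $Q$. Fix a vertex $i_0$ of $Q$ of degree $2$ in the underlying graph, and for $i\in Q_0$ let $d(i)$ be the length of a shortest directed path from $i_0$ to $i$. Let $\mathbf{a}=(a_1,\dots,a_n)\in\mathbb{Z}_{\ge 0}^n$ be the $\mathbf{d}$-vector of a cluster monomial of $\mathcal{A}(Q)$, and let $x[\mathbf{a}]$ be this cluster monomial. For $i\in Q_0$ let $\mathbf{s}_i=(s_{i,1},\dots,s_{i,a_i})\in\{0,1\}^{a_i}$, and put $|\mathbf{s}_i|=\sum_{r=1}^{a_i}s_{i,r}$, $|\bar{\mathbf{s}}_i|=a_i-|\mathbf{s}_i|$. Call $\mathbf{s}=(\mathbf{s}_1,\dots,\mathbf{s}_n)$ a globally compatible sequence (GCS) if for every $3$-cycle $i\to j\to k\to i$ of $Q$: - if $d(i)<d(j)<d(k)$, then $(s_{i,t},s_{j,t})\neq(1,0)$ for $1\le t\le\sigma_{ijk}$; - if $d(j)<d(k)<d(i)$, then $(s_{i,a_i+1-t},s_{j,a_j+1-t})\neq(1,0)$ for $1\le t\le\sigma_{ijk}$; - if $d(k)<d(i)<d(j)$, then $(s_{i,a_i+1-t},s_{j,t})\neq(1,0)$ for $1\le t\le\sigma_{ijk}$. Then $$x[\mathbf{a}]=\Big(\prod_{l=1}^n x_l^{ -a_l}\Big)\sum_{\mathbf{s}}\prod_{i=1}^n x_i^{e_i},\qquad e_i=\sum_{i\to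 j}|\bar{\mathbf{s}}_j|+\sum_{k\to i}|\mathbf{s}_k|-\sum_{i\to j\to k\to i}\sigma_{jki},$$ where $\mathbf{s}$ runs over all GCSs, the first sum in $e_i$ is over arrows of $Q$ with tail $i$, the second over arrows with head $i$, and the third over the $3$-cycles $i\to j\to k\to i$ of $Q$ passing through $i$ (written starting from $i$).
   Context: A quiver is a finite directed graph without loops and without oriented $2$-cycles. For a quiver $R$ on vertices $\{1,\dots,N\}$, the coefficient-free cluster algebra $\mathcal{A}(R)\subset\mathbb{Q}(x_1,\dots,x_N)$ is defined as follows. A seed is a pair $(\mathbf{u},R')$ with $\mathbf{u}=(u_1,\dots,u_N)$ a free generating set of the field and $R'$ a quiver. Mutation at $k$ replaces $R'$ by $\mu_k(R')$: for each path $i\to k\to j$ add an arrow $i\to j$, reverse all arrows at $k$, and delete $2$-cycles. It also replaces $u_k$ by $u_k'=(\prod_{j\to k}u_j+\prod_{k\to j}u_j)/u_k$. Clusters are the tuples obtained from $((x_1,\dots,x_N),R)$ by iterated mutations. Cluster variables are their entries, and a cluster monomial is a product of nonnegative powers of cluster variables from one cluster. A type $A$ quiver is a quiver mutation-equivalent to $1\to2\to\cdots\to N$. Such a quiver arises from a triangulation of a convex $(N+3)$-gon by pairwise non-crossing diagonals $T_1,\dots,T_N$: there is an arrow $i\to j$ iff $T_i,T_j$ are two sides of a triangle of the triangulation and $T_j$ is obtained from $T_i$ by a counterclockwise rotation (by less than $180^\circ$) about their common endpoint. Fix such a triangulation. The cluster variables correspond bijectively to the diagonals, with $x_i\leftrightarrow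 T_i$. Cluster monomials correspond to collections $\{(D_1,d_1),\dots,(D_m,d_m)\}$ of pairwise distinct, pairwise non-crossing diagonals $D_j$ with positive integers $d_j$. For diagonals $D,E$ set $i(D,E)=1$ if they cross in the interior, $-1$ if $D=E$, and $0$ otherwise. The $\mathbf{d}$-vector of the monomial is $(a_1,\dots,a_N)$ with $a_i=\sum_j d_j\,i(D_j,T_i)$. Write $[x]_+=\max(x,0)$ and $\sigma(x,y,z)=\tfrac12\big([x+y-z]_+-[x-y-z]_+-[y-x-z]_+\big)$ for $x,y,z\ge0$. Set $\sigma_{ijk}=\sigma(a_i,a_j,a_k)$. -}

module Defs where

open import Data.Bool using (Bool; true; false; _∧_; _∨_; not; if_then_else_; T)
open import Data.Nat as ℕ using (ℕ; zero; suc; _∸_; _<ᵇ_; _≡ᵇ_; ⌊_/2⌋; _<_; _≤_)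
open import Data.Nat.DivMod using (_%_)
open import Data.Integer as ℤ using (ℤ; +_; -[1+_]; 0ℤ; 1ℤ)
open import Data.Fin using (Fin; zero; suc; _≟_)
open import Data.Vec using (Vec; []; _∷_; tabulate; replicate; zipWith)
open import Data.Vec.Properties using (≡-dec)
open import Data.List using (List; []; _∷_; _++_; map; concatMap; foldr; upTo; allFin)
open import Data.Bool.ListAction using (any; all)
open import Data.Product using (_×_; _,_; proj₁; proj₂; Σ; ∃)
open import Data.Sum using (_⊎_)
open import Relation.Nullary using (¬_; does)
open import Relation.Binary.PropositionalEquality using (_≡_; _≢_)

sumℕ : ∀ {n} → (Fin n → ℕ) → ℕ
sumℕ {zero} f = 0
sumℕ {suc n} f = f zero ℕ.+ sumℕ (λ i → f (suc i))

sumℤ : ∀ {n} → (Fin n → ℤ) → ℤ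
sumℤ {zero} f = 0ℤ
sumℤ {suc n} f = f zero ℤ.+ sumℤ (λ i → f (suc i))

anyFin : ∀ {n} → (Fin n → Bool) → Bool
anyFin {n} p = any p (allFin n)

allFin? : ∀ {n} → (Fin n → Bool) → Bool
allFin? {n} p = all p (allFin n)

_==F_ : ∀ {n} → Fin n → Fin n → Bool
i ==F j = does (i ≟ j)

Poly : ℕ → Set
Poly n = List (ℤ × Vec ℕ n)

coeff : ∀ {n} → Poly n → Vec ℕ n → ℤ
coeff [] e = 0ℤ
coeff ((c , f) ∷ p) e = if does (≡-dec ℕ._≟_ f e) then c ℤ.+ coeff p e else coeff p e

_≈P_ : ∀ {n} → Poly n → Poly n → Set
p ≈P q = ∀ e → coeff p e ≡ coeff q e

_+P_ : ∀ {n} → Poly n → Poly n → Poly n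
p +P q = p ++ q

_*P_ : ∀ {n} → Poly n → Poly n → Poly n
p *P q = concatMap (λ { (c , e) → map (λ { (d , f) → (c ℤ.* d , zipWith ℕ._+_ e f) }) q }) p

monP : ∀ {n} → Vec ℕ n → Poly n
monP e = (1ℤ , e) ∷ []

oneP : ∀ {n} → Poly n
oneP = monP (replicate _ 0)

varP : ∀ {n} → Fin n → Poly n
varP i = monP (tabulate (λ j → if i ==F j then 1 else 0))

-- The field ℚ(x_1..x_n) as fractions num/den of integer polynomials,
-- with equality  a/b ≈ c/d  iff  a·d = c·b.

Frac : ℕ → Set
Frac n = Poly n × Poly n

_≈F_ : ∀ {n} → Frac n → Frac n → Set
(a , b) ≈F (c , d) = (a *P d) ≈P (c *P b)

_+F_ : ∀ {n} → Frac n → Frac n → Frac n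
(a , b) +F (c , d) = ((a *P d) +P (c *P b)) , (b *P d)

_*F_ : ∀ {n} → Frac n → Frac n → Frac n
(a , b) *F (c , d) = (a *P c) , (b *P d)

_/F_ : ∀ {n} → Frac n → Frac n → Frac n
(a , b) /F (c , d) = (a *P d) , (b *P c)

zeroF oneF : ∀ {n} → Frac n
zeroF = [] , oneP
oneF = oneP , oneP

varF : ∀ {n} → Fin n → Frac n
varF i = varP i , oneP

_^F_ : ∀ {n} → Frac n → ℕ → Frac n
u ^F zero = oneF
u ^F suc m = u *F (u ^F m)

prodF : ∀ {n m} → (Fin m → Frac n) → Frac n
prodF {m = zero} f = oneF
prodF {m = suc m} f = f zero *F prodF (λ i → f (suc i))

sumListF : ∀ {n} → List (Frac n) → Frac n
sumListF = foldr _+F_ zeroF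

posPart negPart : ℤ → ℕ
posPart (+ k) = k
posPart -[1+ k ] = 0
negPart (+ k) = 0
negPart -[1+ k ] = suc k

laurent : ∀ {n} → (Fin n → ℤ) → Frac n
laurent v = monP (tabulate (λ i → posPart (v i))) , monP (tabulate (λ i → negPart (v i)))

-- Quivers on vertex set Fin n: Q i j = number of arrows i → j

Quiver : ℕ → Set
Quiver n = Fin n → Fin n → ℕ

-- quiver mutation at k (add i→j per path i→k→j, reverse arrows at k,
-- cancel 2-cycles)
mutQ : ∀ {n} → Fin n → Quiver n → Quiver n
mutQ k R i j =
  if i ==F k then R j k else
  if j ==F k then R k i else
  (R i j ℕ.+ R i k ℕ.* R k j) ∸ (R j i ℕ.+ R j k ℕ.* R k i)

mutU : ∀ {n} → Fin n → Quiver n → (Fin n → Frac n) → (Fin n → Frac n)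
mutU k R u i =
  if i ==F k
  then (prodF (λ j → u j ^F R j k) +F prodF (λ j → u j ^F R k j)) /F u k
  else u i

-- Diagonals of a convex m-gon with vertices 0,1,..,m-1 in counterclockwise
-- order.  A diagonal is stored as a pair (p , q) with p < q.

Diag : Set
Diag = ℕ × ℕ

IsDiag : ℕ → Diag → Set
IsDiag m (p , q) = p < q × q < m × q ≢ suc p × ¬ (p ≡ 0 × suc q ≡ m)

crossB : Diag → Diag → Bool
crossB (p , q) (r , s) = ((p <ᵇ r) ∧ (r <ᵇ q) ∧ (q <ᵇ s)) ∨ ((r <ᵇ p) ∧ (p <ᵇ s) ∧ (s <ᵇ q))

eqDB : Diag → Diag → Bool
eqDB (p , q) (r , s) = (p ≡ᵇ r) ∧ (q ≡ᵇ s)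

intNum : Diag → Diag → ℤ
intNum D E = if eqDB D E then ℤ.- 1ℤ else (if crossB D E then 1ℤ else 0ℤ)

IsTriangulation : (n : ℕ) → (Fin n → Diag) → Set
IsTriangulation n D =
  (∀ i → IsDiag (n ℕ.+ 3) (D i)) ×
  (∀ i j → i ≢ j → D i ≢ D j) ×
  (∀ i j → T (not (crossB (D i) (D j))))

norm : ℕ → ℕ → Diag
norm u v = if u <ᵇ v then (u , v) else (v , u)

isSideB : ∀ {n} → (Fin n → Diag) → ℕ → ℕ → Bool
isSideB {n} D u v =
  let m = n ℕ.+ 3 ; e = norm u v in
  ((suc (proj₁ e)) ≡ᵇ proj₂ e) ∨ (((proj₁ e) ≡ᵇ 0) ∧ (suc (proj₂ e) ≡ᵇ m))
  ∨ anyFin (λ k → eqDB (D k) e)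

isTriangleB : ∀ {n} → (Fin n → Diag) → ℕ → ℕ → ℕ → Bool
isTriangleB D u v w =
  not (u ≡ᵇ v) ∧ not (v ≡ᵇ w) ∧ not (u ≡ᵇ w) ∧
  isSideB D u v ∧ isSideB D v w ∧ isSideB D u w

ccwFrom : (m : ℕ) → .{{_ : ℕ.NonZero m}} → ℕ → ℕ → ℕ
ccwFrom m v x = (x ℕ.+ m ∸ v) % m

-- arrow i → j in the quiver of the triangulation D: D i = {v,u},
-- D j = {v,w} share the endpoint v, {u,v,w} is a triangle of D, and
-- rotating D i counterclockwise about v (by less than 180°) gives D j,
-- i.e. w comes after u in counterclockwise order starting from v.
arrowB : ∀ {n} → (Fin n → Diag) → Fin n → Fin n → Bool
arrowB {n} D i j =
  any (λ v → any (λ u → any (λ w →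
      eqDB (D i) (norm v u) ∧ eqDB (D j) (norm v w) ∧ isTriangleB D u v w ∧
      (ccwFrom (suc (suc (suc n))) v u <ᵇ ccwFrom (suc (suc (suc n))) v w))
    (upTo (n ℕ.+ 3))) (upTo (n ℕ.+ 3))) (upTo (n ℕ.+ 3))

quiverOf : ∀ {n} → (Fin n → Diag) → Quiver n
quiverOf D i j = if arrowB D i j then 1 else 0

-- Seeds, flips and reachable seeds.  A seed carries the cluster, the
-- quiver and the triangulation whose diagonals label its cluster
-- variables (cluster variable u_k ↔ diagonal D_k).

record Seed (n : ℕ) : Set where
  constructor seed
  field
    clus : Fin n → Frac n
    quiv : Quiver n
    tri  : Fin n → Diag
open Seed public

Flip : ∀ {n} → (Fin n → Diag) → Fin n → (Fin n → Diag) → Set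
Flip {n} D k D' = (∀ j → j ≢ k → D' j ≡ D j) × D' k ≢ D k × IsTriangulation n D'

data Reachable {n : ℕ} (D0 : Fin n → Diag) : Seed n → Set where
  init : Reachable D0 (seed varF (quiverOf D0) D0)
  step : ∀ {u R D D'} (k : Fin n) → Reachable D0 (seed u R D) → Flip D k D' →
         Reachable D0 (seed (mutU k R u) (mutQ k R) D')

clusterMonomial : ∀ {n} → Seed n → (Fin n → ℕ) → Frac n
clusterMonomial S m = prodF (λ k → clus S k ^F m k)

dVector : ∀ {n} → (Fin n → Diag) → Seed n → (Fin n → ℕ) → Fin n → ℤ
dVector D0 S m i = sumℤ (λ k → (+ m k) ℤ.* intNum (tri S k) (D0 i))

pathLenB : ∀ {n} → Quiver n → Fin n → ℕ → Fin n → Bool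
pathLenB Q i0 zero j = i0 ==F j
pathLenB Q i0 (suc l) j = anyFin (λ i → pathLenB Q i0 l i ∧ (0 <ᵇ Q i j))

-- least l < bound with p l (bound if none)
firstTrue : (ℕ → Bool) → ℕ → ℕ
firstTrue p zero = zero
firstTrue p (suc b) = if p 0 then 0 else suc (firstTrue (λ l → p (suc l)) b)

-- d(j): length of a shortest directed path from i0 to j (paths of length
-- < n suffice; value n if j is unreachable, which does not occur here)
dist : ∀ {n} → Quiver n → Fin n → Fin n → ℕ
dist {n} Q i0 j = firstTrue (λ l → pathLenB Q i0 l j) n

-- σ(x,y,z) = ½([x+y-z]_+ - [x-y-z]_+ - [y-x-z]_+)  (computed in ℕ; the
-- bracket is ≥ 0, and for the relevant data it is even)

σ : ℕ → ℕ → ℕ → ℕ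
σ x y z = ⌊ ((x ℕ.+ y) ∸ z) ∸ (x ∸ (y ℕ.+ z)) ∸ (y ∸ (x ℕ.+ z)) /2⌋

-- Sequences s = (s_1,..,s_n), s_i ∈ {0,1}^{a_i}  (true = 1)

Seq : ∀ {n} → (Fin n → ℕ) → Set
Seq {n} a = (i : Fin n) → Vec Bool (a i)

allVecs : (m : ℕ) → List (Vec Bool m)
allVecs zero = [] ∷ []
allVecs (suc m) = concatMap (λ v → (true ∷ v) ∷ (false ∷ v) ∷ []) (allVecs m)

consSeq : ∀ {n} {a : Fin (suc n) → ℕ} → Vec Bool (a zero) →
          ((i : Fin n) → Vec Bool (a (suc i))) → Seq a
consSeq v f zero = v
consSeq v f (suc i) = f i

allSeqs : ∀ n (a : Fin n → ℕ) → List (Seq a)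
allSeqs zero a = (λ ()) ∷ []
allSeqs (suc n) a =
  concatMap (λ v → map (λ f → consSeq {a = a} v f) (allSeqs n (λ i → a (suc i))))
            (allVecs (a zero))

-- 1-based entry s_{i,t} (1 ≤ t ≤ length)
atZ : ∀ {m} → Vec Bool m → ℕ → Bool
atZ [] _ = false
atZ (b ∷ v) zero = b
atZ (b ∷ v) (suc t) = atZ v t

at : ∀ {m} → Vec Bool m → ℕ → Bool
at v t = atZ v (t ∸ 1)

ones : ∀ {m} → Vec Bool m → ℕ
ones [] = 0
ones (true ∷ v) = suc (ones v)
ones (false ∷ v) = ones v

notOneZero : Bool → Bool → Bool
notOneZero b c = not (b ∧ not c)

cycle3B : ∀ {n} → Quiver n → Fin n → Fin n → Fin n → Bool
cycle3B Q i j k = (0 <ᵇ Q i j) ∧ (0 <ᵇ Q j k) ∧ (0 <ᵇ Q k i)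

σ3 : ∀ {n} → (Fin n → ℕ) → Fin n → Fin n → Fin n → ℕ
σ3 a i j k = σ (a i) (a j) (a k)

forT : ℕ → (ℕ → Bool) → Bool
forT N p = all (λ t → p (suc t)) (upTo N)

isGCS : ∀ {n} → Quiver n → Fin n → (a : Fin n → ℕ) → Seq a → Bool
isGCS {n} Q i0 a s =
  allFin? (λ i → allFin? (λ j → allFin? (λ k →
    let d = dist Q i0 ; N = σ3 a i j k in
    not (cycle3B Q i j k) ∨
    ((not ((d i <ᵇ d j) ∧ (d j <ᵇ d k)) ∨
        forT N (λ t → notOneZero (at (s i) t) (at (s j) t))) ∧
     (not ((d j <ᵇ d k) ∧ (d k <ᵇ d i)) ∨
        forT N (λ t → notOneZero (at (s i) (a i ℕ.+ 1 ∸ t)) (at (s j) (a j ℕ.+ 1 ∸ t)))) ∧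
     (not ((d k <ᵇ d i) ∧ (d i <ᵇ d j)) ∨
        forT N (λ t → notOneZero (at (s i) (a i ℕ.+ 1 ∸ t)) (at (s j) t)))))))

expo : ∀ {n} → Quiver n → (a : Fin n → ℕ) → Seq a → Fin n → ℤ
expo Q a s i =
  (+ sumℕ (λ j → Q i j ℕ.* (a j ∸ ones (s j))))
  ℤ.+ (+ sumℕ (λ k → Q k i ℕ.* ones (s k)))
  ℤ.- (+ sumℕ (λ j → sumℕ (λ k → Q i j ℕ.* Q j k ℕ.* Q k i ℕ.* σ3 a j k i)))

gcsFormula : ∀ {n} → Quiver n → Fin n → (a : Fin n → ℕ) → Frac n
gcsFormula {n} Q i0 a =
  laurent (λ l → ℤ.- (+ a l)) *F
  sumListF (concatMap (λ s → if isGCS Q i0 a s then laurent (expo Q a s) ∷ [] else [])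
                      (allSeqs n a))

degree : ∀ {n} → Quiver n → Fin n → ℕ
degree Q i = sumℕ (λ j → Q i j ℕ.+ Q j i)

{-# OPTIONS --safe #-}
-- The identity is checked at all points with positive integer coordinates, which determines a
-- polynomial.  There the cluster variables become the lambda lengths X of the chords of the
-- polygon: determinants of pairs of plane vectors attached to the vertices, so that the exchange
-- relations are Plücker relations.  Root the tree of triangles at the ear cut off by the diagonal
-- of i₀.  If the arcs of the monomial that cross the diagonal {p , q} end at b₁ ≥ b₂ ≥ … below it,
-- then the sum over all sequences below {p , q} is the product of X b q or X p b over the rays b,
-- according to the value of s at the crossing, times the lambda lengths of the arcs lying
-- entirely below.  In a triangle p < r < q this follows by applying the Ptolemy relation to every
-- arc separately: the forbidden pattern (1 , 0) leaves three of four terms, which are those of two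
-- successive Ptolemy relations.
module Submission where

open import Defs
open import Algebra.Bundles using (CommutativeRing)
open import Algebra.Structures using (IsCommutativeRing)
open import Data.Bool using (Bool; true; false; if_then_else_; _∧_; T; not; _∨_)
open import Data.Bool.ListAction using (any; all)
open import Data.Bool.Properties using (T-∧; T-∨; ∧-identityʳ)
open import Data.Empty using (⊥)
open import Data.Fin as Fin using (Fin; zero; suc)
import Data.Fin.Properties as FinP
open import Data.Integer as ℤ using (ℤ; +_; 0ℤ; 1ℤ; _⊖_)
import Data.Integer.Properties as ℤP
open import Data.List using (List; []; _∷_; _++_; map; concatMap; upTo; allFin; length; reverse; _∷ʳ_; filter; tabulate; replicate)
open import Data.List.Membership.Propositional using (_∈_; find; lose)
open import Data.List.Membership.Propositional.Properties using (∈-upTo⁺; ∈-upTo⁻; ∈-allFin; ∈-++⁻; ∈-++⁺ˡ; ∈-++⁺ʳ; ∈-map⁻; ∈-filter⁻)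
open import Data.List.Membership.Propositional.Properties.WithK using (unique∧set⇒bag)
import Data.List.Properties as ListP
open import Data.List.Relation.Binary.BagAndSetEquality using (∼bag⇒↭)
open import Data.List.Relation.Binary.Permutation.Propositional as Perm using (_↭_)
import Data.List.Relation.Binary.Permutation.Propositional.Properties as PermP
open import Data.List.Relation.Unary.All as All using (All; []; _∷_)
import Data.List.Relation.Unary.All.Properties as AllP
open import Data.List.Relation.Unary.AllPairs as AllPairs using (AllPairs; []; _∷_)
import Data.List.Relation.Unary.AllPairs.Properties as AllPairsP
open import Data.List.Relation.Unary.Any using (Any; here; there)
open import Data.List.Relation.Unary.Any.Properties as AnyP using (any⁺; any⁻)
open import Data.List.Relation.Unary.Unique.Propositional using (Unique)
import Data.List.Relation.Unary.Unique.Propositional.Properties as UniqueP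
open import Data.Nat as ℕ using (ℕ; zero; suc; _∸_; _<ᵇ_; _≡ᵇ_; _<_; _≤_; _<?_; _≤?_; z≤n; s≤s; _≥_; ⌊_/2⌋)
open import Data.Nat.DivMod using (_%_; m<n⇒m%n≡m; [m+n]%n≡m%n)
open import Data.Nat.Divisibility as ℕD using (_∣_)
import Data.Nat.Properties as ℕP
import Data.Nat.Solver as ℕSolver
open import Data.Product using (_×_; _,_; proj₁; proj₂; Σ; ∃)
import Data.Product.Properties as ProductP
open import Data.Rational as ℚ using (ℚ; 0ℚ; 1ℚ)
import Data.Rational.Properties as ℚP
open import Data.Rational.Unnormalised as ℚᵘ using (mkℚᵘ; *≡*)
import Data.Rational.Unnormalised.Properties as ℚᵘP
open import Data.Sum as Sum using (_⊎_; inj₁; inj₂; [_,_]′; swap)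
open import Data.Unit using (tt)
open import Data.Vec as Vec using (Vec; []; _∷_; toList)
import Data.Vec.Properties as VecP
open import Function using (_∘_)
open import Function.Bundles using (Equivalence; mk⇔)
open import Level using (0ℓ)
open import Relation.Binary.Definitions using (tri<; tri≈; tri>)
open import Relation.Binary.PropositionalEquality
open import Relation.Nullary using (yes; no; ¬_; does; Dec; _×-dec_; _⊎-dec_; ¬?)
open import Relation.Nullary.Decidable using (map′; T?)
open import Relation.Nullary.Negation using (contradiction)
import Algebra.Properties.AbelianGroup ℤP.+-0-abelianGroup as ℤG
open ℕSolver.+-*-Solver using () renaming (solve to solveℕ; _:+_ to _:+ℕ_; _:=_ to _:=ℕ_; con to conℕ)

-- The coefficient field

-- Two difficulties shape the proof. The conditions on s compare the t-th entries of neighbouring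
-- sequences, counted from either end. They become local once the arcs are listed in the order in
-- which they meet a diagonal: the arcs cutting a corner of a triangle then form an initial or final
-- segment of the lists of the two sides at that corner, and σ is their number, because an arc
-- ending at a vertex of the triangle excludes arcs cutting off that vertex. Each condition thus
-- relates the two entries of a single arc. Which ends are compared depends on the distances; these
-- are d, d + 1, d + 2 around every triangle other than an ear, since by hypothesis such a triangle
-- is bounded by three diagonals. The second difficulty is the cyclic symmetry. Trees and
-- inequalities want a linear order, so the polygon is rotated until the diagonal of i₀ is {0 , n +
-- 1} and the tip of its ear is n + 2. The ear exists because a diagonal between two full triangles
-- has degree 4. The exponents fit the same scheme: each arrow lies in exactly one 3-cycle, so the
-- whole summand is a product over triangles.

-- The computational behaviour of ℚ is irrelevant and slow, hence abstract; a module of its own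
-- keeps it opaque in later abstract blocks.
module Coefficients where

  infixl 6 _⊕_
  infixl 7 _⊗_

  abstract
    K : Set
    K = ℚ
    0K 1K : K
    0K = 0ℚ
    1K = 1ℚ
    _⊕_ _⊗_ : K → K → K
    _⊕_ = ℚ._+_
    _⊗_ = ℚ._*_
    neg : K → K
    neg = ℚ.-_
    ring-laws : IsCommutativeRing _≡_ _⊕_ _⊗_ neg 0K 1K
    ring-laws = ℚP.+-*-isCommutativeRing
    -- The value at zero is a convention only: the cancellation laws all assume `Pos`.
    inv : K → K
    inv x with x ℚP.≟ 0ℚ
    ... | yes _ = 0ℚ
    ... | no x≢0 = ℚ.1/_ x {{ℚ.≢-nonZero x≢0}}
    Pos : K → Set
    Pos x = 0ℚ ℚ.< x
    pos-1 : Pos 1K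
    pos-1 = ℚP.positive⁻¹ 1ℚ
    pos-+ : ∀ {x y} → Pos x → Pos y → Pos (x ⊕ y)
    pos-+ = ℚP.+-mono-<
    pos-* : ∀ {x y} → Pos x → Pos y → Pos (x ⊗ y)
    pos-* {x} {y} px py = ℚP.positive⁻¹ (x ℚ.* y) {{ℚP.pos*pos⇒pos x {{ℚ.positive px}} y {{ℚ.positive py}}}}
    inv-right : ∀ {x} → Pos x → x ⊗ inv x ≡ 1K
    inv-right {x} px with x ℚP.≟ 0ℚ
    ... | yes x≡0 = contradiction (sym x≡0) (ℚP.<⇒≢ px)
    ... | no x≢0 = ℚP.*-inverseʳ x {{ℚ.≢-nonZero x≢0}}
    pos-inv : ∀ {x} → Pos x → Pos (inv x)
    pos-inv {x} px with x ℚP.≟ 0ℚ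
    ... | yes x≡0 = contradiction (sym x≡0) (ℚP.<⇒≢ px)
    ... | no x≢0 = ℚP.positive⁻¹ _ {{ℚP.1/pos⇒pos x {{ℚ.positive px}}}}
    ι : ℤ → K
    ι z = ℚ.fromℚᵘ (mkℚᵘ z 0)
    ι-1 : ι 1ℤ ≡ 1K
    ι-1 = refl
    ι-0 : ι 0ℤ ≡ 0K
    ι-0 = refl
    ι-+ : ∀ x y → ι (x ℤ.+ y) ≡ ι x ⊕ ι y
    ι-+ x y = ℚP.toℚᵘ-injective (ℚᵘP.≃-trans (ℚP.toℚᵘ-fromℚᵘ (mkℚᵘ (x ℤ.+ y) 0)) (ℚᵘP.≃-trans
      (*≡* (cong (ℤ._* 1ℤ) (cong₂ ℤ._+_ (sym (ℤP.*-identityʳ x)) (sym (ℤP.*-identityʳ y)))))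
      (ℚᵘP.≃-sym (ℚᵘP.≃-trans (ℚP.toℚᵘ-homo-+ (ι x) (ι y))
         (ℚᵘP.+-cong (ℚP.toℚᵘ-fromℚᵘ (mkℚᵘ x 0)) (ℚP.toℚᵘ-fromℚᵘ (mkℚᵘ y 0)))))))
    ι-* : ∀ x y → ι (x ℤ.* y) ≡ ι x ⊗ ι y
    ι-* x y = ℚP.toℚᵘ-injective (ℚᵘP.≃-trans (ℚP.toℚᵘ-fromℚᵘ (mkℚᵘ (x ℤ.* y) 0)) (ℚᵘP.≃-trans
      (*≡* refl)
      (ℚᵘP.≃-sym (ℚᵘP.≃-trans (ℚP.toℚᵘ-homo-* (ι x) (ι y))
         (ℚᵘP.*-cong (ℚP.toℚᵘ-fromℚᵘ (mkℚᵘ x 0)) (ℚP.toℚᵘ-fromℚᵘ (mkℚᵘ y 0)))))))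
    ι-injective : ∀ {x y} → ι x ≡ ι y → x ≡ y
    ι-injective {x} {y} e with ℚP.fromℚᵘ-injective {mkℚᵘ x 0} {mkℚᵘ y 0} e
    ... | *≡* p = trans (sym (ℤP.*-identityʳ x)) (trans p (ℤP.*-identityʳ y))
    pos-ι : ∀ k → Pos (ι (+ suc k))
    pos-ι k = ℚP.toℚᵘ-cancel-< (ℚᵘP.<-respʳ-≃ (ℚᵘP.≃-sym (ℚP.toℚᵘ-fromℚᵘ (mkℚᵘ (+ suc k) 0)))
        (ℚᵘP.positive⁻¹ (mkℚᵘ (+ suc k) 0)))

open Coefficients

K-ring : CommutativeRing 0ℓ 0ℓ
K-ring = record { isCommutativeRing = ring-laws }

open CommutativeRing K-ring public using (+-assoc; +-comm; +-identityˡ; +-identityʳ; *-assoc; *-comm; *-identityˡ;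
    *-identityʳ; distribˡ; distribʳ; zeroˡ; zeroʳ)

open import Algebra.Solver.Ring.NaturalCoefficients.Default (CommutativeRing.commutativeSemiring K-ring)
  using (solve; _:=_; _:+_; _:*_; con)

*-cancelʳ-pos : ∀ {x y z} → Pos z → x ⊗ z ≡ y ⊗ z → x ≡ y
*-cancelʳ-pos {x} {y} {z} pz e = begin
  x               ≡⟨ *-identityʳ x ⟨
  x ⊗ 1K          ≡⟨ cong (x ⊗_) (inv-right pz) ⟨
  x ⊗ (z ⊗ inv z) ≡⟨ *-assoc x z (inv z) ⟨
  x ⊗ z ⊗ inv z   ≡⟨ cong (_⊗ inv z) e ⟩
  y ⊗ z ⊗ inv z   ≡⟨ *-assoc y z (inv z) ⟩
  y ⊗ (z ⊗ inv z) ≡⟨ cong (y ⊗_) (inv-right pz) ⟩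
  y ⊗ 1K          ≡⟨ *-identityʳ y ⟩
  y               ∎
  where open ≡-Reasoning

pow : K → ℕ → K
pow x zero = 1K
pow x (suc k) = x ⊗ pow x k

pow-+ : ∀ x k l → pow x (k ℕ.+ l) ≡ pow x k ⊗ pow x l
pow-+ x zero l = sym (*-identityˡ _)
pow-+ x (suc k) l = trans (cong (x ⊗_) (pow-+ x k l)) (sym (*-assoc x (pow x k) (pow x l)))

pow-* : ∀ x y k → pow (x ⊗ y) k ≡ pow x k ⊗ pow y k
pow-* x y zero = sym (*-identityˡ _)
pow-* x y (suc k) = trans (cong (x ⊗ y ⊗_) (pow-* x y k))
    (solve 4 (λ x y a b → x :* y :* (a :* b) := x :* a :* (y :* b)) refl (x) (y) (pow x k) (pow y k))

pow-1 : ∀ k → pow 1K k ≡ 1K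
pow-1 zero = refl
pow-1 (suc k) = trans (*-identityˡ _) (pow-1 k)

pos-pow : ∀ {x} → Pos x → ∀ k → Pos (pow x k)
pos-pow px zero = pos-1
pos-pow px (suc k) = pos-* px (pos-pow px k)

pow-inv : ∀ {x} → Pos x → ∀ k → pow x k ⊗ pow (inv x) k ≡ 1K
pow-inv {x} px k = trans (sym (pow-* x (inv x) k)) (trans (cong (λ y → pow y k) (inv-right px)) (pow-1 k))

∏ : ∀ {n} → (Fin n → K) → K
∏ {zero} f = 1K
∏ {suc n} f = f zero ⊗ ∏ (λ i → f (suc i))

∏-cong : ∀ {n} {f g : Fin n → K} → (∀ i → f i ≡ g i) → ∏ f ≡ ∏ g
∏-cong {zero} e = refl
∏-cong {suc n} e = cong₂ _⊗_ (e zero) (∏-cong (λ i → e (suc i)))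

∏-1 : ∀ n → ∏ {n} (λ _ → 1K) ≡ 1K
∏-1 zero = refl
∏-1 (suc n) = trans (*-identityˡ _) (∏-1 n)

∏-* : ∀ {n} (f g : Fin n → K) → ∏ (λ i → f i ⊗ g i) ≡ ∏ f ⊗ ∏ g
∏-* {zero} f g = sym (*-identityˡ _)
∏-* {suc n} f g = trans (cong (f zero ⊗ g zero ⊗_) (∏-* (λ i → f (suc i)) (λ i → g (suc i))))
  (solve 4 (λ x y a b → x :* y :* (a :* b) := x :* a :* (y :* b)) refl (f zero) (g zero) (∏ (λ i → f (suc i)))
      (∏ (λ i → g (suc i))))

∏-swap : ∀ {m n} (f : Fin m → Fin n → K) → ∏ (λ i → ∏ (f i)) ≡ ∏ (λ j → ∏ (λ i → f i j))
∏-swap {zero} {n} f = sym (∏-1 n)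
∏-swap {suc m} f = trans (cong (∏ (f zero) ⊗_) (∏-swap (λ i → f (suc i))))
    (sym (∏-* (f zero) (λ j → ∏ (λ i → f (suc i) j))))

pos-∏ : ∀ {n} {f : Fin n → K} → (∀ i → Pos (f i)) → Pos (∏ f)
pos-∏ {zero} p = pos-1
pos-∏ {suc n} p = pos-* (p zero) (pos-∏ (λ i → p (suc i)))

pow-sumℕ : ∀ {n} x (f : Fin n → ℕ) → pow x (sumℕ f) ≡ ∏ (λ i → pow x (f i))
pow-sumℕ {zero} x f = refl
pow-sumℕ {suc n} x f = trans (pow-+ x (f zero) _) (cong (pow x (f zero) ⊗_) (pow-sumℕ x (λ i → f (suc i))))

-- The sum over GCSs becomes a sum over all sequences with weights 0 and 1, which can be factored
-- over triangles and carried out one sequence at a time.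
indicator : Bool → K
indicator b = if b then 1K else 0K

indicator-∧ : ∀ b c → indicator (b ∧ c) ≡ indicator b ⊗ indicator c
indicator-∧ true c = sym (*-identityˡ _)
indicator-∧ false c = sym (zeroˡ _)

∑ : ∀ {A : Set} → List A → (A → K) → K
∑ [] f = 0K
∑ (x ∷ xs) f = f x ⊕ ∑ xs f

∑-++ : ∀ {A : Set} (xs ys : List A) f → ∑ (xs ++ ys) f ≡ ∑ xs f ⊕ ∑ ys f
∑-++ [] ys f = sym (+-identityˡ _)
∑-++ (x ∷ xs) ys f = trans (cong (f x ⊕_) (∑-++ xs ys f)) (sym (+-assoc _ _ _))

∑-cong : ∀ {A : Set} (xs : List A) {f g : A → K} → (∀ x → f x ≡ g x) → ∑ xs f ≡ ∑ xs g
∑-cong [] e = refl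
∑-cong (x ∷ xs) e = cong₂ _⊕_ (e x) (∑-cong xs e)

-- Evaluation of polynomials and fractions

mono : ∀ {n} → (Fin n → K) → Vec ℕ n → K
mono x [] = 1K
mono x (k ∷ e) = pow (x zero) k ⊗ mono (λ i → x (suc i)) e

ev : ∀ {n} → (Fin n → K) → Poly n → K
ev x [] = 0K
ev x ((c , e) ∷ p) = ι c ⊗ mono x e ⊕ ev x p

module _ {n} (x : Fin n → K) where

  ev-++ : ∀ p q → ev x (p ++ q) ≡ ev x p ⊕ ev x q
  ev-++ [] q = sym (+-identityˡ _)
  ev-++ ((c , e) ∷ p) q = trans (cong (ι c ⊗ mono x e ⊕_) (ev-++ p q)) (sym (+-assoc _ _ _))

mono-zipWith : ∀ {n} (x : Fin n → K) e f → mono x (Vec.zipWith ℕ._+_ e f) ≡ mono x e ⊗ mono x f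
mono-zipWith x [] [] = sym (*-identityˡ _)
mono-zipWith x (k ∷ e) (l ∷ f) = trans (cong₂ _⊗_ (pow-+ (x zero) k l) (mono-zipWith (λ i → x (suc i)) e f))
  (solve 4 (λ a b c d → a :* b :* (c :* d) := a :* c :* (b :* d)) refl (pow (x zero) k) (pow (x zero) l)
      (mono (λ i → x (suc i)) e) (mono (λ i → x (suc i)) f))

mono-tabulate : ∀ {n} (x : Fin n → K) (f : Fin n → ℕ) → mono x (Vec.tabulate f) ≡ ∏ (λ i → pow (x i) (f i))
mono-tabulate {zero} x f = refl
mono-tabulate {suc n} x f = cong (pow (x zero) (f zero) ⊗_) (mono-tabulate (λ i → x (suc i)) (λ i → f (suc i)))

mono-0 : ∀ {n} (x : Fin n → K) → mono x (Vec.replicate n 0) ≡ 1K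
mono-0 {zero} x = refl
mono-0 {suc n} x = trans (*-identityˡ _) (mono-0 (λ i → x (suc i)))

module _ {n} (x : Fin n → K) where

  -- The product `*P` maps an anonymous pattern-matching function over q; quantifying over every g
  -- with the same values makes the lemma applicable to it.
  ev-scale : ∀ (g : ℤ × Vec ℕ n → ℤ × Vec ℕ n) c e → (∀ d f → g (d , f) ≡ (c ℤ.* d , Vec.zipWith ℕ._+_ e f)) →
    ∀ q → ev x (map g q) ≡ ι c ⊗ mono x e ⊗ ev x q
  ev-scale g c e h [] = sym (zeroʳ _)
  ev-scale g c e h ((d , f) ∷ q) rewrite h d f | ι-* c d | mono-zipWith x e f | ev-scale g c e h q =
    (solve 5 (λ a b c d f → a :* b :* (c :* d) :+ a :* c :* f := a :* c :* (b :* d :+ f)) refl (ι c) (ι d) (mono x e)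
        (mono x f) (ev x q))

  ev-*P : ∀ p q → ev x (p *P q) ≡ ev x p ⊗ ev x q
  ev-*P [] q = sym (zeroˡ _)
  ev-*P ((c , e) ∷ p) q = trans (ev-++ x (map _ q) (p *P q))
    (trans (cong₂ _⊕_ (ev-scale _ c e (λ _ _ → refl) q) (ev-*P p q)) (sym (distribʳ (ev x q) _ _)))

  ev-monP : ∀ e → ev x (monP e) ≡ mono x e
  ev-monP e rewrite ι-1 = trans (+-identityʳ _) (*-identityˡ _)

  ev-oneP : ev x oneP ≡ 1K
  ev-oneP = trans (ev-monP (Vec.replicate n 0)) (mono-0 x)

-- Polynomials are determined by their values at positive integer points

negP : ∀ {n} → Poly n → Poly n
negP = map (λ t → ℤ.- proj₁ t , proj₂ t)

ι-neg : ∀ c → ι (ℤ.- c) ⊕ ι c ≡ 0K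
ι-neg c = trans (sym (ι-+ (ℤ.- c) c)) (trans (cong ι (ℤP.+-inverseˡ c)) ι-0)

ev-negP : ∀ {n} (x : Fin n → K) p → ev x (negP p) ⊕ ev x p ≡ 0K
ev-negP x [] = +-identityʳ _
ev-negP x ((c , e) ∷ p) = trans (solve 5 (λ a b m u v → a :* m :+ u :+ (b :* m :+ v) := (a :+ b) :* m :+ (u :+ v))
    refl (ι (ℤ.- c)) (ι c) (mono x e) (ev x (negP p)) (ev x p))
  (trans (cong₂ (λ s t → s ⊗ mono x e ⊕ t) (ι-neg c) (ev-negP x p)) (trans (+-identityʳ _) (zeroˡ _)))

coeff-++ : ∀ {n} (p q : Poly n) e → coeff (p ++ q) e ≡ coeff p e ℤ.+ coeff q e
coeff-++ [] q e = sym (ℤP.+-identityˡ _)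
coeff-++ ((c , f) ∷ p) q e with does (VecP.≡-dec ℕ._≟_ f e)
... | true = trans (cong (ℤ._+_ c) (coeff-++ p q e)) (sym (ℤP.+-assoc c _ _))
... | false = coeff-++ p q e

coeff-negP : ∀ {n} (p : Poly n) e → coeff (negP p) e ≡ ℤ.- coeff p e
coeff-negP [] e = refl
coeff-negP ((c , f) ∷ p) e with does (VecP.≡-dec ℕ._≟_ f e)
... | true = trans (cong (ℤ._+_ (ℤ.- c)) (coeff-negP p e)) (sym (ℤP.neg-distrib-+ c _))
... | false = coeff-negP p e

natPoint : ∀ {n} → (Fin n → ℕ) → Fin n → K
natPoint x i = ι (+ suc (x i))

-- Integral values are what the divisibility argument of `integer-zero` works with.
ev-integral : ∀ {n} (x : Fin n → ℕ) p → ∃ λ z → ev (natPoint x) p ≡ ι z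
ev-integral x [] = 0ℤ , sym ι-0
ev-integral x ((c , e) ∷ p) with ev-integral x p | mono-integral x e
  where
  pow-integral : ∀ y k → ∃ λ z → pow (ι y) k ≡ ι z
  pow-integral y zero = 1ℤ , sym ι-1
  pow-integral y (suc k) with pow-integral y k
  ... | z , eq = y ℤ.* z , trans (cong (ι y ⊗_) eq) (sym (ι-* y z))
  mono-integral : ∀ {n} (x : Fin n → ℕ) e → ∃ λ z → mono (natPoint x) e ≡ ι z
  mono-integral x [] = 1ℤ , sym ι-1
  mono-integral x (k ∷ e) with pow-integral (+ suc (x zero)) k | mono-integral (λ i → x (suc i)) e
  ... | y , eq | z , eq′ = y ℤ.* z , trans (cong₂ _⊗_ eq eq′) (sym (ι-* y z))
... | z , eq | y , eq′ = c ℤ.* y ℤ.+ z ,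
  trans (cong₂ (λ s t → ι c ⊗ s ⊕ t) eq′ eq) (trans (cong (_⊕ ι z) (sym (ι-* c y))) (sym (ι-+ (c ℤ.* y) z)))

slice₀ : ∀ {n} → Poly (suc n) → Poly n
slice₀ [] = []
slice₀ ((c , zero ∷ e) ∷ p) = (c , e) ∷ slice₀ p
slice₀ ((c , suc k ∷ e) ∷ p) = slice₀ p

shift : ∀ {n} → Poly (suc n) → Poly (suc n)
shift [] = []
shift ((c , zero ∷ e) ∷ p) = shift p
shift ((c , suc k ∷ e) ∷ p) = (c , k ∷ e) ∷ shift p

ev-slice : ∀ {n} (x : Fin (suc n) → K) p → ev x p ≡ ev (λ i → x (suc i)) (slice₀ p) ⊕ x zero ⊗ ev x (shift p)
ev-slice x [] = sym (trans (+-identityˡ _) (zeroʳ _))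
ev-slice x ((c , zero ∷ e) ∷ p) rewrite ev-slice x p =
  (solve 4 (λ c m u v → c :* (con 1 :* m) :+ (u :+ v) := c :* m :+ u :+ v) refl (ι c) (mono (λ i → x (suc i)) e)
      (ev (λ i → x (suc i)) (slice₀ p)) (x zero ⊗ ev x (shift p)))
ev-slice x ((c , suc k ∷ e) ∷ p) rewrite ev-slice x p =
  (solve 6 (λ c y k m u v → c :* (y :* k :* m) :+ (u :+ y :* v) := u :+ y :* (c :* (k :* m) :+ v)) refl (ι c) (x zero)
      (pow (x zero) k) (mono (λ i → x (suc i)) e) (ev (λ i → x (suc i)) (slice₀ p)) (ev x (shift p)))

coeff-zero : ∀ {n} (p : Poly (suc n)) e → coeff p (zero ∷ e) ≡ coeff (slice₀ p) e
coeff-zero [] e = refl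
coeff-zero ((c , zero ∷ f) ∷ p) e with VecP.≡-dec ℕ._≟_ f e
... | yes refl = cong (ℤ._+_ c) (coeff-zero p e)
... | no _ = coeff-zero p e
coeff-zero ((c , suc k ∷ f) ∷ p) e = coeff-zero p e

coeff-suc : ∀ {n} (p : Poly (suc n)) l e → coeff p (suc l ∷ e) ≡ coeff (shift p) (l ∷ e)
coeff-suc [] l e = refl
coeff-suc ((c , zero ∷ f) ∷ p) l e = coeff-suc p l e
coeff-suc ((c , suc k ∷ f) ∷ p) l e with does (VecP.≡-dec ℕ._≟_ (k ∷ f) (l ∷ e))
... | true = cong (ℤ._+_ c) (coeff-suc p l e)
... | false = coeff-suc p l e

cons : ∀ {n} {A : Set} → A → (Fin n → A) → Fin (suc n) → A
cons a f zero = a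
cons a f (suc i) = f i

-- Every positive integer divides c, the cofactor being allowed to vary; divisibility by suc ∣c∣
-- leaves only c = 0.
integer-zero : ∀ c (r : ℕ → ℤ) → (∀ k → c ℤ.+ (+ suc k) ℤ.* r k ≡ 0ℤ) → c ≡ 0ℤ
integer-zero c r h = ℤP.∣i∣≡0⇒i≡0 (small (∣c∣∣ ) )
  where
  k = ℤ.∣ c ∣
  eq : ℤ.∣ c ∣ ≡ suc k ℕ.* ℤ.∣ r k ∣
  eq = trans (trans (sym (ℤP.∣-i∣≡∣i∣ c)) (cong ℤ.∣_∣ (sym
      (ℤG.∙-cancelˡ c _ _ (trans (h k) (sym (ℤP.+-inverseʳ c)))))))
         (ℤP.abs-* (+ suc k) (r k))
  ∣c∣∣ : suc k ∣ ℤ.∣ c ∣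
  ∣c∣∣ = subst (suc k ∣_) (sym eq) (ℕD.m∣m*n _)
  small : suc k ∣ k → k ≡ 0
  small d with k
  ... | zero = refl
  ... | suc l = contradiction (ℕD.∣⇒≤ d) ℕP.1+n≰n

module _ {n} (p : Poly (suc n)) (h : ∀ x → ev (natPoint x) p ≡ 0K) where

  -- With the other coordinates fixed, the constant term in the first variable is divisible by each
  -- value 1, 2, 3, ... of that variable.
  slice-zero : ∀ x′ → ev (natPoint x′) (slice₀ p) ≡ 0K
  slice-zero x′ with ev-integral x′ (slice₀ p)
  ... | c , eq = trans eq (trans (cong ι (integer-zero c r divisible)) ι-0)
    where
    r : ℕ → ℤ
    r m = proj₁ (ev-integral (cons m x′) (shift p))
    divisible : ∀ m → c ℤ.+ (+ suc m) ℤ.* r m ≡ 0ℤ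
    divisible m = ι-injective (trans (ι-+ c _) (trans (cong₂ _⊕_ (sym eq) (trans (ι-* (+ suc m) (r m))
      (cong (ι (+ suc m) ⊗_) (sym (proj₂ (ev-integral (cons m x′) (shift p)))))))
      (trans (sym (ev-slice (natPoint (cons m x′)) p)) (trans (h (cons m x′)) (sym ι-0)))))

  shift-zero : ∀ x → ev (natPoint x) (shift p) ≡ 0K
  shift-zero x = *-cancelʳ-pos (pos-ι (x zero)) (trans (*-comm (ev (natPoint x) (shift p)) (natPoint x zero))
      (trans (trans (sym (+-identityˡ _))
    (trans (cong (_⊕ (natPoint x zero ⊗ ev (natPoint x) (shift p))) (sym (slice-zero (λ i → x (suc i)))))
      (trans (sym (ev-slice (natPoint x) p)) (h x)))) (sym (zeroˡ _))))

-- The recursion is on the exponent vector: a zero entry drops the first variable, a positive one is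
-- lowered by `shift`, which still vanishes because the first coordinate is positive and can be
-- cancelled.
vanishing : ∀ {n} (p : Poly n) → (∀ x → ev (natPoint x) p ≡ 0K) → ∀ e → coeff p e ≡ 0ℤ
vanishing p h [] = ι-injective (trans (sym (ev₀ p)) (trans (h (λ ())) (sym ι-0)))
  where
  ev₀ : ∀ p → ev (natPoint (λ ())) p ≡ ι (coeff p [])
  ev₀ [] = sym ι-0
  ev₀ ((c , []) ∷ p) = trans (cong₂ _⊕_ (*-identityʳ _) (ev₀ p)) (sym (ι-+ c _))
vanishing p h (zero ∷ e) = trans (coeff-zero p e) (vanishing (slice₀ p) (slice-zero p h) e)
vanishing p h (suc l ∷ e) = trans (coeff-suc p l e) (vanishing (shift p) (shift-zero p h) (l ∷ e))

ev-injective : ∀ {n} (p q : Poly n) → (∀ x → ev (natPoint x) p ≡ ev (natPoint x) q) → p ≈P q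
ev-injective p q h e = ℤG.∙-cancelʳ (ℤ.- coeff q e) _ _ (trans diff (sym (ℤP.+-inverseʳ (coeff q e))))
  where
  diff : coeff p e ℤ.+ ℤ.- coeff q e ≡ 0ℤ
  diff = trans (sym (trans (coeff-++ p (negP q) e) (cong (ℤ._+_ (coeff p e)) (coeff-negP q e))))
    (vanishing (p ++ negP q) (λ x → trans (ev-++ (natPoint x) p (negP q)) (trans (+-comm _ _)
      (trans (cong (ev (natPoint x) (negP q) ⊕_) (h x)) (ev-negP (natPoint x) q)))) e)

zpow : K → ℤ → K
zpow y z = pow y (posPart z) ⊗ pow (inv y) (negPart z)

module Evaluate {n} (x : Fin n → K) (x-pos : ∀ i → Pos (x i)) where

  infix 4 _≐_
  -- A relation, since fractions are unreduced pairs. The denominator is kept positive because a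
  -- mutation divides by a cluster variable: its numerator, which moves into the denominator, is
  -- then positive as well.
  _≐_ : Frac n → K → Set
  (a , b) ≐ y = Pos (ev x b) × ev x a ≡ y ⊗ ev x b

  ≐-one : oneF ≐ 1K
  ≐-one = subst Pos (sym (ev-oneP x)) pos-1 , sym (*-identityˡ _)

  ≐-monP : ∀ e → (monP e , oneP) ≐ mono x e
  ≐-monP e = proj₁ ≐-one , trans (ev-monP x e) (sym (trans (cong (mono x e ⊗_) (ev-oneP x)) (*-identityʳ _)))

  ≐-+ : ∀ {f g y z} → f ≐ y → g ≐ z → (f +F g) ≐ (y ⊕ z)
  ≐-+ {a , b} {c , d} {y} {z} (pb , eb) (pd , ed)
    rewrite ev-*P x b d | ev-++ x (a *P d) (c *P b) | ev-*P x a d | ev-*P x c b | eb | ed =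
    pos-* pb pd , (solve 4 (λ y z b d → y :* b :* d :+ z :* d :* b := (y :+ z) :* (b :* d)) refl (y) (z) (ev x b)
        (ev x d))

  ≐-* : ∀ {f g y z} → f ≐ y → g ≐ z → (f *F g) ≐ (y ⊗ z)
  ≐-* {a , b} {c , d} {y} {z} (pb , eb) (pd , ed) rewrite ev-*P x b d | ev-*P x a c | eb | ed =
    pos-* pb pd , (solve 4 (λ y z b d → y :* b :* (z :* d) := (y :* z) :* (b :* d)) refl (y) (z) (ev x b) (ev x d))

  ≐-/ : ∀ {f g y z} → f ≐ y → g ≐ z → Pos z → (f /F g) ≐ (y ⊗ inv z)
  ≐-/ {a , b} {c , d} {y} {z} (pb , eb) (pd , ed) pz rewrite ev-*P x a d | ev-*P x b c | eb | ed =
    pos-* pb (pos-* pz pd) , sym (trans (solve 5 (λ y i z b d → y :* i :* (b :* (z :* d)) := y :* b :* d :* (z :* i))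
        refl (y) (inv z) (z) (ev x b) (ev x d))
      (trans (cong (y ⊗ ev x b ⊗ ev x d ⊗_) (inv-right pz)) (*-identityʳ _)))

  ≐-^ : ∀ {f y} → f ≐ y → ∀ k → (f ^F k) ≐ pow y k
  ≐-^ h zero = ≐-one
  ≐-^ {f} h (suc k) = ≐-* {f} {f ^F k} h (≐-^ h k)

  ≐-prod : ∀ {m} {f : Fin m → Frac n} {y : Fin m → K} → (∀ i → f i ≐ y i) → prodF f ≐ ∏ y
  ≐-prod {zero} h = ≐-one
  ≐-prod {suc m} {f} h = ≐-* {f zero} {prodF (λ i → f (suc i))} (h zero) (≐-prod (λ i → h (suc i)))

  ≐-var : ∀ i → varF i ≐ x i
  ≐-var i = subst (varF i ≐_) (mono-var i x) (≐-monP (Vec.tabulate (λ j → if i ==F j then 1 else 0)))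
    where
    mono-var : ∀ {m} (i : Fin m) (x : Fin m → K) → mono x (Vec.tabulate (λ j → if i ==F j then 1 else 0)) ≡ x i
    mono-var {suc m} zero x = trans (cong₂ _⊗_ (*-identityʳ (x zero))
        (trans (mono-tabulate (λ j → x (suc j)) (λ _ → 0)) (∏-1 m))) (*-identityʳ _)
    mono-var (suc i) x = trans (*-identityˡ _) (mono-var i (λ j → x (suc j)))

  ≐-laurent : ∀ v → laurent v ≐ ∏ (λ i → zpow (x i) (v i))
  ≐-laurent v rewrite ev-monP x (Vec.tabulate (λ i → negPart (v i))) | ev-monP x (Vec.tabulate (λ i → posPart (v i)))
    | mono-tabulate x (λ i → negPart (v i)) | mono-tabulate x (λ i → posPart (v i)) =
    pos-∏ (λ i → pos-pow (x-pos i) (negPart (v i))) ,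
    trans (∏-cong λ i → sym (trans (*-assoc _ _ _) (trans (cong (pow (x i) (posPart (v i)) ⊗_)
        (trans (*-comm _ _) (pow-inv (x-pos i) (negPart (v i))))) (*-identityʳ _))))
      (∏-* (λ i → zpow (x i) (v i)) (λ i → pow (x i) (negPart (v i))))

  ≐-sumList : ∀ {A : Set} (xs : List A) (f : A → Bool) (g : A → Frac n) (y : A → K) → (∀ a → g a ≐ y a) →
    sumListF (concatMap (λ a → if f a then g a ∷ [] else []) xs) ≐ ∑ xs (λ a → indicator (f a) ⊗ y a)
  ≐-sumList [] f g y h = proj₁ ≐-one , sym (zeroˡ _)
  ≐-sumList (a ∷ xs) f g y h with f a
  ... | true = ≐-+ {g a} {sumListF (concatMap (λ a → if f a then g a ∷ [] else []) xs)}
                 (subst (g a ≐_) (sym (*-identityˡ _)) (h a)) (≐-sumList xs f g y h)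
  ... | false = subst (sumListF (concatMap (λ a → if f a then g a ∷ [] else []) xs) ≐_)
                  (sym (trans (cong (_⊕ _) (zeroˡ _)) (+-identityˡ _))) (≐-sumList xs f g y h)

-- The fractions are not compared with each other but with a common value y x, which makes the cross
-- products agree at all positive integer points.
≈F-by-evaluation : ∀ {n} (f g : Frac n) (y : (Fin n → ℕ) → K) →
  (∀ x → Evaluate._≐_ (natPoint x) (λ i → pos-ι (x i)) f (y x)) →
  (∀ x → Evaluate._≐_ (natPoint x) (λ i → pos-ι (x i)) g (y x)) → f ≈F g
≈F-by-evaluation (a , b) (c , d) y h h′ = ev-injective (a *P d) (c *P b) λ x →
  trans (ev-*P _ a d) (trans (cong (_⊗ ev (natPoint x) d) (proj₂ (h x)))
    (trans (solve 3 (λ y b d → y :* b :* d := y :* d :* b) refl (y x) (ev (natPoint x) b) (ev (natPoint x) d))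
      (sym (trans (ev-*P _ c b) (cong (_⊗ ev (natPoint x) b) (proj₂ (h′ x)))))))

-- Cyclic order on the vertices of a polygon

pattern case₁ x = inj₁ x
pattern case₂ x = inj₂ (inj₁ x)
pattern case₃ x = inj₂ (inj₂ x)

-- u, v, w are met in this order going counterclockwise around the polygon.
CO : ℕ → ℕ → ℕ → Set
CO u v w = (u < v × v < w) ⊎ (v < w × w < u) ⊎ (w < u × u < v)

CO-rot : ∀ {u v w} → CO u v w → CO v w u
CO-rot (case₁ p) = case₃ p
CO-rot (case₂ p) = case₁ p
CO-rot (case₃ p) = case₂ p

CO-rot² : ∀ {u v w} → CO u v w → CO w u v
CO-rot² = CO-rot ∘ CO-rot

CO-asym : ∀ {u v w} → CO u v w → ¬ CO u w v
CO-asym (case₁ (p , q)) (case₁ (r , s)) = ℕP.<-asym q s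
CO-asym (case₁ (p , q)) (case₂ (r , s)) = ℕP.<-asym p s
CO-asym (case₁ (p , q)) (case₃ (r , s)) = ℕP.<-asym p r
CO-asym (case₂ (p , q)) (case₁ (r , s)) = ℕP.<-asym p s
CO-asym (case₂ (p , q)) (case₂ (r , s)) = ℕP.<-asym p r
CO-asym (case₂ (p , q)) (case₃ (r , s)) = ℕP.<-asym q s
CO-asym (case₃ (p , q)) (case₁ (r , s)) = ℕP.<-asym p r
CO-asym (case₃ (p , q)) (case₂ (r , s)) = ℕP.<-asym q s
CO-asym (case₃ (p , q)) (case₃ (r , s)) = ℕP.<-asym p s

CO-trans : ∀ {a b c d} → CO a b c → CO a c d → CO a b d
CO-trans (case₁ (p , q)) (case₁ (r , s)) = case₁ (p , ℕP.<-trans q s)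
CO-trans (case₁ (p , q)) (case₂ (r , s)) = contradiction (ℕP.<-trans p (ℕP.<-trans q (ℕP.<-trans r s)))
    (ℕP.<-irrefl refl)
CO-trans (case₁ (p , q)) (case₃ (r , s)) = case₃ (r , p)
CO-trans (case₂ (p , q)) (case₁ (r , s)) = contradiction q (ℕP.<-asym r)
CO-trans (case₂ (p , q)) (case₂ (r , s)) = case₂ (ℕP.<-trans p r , s)
CO-trans (case₂ (p , q)) (case₃ (r , s)) = contradiction q (ℕP.<-asym s)
CO-trans (case₃ (p , q)) (case₁ (r , s)) = contradiction p (ℕP.<-asym r)
CO-trans (case₃ (p , q)) (case₂ (r , s)) = case₃ (s , q)
CO-trans (case₃ (p , q)) (case₃ (r , s)) = contradiction p (ℕP.<-asym s)

CO-total : ∀ {u v w} → u ≢ v → v ≢ w → u ≢ w → CO u v w ⊎ CO u w v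
CO-total {u} {v} {w} u≢v v≢w u≢w with ℕP.<-cmp u v | ℕP.<-cmp v w | ℕP.<-cmp u w
... | tri≈ _ e _ | _ | _ = contradiction e u≢v
... | _ | tri≈ _ e _ | _ = contradiction e v≢w
... | _ | _ | tri≈ _ e _ = contradiction e u≢w
... | tri< p _ _ | tri< q _ _ | _ = inj₁ (case₁ (p , q))
... | tri< p _ _ | tri> _ _ q | tri< r _ _ = inj₂ (case₁ (r , q))
... | tri< p _ _ | tri> _ _ q | tri> _ _ r = inj₁ (case₃ (r , p))
... | tri> _ _ p | tri< q _ _ | tri< r _ _ = inj₂ (case₃ (p , r))
... | tri> _ _ p | tri< q _ _ | tri> _ _ r = inj₁ (case₂ (q , r))
... | tri> _ _ p | tri> _ _ q | _ = inj₂ (case₂ (q , p))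

CO-≢₁₂ : ∀ {u v w} → CO u v w → u ≢ v
CO-≢₁₂ (case₁ (p , q)) refl = ℕP.<-irrefl refl p
CO-≢₁₂ (case₂ (p , q)) refl = ℕP.<-asym p q
CO-≢₁₂ (case₃ (p , q)) refl = ℕP.<-irrefl refl q

CO-≢₂₃ : ∀ {u v w} → CO u v w → v ≢ w
CO-≢₂₃ = CO-≢₁₂ ∘ CO-rot

CO-≢₁₃ : ∀ {u v w} → CO u v w → u ≢ w
CO-≢₁₃ c e = CO-≢₁₂ (CO-rot² c) (sym e)

CO-trans′ : ∀ {a b c d} → CO a b c → CO a c d → CO b c d
CO-trans′ p q = CO-rot (CO-rot (CO-trans (CO-rot q) (CO-rot² p)))

CO-linear : ∀ {p r q} → p < q → CO p r q → p < r × r < q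
CO-linear p<q (case₁ x) = x
CO-linear p<q (case₂ (_ , x)) = contradiction p<q (ℕP.<-asym x)
CO-linear p<q (case₃ (x , _)) = contradiction p<q (ℕP.<-asym x)

CO-outer : ∀ {p s q} → p < q → CO q s p → s < p ⊎ q < s
CO-outer p<q (case₁ (x , y)) = contradiction (ℕP.<-trans x y) (ℕP.<-asym p<q)
CO-outer p<q (case₂ (x , _)) = inj₁ x
CO-outer p<q (case₃ (_ , x)) = inj₂ x

data Norm (u v : ℕ) : Diag → Set where
  ascending : u < v → Norm u v (u , v)
  descending : v ≤ u → Norm u v (v , u)

norm-view : ∀ u v → Norm u v (norm u v)
norm-view u v with u <ᵇ v in eq
... | true = ascending (ℕP.<ᵇ⇒< u v (subst T (sym eq) tt))
... | false = descending (ℕP.≮⇒≥ λ u<v → subst T eq (ℕP.<⇒<ᵇ u<v))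

norm-< : ∀ {u v} → u < v → norm u v ≡ (u , v)
norm-< {u} {v} p with norm u v | norm-view u v
... | _ | ascending _ = refl
... | _ | descending q = contradiction p (ℕP.≤⇒≯ q)

norm-sym : ∀ u v → norm u v ≡ norm v u
norm-sym u v with norm u v | norm-view u v | norm v u | norm-view v u
... | _ | ascending p | _ | ascending q = contradiction p (ℕP.<-asym q)
... | _ | ascending p | _ | descending q = refl
... | _ | descending p | _ | ascending q = refl
... | _ | descending p | _ | descending q = cong₂ _,_ (ℕP.≤-antisym p q) (ℕP.≤-antisym q p)

SamePair : ℕ → ℕ → ℕ → ℕ → Set
SamePair u v x y = (u ≡ x × v ≡ y) ⊎ (u ≡ y × v ≡ x)

norm-injective : ∀ {u v x y} → norm u v ≡ norm x y → SamePair u v x y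
norm-injective {u} {v} {x} {y} e with norm u v | norm-view u v | norm x y | norm-view x y
norm-injective refl | _ | ascending _ | _ | ascending _ = inj₁ (refl , refl)
norm-injective refl | _ | ascending _ | _ | descending _ = inj₂ (refl , refl)
norm-injective refl | _ | descending _ | _ | ascending _ = inj₂ (refl , refl)
norm-injective refl | _ | descending _ | _ | descending _ = inj₁ (refl , refl)

norm-bounded : ∀ {m} u v → proj₁ (norm u v) < m → proj₂ (norm u v) < m → u < m × v < m
norm-bounded u v p q with norm u v | norm-view u v
... | _ | ascending _ = p , q
... | _ | descending _ = q , p

-- The chord {b , d} crosses {a , c}, with b on the counterclockwise side from a to c.
Cross : ℕ → ℕ → ℕ → ℕ → Set
Cross a c b d = CO a b c × CO c d a

crossB⇒Cross : ∀ {a c b d} → T (crossB (norm a c) (norm b d)) → Cross a c b d ⊎ Cross a c d b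
crossB⇒Cross {a} {c} {b} {d} t with norm a c | norm-view a c | norm b d | norm-view b d
... | (p , q) | v | (r , s) | w with Equivalence.to (T-∨ {(p <ᵇ r) ∧ (r <ᵇ q) ∧ (q <ᵇ s)}) t
... | inj₁ h with Equivalence.to (T-∧ {p <ᵇ r}) h
... | h₁ , h₂ with Equivalence.to (T-∧ {r <ᵇ q}) h₂
... | h₃ , h₄ with ℕP.<ᵇ⇒< p r h₁ | ℕP.<ᵇ⇒< r q h₃ | ℕP.<ᵇ⇒< q s h₄ | v | w
... | p<r | r<q | q<s | ascending _ | ascending _ = inj₁ (case₁ (p<r , r<q) , case₃ (ℕP.<-trans p<r r<q , q<s))
... | p<r | r<q | q<s | ascending _ | descending _ = inj₂ (case₁ (p<r , r<q) , case₃ (ℕP.<-trans p<r r<q , q<s))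
... | p<r | r<q | q<s | descending _ | ascending _ = inj₂ (case₃ (ℕP.<-trans p<r r<q , q<s) , case₁ (p<r , r<q))
... | p<r | r<q | q<s | descending _ | descending _ = inj₁ (case₃ (ℕP.<-trans p<r r<q , q<s) , case₁ (p<r , r<q))
crossB⇒Cross {a} {c} {b} {d} t | (p , q) | v | (r , s) | w | inj₂ h with Equivalence.to (T-∧ {r <ᵇ p}) h
... | h₁ , h₂ with Equivalence.to (T-∧ {p <ᵇ s}) h₂
... | h₃ , h₄ with ℕP.<ᵇ⇒< r p h₁ | ℕP.<ᵇ⇒< p s h₃ | ℕP.<ᵇ⇒< s q h₄ | v | w
... | r<p | p<s | s<q | ascending _ | ascending _ = inj₂ (case₁ (p<s , s<q) , case₂ (r<p , ℕP.<-trans p<s s<q))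
... | r<p | p<s | s<q | ascending _ | descending _ = inj₁ (case₁ (p<s , s<q) , case₂ (r<p , ℕP.<-trans p<s s<q))
... | r<p | p<s | s<q | descending _ | ascending _ = inj₁ (case₂ (r<p , ℕP.<-trans p<s s<q) , case₁ (p<s , s<q))
... | r<p | p<s | s<q | descending _ | descending _ = inj₂ (case₂ (r<p , ℕP.<-trans p<s s<q) , case₁ (p<s , s<q))

crossB-intro : ∀ {p q r s} → (p < r × r < q × q < s) ⊎ (r < p × p < s × s < q) → T (crossB (p , q) (r , s))
crossB-intro {p} {q} {r} {s} (inj₁ (x , y , z)) = Equivalence.from (T-∨ {(p <ᵇ r) ∧ (r <ᵇ q) ∧ (q <ᵇ s)})
  (inj₁ (Equivalence.from T-∧ (ℕP.<⇒<ᵇ x , Equivalence.from T-∧ (ℕP.<⇒<ᵇ y , ℕP.<⇒<ᵇ z))))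
crossB-intro {p} {q} {r} {s} (inj₂ (x , y , z)) = Equivalence.from (T-∨ {(p <ᵇ r) ∧ (r <ᵇ q) ∧ (q <ᵇ s)})
  (inj₂ (Equivalence.from T-∧ (ℕP.<⇒<ᵇ x , Equivalence.from T-∧ (ℕP.<⇒<ᵇ y , ℕP.<⇒<ᵇ z))))

Cross⇒crossB : ∀ {a c b d} → Cross a c b d → T (crossB (norm a c) (norm b d))
Cross⇒crossB {a} {c} {b} {d} (x , y) with norm a c | norm-view a c | norm b d | norm-view b d
... | _ | ascending a<c | _ | ascending b<d with CO-linear a<c x | CO-outer a<c y
... | p , q | inj₁ d<a = contradiction (ℕP.<-trans p (ℕP.<-trans b<d d<a)) (ℕP.<-irrefl refl)
... | p , q | inj₂ c<d = crossB-intro (inj₁ (p , q , c<d))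
Cross⇒crossB {a} {c} {b} {d} (x , y) | _ | ascending a<c | _ | descending d≤b with CO-linear a<c x | CO-outer a<c y
... | p , q | inj₁ d<a = crossB-intro (inj₂ (d<a , p , q))
... | p , q | inj₂ c<d = contradiction (ℕP.<-≤-trans (ℕP.<-trans q c<d) d≤b) (ℕP.<-irrefl refl)
Cross⇒crossB {a} {c} {b} {d} (x , y) | _ | descending c≤a | _ | ascending b<d
  with CO-linear (ℕP.≤∧≢⇒< c≤a (CO-≢₁₃ y)) y | CO-outer (ℕP.≤∧≢⇒< c≤a (CO-≢₁₃ y)) x
... | p , q | inj₁ b<c = crossB-intro (inj₂ (b<c , p , q))
... | p , q | inj₂ a<b = contradiction (ℕP.<-trans a<b (ℕP.<-trans b<d q)) (ℕP.<-irrefl refl)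
Cross⇒crossB {a} {c} {b} {d} (x , y) | _ | descending c≤a | _ | descending d≤b
  with CO-linear (ℕP.≤∧≢⇒< c≤a (CO-≢₁₃ y)) y | CO-outer (ℕP.≤∧≢⇒< c≤a (CO-≢₁₃ y)) x
... | p , q | inj₁ b<c = contradiction (ℕP.<-≤-trans (ℕP.<-trans b<c p) d≤b) (ℕP.<-irrefl refl)
... | p , q | inj₂ a<b = crossB-intro (inj₁ (p , q , a<b))

Consec : ℕ → ℕ → ℕ → Set
Consec m u v = (suc u ≡ v ⊎ suc v ≡ u) ⊎ ((u ≡ 0 × suc v ≡ m) ⊎ (v ≡ 0 × suc u ≡ m))

Consec-sym : ∀ {m u v} → Consec m u v → Consec m v u
Consec-sym (inj₁ (inj₁ x)) = inj₁ (inj₂ x)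
Consec-sym (inj₁ (inj₂ x)) = inj₁ (inj₁ x)
Consec-sym (inj₂ (inj₁ x)) = inj₂ (inj₂ x)
Consec-sym (inj₂ (inj₂ x)) = inj₂ (inj₁ x)

Consec-empty : ∀ {m u v x y} → x < m → y < m → Consec m u v → ¬ Cross u v x y
Consec-empty xm ym (inj₁ (inj₁ refl)) (c , _) with CO-linear (ℕP.n<1+n _) c
... | p , q = ℕP.<-irrefl refl (ℕP.<-≤-trans p (ℕP.≤-pred q))
Consec-empty xm ym (inj₁ (inj₂ refl)) (_ , c) with CO-linear (ℕP.n<1+n _) c
... | p , q = ℕP.<-irrefl refl (ℕP.<-≤-trans p (ℕP.≤-pred q))
Consec-empty xm (s≤s ym) (inj₂ (inj₁ (refl , refl))) (_ , c) with c
... | case₁ (p , _) = ℕP.<-irrefl refl (ℕP.<-≤-trans p ym)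
... | case₂ (() , _)
... | case₃ (_ , p) = ℕP.<-irrefl refl (ℕP.<-≤-trans p ym)
Consec-empty (s≤s xm) ym (inj₂ (inj₂ (refl , refl))) (c , _) with c
... | case₁ (p , _) = ℕP.<-irrefl refl (ℕP.<-≤-trans p xm)
... | case₂ (() , _)
... | case₃ (_ , p) = ℕP.<-irrefl refl (ℕP.<-≤-trans p xm)

-- Vertices on both sides characterise diagonals by the cyclic order alone, which makes `IsDiag`
-- invariant under rotation. The witnesses are p + 1 on one side, and on the other q + 1 if p = 0
-- (then q + 1 < m) and 0 otherwise.
IsDiag⇒sides : ∀ {m p q} → IsDiag m (p , q) → ∃ λ x → ∃ λ y → x < m × y < m × Cross p q x y
IsDiag⇒sides {m} {zero} {q} (p<q , q<m , q≢ , ¬0) = 1 , suc q , ℕP.≤-<-trans p<q q<m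
    , ℕP.≤∧≢⇒< q<m (λ e → ¬0 (refl , e)) ,
  case₁ (s≤s z≤n , ℕP.≤∧≢⇒< p<q (q≢ ∘ sym)) , case₃ (p<q , ℕP.n<1+n q)
IsDiag⇒sides {m} {suc p} {q} (p<q , q<m , q≢ , ¬0) = suc (suc p) , 0 , ℕP.≤-<-trans p<q q<m , ℕP.≤-<-trans z≤n q<m ,
  case₁ (ℕP.n<1+n _ , ℕP.≤∧≢⇒< p<q (q≢ ∘ sym)) , case₂ (s≤s z≤n , p<q)

sides⇒IsDiag : ∀ {m u v x y} → u < m → v < m → x < m → y < m → Cross u v x y → IsDiag m (norm u v)
sides⇒IsDiag {m} {u} {v} um vm xm ym c with norm u v | norm-view u v
... | _ | ascending u<v = u<v , vm , (λ e → Consec-empty xm ym (inj₁ (inj₁ (sym e))) c) , λ e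
    → Consec-empty xm ym (inj₂ (inj₁ e)) c
... | _ | descending v≤u = ℕP.≤∧≢⇒< v≤u (CO-≢₁₃ (proj₂ c)) , um , (λ e → Consec-empty xm ym (inj₁ (inj₂ (sym e))) c)
    , λ e → Consec-empty xm ym (inj₂ (inj₂ e)) c

-- Position of w when the vertices are renumbered counterclockwise from c.
ρ : ℕ → ℕ → ℕ → ℕ
ρ m c w = if w <ᵇ c then w ℕ.+ m ∸ c else w ∸ c

data Rotated (m c w : ℕ) : ℕ → Set where
  before : w < c → Rotated m c w (w ℕ.+ m ∸ c)
  after : c ≤ w → Rotated m c w (w ∸ c)

ρ-view : ∀ m c w → Rotated m c w (ρ m c w)
ρ-view m c w with w <ᵇ c in eq
... | true = before (ℕP.<ᵇ⇒< w c (subst T (sym eq) tt))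
... | false = after (ℕP.≮⇒≥ λ w<c → subst T eq (ℕP.<⇒<ᵇ w<c))

module Rotation {m c : ℕ} (c≤m : c ≤ m) where

  ρ-bound : ∀ {w} → w < m → ρ m c w < m
  ρ-bound {w} w<m with ρ m c w | ρ-view m c w
  ... | _ | before w<c = ℕP.+-cancelʳ-< c _ _ (subst (ℕ._< m ℕ.+ c) (sym (ℕP.m∸n+n≡m (ℕP.≤-trans c≤m (ℕP.m≤n+m m w))))
          (subst (w ℕ.+ m ℕ.<_) (ℕP.+-comm c m) (ℕP.+-monoˡ-< m w<c)))
  ... | _ | after c≤w = ℕP.≤-<-trans (ℕP.m∸n≤m w c) w<m

  -- A pair changes order exactly when c separates it. The position of c is recorded as well, to
  -- rule out inconsistent combinations for three vertices.
  ρ-mono : ∀ {u v} → u < v → v < m → (ρ m c u < ρ m c v × (v < c ⊎ c ≤ u)) ⊎ (ρ m c v < ρ m c u × u < c × c ≤ v)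
  ρ-mono {u} {v} u<v v<m with ρ m c u | ρ-view m c u | ρ m c v | ρ-view m c v
  ... | _ | before u<c | _ | before v<c = inj₁ (ℕP.∸-monoˡ-< (ℕP.+-monoˡ-< m u<v) (ℕP.≤-trans c≤m (ℕP.m≤n+m m u))
      , inj₁ v<c)
  ... | _ | before u<c | _ | after c≤v = inj₂ (ℕP.∸-monoˡ-< (ℕP.<-≤-trans v<m (ℕP.m≤n+m m u)) c≤v , u<c , c≤v)
  ... | _ | after c≤u | _ | before v<c = contradiction (ℕP.<-trans u<v v<c) (ℕP.≤⇒≯ c≤u)
  ... | _ | after c≤u | _ | after c≤v = inj₁ (ℕP.∸-monoˡ-< u<v c≤u , inj₂ c≤u)

  CO-ρ-linear : ∀ {u v w} → w < m → u < v → v < w → CO (ρ m c u) (ρ m c v) (ρ m c w)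
  CO-ρ-linear w<m u<v v<w with ρ-mono u<v (ℕP.<-trans v<w w<m) | ρ-mono v<w w<m
  ... | inj₁ (p , _) | inj₁ (q , _) = case₁ (p , q)
  ... | inj₁ (p , inj₁ v<c) | inj₂ (q , v<c′ , c≤w) with ρ-mono (ℕP.<-trans u<v v<w) w<m
  ...   | inj₁ (r , inj₁ w<c) = contradiction w<c (ℕP.≤⇒≯ c≤w)
  ...   | inj₁ (r , inj₂ c≤u) = contradiction (ℕP.<-trans u<v v<c) (ℕP.≤⇒≯ c≤u)
  ...   | inj₂ (r , _) = case₃ (r , p)
  CO-ρ-linear w<m u<v v<w | inj₁ (p , inj₂ c≤u) | inj₂ (q , v<c , c≤w) = contradiction (ℕP.<-trans u<v v<c)
      (ℕP.≤⇒≯ c≤u)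
  CO-ρ-linear w<m u<v v<w | inj₂ (p , u<c , c≤v) | inj₁ (q , _) with ρ-mono (ℕP.<-trans u<v v<w) w<m
  ... | inj₁ (r , inj₁ w<c) = contradiction (ℕP.<-trans v<w w<c) (ℕP.≤⇒≯ c≤v)
  ... | inj₁ (r , inj₂ c≤u) = contradiction u<c (ℕP.≤⇒≯ c≤u)
  ... | inj₂ (r , _) = case₂ (q , r)
  CO-ρ-linear w<m u<v v<w | inj₂ (p , u<c , c≤v) | inj₂ (q , v<c , c≤w) = contradiction v<c (ℕP.≤⇒≯ c≤v)

  CO-ρ : ∀ {u v w} → u < m → v < m → w < m → CO u v w → CO (ρ m c u) (ρ m c v) (ρ m c w)
  CO-ρ um vm wm (case₁ (p , q)) = CO-ρ-linear wm p q
  CO-ρ um vm wm (case₂ (p , q)) = CO-rot² (CO-ρ-linear um p q)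
  CO-ρ um vm wm (case₃ (p , q)) = CO-rot (CO-ρ-linear vm p q)

  -- The inverse of the renumbering from c is the one from m ∸ c. For c = 0 this is `ρ m m`, which
  -- is why the bound on c is c ≤ m and not c < m.
  ρ-inverse : ∀ {w} → w < m → ρ m (m ∸ c) (ρ m c w) ≡ w
  ρ-inverse {w} w<m with ρ m c w | ρ-view m c w
  ... | _ | before w<c with ρ m (m ∸ c) (w ℕ.+ m ∸ c) | ρ-view m (m ∸ c) (w ℕ.+ m ∸ c)
  ...   | _ | before x = contradiction (ℕP.m≤n+m (m ∸ c) w) (ℕP.<⇒≱ (subst (ℕ._< m ∸ c) (ℕP.+-∸-assoc w c≤m) x))
  ...   | _ | after x = trans (cong (_∸ (m ∸ c)) (ℕP.+-∸-assoc w c≤m)) (ℕP.m+n∸n≡m w (m ∸ c))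
  ρ-inverse {w} w<m | _ | after c≤w with ρ m (m ∸ c) (w ∸ c) | ρ-view m (m ∸ c) (w ∸ c)
  ... | _ | before x = trans (cong (_∸ (m ∸ c)) (trans (sym (ℕP.+-∸-comm m c≤w)) (ℕP.+-∸-assoc w c≤m)))
      (ℕP.m+n∸n≡m w (m ∸ c))
  ... | _ | after x = contradiction (ℕP.∸-monoˡ-< w<m c≤w) (ℕP.≤⇒≯ x)

  ρ-injective : ∀ {u v} → u < m → v < m → ρ m c u ≡ ρ m c v → u ≡ v
  ρ-injective um vm e = trans (sym (ρ-inverse um)) (trans (cong (ρ m (m ∸ c)) e) (ρ-inverse vm))

CO-ρ⁻¹ : ∀ {m c u v w} → c ≤ m → u < m → v < m → w < m → CO (ρ m c u) (ρ m c v) (ρ m c w) → CO u v w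
CO-ρ⁻¹ {m} {c} c≤m um vm wm h =
  subst₂ (λ x y → CO x y _) (inverse um) (inverse vm) (subst (CO _ _) (inverse wm)
    (Rotation.CO-ρ (ℕP.m∸n≤m m c) (bound um) (bound vm) (bound wm) h))
  where
  inverse = Rotation.ρ-inverse c≤m
  bound = Rotation.ρ-bound c≤m

ρ-self : ∀ m c → ρ m c c ≡ 0
ρ-self m c with ρ m c c | ρ-view m c c
... | _ | before x = contradiction x (ℕP.<-irrefl refl)
... | _ | after _ = ℕP.n∸n≡0 c

ccwFrom-ρ : ∀ m .{{_ : ℕ.NonZero m}} {v x} → v < m → x < m → ccwFrom m v x ≡ ρ m v x
ccwFrom-ρ m {v} {x} v<m x<m with ρ m v x | ρ-view m v x
... | _ | before x<v = m<n⇒m%n≡m (subst (ℕ._< m) (rotated-before x<v) (Rotation.ρ-bound (ℕP.<⇒≤ v<m) x<m))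
  where
  rotated-before : x < v → ρ m v x ≡ x ℕ.+ m ∸ v
  rotated-before x<v with ρ m v x | ρ-view m v x
  ... | _ | before _ = refl
  ... | _ | after v≤x = contradiction x<v (ℕP.≤⇒≯ v≤x)
... | _ | after v≤x = trans (cong (_% m) (ℕP.+-∸-comm m v≤x)) (trans ([m+n]%n≡m%n (x ∸ v) m)
    (m<n⇒m%n≡m (ℕP.≤-<-trans (ℕP.m∸n≤m x v) x<m)))

ρ-<⇒CO : ∀ {m v u w} → v < m → u < m → w < m → u ≢ v → ρ m v u < ρ m v w → CO v u w
ρ-<⇒CO {m} {v} {u} vm um wm u≢v h = CO-ρ⁻¹ (ℕP.<⇒≤ vm) vm um wm
    (case₁ (subst (ℕ._< ρ m v u) (sym (ρ-self m v)) (ℕP.n≢0⇒n>0 ρu≢0) , h))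
  where
  ρu≢0 : ρ m v u ≢ 0
  ρu≢0 e = u≢v (Rotation.ρ-injective (ℕP.<⇒≤ vm) um vm (trans e (sym (ρ-self m v))))

CO⇒ρ-< : ∀ {m v u w} → v < m → u < m → w < m → CO v u w → ρ m v u < ρ m v w
CO⇒ρ-< {m} {v} {u} {w} vm um wm c with Rotation.CO-ρ (ℕP.<⇒≤ vm) vm um wm c
... | case₁ (_ , q) = q
... | case₂ (p , q) = p
... | case₃ (p , q) = contradiction (subst (ρ m v w ℕ.<_) (ρ-self m v) p) λ ()

-- Triangulations are binary trees

⟦_⟧ : ∀ {P : Set} → Dec P → ℕ
⟦ d ⟧ = if does d then 1 else 0

⟦⟧≤1 : ∀ {P : Set} (d : Dec P) → ⟦ d ⟧ ≤ 1
⟦⟧≤1 (yes _) = s≤s z≤n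
⟦⟧≤1 (no _) = z≤n

⟦⟧-≤ : ∀ {P : Set} {k} (d : Dec P) → (P → 1 ≤ k) → ⟦ d ⟧ ≤ k
⟦⟧-≤ (yes p) h = h p
⟦⟧-≤ (no _) h = z≤n

⟦⟧-yes : ∀ {P : Set} (d : Dec P) → P → ⟦ d ⟧ ≡ 1
⟦⟧-yes (yes _) p = refl
⟦⟧-yes (no ¬p) p = contradiction p ¬p

⟦⟧-no : ∀ {P : Set} (d : Dec P) → ¬ P → ⟦ d ⟧ ≡ 0
⟦⟧-no (yes p) ¬p = contradiction p ¬p
⟦⟧-no (no _) ¬p = refl

⟦⟧-true : ∀ {P : Set} (d : Dec P) → 0 < ⟦ d ⟧ → P
⟦⟧-true (yes p) _ = p

if-yes : ∀ {P A : Set} (d : Dec P) {a b : A} → P → (if does d then a else b) ≡ a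
if-yes (yes _) p = refl
if-yes (no ¬p) p = contradiction p ¬p

if-no : ∀ {P A : Set} (d : Dec P) {a b : A} → ¬ P → (if does d then a else b) ≡ b
if-no (yes p) ¬p = contradiction p ¬p
if-no (no _) ¬p = refl

sumℕ-mono : ∀ {n} {f g : Fin n → ℕ} → (∀ i → f i ≤ g i) → sumℕ f ≤ sumℕ g
sumℕ-mono {zero} h = z≤n
sumℕ-mono {suc n} h = ℕP.+-mono-≤ (h zero) (sumℕ-mono (h ∘ suc))

sumℕ-cong : ∀ {n} {f g : Fin n → ℕ} → (∀ i → f i ≡ g i) → sumℕ f ≡ sumℕ g
sumℕ-cong {zero} h = refl
sumℕ-cong {suc n} h = cong₂ ℕ._+_ (h zero) (sumℕ-cong (h ∘ suc))

sumℕ-+ : ∀ {n} (f g : Fin n → ℕ) → sumℕ (λ i → f i ℕ.+ g i) ≡ sumℕ f ℕ.+ sumℕ g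
sumℕ-+ {zero} f g = refl
sumℕ-+ {suc n} f g = trans (cong (f zero ℕ.+ g zero ℕ.+_) (sumℕ-+ (f ∘ suc) (g ∘ suc)))
  (interchange (f zero) (g zero) (sumℕ (f ∘ suc)) (sumℕ (g ∘ suc)))
  where
  interchange : ∀ a b c d → a ℕ.+ b ℕ.+ (c ℕ.+ d) ≡ a ℕ.+ c ℕ.+ (b ℕ.+ d)
  interchange a b c d = trans (ℕP.+-assoc a b _) (trans (cong (a ℕ.+_) (trans (sym (ℕP.+-assoc b c d))
    (trans (cong (ℕ._+ d) (ℕP.+-comm b c)) (ℕP.+-assoc c b d)))) (sym (ℕP.+-assoc a c _)))

sumℕ-const : ∀ n k → sumℕ {n} (λ _ → k) ≡ n ℕ.* k
sumℕ-const zero k = refl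
sumℕ-const (suc n) k = cong (k ℕ.+_) (sumℕ-const n k)

sumℕ-0 : ∀ {n} {f : Fin n → ℕ} → (∀ i → f i ≡ 0) → sumℕ f ≡ 0
sumℕ-0 {n} h = trans (sumℕ-cong h) (trans (sumℕ-const n 0) (ℕP.*-zeroʳ n))

sumℕ-single : ∀ {n} {f : Fin n → ℕ} i → (∀ j → j ≢ i → f j ≡ 0) → sumℕ f ≡ f i
sumℕ-single {suc n} {f} zero h = trans (cong (f zero ℕ.+_) (sumℕ-0 (λ j → h (suc j) λ ()))) (ℕP.+-identityʳ _)
sumℕ-single {suc n} {f} (suc i) h = cong₂ ℕ._+_ (h zero λ ())
    (sumℕ-single i (λ j j≢i → h (suc j) (j≢i ∘ FinP.suc-injective)))

unique-count : ∀ {n} {P : Fin n → Set} (d : ∀ i → Dec (P i)) → (∀ i j → P i → P j → i ≡ j) → sumℕ (λ i → ⟦ d i ⟧) ≤ 1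
unique-count d h with FinP.any? d
... | yes (i , p) = ℕP.≤-trans (ℕP.≤-reflexive (sumℕ-single i (λ j j≢i → ⟦⟧-no (d j) λ q → j≢i (h j i q p))))
    (⟦⟧≤1 (d i))
... | no ¬p = ℕP.≤-trans (ℕP.≤-reflexive (sumℕ-0 λ i → ⟦⟧-no (d i) λ p → ¬p (i , p))) z≤n

_≟D_ : (e f : Diag) → Dec (e ≡ f)
_≟D_ = ProductP.≡-dec ℕ._≟_ ℕ._≟_

T-not : ∀ {b} → T (not b) → ¬ T b
T-not {false} _ ()

largest : ∀ {P : ℕ → Set} → (∀ r → Dec (P r)) → ∀ p k → P (suc p) →
  ∃ λ r → p < r × r < suc (suc p) ℕ.+ k × P r × (∀ r′ → r < r′ → r′ < suc (suc p) ℕ.+ k → ¬ P r′)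
largest {P} P? p k base = search (suc p ℕ.+ k) (s≤s (ℕP.m≤m+n p k)) λ r′ a b → contradiction b (ℕP.≤⇒≯ a)
  where
  search : ∀ r → p < r → (∀ r′ → r < r′ → r′ < suc (suc p) ℕ.+ k → ¬ P r′) →
    ∃ λ r → p < r × r < suc (suc p) ℕ.+ k × P r × (∀ r′ → r < r′ → r′ < suc (suc p) ℕ.+ k → ¬ P r′)
  search (suc r) (s≤s p≤r) h with suc r <? suc (suc p) ℕ.+ k | P? (suc r)
  ... | yes b | yes pr = suc r , s≤s p≤r , b , pr , h
  ... | yes b | no ¬pr with ℕP.m≤n⇒m<n∨m≡n p≤r
  ...   | inj₁ p<r = search r p<r λ r′ a c pr′ → [ (λ x → h r′ x c pr′) , (λ { refl → ¬pr pr′ }) ]′ (ℕP.m≤n⇒m<n∨m≡n a)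
  ...   | inj₂ refl = contradiction base ¬pr
  search (suc r) (s≤s p≤r) h | no ¬b | _ with ℕP.m≤n⇒m<n∨m≡n p≤r
  ...   | inj₁ p<r = search r p<r λ r′ a c → [ (λ x → h r′ x c)
      , (λ { refl → contradiction c ¬b }) ]′ (ℕP.m≤n⇒m<n∨m≡n a)
  ...   | inj₂ refl = contradiction (s≤s (s≤s (ℕP.m≤m+n _ k))) ¬b

-- A triangulated polygon below the chord {p , q}: `leaf` is a boundary edge, `node` the triangle p
-- < r < q with the polygons below its two other sides. S certifies the chord on top.
data Tree (S : ℕ → ℕ → Set) : ℕ → ℕ → Set where
  leaf : ∀ {p} → Tree S p (suc p)
  node : ∀ {p r q} → S p q → p < r → r < q → Tree S p r → Tree S r q → Tree S p q

Avoids : (S : ℕ → ℕ → Set) → ℕ → ℕ → Set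
Avoids S u v = ∀ a b → S a b → ¬ (a < u × u < b × b < v) × ¬ (u < a × a < v × v < b)

-- Descent towards {u , v}. If the apex r lies strictly between u and v, then {p , r} with p < u or
-- {r , q} with v < q would cross {u , v}; so the current node is the one sought.
subtree : ∀ {S p q u v} → Tree S p q → u < v → p ≤ u → v ≤ q → Avoids S u v → Tree S u v
subtree leaf u<v p≤u v≤q h with ℕP.≤-antisym p≤u (ℕP.≤-pred (ℕP.<-≤-trans u<v v≤q))
... | refl with ℕP.≤-antisym v≤q u<v
... | refl = leaf
subtree {S} {p} {q} {u} {v} t@(node {r = r} s p<r r<q t₁ t₂) u<v p≤u v≤q h with v ≤? r | r ≤? u
... | yes v≤r | _ = subtree t₁ u<v p≤u v≤r h
... | no _ | yes r≤u = subtree t₂ u<v r≤u v≤q h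
... | no v≰r | no r≰u with left t₁ | right t₂
  where
  left : Tree S p r → p ≡ u
  left leaf = ℕP.≤-antisym p≤u (ℕP.≤-pred (ℕP.≰⇒> r≰u))
  left (node s′ _ _ _ _) with ℕP.m≤n⇒m<n∨m≡n p≤u
  ... | inj₁ p<u = contradiction (p<u , ℕP.≰⇒> r≰u , ℕP.≰⇒> v≰r) (proj₁ (h p r s′))
  ... | inj₂ e = e
  right : Tree S r q → v ≡ q
  right leaf = ℕP.≤-antisym v≤q (ℕP.≰⇒> v≰r)
  right (node s′ _ _ _ _) with ℕP.m≤n⇒m<n∨m≡n v≤q
  ... | inj₁ v<q = contradiction (ℕP.≰⇒> r≰u , ℕP.≰⇒> v≰r , v<q) (proj₂ (h r q s′))
  ... | inj₂ e = e
... | refl | refl = t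

module Triangulated {n : ℕ} {D : Fin n → Diag} (tri : IsTriangulation n D) where

  m : ℕ
  m = n ℕ.+ 3

  isDiag : ∀ i → IsDiag m (D i)
  isDiag = proj₁ tri

  D-injective : ∀ {i j} → D i ≡ D j → i ≡ j
  D-injective {i} {j} e with i Fin.≟ j
  ... | yes p = p
  ... | no ¬p = contradiction e (proj₁ (proj₂ tri) i j ¬p)

  uncrossed : ∀ i j {p q r s} → D i ≡ (p , q) → D j ≡ (r , s) → ¬ (p < r × r < q × q < s)
  uncrossed i j ei ej h = T-not (proj₂ (proj₂ tri) i j)
      (subst₂ (λ e f → T (crossB e f)) (sym ei) (sym ej) (crossB-intro (inj₁ h)))

  Inside : ℕ → ℕ → Diag → Set
  Inside p q e = p ≤ proj₁ e × proj₂ e ≤ q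

  inside? : ∀ p q e → Dec (Inside p q e)
  inside? p q e = (p ≤? proj₁ e) ×-dec (proj₂ e ≤? q)

  count : ℕ → ℕ → ℕ
  count p q = sumℕ (λ i → ⟦ inside? p q (D i) ⟧)

  occurs : ℕ → ℕ → ℕ
  occurs p q = sumℕ (λ i → ⟦ D i ≟D (p , q) ⟧)

  occurs≤1 : ∀ p q → occurs p q ≤ 1
  occurs≤1 p q = unique-count (λ i → D i ≟D (p , q)) (λ i j e f → D-injective (trans e (sym f)))

  Split : ℕ → ℕ → ℕ → Set
  Split p r q = ∀ i → Inside p q (D i) → D i ≡ (p , q) ⊎ (proj₂ (D i) ≤ r ⊎ r ≤ proj₁ (D i))

  -- The vertex r is the end of the longest diagonal from p that stops short of q, or p + 1 if there
  -- is none. A diagonal passing over r must start at p, since otherwise it would cross {p , r}; by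
  -- maximality it is then {p , q}.
  split : ∀ p q → suc p < q → ∃ λ r → p < r × r < q × Split p r q
  split p q p+1<q with ℕP.m≤n⇒∃[o]m+o≡n p+1<q
  ... | k , refl with largest {P = λ r → r ≡ suc p ⊎ ∃ λ i → D i ≡ (p , r)}
                       (λ r → (r ℕ.≟ suc p) ⊎-dec FinP.any? (λ i → D i ≟D (p , r))) p k (inj₁ refl)
  ... | r , p<r , r<q , pr , max = r , p<r , r<q , classify
    where
    classify : Split p r q
    classify i (p≤a , b≤q) with proj₂ (D i) ≤? r | r ≤? proj₁ (D i)
    ... | yes x | _ = inj₂ (inj₁ x)
    ... | no _ | yes x = inj₂ (inj₂ x)
    ... | no b≰r | no r≰a with ℕP.m≤n⇒m<n∨m≡n p≤a
    ...   | inj₁ p<a = [ (λ e → contradiction (subst (_≤ proj₁ (D i)) (sym e) p<a) r≰a) ,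
                         (λ (j , e) → contradiction (p<a , ℕP.≰⇒> r≰a , ℕP.≰⇒> b≰r) (uncrossed j i e refl)) ]′ pr
    ...   | inj₂ p≡a with ℕP.m≤n⇒m<n∨m≡n b≤q
    ...     | inj₁ b<q = contradiction (inj₂ (i , cong (_, proj₂ (D i)) (sym p≡a))) (max _ (ℕP.≰⇒> b≰r) b<q)
    ...     | inj₂ e = inj₁ (cong₂ _,_ (sym p≡a) e)

  count-split : ∀ {p r q} → Split p r q → count p q ≤ occurs p q ℕ.+ (count p r ℕ.+ count r q)
  count-split {p} {r} {q} h = ℕP.≤-trans (sumℕ-mono pointwise)
    (ℕP.≤-reflexive (trans (sumℕ-+ (λ i → ⟦ D i ≟D (p , q) ⟧) (λ i → ⟦ inside? p r (D i) ⟧ ℕ.+ ⟦ inside? r q (D i) ⟧))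
      (cong (occurs p q ℕ.+_) (sumℕ-+ (λ i → ⟦ inside? p r (D i) ⟧) (λ i → ⟦ inside? r q (D i) ⟧)))))
    where
    pointwise : ∀ i → ⟦ inside? p q (D i) ⟧ ≤ ⟦ D i ≟D (p , q) ⟧ ℕ.+ (⟦ inside? p r (D i) ⟧ ℕ.+ ⟦ inside? r q (D i) ⟧)
    pointwise i = ⟦⟧-≤ (inside? p q (D i)) λ x → [
      (λ e → ℕP.≤-trans (ℕP.≤-reflexive (sym (⟦⟧-yes (D i ≟D (p , q)) e))) (ℕP.m≤m+n _ _)) , [
      (λ b≤r → ℕP.≤-trans (ℕP.≤-trans (ℕP.≤-reflexive (sym (⟦⟧-yes (inside? p r (D i)) (proj₁ x , b≤r))))
          (ℕP.m≤m+n _ _)) (ℕP.m≤n+m _ ⟦ D i ≟D (p , q) ⟧)) ,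
      (λ r≤a → ℕP.≤-trans (ℕP.≤-trans (ℕP.≤-reflexive (sym (⟦⟧-yes (inside? r q (D i)) (r≤a , proj₂ x))))
          (ℕP.m≤n+m _ ⟦ inside? p r (D i) ⟧)) (ℕP.m≤n+m _ ⟦ D i ≟D (p , q) ⟧)) ]′ ]′ (h i x)

  shrink : ∀ {p r q k} → p < r → r < q → q ≤ suc p ℕ.+ suc k → r ≤ suc p ℕ.+ k × q ≤ suc r ℕ.+ k
  shrink {p} {r} {q} {k} p<r r<q h =
    ℕP.≤-pred (ℕP.≤-trans r<q (subst (q ≤_) (ℕP.+-suc (suc p) k) h)) ,
    ℕP.≤-trans h (subst (_≤ suc r ℕ.+ k) (sym (ℕP.+-suc (suc p) k)) (s≤s (ℕP.+-monoˡ-≤ k p<r)))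

  combine : ∀ d a b p r q → d ≤ 1 → a ℕ.+ suc p ≤ r → b ℕ.+ suc r ≤ q → d ℕ.+ (a ℕ.+ b) ℕ.+ suc p ≤ q
  combine d a b p r q d≤1 ha hb = begin
    d ℕ.+ (a ℕ.+ b) ℕ.+ suc p  ≡⟨ solveℕ 4 (λ d a b p → d :+ℕ (a :+ℕ b) :+ℕ (conℕ 1 :+ℕ p) :=ℕ b :+ℕ
        (d :+ℕ (a :+ℕ (conℕ 1 :+ℕ p)))) refl d a b p ⟩
    b ℕ.+ (d ℕ.+ (a ℕ.+ suc p)) ≤⟨ ℕP.+-monoʳ-≤ b (ℕP.+-mono-≤ d≤1 ha) ⟩
    b ℕ.+ suc r                 ≤⟨ hb ⟩
    q                           ∎
    where
    open ℕP.≤-Reasoning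

  -- The polygon on p, ..., q admits at most q - p - 1 diagonals, {p , q} included: one for {p , q}
  -- and, by `split`, those of the two halves. The number k is fuel bounding the length of the
  -- interval.
  count-bound : ∀ k p q → p < q → q ≤ suc p ℕ.+ k → count p q ℕ.+ suc p ≤ q
  count-bound k p q p<q h with ℕP.m≤n⇒m<n∨m≡n p<q
  ... | inj₂ refl = ℕP.≤-reflexive (cong (ℕ._+ suc p) (sumℕ-0 λ i → ⟦⟧-no (inside? p (suc p) (D i)) (none i)))
    where
    none : ∀ i → ¬ Inside p (suc p) (D i)
    none i (p≤a , b≤p+1) with isDiag i
    ... | a<b , _ , b≢ , _ = b≢ (ℕP.≤-antisym (ℕP.≤-trans b≤p+1 (s≤s p≤a)) a<b)
  count-bound zero p q p<q h | inj₁ x = contradiction (ℕP.<-≤-trans x (subst (q ≤_) (ℕP.+-identityʳ _) h))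
      (ℕP.<-irrefl refl)
  count-bound (suc k) p q p<q h | inj₁ x with split p q x
  ... | r , p<r , r<q , s with shrink p<r r<q h
  ... | h₁ , h₂ = ℕP.≤-trans (ℕP.+-monoˡ-≤ (suc p) (count-split s))
    (combine _ _ _ p r q (occurs≤1 p q) (count-bound k p r p<r h₁) (count-bound k r q r<q h₂))

  bound : ∀ {p q} → p < q → count p q ℕ.+ suc p ≤ q
  bound {p} {q} p<q = count-bound q p q p<q (ℕP.m≤n+m q (suc p))

  Side : ℕ → ℕ → Set
  Side p q = (∃ λ i → D i ≡ (p , q)) ⊎ (p ≡ 0 × suc q ≡ m)

  tight-split : ∀ {p r q} → p < r → r < q → q ≤ suc (count p r ℕ.+ suc p ℕ.+ count r q) →
    r ≤ count p r ℕ.+ suc p × q ≤ count r q ℕ.+ suc r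
  tight-split {p} {r} {q} p<r r<q h = ℕP.≮⇒≥ too-small ,
    ℕP.≤-trans h (ℕP.≤-trans (s≤s (ℕP.+-monoˡ-≤ (count r q) (bound p<r))) (ℕP.≤-reflexive (ℕP.+-comm (suc r) _)))
    where
    too-small : ¬ (count p r ℕ.+ suc p < r)
    too-small x = ℕP.<-irrefl refl (ℕP.<-≤-trans (ℕP.≤-<-trans h (ℕP.≤-<-trans (ℕP.+-monoˡ-≤ (count r q) x)
      (ℕP.≤-reflexive (trans (cong suc (ℕP.+-comm r _)) (sym (ℕP.+-suc _ r)))))) (bound r<q))

  rearrange : ∀ a b p → a ℕ.+ b ℕ.+ suc p ≡ a ℕ.+ suc p ℕ.+ b
  rearrange a b p = trans (ℕP.+-assoc a b _) (trans (cong (a ℕ.+_) (ℕP.+-comm b _)) (sym (ℕP.+-assoc a _ b)))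

  -- Where the bound is attained, {p , q} must itself be a diagonal, and both halves of the split
  -- attain their bounds.
  tight-tree : ∀ k p q → p < q → q ≤ suc p ℕ.+ k → q ≤ count p q ℕ.+ suc p → Tree Side p q
  tight-tree k p q p<q h t with ℕP.m≤n⇒m<n∨m≡n p<q
  ... | inj₂ refl = leaf
  tight-tree zero p q p<q h t | inj₁ x = contradiction (ℕP.<-≤-trans x (subst (q ≤_) (ℕP.+-identityʳ _) h))
      (ℕP.<-irrefl refl)
  tight-tree (suc k) p q p<q h t | inj₁ x with split p q x
  ... | r , p<r , r<q , s with shrink p<r r<q h | FinP.any? (λ i → D i ≟D (p , q))
  ... | h₁ , h₂ | yes (i , e) =
    node (inj₁ (i , e)) p<r r<q (tight-tree k p r p<r h₁ (proj₁ both)) (tight-tree k r q r<q h₂ (proj₂ both))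
    where
    both = tight-split p<r r<q (ℕP.≤-trans t (ℕP.≤-trans
        (ℕP.+-monoˡ-≤ (suc p) (ℕP.≤-trans (count-split s) (ℕP.+-monoˡ-≤ _ (occurs≤1 p q))))
      (ℕP.≤-reflexive (cong suc (rearrange (count p r) _ p)))))
  ... | h₁ , h₂ | no ¬e = contradiction (ℕP.≤-<-trans t
      (ℕP.<-≤-trans (s≤s (ℕP.+-monoˡ-≤ (suc p) (count-split s))) strict)) (ℕP.<-irrefl refl)
    where
    strict : suc (occurs p q ℕ.+ (count p r ℕ.+ count r q) ℕ.+ suc p) ≤ q
    strict rewrite sumℕ-0 {f = λ i → ⟦ D i ≟D (p , q) ⟧} (λ i → ⟦⟧-no (D i ≟D (p , q)) λ e → ¬e (i , e)) =
      combine 1 _ _ p r q ℕP.≤-refl (bound p<r) (bound r<q)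

  abstract
    -- `IsTriangulation` asks only for n distinct non-crossing diagonals. That they cut the polygon
    -- into triangles follows by counting: the top edge {0 , n + 2} is not a diagonal, so the n
    -- diagonals fill both halves of the first split.
    tree : Tree Side 0 (n ℕ.+ 2)
    tree with split 0 (n ℕ.+ 2) (ℕP.m≤n+m 2 n)
    ... | r , p<r , r<q , s =
      node (inj₂ (refl , sym (ℕP.+-suc n 2))) p<r r<q (tight-tree r 0 r p<r (ℕP.n≤1+n r) (proj₁ both))
        (tight-tree (n ℕ.+ 2) r (n ℕ.+ 2) r<q (ℕP.m≤n+m _ (suc r)) (proj₂ both))
      where
      all-inside : count 0 (n ℕ.+ 2) ≡ n
      all-inside = trans (sumℕ-cong λ i → ⟦⟧-yes (inside? 0 (n ℕ.+ 2) (D i))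
        (z≤n , ℕP.≤-pred (subst (proj₂ (D i) <_) (ℕP.+-suc n 2) (proj₁ (proj₂ (isDiag i))))))
            (trans (sumℕ-const n 1) (ℕP.*-identityʳ n))
      no-root : occurs 0 (n ℕ.+ 2) ≡ 0
      no-root = sumℕ-0 λ i → ⟦⟧-no (D i ≟D (0 , n ℕ.+ 2)) λ e →
        proj₂ (proj₂ (proj₂ (isDiag i))) (cong proj₁ e , trans (cong (suc ∘ proj₂) e) (sym (ℕP.+-suc n 2)))
      both : r ≤ count 0 r ℕ.+ 1 × n ℕ.+ 2 ≤ count r (n ℕ.+ 2) ℕ.+ suc r
      both = tight-split p<r r<q (ℕP.≤-trans (ℕP.≤-reflexive
          (trans (ℕP.+-suc n 1) (cong (λ c → suc (c ℕ.+ 1)) (sym all-inside))))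
        (s≤s (ℕP.≤-trans (ℕP.+-monoˡ-≤ 1 (subst (λ d → count 0 (n ℕ.+ 2) ≤ d ℕ.+ (count 0 r ℕ.+ count r (n ℕ.+ 2)))
            no-root (count-split s)))
          (ℕP.≤-reflexive (rearrange (count 0 r) _ 0)))))

-- Chords, rotations and arrows

Cross-swap : ∀ {u v x y} → Cross u v x y → Cross x y v u
Cross-swap (p , q) = CO-trans′ p (CO-rot² q) , CO-rot² (CO-trans p (CO-rot² q))

Cross-flip : ∀ {u v x y} → Cross u v x y → Cross v u y x
Cross-flip (p , q) = q , p

Consec? : ∀ m u v → Dec (Consec m u v)
Consec? m u v = ((suc u ℕ.≟ v) ⊎-dec (suc v ℕ.≟ u)) ⊎-dec
  (((u ℕ.≟ 0) ×-dec (suc v ℕ.≟ m)) ⊎-dec ((v ℕ.≟ 0) ×-dec (suc u ℕ.≟ m)))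

nonconsecutive-sides : ∀ {m u v} → u < m → v < m → u ≢ v → ¬ Consec m u v → ∃ λ x → ∃ λ y → x < m × y < m
    × Cross u v x y
nonconsecutive-sides {m} {u} {v} um vm u≢v ¬c with ℕP.<-cmp u v
... | tri< u<v _ _ = IsDiag⇒sides (u<v , vm , (λ e → ¬c (inj₁ (inj₁ (sym e)))) , λ e → ¬c (inj₂ (inj₁ e)))
... | tri≈ _ e _ = contradiction e u≢v
... | tri> _ _ v<u with IsDiag⇒sides (v<u , um , (λ e → ¬c (inj₁ (inj₂ (sym e)))) , λ e → ¬c (inj₂ (inj₂ e)))
...   | x , y , xm , ym , c = y , x , ym , xm , Cross-flip c

Chord : ∀ {n} → (Fin n → Diag) → ℕ → ℕ → Set
Chord {n} D u v = Consec (n ℕ.+ 3) u v ⊎ ∃ λ i → D i ≡ norm u v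

chord-sym : ∀ {n} {D : Fin n → Diag} {u v} → Chord D u v → Chord D v u
chord-sym (inj₁ c) = inj₁ (Consec-sym c)
chord-sym {u = u} {v} (inj₂ (i , e)) = inj₂ (i , trans e (norm-sym u v))

rotate : ∀ {n} → ℕ → (Fin n → Diag) → Fin n → Diag
rotate {n} c D i = norm (ρ (n ℕ.+ 3) c (proj₁ (D i))) (ρ (n ℕ.+ 3) c (proj₂ (D i)))

notT : ∀ {b} → ¬ T b → T (not b)
notT {true} h = h tt
notT {false} h = tt

module Polygon {n : ℕ} {D : Fin n → Diag} (tri : IsTriangulation n D) where
  open Triangulated tri public

  D-bound₁ : ∀ i → proj₁ (D i) < m
  D-bound₁ i = ℕP.<-trans (proj₁ (isDiag i)) (proj₁ (proj₂ (isDiag i)))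

  D-bound₂ : ∀ i → proj₂ (D i) < m
  D-bound₂ i = proj₁ (proj₂ (isDiag i))

  D-norm : ∀ i → norm (proj₁ (D i)) (proj₂ (D i)) ≡ D i
  D-norm i = norm-< (proj₁ (isDiag i))

  endpoints-bound : ∀ {i u v} → D i ≡ norm u v → u < m × v < m
  endpoints-bound {i} {u} {v} e = norm-bounded u v (subst (λ e → proj₁ e < m) e (D-bound₁ i))
      (subst (λ e → proj₂ e < m) e (D-bound₂ i))

  chords-uncrossed : ∀ {u v x y} → u < m → v < m → x < m → y < m → Chord D u v → Chord D x y → ¬ Cross u v x y
  chords-uncrossed um vm xm ym (inj₁ c) _ k = Consec-empty xm ym c k
  chords-uncrossed um vm xm ym (inj₂ _) (inj₁ c) k = Consec-empty vm um c (Cross-swap k)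
  chords-uncrossed um vm xm ym (inj₂ (i , e)) (inj₂ (j , f)) k =
    T-not (proj₂ (proj₂ tri) i j) (subst₂ (λ e f → T (crossB e f)) (sym e) (sym f) (Cross⇒crossB k))

  module _ {c : ℕ} (c≤m : c ≤ m) where
    open Rotation c≤m

    Cross-ρ : ∀ {u v x y} → u < m → v < m → x < m → y < m → Cross u v x y
        → Cross (ρ m c u) (ρ m c v) (ρ m c x) (ρ m c y)
    Cross-ρ um vm xm ym (p , q) = CO-ρ um xm vm p , CO-ρ vm ym um q

    Cross-ρ⁻¹ : ∀ {u v x y} → u < m → v < m → x < m → y < m → Cross (ρ m c u) (ρ m c v) (ρ m c x) (ρ m c y)
        → Cross u v x y
    Cross-ρ⁻¹ um vm xm ym (p , q) = CO-ρ⁻¹ c≤m um xm vm p , CO-ρ⁻¹ c≤m vm ym um q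

    -- Nonconsecutive vertices have vertices on both sides, and rotation keeps them there. Arguing
    -- by cyclic order avoids the wrap-around cases of `Consec`.
    Consec-ρ⁻¹ : ∀ {u v} → u < m → v < m → u ≢ v → Consec m (ρ m c u) (ρ m c v) → Consec m u v
    Consec-ρ⁻¹ {u} {v} um vm u≢v k with Consec? m u v
    ... | yes h = h
    ... | no h with nonconsecutive-sides um vm u≢v h
    ...   | x , y , xm , ym , cr = contradiction (Cross-ρ um vm xm ym cr) (Consec-empty (ρ-bound xm) (ρ-bound ym) k)

    norm-ρ-injective : ∀ {u v x y} → u < m → v < m → x < m → y < m → norm (ρ m c u) (ρ m c v)
        ≡ norm (ρ m c x) (ρ m c y) → norm u v ≡ norm x y
    norm-ρ-injective {x = x} {y} um vm xm ym e with norm-injective e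
    ... | inj₁ (p , q) = cong₂ norm (ρ-injective um xm p) (ρ-injective vm ym q)
    ... | inj₂ (p , q) = trans (cong₂ norm (ρ-injective um ym p) (ρ-injective vm xm q)) (norm-sym y x)

    rotate-triangulation : IsTriangulation n (rotate c D)
    rotate-triangulation = diag , distinct , uncross
      where
      diag : ∀ i → IsDiag m (rotate c D i)
      diag i with IsDiag⇒sides (isDiag i)
      ... | x , y , xm , ym , k = sides⇒IsDiag (ρ-bound (D-bound₁ i)) (ρ-bound (D-bound₂ i)) (ρ-bound xm) (ρ-bound ym)
        (Cross-ρ (D-bound₁ i) (D-bound₂ i) xm ym k)
      distinct : ∀ i j → i ≢ j → rotate c D i ≢ rotate c D j
      distinct i j i≢j e = i≢j (D-injective (trans (sym (D-norm i)) (trans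
        (norm-ρ-injective (D-bound₁ i) (D-bound₂ i) (D-bound₁ j) (D-bound₂ j) e) (D-norm j))))
      uncross : ∀ i j → T (not (crossB (rotate c D i) (rotate c D j)))
      uncross i j = notT λ t → [
          (λ k → T-not (proj₂ (proj₂ tri) i j) (subst₂ (λ e f → T (crossB e f)) (D-norm i) (D-norm j)
            (Cross⇒crossB (Cross-ρ⁻¹ (D-bound₁ i) (D-bound₂ i) (D-bound₁ j) (D-bound₂ j) k)))) ,
          (λ k → T-not (proj₂ (proj₂ tri) i j) (subst₂ (λ e f → T (crossB e f)) (D-norm i)
              (trans (norm-sym _ _) (D-norm j))
            (Cross⇒crossB (Cross-ρ⁻¹ (D-bound₁ i) (D-bound₂ i) (D-bound₂ j) (D-bound₁ j) k)))) ]′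
        (crossB⇒Cross {ρ m c (proj₁ (D i))} {ρ m c (proj₂ (D i))} {ρ m c (proj₁ (D j))} {ρ m c (proj₂ (D j))} t)

    rotate-norm : ∀ {i u v} → D i ≡ norm u v → rotate c D i ≡ norm (ρ m c u) (ρ m c v)
    rotate-norm {i} {u} {v} e with norm-injective (trans (D-norm i) e)
    ... | inj₁ (p , q) = cong₂ (λ a b → norm (ρ m c a) (ρ m c b)) p q
    ... | inj₂ (p , q) = trans (cong₂ (λ a b → norm (ρ m c a) (ρ m c b)) p q) (norm-sym _ _)

    rotate-norm⁻¹ : ∀ {i u v} → u < m → v < m → rotate c D i ≡ norm (ρ m c u) (ρ m c v) → D i ≡ norm u v
    rotate-norm⁻¹ {i} um vm e = trans (sym (D-norm i)) (norm-ρ-injective (D-bound₁ i) (D-bound₂ i) um vm e)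

    rotate-chord⁻¹ : ∀ {u v} → u < m → v < m → u ≢ v → Chord (rotate c D) (ρ m c u) (ρ m c v) → Chord D u v
    rotate-chord⁻¹ um vm u≢v (inj₁ k) = inj₁ (Consec-ρ⁻¹ um vm u≢v k)
    rotate-chord⁻¹ um vm u≢v (inj₂ (i , e)) = inj₂ (i , rotate-norm⁻¹ um vm e)

  m≡ : m ≡ suc (n ℕ.+ 2)
  m≡ = ℕP.+-suc n 2

  side⇒chord : ∀ {p q} → p < q → Side p q → Chord D p q
  side⇒chord p<q (inj₁ (i , e)) = inj₂ (i , trans e (sym (norm-< p<q)))
  side⇒chord p<q (inj₂ e) = inj₁ (inj₂ (inj₁ e))

  tree⇒chord : ∀ {p q} → Tree Side p q → Chord D p q
  tree⇒chord leaf = inj₁ (inj₁ (inj₁ refl))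
  tree⇒chord (node s p<r r<q _ _) = side⇒chord (ℕP.<-trans p<r r<q) s

  avoids : ∀ {u v} → u < v → v < m → (∀ {a b} → a < m → b < m → Chord D a b → ¬ Cross a b u v × ¬ Cross a b v u)
      → Avoids Side u v
  avoids {u} {v} u<v vm h a b s =
    (λ (a<u , u<b , b<v) → proj₁ (h (ℕP.<-trans a<u um) (ℕP.<-trans b<v vm) (side⇒chord (ℕP.<-trans a<u u<b) s))
       (case₁ (a<u , u<b) , case₃ (ℕP.<-trans a<u u<b , b<v))) ,
    (λ (u<a , a<v , v<b) → proj₂ (h (ℕP.<-trans a<v vm) (side-bound s) (side⇒chord (ℕP.<-trans a<v v<b) s))
       (case₁ (a<v , v<b) , case₂ (u<a , ℕP.<-trans a<v v<b)))
    where
    um : u < m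
    um = ℕP.<-trans u<v vm
    side-bound : ∀ {a b} → Side a b → b < m
    side-bound (inj₁ (i , e)) = subst (λ e → proj₂ e < m) e (D-bound₂ i)
    side-bound (inj₂ (_ , e)) = ℕP.≤-reflexive e

  tree-at : ∀ {u v} → u < v → v < m → Avoids Side u v → Tree Side u v
  tree-at {u} {v} u<v vm h = subtree tree u<v z≤n (ℕP.≤-pred (subst (v <_) m≡ vm)) h

  -- A chord that crosses nothing cuts off a subtree, and the certificate at the root of this
  -- subtree is the diagonal sought.
  maximal : ∀ {u v} → u < v → v < m → ¬ Consec m u v →
      (∀ {a b} → a < m → b < m → Chord D a b → ¬ Cross a b u v × ¬ Cross a b v u) →
    ∃ λ i → D i ≡ (u , v)
  maximal u<v vm ¬c h with tree-at u<v vm (avoids u<v vm h)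
  ... | leaf = contradiction (inj₁ (inj₁ refl)) ¬c
  ... | node (inj₁ x) _ _ _ _ = x
  ... | node (inj₂ e) _ _ _ _ = contradiction (inj₂ (inj₁ e)) ¬c

abstract
  -- Rotating u to 0 places the chosen side of the chord below {0 , v′}, where the tree has a
  -- triangle. The vertex x selects the side and excludes a boundary edge.
  apex : ∀ {n} {D : Fin n → Diag} (tri : IsTriangulation n D) → let m = n ℕ.+ 3 in
    ∀ {u v x} → u < m → v < m → x < m → Chord D u v → CO u x v →
    ∃ λ w → w < m × CO u w v × Chord D u w × Chord D w v
  apex {n} {D} tri {u} {v} {x} um vm xm ch co = result refl
      (R.tree-at 0<v (ρ-bound′ vm) (R.avoids 0<v (ρ-bound′ vm) no-cross))
    where
    open Polygon tri
    u≤m : u ≤ m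
    u≤m = ℕP.<⇒≤ um
    module R = Polygon (rotate-triangulation u≤m)
    ρ-bound′ : ∀ {w} → w < m → ρ m u w < m
    ρ-bound′ = Rotation.ρ-bound u≤m
    inv-bound : ∀ {w} → w < m → ρ m (m ∸ u) w < m
    inv-bound = Rotation.ρ-bound (ℕP.m∸n≤m m u)
    co′ : CO 0 (ρ m u x) (ρ m u v)
    co′ = subst (λ z → CO z (ρ m u x) (ρ m u v)) (ρ-self m u) (Rotation.CO-ρ u≤m um xm vm co)
    0<v : 0 < ρ m u v
    0<v = ℕP.n≢0⇒n>0 λ e → CO-≢₁₃ co′ (sym e)
    left-inverse : ∀ {w} → w < m → ρ m u (ρ m (m ∸ u) w) ≡ w
    left-inverse {w} wm = trans (cong (λ k → ρ m k (ρ m (m ∸ u) w)) (sym (ℕP.m∸[m∸n]≡n u≤m)))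
        (Rotation.ρ-inverse (ℕP.m∸n≤m m u) wm)
    pull-back : ∀ {a b} → a < m → b < m → a ≢ b → Chord (rotate u D) a b → Chord D (ρ m (m ∸ u) a) (ρ m (m ∸ u) b)
    pull-back am bm a≢b k = rotate-chord⁻¹ u≤m (inv-bound am) (inv-bound bm)
      (λ e → a≢b (trans (sym (left-inverse am)) (trans (cong (ρ m u) e) (left-inverse bm))))
      (subst₂ (Chord (rotate u D)) (sym (left-inverse am)) (sym (left-inverse bm)) k)
    origin : ρ m (m ∸ u) 0 ≡ u
    origin = trans (cong (ρ m (m ∸ u)) (sym (ρ-self m u))) (Rotation.ρ-inverse u≤m um)
    target : ρ m (m ∸ u) (ρ m u v) ≡ v
    target = Rotation.ρ-inverse u≤m vm
    0<m : 0 < m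
    0<m = ℕP.≤-<-trans z≤n um
    no-cross : ∀ {a b} → a < m → b < m → Chord (rotate u D) a b → ¬ Cross a b 0 (ρ m u v) × ¬ Cross a b (ρ m u v) 0
    no-cross am bm k =
      (λ c → chords-uncrossed (inv-bound am) (inv-bound bm) um vm (pull-back am bm (CO-≢₁₃ (proj₁ c)) k) ch
        (subst₂ (Cross _ _) origin target (Cross-ρ (ℕP.m∸n≤m m u) am bm 0<m (ρ-bound′ vm) c))) ,
      (λ c → chords-uncrossed (inv-bound am) (inv-bound bm) vm um (pull-back am bm (CO-≢₁₃ (proj₁ c)) k)
          (chord-sym {D = D} ch)
        (subst₂ (Cross _ _) target origin (Cross-ρ (ℕP.m∸n≤m m u) am bm (ρ-bound′ vm) 0<m c)))
    -- The end of the chord is generalised to a variable with an equation, so that the tree can be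
    -- matched on.
    result : ∀ {v′} → v′ ≡ ρ m u v → Tree R.Side 0 v′ → ∃ λ w → w < m × CO u w v × Chord D u w × Chord D w v
    result {v′} refl′ (node {r = r} s 0<r r<v t₁ t₂) = ρ m (m ∸ u) r , inv-bound rm ,
      subst₂ (λ a b → CO a (ρ m (m ∸ u) r) b) origin target′
          (Rotation.CO-ρ (ℕP.m∸n≤m m u) 0<m rm v′m (case₁ (0<r , r<v))) ,
      subst (λ a → Chord D a (ρ m (m ∸ u) r)) origin (pull-back 0<m rm (ℕP.<⇒≢ 0<r) (R.tree⇒chord t₁)) ,
      subst (Chord D (ρ m (m ∸ u) r)) target′ (pull-back rm v′m (ℕP.<⇒≢ r<v) (R.tree⇒chord t₂))
      where
      v′m : v′ < m
      v′m = subst (_< m) (sym refl′) (ρ-bound′ vm)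
      rm : r < m
      rm = ℕP.<-trans r<v v′m
      target′ : ρ m (m ∸ u) v′ ≡ v
      target′ = trans (cong (ρ m (m ∸ u)) refl′) target
    result e leaf with CO-linear (subst (0 <_) e (s≤s z≤n)) co′
    ... | p , q = contradiction (ℕP.<-≤-trans p (ℕP.≤-pred (subst (ρ m u x <_) (sym e) q))) (ℕP.<-irrefl refl)

-- The Boolean tests behind the quiver

∃<upTo : ∀ {k} (p : ℕ → Bool) → T (any p (upTo k)) → ∃ λ x → x < k × T (p x)
∃<upTo {k} p t with find (any⁻ p (upTo k) t)
... | x , x∈ , px = x , ∈-upTo⁻ x∈ , px

upTo-any : ∀ {k} (p : ℕ → Bool) {x} → x < k → T (p x) → T (any p (upTo k))
upTo-any p x<k px = any⁺ p (lose (∈-upTo⁺ x<k) px)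

anyFin⇒∃ : ∀ {n} (p : Fin n → Bool) → T (anyFin p) → ∃ λ i → T (p i)
anyFin⇒∃ p t with find (any⁻ p (allFin _) t)
... | i , _ , pi = i , pi

∃⇒anyFin : ∀ {n} (p : Fin n → Bool) i → T (p i) → T (anyFin p)
∃⇒anyFin p i pi = any⁺ p (lose (∈-allFin i) pi)

eqDB⇒≡ : ∀ {e f} → T (eqDB e f) → e ≡ f
eqDB⇒≡ {p , q} {r , s} t with Equivalence.to (T-∧ {p ≡ᵇ r}) t
... | a , b = cong₂ _,_ (ℕP.≡ᵇ⇒≡ p r a) (ℕP.≡ᵇ⇒≡ q s b)

≡⇒eqDB : ∀ {e f} → e ≡ f → T (eqDB e f)
≡⇒eqDB {p , q} refl = Equivalence.from T-∧ (ℕP.≡⇒≡ᵇ p p refl , ℕP.≡⇒≡ᵇ q q refl)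

module _ {n : ℕ} {D : Fin n → Diag} where

  isSideB⇒Chord : ∀ {u v} → T (isSideB D u v) → Chord D u v
  isSideB⇒Chord {u} {v} t with Equivalence.to (T-∨ {suc (proj₁ (norm u v)) ≡ᵇ proj₂ (norm u v)}) t
  ... | inj₁ h with norm u v | norm-view u v
  ...   | _ | ascending _ = inj₁ (inj₁ (inj₁ (ℕP.≡ᵇ⇒≡ _ _ h)))
  ...   | _ | descending _ = inj₁ (inj₁ (inj₂ (ℕP.≡ᵇ⇒≡ _ _ h)))
  isSideB⇒Chord {u} {v} t | inj₂ h with Equivalence.to
      (T-∨ {(proj₁ (norm u v) ≡ᵇ 0) ∧ (suc (proj₂ (norm u v)) ≡ᵇ n ℕ.+ 3)}) h
  ... | inj₁ h′ with Equivalence.to (T-∧ {proj₁ (norm u v) ≡ᵇ 0}) h′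
  ...   | a , b with norm u v | norm-view u v
  ...     | _ | ascending _ = inj₁ (inj₂ (inj₁ (ℕP.≡ᵇ⇒≡ _ _ a , ℕP.≡ᵇ⇒≡ _ _ b)))
  ...     | _ | descending _ = inj₁ (inj₂ (inj₂ (ℕP.≡ᵇ⇒≡ _ _ a , ℕP.≡ᵇ⇒≡ _ _ b)))
  isSideB⇒Chord {u} {v} t | inj₂ h | inj₂ h′ with anyFin⇒∃ (λ k → eqDB (D k) (norm u v)) h′
  ... | i , e = inj₂ (i , eqDB⇒≡ e)

  Chord⇒isSideB : ∀ {u v} → u ≢ v → Chord D u v → T (isSideB D u v)
  Chord⇒isSideB {u} {v} u≢v (inj₂ (i , e)) = Equivalence.from (T-∨ {suc (proj₁ (norm u v)) ≡ᵇ proj₂ (norm u v)})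
    (inj₂ (Equivalence.from (T-∨ {(proj₁ (norm u v) ≡ᵇ 0) ∧ (suc (proj₂ (norm u v)) ≡ᵇ n ℕ.+ 3)})
      (inj₂ (∃⇒anyFin (λ k → eqDB (D k) (norm u v)) i (≡⇒eqDB e)))))
  Chord⇒isSideB {u} {v} u≢v (inj₁ c) = lemma c
    where
    short : ∀ {u v} → suc u ≡ v → T (isSideB D u v)
    short {u} refl rewrite norm-< (ℕP.n<1+n u) = Equivalence.from T-∨ (inj₁ (ℕP.≡⇒≡ᵇ (suc u) (suc u) refl))
    long : ∀ {u v} → u ≢ v → u ≡ 0 × suc v ≡ n ℕ.+ 3 → T (isSideB D u v)
    long {v = v} u≢v (refl , e) rewrite norm-< (ℕP.n≢0⇒n>0 (u≢v ∘ sym)) = Equivalence.from (T-∨ {1 ≡ᵇ v})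
        (inj₂ (Equivalence.from T-∨
      (inj₁ (ℕP.≡⇒≡ᵇ _ _ e))))
    sym′ : ∀ {u v} → T (isSideB D u v) → T (isSideB D v u)
    sym′ {u} {v} t rewrite norm-sym u v = t
    lemma : Consec (n ℕ.+ 3) u v → T (isSideB D u v)
    lemma (inj₁ (inj₁ e)) = short e
    lemma (inj₁ (inj₂ e)) = sym′ {v} {u} (short e)
    lemma (inj₂ (inj₁ e)) = long u≢v e
    lemma (inj₂ (inj₂ e)) = sym′ {v} {u} (long (u≢v ∘ sym) e)

≢⇒≢ᵇ : ∀ {u v} → u ≢ v → T (not (u ≡ᵇ v))
≢⇒≢ᵇ {u} {v} h = notT (h ∘ ℕP.≡ᵇ⇒≡ u v)

≢ᵇ⇒≢ : ∀ {u v} → T (not (u ≡ᵇ v)) → u ≢ v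
≢ᵇ⇒≢ {u} {v} t e = T-not t (ℕP.≡⇒≡ᵇ u v e)

-- Only the closing side needs a `Chord`: the two other sides of the triangle are the diagonals D i
-- and D j, and the distinctness of its vertices is contained in `CO`.
record Arrow {n} (D : Fin n → Diag) (i j : Fin n) : Set where
  constructor arrow
  field
    {v u w} : ℕ
    tail-eq : D i ≡ norm v u
    head-eq : D j ≡ norm v w
    ccw : CO v u w
    closed : Chord D u w

module Arrows {n : ℕ} {D : Fin n → Diag} (tri : IsTriangulation n D) where
  open Polygon tri

  private
    m′ : ℕ
    m′ = suc (suc (suc n))
    m′≡ : m′ ≡ m
    m′≡ = ℕP.+-comm 3 n

    ccw-ρ : ∀ {v x} → v < m → x < m → ccwFrom m′ v x ≡ ρ m v x
    ccw-ρ {v} {x} vm xm = trans (ccwFrom-ρ m′ (subst (v <_) (sym m′≡) vm) (subst (x <_) (sym m′≡) xm))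
        (cong (λ k → ρ k v x) m′≡)

  arrowB⇒Arrow : ∀ {i j} → T (arrowB D i j) → Arrow D i j
  arrowB⇒Arrow {i} {j} t with ∃<upTo _ t
  ... | v , vm , t₁ with ∃<upTo _ t₁
  ... | u , um , t₂ with ∃<upTo _ t₂
  ... | w , wm , t₃ with Equivalence.to (T-∧ {eqDB (D i) (norm v u)}) t₃
  ... | ei , t₄ with Equivalence.to (T-∧ {eqDB (D j) (norm v w)}) t₄
  ... | ej , t₅ with Equivalence.to (T-∧ {isTriangleB D u v w}) t₅
  ... | t₆ , lt with Equivalence.to (T-∧ {not (u ≡ᵇ v)}) t₆
  ... | u≢v , t₇ with Equivalence.to (T-∧ {not (v ≡ᵇ w)}) t₇
  ... | v≢w , t₈ with Equivalence.to (T-∧ {not (u ≡ᵇ w)}) t₈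
  ... | u≢w , t₉ with Equivalence.to (T-∧ {isSideB D u v}) t₉
  ... | _ , t₁₀ with Equivalence.to (T-∧ {isSideB D v w}) t₁₀
  ... | _ , s = arrow (eqDB⇒≡ ei) (eqDB⇒≡ ej)
    (ρ-<⇒CO vm um wm (≢ᵇ⇒≢ u≢v) (subst₂ _<_ (ccw-ρ vm um) (ccw-ρ vm wm)
        (ℕP.<ᵇ⇒< (ccwFrom m′ v u) (ccwFrom m′ v w) lt))) (isSideB⇒Chord s)

  Arrow⇒arrowB : ∀ {i j} → Arrow D i j → T (arrowB D i j)
  Arrow⇒arrowB {i} {j} (arrow {v} {u} {w} ei ej c ch) with endpoints-bound ei | endpoints-bound ej
  ... | vm , um | _ , wm = upTo-any _ vm (upTo-any _ um (upTo-any _ wm (both (≡⇒eqDB ei) (both (≡⇒eqDB ej) (both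
      (both (≢⇒≢ᵇ u≢v) (both (≢⇒≢ᵇ v≢w) (both (≢⇒≢ᵇ u≢w)
          (both (Chord⇒isSideB {D = D} u≢v (inj₂ (i , trans ei (norm-sym v u))))
        (both (Chord⇒isSideB {D = D} v≢w (inj₂ (j , ej))) (Chord⇒isSideB {D = D} u≢w ch))))))
      (ℕP.<⇒<ᵇ (subst₂ _<_ (sym (ccw-ρ vm um)) (sym (ccw-ρ vm wm)) (CO⇒ρ-< vm um wm c))))))))
    where
    both : ∀ {a b} → T a → T b → T (a ∧ b)
    both x y = Equivalence.from T-∧ (x , y)
    u≢v : u ≢ v
    u≢v e = CO-≢₁₂ c (sym e)
    v≢w = CO-≢₁₃ c
    u≢w = CO-≢₂₃ c

  -- Opaque, since unfolding arrowB is expensive.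
  abstract
    arrow? : ∀ i j → Dec (Arrow D i j)
    arrow? i j = map′ arrowB⇒Arrow Arrow⇒arrowB (T? (arrowB D i j))

    quiver-≡ : ∀ i j → quiverOf D i j ≡ ⟦ arrow? i j ⟧
    quiver-≡ i j = refl

  -- Distinct diagonals share at most one vertex, so the vertices stored in the arrow must be the
  -- given ones.
  arrow-at : ∀ {i j v u w} → D i ≡ norm v u → D j ≡ norm v w → u ≢ w → Arrow D i j → CO v u w × Chord D u w
  arrow-at {v = v} {u} {w} ei ej u≢w (arrow {v′} {u′} {w′} ei′ ej′ c ch)
    with norm-injective (trans (sym ei) ei′) | norm-injective (trans (sym ej) ej′)
  ... | inj₁ (refl , refl) | inj₁ (_ , refl) = c , ch
  ... | inj₁ (refl , refl) | inj₂ (e , refl) = contradiction e (CO-≢₁₃ c)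
  ... | inj₂ (refl , refl) | inj₁ (e , _) = contradiction (sym e) (CO-≢₁₂ c)
  ... | inj₂ (refl , refl) | inj₂ (_ , e) = contradiction (sym e) u≢w

-- Flips are quiver mutations

⟦⟧-⇔ : ∀ {P Q : Set} (p : Dec P) (q : Dec Q) → (P → Q) → (Q → P) → ⟦ p ⟧ ≡ ⟦ q ⟧
⟦⟧-⇔ (yes p) q f g = sym (⟦⟧-yes q (f p))
⟦⟧-⇔ (no ¬p) q f g = sym (⟦⟧-no q (¬p ∘ g))

⟦⟧-⊎ : ∀ {P A B : Set} (p : Dec P) (a : Dec A) (b : Dec B) → (P → A ⊎ B) → (A ⊎ B → P) → ¬ (A × B) → ⟦ p ⟧
    ≡ ⟦ a ⟧ ℕ.+ ⟦ b ⟧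
⟦⟧-⊎ p (yes a) (yes b) f g h = contradiction (a , b) h
⟦⟧-⊎ p (yes a) (no ¬b) f g h = ⟦⟧-yes p (g (inj₁ a))
⟦⟧-⊎ p (no ¬a) (yes b) f g h = ⟦⟧-yes p (g (inj₂ b))
⟦⟧-⊎ p (no ¬a) (no ¬b) f g h = ⟦⟧-no p ([ ¬a , ¬b ]′ ∘ f)

-- The two triangles abc and cda on either side of the diagonal D k.
record Quad {n} (D : Fin n → Diag) (k : Fin n) (a b c d : ℕ) : Set where
  constructor quad
  field
    diagonal : D k ≡ norm a c
    abc : CO a b c
    cda : CO c d a
    b<m : b < n ℕ.+ 3
    d<m : d < n ℕ.+ 3
    ab : Chord D a b
    bc : Chord D b c
    cd : Chord D c d
    da : Chord D d a
  bcd : CO b c d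
  bcd = CO-trans′ abc (CO-rot² cda)
  dab : CO d a b
  dab = CO-rot² (CO-trans abc (CO-rot² cda))

quad-turn : ∀ {n} {D : Fin n → Diag} {k a b c d} → Quad D k a b c d → Quad D k c d a b
quad-turn {a = a} {c = c} (quad e x y bm dm ab bc cd da) = quad (trans e (norm-sym a c)) y x dm bm cd da ab bc

module Quads {n : ℕ} {D : Fin n → Diag} (tri : IsTriangulation n D) where
  open Arrows tri
  open Polygon tri

  -- Of two candidates on the same side of {a , c}, the side at a of one crosses the side at c of
  -- the other.
  unique-apex : ∀ {a c u b} → a < m → c < m → u < m → b < m → CO a u c → CO a b c →
    Chord D a u → Chord D u c → Chord D a b → Chord D b c → u ≡ b
  unique-apex {a} {c} {u} {b} am cm um bm auc abc au uc ab bc with u ℕ.≟ b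
  ... | yes e = e
  ... | no u≢b with CO-total (CO-≢₁₂ auc) u≢b (CO-≢₁₂ abc)
  ...   | inj₁ aub = contradiction (aub , CO-rot abc) (chords-uncrossed am bm um cm ab uc)
  ...   | inj₂ abu = contradiction (abu , CO-rot auc) (chords-uncrossed am um bm cm au bc)

  quad-at : ∀ k → ∃ λ a → ∃ λ b → ∃ λ c → ∃ λ d → Quad D k a b c d
  quad-at k with IsDiag⇒sides (isDiag k)
  ... | x , y , xm , ym , p , q
    with apex tri (D-bound₁ k) (D-bound₂ k) xm (inj₂ (k , sym (D-norm k))) p
       | apex tri (D-bound₂ k) (D-bound₁ k) ym (inj₂ (k
           , trans (sym (D-norm k)) (norm-sym (proj₁ (D k)) (proj₂ (D k))))) q
  ... | b , bm , co , ab , bc | d , dm , co′ , cd , da = _ , b , _ , d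
      , quad (sym (D-norm k)) co co′ bm dm ab bc cd da

  arrow-asym : ∀ {i j} → Arrow D i j → ¬ Arrow D j i
  arrow-asym (arrow ei ej c ch) x = CO-asym c (proj₁ (arrow-at ej ei (CO-≢₂₃ c ∘ sym) x))

  arrow-yes : ∀ {i j} → Arrow D i j → ⟦ arrow? i j ⟧ ≡ 1
  arrow-yes {i} {j} = ⟦⟧-yes (arrow? i j)

  arrow-no : ∀ {i j} → ¬ Arrow D i j → ⟦ arrow? i j ⟧ ≡ 0
  arrow-no {i} {j} = ⟦⟧-no (arrow? i j)

  module _ {k a b c d} (Q : Quad D k a b c d) where
    open Quad Q

    am : a < m
    am = proj₁ (endpoints-bound diagonal)
    cm : c < m
    cm = proj₂ (endpoints-bound diagonal)

    arrow-in⇒ : ∀ {j} → Arrow D j k → D j ≡ norm a b ⊎ D j ≡ norm c d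
    arrow-in⇒ {j} (arrow {v} {u} {w} ej ek co ch) with norm-injective (trans (sym ek) diagonal)
    ... | inj₁ (refl , refl) = inj₁ (subst (λ x → D j ≡ norm a x)
      (unique-apex am cm (proj₂ (endpoints-bound ej)) b<m co abc (inj₂ (j , ej)) ch ab bc) ej)
    ... | inj₂ (refl , refl) = inj₂ (subst (λ x → D j ≡ norm c x)
      (unique-apex cm am (proj₂ (endpoints-bound ej)) d<m co cda (inj₂ (j , ej)) ch cd da) ej)

    arrow-out⇒ : ∀ {j} → Arrow D k j → D j ≡ norm b c ⊎ D j ≡ norm d a
    arrow-out⇒ {j} (arrow {v} {u} {w} ek ej co ch) with norm-injective (trans (sym ek) diagonal)
    ... | inj₁ (refl , refl) = inj₂ (trans ej (trans (norm-sym a w) (cong (λ x → norm x a)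
      (unique-apex cm am (proj₂ (endpoints-bound ej)) d<m (CO-rot co) cda ch (chord-sym {D = D} (inj₂ (j , ej))) cd
          da))))
    ... | inj₂ (refl , refl) = inj₁ (trans ej (trans (norm-sym c w) (cong (λ x → norm x c)
      (unique-apex am cm (proj₂ (endpoints-bound ej)) b<m (CO-rot co) abc ch (chord-sym {D = D} (inj₂ (j , ej))) ab
          bc))))

    arrow-ab : ∀ {j} → D j ≡ norm a b → Arrow D j k
    arrow-ab e = arrow e diagonal abc bc

    arrow-bc : ∀ {j} → D j ≡ norm b c → Arrow D k j
    arrow-bc e = arrow (trans diagonal (norm-sym a c)) (trans e (norm-sym b c)) (CO-rot² abc) ab

    ab≢cd : norm a b ≢ norm c d
    ab≢cd e with norm-injective e
    ... | inj₁ (x , _) = CO-≢₁₃ abc x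
    ... | inj₂ (x , _) = CO-≢₂₃ cda (sym x)

  module _ {k a b c d} (Q : Quad D k a b c d) where

    arrow-in⇐ : ∀ {j} → D j ≡ norm a b ⊎ D j ≡ norm c d → Arrow D j k
    arrow-in⇐ = [ arrow-ab Q , arrow-ab (quad-turn Q) ]′

    arrow-out⇐ : ∀ {j} → D j ≡ norm b c ⊎ D j ≡ norm d a → Arrow D k j
    arrow-out⇐ = [ arrow-bc Q , arrow-bc (quad-turn Q) ]′

    -- Incoming arrows come from one pair of opposite sides of the quadrilateral, and outgoing ones
    -- lead to the other pair (`quiver-out`): this gives the exchange relation the shape of
    -- Ptolemy's. A boundary side matches no j.
    quiver-in : ∀ j → quiverOf D j k ≡ ⟦ D j ≟D norm a b ⟧ ℕ.+ ⟦ D j ≟D norm c d ⟧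
    quiver-in j = trans (quiver-≡ j k) (⟦⟧-⊎ (arrow? j k) (D j ≟D norm a b) (D j ≟D norm c d) (arrow-in⇒ Q) arrow-in⇐
      (λ (x , y) → ab≢cd Q (trans (sym x) y)))

    quiver-out : ∀ j → quiverOf D k j ≡ ⟦ D j ≟D norm b c ⟧ ℕ.+ ⟦ D j ≟D norm d a ⟧
    quiver-out j = trans (quiver-≡ k j) (⟦⟧-⊎ (arrow? k j) (D j ≟D norm b c) (D j ≟D norm d a) (arrow-out⇒ Q)
        arrow-out⇐
      (λ (x , y) → bc≢da (trans (sym x) y)))
      where
      open Quad Q
      bc≢da : norm b c ≢ norm d a
      bc≢da e with norm-injective e
      ... | inj₁ (_ , x) = CO-≢₁₃ abc (sym x)
      ... | inj₂ (x , _) = CO-≢₁₂ abc (sym x)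

module FlipAt {n : ℕ} {D D′ : Fin n → Diag} (tri : IsTriangulation n D) {k : Fin n} (flip : Flip D k D′) where
  private
    module P = Polygon tri
  open P using (m)

  tri′ : IsTriangulation n D′
  tri′ = proj₂ (proj₂ flip)

  private
    module P′ = Polygon tri′

  same : ∀ {j} → j ≢ k → D′ j ≡ D j
  same {j} = proj₁ flip j

  module _ {a b c d} (Q : Quad D k a b c d) where
    open Quad Q

    keep-chord : ∀ {u v} → norm u v ≢ norm a c → Chord D u v → Chord D′ u v
    keep-chord ne (inj₁ x) = inj₁ x
    keep-chord ne (inj₂ (i , e)) = inj₂ (i , trans (same (λ { refl → ne (trans (sym e) diagonal) })) e)

    ab≢ac : norm a b ≢ norm a c
    ab≢ac e with norm-injective e
    ... | inj₁ (_ , x) = CO-≢₂₃ abc x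
    ... | inj₂ (x , _) = CO-≢₁₃ abc x

    bc≢ac : norm b c ≢ norm a c
    bc≢ac e with norm-injective e
    ... | inj₁ (x , _) = CO-≢₁₂ abc (sym x)
    ... | inj₂ (x , _) = CO-≢₂₃ abc x

    ab′ : Chord D′ a b
    ab′ = keep-chord ab≢ac ab

    bc′ : Chord D′ b c
    bc′ = keep-chord bc≢ac bc

    -- With an end x other than b the new diagonal would cross {a , b} or {b , c}, and both survive
    -- the flip.
    opposite : ∀ {x y} → D′ k ≡ norm x y → Cross a c x y → x ≡ b
    opposite {x} {y} e (axc , cya) with x ℕ.≟ b
    ... | yes x≡b = x≡b
    ... | no x≢b with CO-total (CO-≢₁₂ axc) x≢b (CO-≢₁₂ abc) | P.endpoints-bound diagonal | P′.endpoints-bound e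
    ...   | inj₁ axb | am , cm | xm , ym = contradiction (axb , CO-rot (CO-trans abc (CO-rot² cya)))
              (P′.chords-uncrossed am b<m xm ym ab′ (inj₂ (k , e)))
    ...   | inj₂ abx | am , cm | xm , ym = contradiction (CO-trans′ abx axc , CO-rot (CO-trans′ abc (CO-rot² cya)))
              (P′.chords-uncrossed b<m cm xm ym bc′ (inj₂ (k , e)))

  -- Otherwise the new diagonal would cross nothing in D and by `maximal` be some D i; here i = k is
  -- excluded by `Flip`, and i ≢ k by the distinctness of the diagonals of D′.
  crosses : T (crossB (D k) (D′ k))
  crosses with T? (crossB (D k) (D′ k))
  ... | yes t = t
  ... | no ¬t with P.maximal (proj₁ (P′.isDiag k)) (P′.D-bound₂ k) not-consec avoid
    where
    u = proj₁ (D′ k)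
    v = proj₂ (D′ k)
    not-consec : ¬ Consec m u v
    not-consec c with IsDiag⇒sides (P′.isDiag k)
    ... | x , y , xm , ym , cr = Consec-empty xm ym c cr
    uncrossed-chord : ∀ {s t} → norm s t ≡ D′ k → s < m → t < m → ∀ {p q} → p < m → q < m → Chord D p q
        → ¬ Cross p q s t
    uncrossed-chord e sm tm pm qm (inj₁ c) cr = Consec-empty sm tm c cr
    uncrossed-chord e sm tm pm qm (inj₂ (i , f)) cr with i Fin.≟ k
    ... | yes refl = ¬t (subst₂ (λ x y → T (crossB x y)) (sym f) e (Cross⇒crossB cr))
    ... | no i≢k = P′.chords-uncrossed pm qm sm tm (inj₂ (i , trans (same i≢k) f)) (inj₂ (k , sym e)) cr
    avoid : ∀ {p q} → p < m → q < m → Chord D p q → ¬ Cross p q u v × ¬ Cross p q v u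
    avoid pm qm ch = uncrossed-chord (P′.D-norm k) (P′.D-bound₁ k) (P′.D-bound₂ k) pm qm ch ,
      uncrossed-chord (trans (norm-sym v u) (P′.D-norm k)) (P′.D-bound₂ k) (P′.D-bound₁ k) pm qm ch
  ... | i , e with i Fin.≟ k
  ...   | yes refl = contradiction (sym e) (proj₁ (proj₂ flip))
  ...   | no i≢k = contradiction (P′.D-injective (trans (same i≢k) e)) i≢k

  new-diagonal : ∀ {a b c d} → Quad D k a b c d → D′ k ≡ norm b d
  new-diagonal {a} {b} {c} {d} Q with crossB⇒Cross {a} {c} {proj₁ (D′ k)} {proj₂ (D′ k)}
    (subst₂ (λ x y → T (crossB x y)) (Quad.diagonal Q) (sym (P′.D-norm k)) crosses)
  ... | inj₁ cr = trans (sym (P′.D-norm k)) (cong₂ norm (opposite Q (sym (P′.D-norm k)) cr)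
    (opposite (quad-turn Q) (trans (sym (P′.D-norm k)) (norm-sym (proj₁ (D′ k)) _)) (Cross-flip cr)))
  ... | inj₂ cr = trans (sym (P′.D-norm k)) (trans (norm-sym (proj₁ (D′ k)) _) (cong₂ norm
    (opposite Q (trans (sym (P′.D-norm k)) (norm-sym (proj₁ (D′ k)) _)) cr)
        (opposite (quad-turn Q) (sym (P′.D-norm k)) (Cross-flip cr))))

  flipped-quad : ∀ {a b c d} → Quad D k a b c d → Quad D′ k b c d a
  flipped-quad Q = quad (new-diagonal Q) (Quad.bcd Q) (Quad.dab Q) (proj₂ (P.endpoints-bound (Quad.diagonal Q)))
      (proj₁ (P.endpoints-bound (Quad.diagonal Q)))
    (bc′ Q) (ab′ (quad-turn Q)) (bc′ (quad-turn Q)) (ab′ Q)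

  flip⁻¹ : Flip D′ k D
  flip⁻¹ = (λ j j≢k → sym (same j≢k)) , (λ e → proj₁ (proj₂ flip) (sym e)) , tri

  -- An arrow between other diagonals is lost only if the closing side of its triangle is the
  -- flipped diagonal; it then runs between two sides of the quadrilateral that meet at b or at d.
  keep-arrow : ∀ {a b c d i j} → Quad D k a b c d → i ≢ k → j ≢ k → Arrow D i j →
    Arrow D′ i j ⊎ ((D i ≡ norm b c × D j ≡ norm a b) ⊎ (D i ≡ norm d a × D j ≡ norm c d))
  keep-arrow {a} {b} {c} {d} {i} {j} Q i≢k j≢k (arrow {v} {u} {w} ei ej co ch) with norm u w ≟D norm a c
  ... | no ne = inj₁ (arrow (trans (same i≢k) ei) (trans (same j≢k) ej) co (keep-chord Q ne ch))
  ... | yes e with P.endpoints-bound ei | P.endpoints-bound ej | norm-injective e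
  ...   | vm , um | _ , wm | inj₁ (refl , refl) = inj₂
      (inj₂ (trans ei (cong (λ x → norm x a) v≡d) , trans (trans ej (cong (λ x → norm x c) v≡d)) (norm-sym d c)))
    where
    v≡d : v ≡ d
    v≡d = Quads.unique-apex tri wm um vm (Quad.d<m Q) (CO-rot² co) (Quad.cda Q)
      (chord-sym {D = D} (inj₂ (j , ej))) (inj₂ (i , ei)) (Quad.cd Q) (Quad.da Q)
  ...   | vm , um | _ , wm | inj₂ (refl , refl) = inj₂
      (inj₁ (trans ei (cong (λ x → norm x c) v≡b) , trans (trans ej (cong (λ x → norm x a) v≡b)) (norm-sym b a)))
    where
    v≡b : v ≡ b
    v≡b = Quads.unique-apex tri wm um vm (Quad.b<m Q) (CO-rot² co) (Quad.abc Q)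
      (chord-sym {D = D} (inj₂ (j , ej))) (inj₂ (i , ei)) (Quad.ab Q) (Quad.bc Q)

mutQ-cong : ∀ {n} {R R′ : Quiver n} k → (∀ i j → R i j ≡ R′ i j) → ∀ i j → mutQ k R i j ≡ mutQ k R′ i j
mutQ-cong k h i j with does (i Fin.≟ k) | does (j Fin.≟ k)
... | true | _ = h j k
... | false | true = h k i
... | false | false = cong₂ _∸_ (cong₂ ℕ._+_ (h i j) (cong₂ ℕ._*_ (h i k) (h k j)))
    (cong₂ ℕ._+_ (h j i) (cong₂ ℕ._*_ (h j k) (h k i)))

module Mutation {n : ℕ} {D D′ : Fin n → Diag} (tri : IsTriangulation n D) {k : Fin n} (flip : Flip D k D′) where
  open FlipAt tri flip
  private
    module F⁻¹ = FlipAt tri′ flip⁻¹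
    module A = Arrows tri
    module A′ = Arrows tri′
    module Q = Quads tri
    module Q′ = Quads tri′
    module P = Polygon tri
    module P′ = Polygon tri′
    R R′ : Quiver n
    R i j = ⟦ A.arrow? i j ⟧
    R′ i j = ⟦ A′.arrow? i j ⟧

    -- Replaces the arrow numbers by numerals, whereupon the truncated subtraction computes.
    evaluate : ∀ {x x′ p p′ q q′ y y′ r r′ s s′ z z′} → x ≡ x′ → p ≡ p′ → q ≡ q′ → y ≡ y′ → r ≡ r′ → s ≡ s′ → z ≡ z′ →
      (x′ ℕ.+ p′ ℕ.* q′) ∸ (y′ ℕ.+ r′ ℕ.* s′) ≡ z′ → (x ℕ.+ p ℕ.* q) ∸ (y ℕ.+ r ℕ.* s) ≡ z
    evaluate refl refl refl refl refl refl refl e = e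

  module _ {i j : Fin n} (i≢k : i ≢ k) (j≢k : j ≢ k) where
    private
      Goal : Set
      Goal = (R i j ℕ.+ R i k ℕ.* R k j) ∸ (R j i ℕ.+ R j k ℕ.* R k i) ≡ R′ i j

      no-chord : ∀ {a b c d} → Quad D k a b c d → ¬ Chord D b d
      no-chord Q ch = P.chords-uncrossed (proj₁ (P.endpoints-bound (Quad.diagonal Q)))
          (proj₂ (P.endpoints-bound (Quad.diagonal Q)))
        (Quad.b<m Q) (Quad.d<m Q) (inj₂ (k , Quad.diagonal Q)) ch (Quad.abc Q , Quad.cda Q)

      no-chord′ : ∀ {a b c d} → Quad D k a b c d → ¬ Chord D′ c a
      no-chord′ Q ch = P′.chords-uncrossed (proj₁ (P′.endpoints-bound (new-diagonal Q)))
          (proj₂ (P′.endpoints-bound (new-diagonal Q)))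
        (proj₂ (P.endpoints-bound (Quad.diagonal Q))) (proj₁ (P.endpoints-bound (Quad.diagonal Q)))
        (inj₂ (k , new-diagonal Q)) ch (Quad.bcd Q , Quad.dab Q)

      module _ {a b c d} (Q : Quad D k a b c d) where
        open Quad Q

        -- Here i, j and k bound one triangle of D: the arrow between i and j cancels against the
        -- path through k. In `case-ab-bc` the roles of i and j are exchanged.
        case-bc-ab : D i ≡ norm b c → D j ≡ norm a b → Goal
        case-bc-ab ei ej = evaluate (Q.arrow-yes a₁) (Q.arrow-no (Q.arrow-asym ki)) (Q.arrow-no (Q.arrow-asym jk))
            (Q.arrow-no (Q.arrow-asym a₁))
          (Q.arrow-yes jk) (Q.arrow-yes ki)
          (Q′.arrow-no λ x → no-chord′ Q (proj₂ (A′.arrow-at (trans (same i≢k) ei)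
              (trans (same j≢k) (trans ej (norm-sym a b))) (CO-≢₁₃ abc ∘ sym) x))) refl
          where
          a₁ : Arrow D i j
          a₁ = arrow ei (trans ej (norm-sym a b)) (CO-rot abc) (inj₂ (k , trans diagonal (norm-sym a c)))
          ki = Q.arrow-bc Q ei
          jk = Q.arrow-ab Q ej

        case-ab-bc : D i ≡ norm a b → D j ≡ norm b c → Goal
        case-ab-bc ei ej = evaluate (Q.arrow-no (Q.arrow-asym a₁)) (Q.arrow-yes ik) (Q.arrow-yes kj) (Q.arrow-yes a₁)
          (Q.arrow-no (Q.arrow-asym kj)) (Q.arrow-no (Q.arrow-asym ik))
          (Q′.arrow-no λ x → no-chord′ Q (chord-sym {D = D′}
              (proj₂ (A′.arrow-at (trans (same i≢k) (trans ei (norm-sym a b))) (trans (same j≢k) ej) (CO-≢₁₃ abc)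
              x)))) refl
          where
          a₁ : Arrow D j i
          a₁ = arrow ej (trans ei (norm-sym a b)) (CO-rot abc) (inj₂ (k , trans diagonal (norm-sym a c)))
          ik = Q.arrow-ab Q ei
          kj = Q.arrow-bc Q ej

        -- Here i and j lie in different triangles at k. No arrow joins them, because {b , d}
        -- crosses D k; the path through k creates one, which is that of the new triangle d, a, b.
        case-ab-da : D i ≡ norm a b → D j ≡ norm d a → Goal
        case-ab-da ei ej = evaluate
          (Q.arrow-no λ x → no-chord Q (proj₂ (A.arrow-at ei (trans ej (norm-sym d a)) (CO-≢₁₃ bcd) x)))
          (Q.arrow-yes ik) (Q.arrow-yes kj)
          (Q.arrow-no λ x → no-chord Q (chord-sym {D = D}
              (proj₂ (A.arrow-at (trans ej (norm-sym d a)) ei (CO-≢₁₃ bcd ∘ sym) x))))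
          (Q.arrow-no (Q.arrow-asym kj)) (Q.arrow-no (Q.arrow-asym ik))
          (Q′.arrow-yes (arrow (trans (same i≢k) ei) (trans (same j≢k) (trans ej (norm-sym d a))) (CO-rot dab)
              (inj₂ (k , new-diagonal Q)))) refl
          where
          ik = Q.arrow-ab Q ei
          kj = Q.arrow-bc (quad-turn Q) ej

        case-da-ab : D i ≡ norm d a → D j ≡ norm a b → Goal
        case-da-ab ei ej = evaluate
          (Q.arrow-no λ x → no-chord Q (chord-sym {D = D}
              (proj₂ (A.arrow-at (trans ei (norm-sym d a)) ej (CO-≢₁₃ bcd ∘ sym) x))))
          (Q.arrow-no (Q.arrow-asym ki)) (Q.arrow-no (Q.arrow-asym jk))
          (Q.arrow-no λ x → no-chord Q (proj₂ (A.arrow-at ej (trans ei (norm-sym d a)) (CO-≢₁₃ bcd) x)))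
          (Q.arrow-yes jk) (Q.arrow-yes ki)
          (Q′.arrow-no λ x → CO-asym (CO-rot dab) (proj₁
              (A′.arrow-at (trans (same i≢k) (trans ei (norm-sym d a))) (trans (same j≢k) ej) (CO-≢₁₃ bcd ∘ sym) x)))
              refl
          where
          ki = Q.arrow-bc (quad-turn Q) ei
          jk = Q.arrow-ab Q ej

      at-quad : ∀ {a b c d} → Quad D k a b c d → Goal
      at-quad Q with A.arrow? i k ×-dec A.arrow? k j | A.arrow? j k ×-dec A.arrow? k i
      ... | yes (ik , kj) | _ with Q.arrow-in⇒ Q ik | Q.arrow-out⇒ Q kj
      ...   | inj₁ x | inj₁ y = case-ab-bc Q x y
      ...   | inj₁ x | inj₂ y = case-ab-da Q x y
      ...   | inj₂ x | inj₁ y = case-ab-da (quad-turn Q) x y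
      ...   | inj₂ x | inj₂ y = case-ab-bc (quad-turn Q) x y
      at-quad Q | no _ | yes (jk , ki) with Q.arrow-in⇒ Q jk | Q.arrow-out⇒ Q ki
      ...   | inj₁ x | inj₁ y = case-bc-ab Q y x
      ...   | inj₁ x | inj₂ y = case-da-ab Q y x
      ...   | inj₂ x | inj₁ y = case-da-ab (quad-turn Q) y x
      ...   | inj₂ x | inj₂ y = case-bc-ab (quad-turn Q) y x
      at-quad {a} {b} {c} {d} Q | no ¬p | no ¬p′ =
        trans (cong₂ _∸_ (trans (cong (R i j ℕ.+_) (product-no (A.arrow? i k) (A.arrow? k j) ¬p)) (ℕP.+-identityʳ _))
                         (trans (cong (R j i ℕ.+_) (product-no (A.arrow? j k) (A.arrow? k i) ¬p′))
                             (ℕP.+-identityʳ _)))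
          (unaffected (A.arrow? i j))
        where
        product-no : ∀ {P Q : Set} (p : Dec P) (q : Dec Q) → ¬ (P × Q) → ⟦ p ⟧ ℕ.* ⟦ q ⟧ ≡ 0
        product-no (yes p) (yes q) h = contradiction (p , q) h
        product-no (yes p) (no _) h = refl
        product-no (no _) q h = refl
        kept : Arrow D i j → Arrow D′ i j
        kept x with keep-arrow Q i≢k j≢k x
        ... | inj₁ y = y
        ... | inj₂ (inj₁ (ei , ej)) = contradiction (Q.arrow-ab Q ej , Q.arrow-bc Q ei) ¬p′
        ... | inj₂ (inj₂ (ei , ej)) = contradiction (Q.arrow-ab (quad-turn Q) ej , Q.arrow-bc (quad-turn Q) ei) ¬p′
        kept⁻¹ : Arrow D′ i j → Arrow D i j
        kept⁻¹ x with F⁻¹.keep-arrow (flipped-quad Q) i≢k j≢k x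
        ... | inj₁ y = y
        ... | inj₂ (inj₁ (ei , ej)) = contradiction (Q.arrow-ab (quad-turn Q) (trans (sym (same i≢k)) ei)
            , Q.arrow-bc Q (trans (sym (same j≢k)) ej)) ¬p
        ... | inj₂ (inj₂ (ei , ej)) = contradiction (Q.arrow-ab Q (trans (sym (same i≢k)) ei)
            , Q.arrow-bc (quad-turn Q) (trans (sym (same j≢k)) ej)) ¬p
        unaffected : Dec (Arrow D i j) → R i j ∸ R j i ≡ R′ i j
        unaffected (yes x) = trans (cong₂ _∸_ (Q.arrow-yes x) (Q.arrow-no (Q.arrow-asym x)))
            (sym (Q′.arrow-yes (kept x)))
        unaffected (no ¬x) = trans (cong (_∸ R j i) (Q.arrow-no ¬x))
            (trans (ℕP.0∸n≡0 (R j i)) (sym (Q′.arrow-no (¬x ∘ kept⁻¹))))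

    mutation-away : Goal
    mutation-away with Q.quad-at k
    ... | a , b , c , d , Q = at-quad Q

  mutation-reverse : ∀ j → R j k ≡ R′ k j × R k j ≡ R′ j k
  mutation-reverse j with Q.quad-at k
  ... | a , b , c , d , Q = ⟦⟧-⇔ (A.arrow? j k) (A′.arrow? k j) in⇒ in⇐
      , ⟦⟧-⇔ (A.arrow? k j) (A′.arrow? j k) out⇒ out⇐
    where
    irreflexive : ∀ {j} → Arrow D j k → j ≢ k
    irreflexive x refl = Q.arrow-asym x x
    Q′ = flipped-quad Q
    in⇒ : Arrow D j k → Arrow D′ k j
    in⇒ x with same (λ { refl → Q.arrow-asym x x })
    ... | e = Q′.arrow-out⇐ Q′ (swap (Sum.map (trans e) (trans e) (Q.arrow-in⇒ Q x)))
    in⇐ : Arrow D′ k j → Arrow D j k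
    in⇐ x with same (λ { refl → Q′.arrow-asym x x })
    ... | e = Q.arrow-in⇐ Q (swap (Sum.map (trans (sym e)) (trans (sym e)) (Q′.arrow-out⇒ Q′ x)))
    out⇒ : Arrow D k j → Arrow D′ j k
    out⇒ x with same (λ { refl → Q.arrow-asym x x })
    ... | e = Q′.arrow-in⇐ Q′ (Sum.map (trans e) (trans e) (Q.arrow-out⇒ Q x))
    out⇐ : Arrow D′ j k → Arrow D k j
    out⇐ x with same (λ { refl → Q′.arrow-asym x x })
    ... | e = Q.arrow-out⇐ Q (Sum.map (trans (sym e)) (trans (sym e)) (Q′.arrow-in⇒ Q′ x))

  mutation-flip : ∀ i j → mutQ k (quiverOf D) i j ≡ quiverOf D′ i j
  mutation-flip i j = trans (mutQ-cong k A.quiver-≡ i j) (trans (entry i j) (sym (A′.quiver-≡ i j)))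
    where
    entry : ∀ i j → mutQ k R i j ≡ R′ i j
    entry i j with i Fin.≟ k | j Fin.≟ k
    ... | yes refl | _ = proj₁ (mutation-reverse j)
    ... | no _ | yes refl = proj₂ (mutation-reverse i)
    ... | no i≢k | no j≢k = mutation-away i≢k j≢k

-- Lambda lengths and cluster variables

∏-1′ : ∀ {n} {f : Fin n → K} → (∀ i → f i ≡ 1K) → ∏ f ≡ 1K
∏-1′ {n} h = trans (∏-cong h) (∏-1 n)

∏-single : ∀ {n} {f : Fin n → K} i → (∀ j → j ≢ i → f j ≡ 1K) → ∏ f ≡ f i
∏-single {suc n} {f} zero h = trans (cong (f zero ⊗_) (∏-1′ λ j → h (suc j) λ ())) (*-identityʳ _)
∏-single {suc n} {f} (suc i) h = trans (cong₂ _⊗_ (h zero λ ())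
    (∏-single i λ j j≢i → h (suc j) (j≢i ∘ FinP.suc-injective))) (*-identityˡ _)

-1K : K
-1K = neg 1K

1-1 : 1K ⊕ -1K ≡ 0K
1-1 = CommutativeRing.-‿inverseʳ K-ring 1K

det : K × K → K × K → K
det (a , b) (c , d) = a ⊗ d ⊕ -1K ⊗ (b ⊗ c)

-- In the semiring identities below -1 is an atom n, so they hold only up to a multiple of 1 + n,
-- which is displayed as a last summand and dropped here.
mod-1-1 : ∀ {x y} z → y ≡ x ⊕ (1K ⊕ -1K) ⊗ z → y ≡ x
mod-1-1 {x} z e = trans e (trans (cong (λ u → x ⊕ u ⊗ z) 1-1) (trans (cong (x ⊕_) (zeroˡ z)) (+-identityʳ x)))

plücker : ∀ p q r s → det p r ⊗ det q s ≡ det p q ⊗ det r s ⊕ det q r ⊗ det p s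
plücker (p₁ , p₂) (q₁ , q₂) (r₁ , r₂) (s₁ , s₂) = sym (mod-1-1 (p₁ ⊗ q₂ ⊗ r₁ ⊗ s₂ ⊕ -1K ⊗ (p₂ ⊗ q₁ ⊗ r₂ ⊗ s₁))
  (solve 9 (λ p p′ q q′ r r′ s s′ n → (p :* q′ :+ n :* (p′ :* q)) :* (r :* s′ :+ n :* (r′ :* s)) :+
      (q :* r′ :+ n :* (q′ :* r)) :* (p :* s′ :+ n :* (p′ :* s)) := (p :* r′ :+ n :* (p′ :* r)) :*
      (q :* s′ :+ n :* (q′ :* s)) :+ (con 1 :+ n) :* (p :* q′ :* r :* s′ :+ n :* (p′ :* q :* r′ :* s))) refl (p₁) (p₂)
      (q₁) (q₂) (r₁) (r₂) (s₁) (s₂) (-1K)))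

combination : K → K → K × K → K × K → K × K
combination α β (a , b) (c , d) = α ⊗ a ⊕ β ⊗ c , α ⊗ b ⊕ β ⊗ d

det-combinationʳ : ∀ α β p q → det p (combination α β p q) ≡ β ⊗ det p q
det-combinationʳ α β (p₁ , p₂) (q₁ , q₂) = mod-1-1 (α ⊗ p₁ ⊗ p₂)
  (solve 7 (λ a b p p′ q q′ n → p :* (a :* p′ :+ b :* q′) :+ n :* (p′ :* (a :* p :+ b :* q)) := b :*
      (p :* q′ :+ n :* (p′ :* q)) :+ (con 1 :+ n) :* (a :* p :* p′)) refl (α) (β) (p₁) (p₂) (q₁) (q₂) (-1K))

det-combinationˡ : ∀ α β p q → det (combination α β p q) q ≡ α ⊗ det p q
det-combinationˡ α β (p₁ , p₂) (q₁ , q₂) = mod-1-1 (β ⊗ q₁ ⊗ q₂)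
  (solve 7 (λ a b p p′ q q′ n → (a :* p :+ b :* q) :* q′ :+ n :* ((a :* p′ :+ b :* q′) :* q) := a :*
      (p :* q′ :+ n :* (p′ :* q)) :+ (con 1 :+ n) :* (b :* q :* q′)) refl (α) (β) (p₁) (p₂) (q₁) (q₂) (-1K))

-- The cyclic order is cut open at one of four places, according to which vertex is the smallest.
CO-four : ∀ {a b c d} → CO a b c → CO c d a →
  ((a < b × b < c × c < d) ⊎ (b < c × c < d × d < a)) ⊎ ((c < d × d < a × a < b) ⊎ (d < a × a < b × b < c))
CO-four (case₁ (p , q)) (case₁ (r , s)) = contradiction (ℕP.<-trans p (ℕP.<-trans q (ℕP.<-trans r s)))
    (ℕP.<-irrefl refl)
CO-four (case₁ (p , q)) (case₂ (r , s)) = inj₂ (inj₂ (r , p , q))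
CO-four (case₁ (p , q)) (case₃ (r , s)) = inj₁ (inj₁ (p , q , s))
CO-four (case₂ (p , q)) (case₁ (r , s)) = inj₁ (inj₂ (p , r , s))
CO-four (case₂ (p , q)) (case₂ (r , s)) = contradiction q (ℕP.<-asym s)
CO-four (case₂ (p , q)) (case₃ (r , s)) = contradiction q (ℕP.<-asym r)
CO-four (case₃ (p , q)) (case₁ (r , s)) = inj₂ (inj₁ (r , s , q))
CO-four (case₃ (p , q)) (case₂ (r , s)) = contradiction p (ℕP.<-asym s)
CO-four (case₃ (p , q)) (case₃ (r , s)) = contradiction p (ℕP.<-asym r)

-- Lambda lengths of all chords, i.e. the values of the cluster variables at the point x.
record Lambda {n} (D : Fin n → Diag) (x : Fin n → K) : Set where
  field
    Λ : Diag → K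
    Λ-diagonal : ∀ i → Λ (D i) ≡ x i
    Λ-boundary : ∀ {u v} → u < n ℕ.+ 3 → v < n ℕ.+ 3 → Consec (n ℕ.+ 3) u v → Λ (norm u v) ≡ 1K
    ptolemy : ∀ {a b c d} → CO a b c → CO c d a →
      Λ (norm a c) ⊗ Λ (norm b d) ≡ Λ (norm a b) ⊗ Λ (norm c d) ⊕ Λ (norm b c) ⊗ Λ (norm d a)

module Construction {n : ℕ} {D : Fin n → Diag} (tri : IsTriangulation n D) (x : Fin n → K) (x-pos : ∀ i → Pos (x i))
    where
  open Polygon tri

  len : ∀ {p q} → Tree Side p q → K
  len leaf = 1K
  len (node (inj₁ (i , _)) _ _ _ _) = x i
  len (node (inj₂ _) _ _ _ _) = 1K

  pos-len : ∀ {p q} (t : Tree Side p q) → Pos (len t)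
  pos-len leaf = pos-1
  pos-len (node (inj₁ (i , _)) _ _ _ _) = x-pos i
  pos-len (node (inj₂ _) _ _ _ _) = pos-1

  -- The apex vector is determined by its determinants with the vectors of the two ends.
  apex-vector : ∀ {p r q} → Side p q → p < r → r < q → Tree Side p r → Tree Side r q → K × K → K × K → K × K
  apex-vector s p<r r<q t₁ t₂ = combination (len t₂ ⊗ inv (len t)) (len t₁ ⊗ inv (len t))
    where t = node s p<r r<q t₁ t₂

  -- Vectors are propagated from the two ends through the tree, one apex at a time. Only p ≤ w ≤ q
  -- is meaningful; other arguments receive the vector of the nearer end.
  place : ∀ {p q} → Tree Side p q → K × K → K × K → ℕ → K × K
  place (leaf {p = p}) vp vq w = if does (w ≤? p) then vp else vq
  place (node {p} {r} {q} s p<r r<q t₁ t₂) vp vq w =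
    if does (w ≤? r) then place t₁ vp (apex-vector s p<r r<q t₁ t₂ vp vq) w else place t₂
        (apex-vector s p<r r<q t₁ t₂ vp vq) vq w

  place-left : ∀ {p q} (t : Tree Side p q) vp vq → place t vp vq p ≡ vp
  place-left (leaf {p = p}) vp vq = if-yes (p ≤? p) ℕP.≤-refl
  place-left (node {p} {r} s p<r r<q t₁ t₂) vp vq = trans (if-yes (p ≤? r) (ℕP.<⇒≤ p<r)) (place-left t₁ _ _)

  place-right : ∀ {p q} (t : Tree Side p q) vp vq → place t vp vq q ≡ vq
  place-right (leaf {p = p}) vp vq = if-no (suc p ≤? p) ℕP.1+n≰n
  place-right (node {p} {r} {q} s p<r r<q t₁ t₂) vp vq = trans (if-no (q ≤? r) (ℕP.<⇒≱ r<q)) (place-right t₂ _ _)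

  -- The apex r belongs to both subtrees and receives the same vector from both, so w = r need not
  -- be excluded.
  place-after : ∀ {p r q} s (p<r : p < r) (r<q : r < q) t₁ t₂ vp vq {w} → r ≤ w →
    place (node s p<r r<q t₁ t₂) vp vq w ≡ place t₂ (apex-vector s p<r r<q t₁ t₂ vp vq) vq w
  place-after {r = r} s p<r r<q t₁ t₂ vp vq {w} r≤w with ℕP.m≤n⇒m<n∨m≡n r≤w
  ... | inj₁ r<w = if-no (w ≤? r) (ℕP.<⇒≱ r<w)
  ... | inj₂ refl = trans (if-yes (r ≤? r) ℕP.≤-refl) (trans (place-right t₁ _ _) (sym (place-left t₂ _ _)))

  len-∷ : ∀ {p q} (t : Tree Side p q) y → y ⊗ inv (len t) ⊗ len t ≡ y
  len-∷ t y = trans (*-assoc _ _ _) (trans (cong (y ⊗_) (trans (*-comm _ _) (inv-right (pos-len t)))) (*-identityʳ y))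

  module _ {p r q} (s : Side p q) (p<r : p < r) (r<q : r < q) (t₁ : Tree Side p r) (t₂ : Tree Side r q)
      (vp vq : K × K)
    (h : det vp vq ≡ len (node s p<r r<q t₁ t₂)) where
    private
      t : Tree Side p q
      t = node s p<r r<q t₁ t₂
      α β : K
      α = len t₂ ⊗ inv (len t)
      β = len t₁ ⊗ inv (len t)

    det-left : det vp (apex-vector s p<r r<q t₁ t₂ vp vq) ≡ len t₁
    det-left = trans (det-combinationʳ α β vp vq) (trans (cong (β ⊗_) h) (len-∷ t (len t₁)))

    det-right : det (apex-vector s p<r r<q t₁ t₂ vp vq) vq ≡ len t₂
    det-right = trans (det-combinationˡ α β vp vq) (trans (cong (α ⊗_) h) (len-∷ t (len t₂)))

  straddle : ∀ {p r q u v} → Tree Side p r → Tree Side r q → Avoids Side u v → p ≤ u → v ≤ q → u < r → r < v → p ≡ u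
      × v ≡ q
  straddle {p} {r} {q} {u} {v} t₁ t₂ av p≤u v≤q u<r r<v = left t₁ , right t₂
    where
    left : Tree Side p r → p ≡ u
    left leaf = ℕP.≤-antisym p≤u (ℕP.≤-pred u<r)
    left (node s′ _ _ _ _) with ℕP.m≤n⇒m<n∨m≡n p≤u
    ... | inj₁ p<u = contradiction (p<u , u<r , r<v) (proj₁ (av p r s′))
    ... | inj₂ e = e
    right : Tree Side r q → v ≡ q
    right leaf = ℕP.≤-antisym v≤q r<v
    right (node s′ _ _ _ _) with ℕP.m≤n⇒m<n∨m≡n v≤q
    ... | inj₁ v<q = contradiction (u<r , r<v , v<q) (proj₂ (av r q s′))
    ... | inj₂ e = e

  Measured : ℕ → ℕ → (ℕ → K × K) → Set
  Measured u v f = ∃ λ (t : Tree Side u v) → det (f u) (f v) ≡ len t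

  measured-by : ∀ {u v f} g → f u ≡ g u → f v ≡ g v → Measured u v g → Measured u v f
  measured-by g eu ev (t , e) = t , trans (cong₂ det eu ev) e

  -- The invariant det vp vq ≡ len t passes to both subtrees because the apex vector has the
  -- prescribed determinants with the two ends. The descent is that of `subtree`.
  place-chord : ∀ {p q u v} (t : Tree Side p q) vp vq → det vp vq ≡ len t → u < v → p ≤ u → v ≤ q → Avoids Side u v
      → Measured u v (place t vp vq)
  place-chord (leaf {p = p}) vp vq h u<v p≤u v≤q av with ℕP.≤-antisym p≤u (ℕP.≤-pred (ℕP.<-≤-trans u<v v≤q))
  ... | refl with ℕP.≤-antisym v≤q u<v
  ... | refl = leaf {p = p} , trans (cong₂ det (place-left {p} (leaf {p = p}) vp vq)
      (place-right (leaf {p = p}) vp vq)) h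
  place-chord {p} {q} {u} {v} t@(node {r = r} s p<r r<q t₁ t₂) vp vq h u<v p≤u v≤q av = choose (v ≤? r) (r ≤? u)
    where
    vr : K × K
    vr = apex-vector s p<r r<q t₁ t₂ vp vq
    choose : Dec (v ≤ r) → Dec (r ≤ u) → Measured u v (place t vp vq)
    choose (yes v≤r) _ = measured-by {f = place t vp vq} (place t₁ vp vr)
        (if-yes (u ≤? r) (ℕP.≤-trans (ℕP.<⇒≤ u<v) v≤r)) (if-yes (v ≤? r) v≤r)
      (place-chord t₁ vp vr (det-left s p<r r<q t₁ t₂ vp vq h) u<v p≤u v≤r av)
    choose (no _) (yes r≤u) = measured-by {f = place t vp vq} (place t₂ vr vq) (place-after s p<r r<q t₁ t₂ vp vq r≤u)
      (place-after s p<r r<q t₁ t₂ vp vq (ℕP.≤-trans r≤u (ℕP.<⇒≤ u<v)))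
      (place-chord t₂ vr vq (det-right s p<r r<q t₁ t₂ vp vq h) u<v r≤u v≤q av)
    choose (no v≰r) (no r≰u) with straddle t₁ t₂ av p≤u v≤q (ℕP.≰⇒> r≰u) (ℕP.≰⇒> v≰r)
    ... | refl , refl = t , trans (cong₂ det (place-left t vp vq) (place-right t vp vq)) h

  private
    top : ℕ
    top = n ℕ.+ 2
    -- The top edge {0 , n + 2} is a boundary edge, and its length 1 is the determinant of the
    -- standard basis.
    e₁ e₂ : K × K
    e₁ = 1K , 0K
    e₂ = 0K , 1K

    det-basis : det e₁ e₂ ≡ 1K
    det-basis = trans (cong₂ _⊕_ (*-identityʳ 1K) (trans (cong (-1K ⊗_) (zeroˡ 0K)) (zeroʳ -1K))) (+-identityʳ 1K)

    top-len : ∀ {p q} (t : Tree Side p q) → p ≡ 0 → suc q ≡ m → len t ≡ 1K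
    top-len leaf _ _ = refl
    top-len (node (inj₁ (i , e)) _ _ _ _) refl h with subst (IsDiag m) e (isDiag i)
    ... | _ , _ , _ , ¬top = contradiction (refl , h) ¬top
    top-len (node (inj₂ _) _ _ _ _) _ _ = refl

    vertex : ℕ → K × K
    vertex = place tree e₁ e₂

  abstract
    measure : ∀ {u v} → u < v → v < m → Avoids Side u v → ∃ λ (t : Tree Side u v) → det (vertex u) (vertex v) ≡ len t
    measure {u} {v} u<v vm av = place-chord tree e₁ e₂ (trans det-basis (sym (top-len tree refl (sym m≡)))) u<v z≤n
        (ℕP.≤-pred (subst (v <_) m≡ vm)) av

  abstract
    det-diagonal : ∀ i → det (vertex (proj₁ (D i))) (vertex (proj₂ (D i))) ≡ x i
    det-diagonal i with measure (proj₁ (isDiag i)) (D-bound₂ i)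
       (avoids (proj₁ (isDiag i)) (D-bound₂ i) λ am bm ch
           → chords-uncrossed am bm (D-bound₁ i) (D-bound₂ i) ch (inj₂ (i , sym (D-norm i))) ,
          chords-uncrossed am bm (D-bound₂ i) (D-bound₁ i) ch
              (inj₂ (i , trans (sym (D-norm i)) (norm-sym (proj₁ (D i)) _))))
    ... | t , e = trans e (len-diagonal i t refl)
      where
      len-diagonal : ∀ i {p q} (t : Tree Side p q) → D i ≡ (p , q) → len t ≡ x i
      len-diagonal i leaf e with subst (IsDiag m) e (isDiag i)
      ... | _ , _ , ¬short , _ = contradiction refl ¬short
      len-diagonal i (node (inj₁ (j , f)) _ _ _ _) e = cong x (D-injective (trans f (sym e)))
      len-diagonal i (node (inj₂ f) _ _ _ _) e with subst (IsDiag m) e (isDiag i)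
      ... | _ , _ , _ , ¬top = contradiction f ¬top

    det-boundary : ∀ {u v} → u < v → v < m → Consec m u v → det (vertex u) (vertex v) ≡ 1K
    det-boundary {u} {v} u<v vm c with measure u<v vm (avoids u<v vm λ am bm ch →
        (λ k → Consec-empty bm am c (Cross-swap k)) , λ k → Consec-empty bm am (Consec-sym c) (Cross-swap k))
    ... | t , e = trans e (len-boundary t c)
      where
      len-boundary : ∀ {u v} (t : Tree Side u v) → Consec m u v → len t ≡ 1K
      len-boundary leaf c = refl
      len-boundary (node _ u<r r<v _ _) (inj₁ (inj₁ refl)) = contradiction (ℕP.<-≤-trans u<r (ℕP.≤-pred r<v))
          (ℕP.<-irrefl refl)
      len-boundary (node _ u<r r<v _ _) (inj₁ (inj₂ refl)) = contradiction
          (ℕP.<-trans (ℕP.<-trans u<r r<v) (ℕP.n<1+n _)) (ℕP.<-irrefl refl)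
      len-boundary t@(node _ _ _ _ _) (inj₂ (inj₁ (e , f))) = top-len t e f
      len-boundary (node _ u<r r<v _ _) (inj₂ (inj₂ (refl , _))) = contradiction (ℕP.<-trans u<r r<v) λ ()

    lambda : Lambda D x
    lambda = record
      { Λ = λ (p , q) → det (vertex p) (vertex q)
      ; Λ-diagonal = det-diagonal
      ; Λ-boundary = boundary
      ; ptolemy = λ {a} {b} {c} {d} p q → cyclic a b c d (CO-four p q)
      }
      where
      δ : Diag → K
      δ (p , q) = det (vertex p) (vertex q)
      boundary : ∀ {u v} → u < m → v < m → Consec m u v → δ (norm u v) ≡ 1K
      boundary {u} {v} um vm c with norm u v | norm-view u v
      ... | _ | ascending u<v = det-boundary u<v vm c
      ... | _ | descending v≤u with ℕP.m≤n⇒m<n∨m≡n v≤u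
      ...   | inj₁ v<u = det-boundary v<u um (Consec-sym c)
      ...   | inj₂ refl = contradiction c (irreflexive um)
        where
        irreflexive : ∀ {u} → u < m → ¬ Consec m u u
        irreflexive um (inj₁ (inj₁ ()))
        irreflexive um (inj₁ (inj₂ ()))
        irreflexive um (inj₂ (inj₁ (refl , e))) = contradiction (trans e m≡) λ e
            → contradiction (trans (ℕP.suc-injective e) (ℕP.+-comm n 2)) λ ()
        irreflexive um (inj₂ (inj₂ (refl , e))) = contradiction (trans e m≡) λ e
            → contradiction (trans (ℕP.suc-injective e) (ℕP.+-comm n 2)) λ ()
      -- Lengths are determinants with the ends in increasing order, so each of the four cuts gives
      -- the Plücker relation of the sorted vertices, up to commutativity.
      cyclic : ∀ a b c d → ((a < b × b < c × c < d) ⊎ (b < c × c < d × d < a))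
          ⊎ ((c < d × d < a × a < b) ⊎ (d < a × a < b × b < c)) →
        δ (norm a c) ⊗ δ (norm b d) ≡ δ (norm a b) ⊗ δ (norm c d) ⊕ δ (norm b c) ⊗ δ (norm d a)
      cyclic a b c d (inj₁ (inj₁ (p , q , r)))
        rewrite norm-< (ℕP.<-trans p q) | norm-< (ℕP.<-trans q r) | norm-< p | norm-< r | norm-< q
          | norm-sym d a | norm-< (ℕP.<-trans p (ℕP.<-trans q r)) = plücker (vertex a) (vertex b) (vertex c)
              (vertex d)
      cyclic a b c d (inj₁ (inj₂ (p , q , r)))
        rewrite norm-sym a c | norm-< (ℕP.<-trans q r) | norm-< (ℕP.<-trans p q) | norm-sym a b | norm-<
            (ℕP.<-trans p (ℕP.<-trans q r))
          | norm-< q | norm-< p | norm-< r = trans (*-comm _ _)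
              (trans (plücker (vertex b) (vertex c) (vertex d) (vertex a))
            (trans (+-comm _ _) (cong₂ _⊕_ (*-comm _ _) refl)))
      cyclic a b c d (inj₂ (inj₁ (p , q , r)))
        rewrite norm-sym a c | norm-< (ℕP.<-trans p q) | norm-sym b d | norm-< (ℕP.<-trans q r) | norm-< r | norm-< p
          | norm-sym b c | norm-< (ℕP.<-trans p (ℕP.<-trans q r)) | norm-< q = trans
              (plücker (vertex c) (vertex d) (vertex a) (vertex b))
            (cong₂ _⊕_ (*-comm _ _) (*-comm _ _))
      cyclic a b c d (inj₂ (inj₂ (p , q , r)))
        rewrite norm-< (ℕP.<-trans q r) | norm-sym b d | norm-< (ℕP.<-trans p q) | norm-< q | norm-sym c d | norm-<
            (ℕP.<-trans p (ℕP.<-trans q r))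
          | norm-< r | norm-< p = trans (*-comm _ _) (trans (plücker (vertex d) (vertex a) (vertex b) (vertex c))
            (trans (+-comm _ _) (cong₂ _⊕_ refl (*-comm _ _))))

module LambdaLengths {n : ℕ} {D₀ : Fin n → Diag} {x : Fin n → K} (x-pos : ∀ i → Pos (x i)) (lam : Lambda D₀ x) where
  open Lambda lam
  open Evaluate x x-pos

  -- The invariant along a sequence of mutations: the values of a cluster depend on its
  -- triangulation only. Positivity is carried along because the next mutation divides by one of
  -- them.
  record Labelled (S : Seed n) : Set where
    field
      triangulation : IsTriangulation n (tri S)
      quiver : ∀ i j → quiv S i j ≡ quiverOf (tri S) i j
      value : ∀ k → clus S k ≐ Λ (tri S k)
      positive : ∀ k → Pos (Λ (tri S k))

  module _ {u R D D′} (k : Fin n) (L : Labelled (seed u R D)) (flip : Flip D k D′) where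
    open Labelled L
    private
      module P = Polygon triangulation
      module F = FlipAt triangulation flip
      module M = Mutation triangulation flip

      -- For a boundary edge no D j matches, and the empty product agrees with the length 1; so
      -- boundary edges need no separate treatment in the exchange relation.
      side-product : ∀ {p q} → p < P.m → q < P.m → Chord D p q → ∏ (λ j → pow (Λ (D j)) ⟦ D j ≟D norm p q ⟧)
          ≡ Λ (norm p q)
      side-product {p} {q} pm qm (inj₁ c) = trans (∏-1′ λ j
          → cong (pow (Λ (D j))) (⟦⟧-no (D j ≟D norm p q) (not-boundary j)))
          (sym (Λ-boundary pm qm c))
        where
        not-boundary : ∀ j → D j ≢ norm p q
        not-boundary j e with norm-injective (trans (P.D-norm j) e) | IsDiag⇒sides (P.isDiag j)
        ... | inj₁ (refl , refl) | _ , _ , xm , ym , cr = Consec-empty xm ym c cr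
        ... | inj₂ (refl , refl) | _ , _ , xm , ym , cr = Consec-empty xm ym (Consec-sym c) cr
      side-product {p} {q} _ _ (inj₂ (i , e)) = trans (∏-single i λ j j≢i → cong (pow (Λ (D j)))
          (⟦⟧-no (D j ≟D norm p q) λ f → j≢i (P.D-injective (trans f (sym e)))))
        (trans (cong (pow (Λ (D i))) (⟦⟧-yes (D i ≟D norm p q) e)) (trans (*-identityʳ _) (cong Λ e)))

      side-pos : ∀ {p q} → p < P.m → q < P.m → Chord D p q → Pos (Λ (norm p q))
      side-pos pm qm (inj₁ c) = subst Pos (sym (Λ-boundary pm qm c)) pos-1
      side-pos _ _ (inj₂ (i , e)) = subst (Pos ∘ Λ) e (positive i)

      two-sides : ∀ {p q r s} (Q : Fin n → ℕ) → p < P.m → q < P.m → r < P.m → s < P.m → Chord D p q → Chord D r s →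
        (∀ j → Q j ≡ ⟦ D j ≟D norm p q ⟧ ℕ.+ ⟦ D j ≟D norm r s ⟧) →
        prodF (λ j → u j ^F Q j) ≐ (Λ (norm p q) ⊗ Λ (norm r s))
      two-sides {p} {q} {r} {s} Q pm qm rm sm c c′ h = subst (prodF (λ j → u j ^F Q j) ≐_)
        (trans (∏-cong λ j → trans (cong (pow (Λ (D j))) (h j))
            (pow-+ (Λ (D j)) ⟦ D j ≟D norm p q ⟧ ⟦ D j ≟D norm r s ⟧))
          (trans (∏-* (λ j → pow (Λ (D j)) ⟦ D j ≟D norm p q ⟧) (λ j → pow (Λ (D j)) ⟦ D j ≟D norm r s ⟧))
            (cong₂ _⊗_ (side-product pm qm c) (side-product rm sm c′))))
        (≐-prod {f = λ j → u j ^F Q j} λ j → ≐-^ (value j) (Q j))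

      module AtQuad {a b c d} (Q : Quad D k a b c d) where
        open Quad Q
        am : a < P.m
        am = proj₁ (P.endpoints-bound diagonal)
        cm : c < P.m
        cm = proj₂ (P.endpoints-bound diagonal)

        exchange : (Λ (norm a b) ⊗ Λ (norm c d) ⊕ Λ (norm b c) ⊗ Λ (norm d a)) ⊗ inv (Λ (D k)) ≡ Λ (D′ k)
        exchange = trans (cong₂ _⊗_ (sym (ptolemy abc cda)) (cong (inv ∘ Λ) diagonal))
          (trans (solve 3 (λ x y i → x :* y :* i := x :* i :* y) refl (Λ (norm a c)) (Λ (norm b d))
              (inv (Λ (norm a c))))
            (trans (cong (_⊗ Λ (norm b d)) (inv-right (subst (Pos ∘ Λ) diagonal (positive k))))
              (trans (*-identityˡ _) (cong Λ (sym (F.new-diagonal Q))))))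

        new-value : ((prodF (λ j → u j ^F R j k) +F prodF (λ j → u j ^F R k j)) /F u k) ≐ Λ (D′ k)
        new-value = subst (((prodF (λ j → u j ^F R j k) +F prodF (λ j → u j ^F R k j)) /F u k) ≐_) exchange
          (≐-/ {prodF (λ j → u j ^F R j k) +F prodF (λ j → u j ^F R k j)} {u k}
            (≐-+ {prodF (λ j → u j ^F R j k)} {prodF (λ j → u j ^F R k j)}
              (two-sides (λ j → R j k) am b<m cm d<m ab cd λ j
                  → trans (quiver j k) (Quads.quiver-in triangulation Q j))
              (two-sides (λ j → R k j) b<m cm d<m am bc da λ j
                  → trans (quiver k j) (Quads.quiver-out triangulation Q j)))
            (value k) (positive k))

        new-positive : Pos (Λ (D′ k))
        new-positive = subst Pos exchange (pos-* (pos-+ (pos-* (side-pos am b<m ab) (side-pos cm d<m cd))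
          (pos-* (side-pos b<m cm bc) (side-pos d<m am da))) (pos-inv (positive k)))

    labelled-step : Labelled (seed (mutU k R u) (mutQ k R) D′)
    labelled-step with Quads.quad-at triangulation k
    ... | a , b , c , d , Q = record
      { triangulation = F.tri′
      ; quiver = λ i j → trans (mutQ-cong k quiver i j) (M.mutation-flip i j)
      ; value = new-values
      ; positive = new-positives
      }
      where
      new-values : ∀ i → mutU k R u i ≐ Λ (D′ i)
      new-values i with i Fin.≟ k
      ... | yes refl = AtQuad.new-value Q
      ... | no i≢k = subst (λ e → u i ≐ Λ e) (sym (F.same i≢k)) (value i)
      new-positives : ∀ i → Pos (Λ (D′ i))
      new-positives i with i Fin.≟ k
      ... | yes refl = AtQuad.new-positive Q
      ... | no i≢k = subst (Pos ∘ Λ) (sym (F.same i≢k)) (positive i)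

  labelled : IsTriangulation n D₀ → ∀ {S} → Reachable D₀ S → Labelled S
  labelled t init = record
    { triangulation = t
    ; quiver = λ _ _ → refl
    ; value = λ k → subst (varF k ≐_) (sym (Λ-diagonal k)) (≐-var k)
    ; positive = λ k → subst Pos (sym (Λ-diagonal k)) (x-pos k)
    }
  labelled t (step k r flip) = labelled-step k (labelled t r) flip

  monomial-value : IsTriangulation n D₀ → ∀ {S} → Reachable D₀ S → (e : Fin n → ℕ) →
    clusterMonomial S e ≐ ∏ (λ k → pow (Λ (tri S k)) (e k))
  monomial-value t {S} r e = ≐-prod {f = λ k → clus S k ^F e k} λ k → ≐-^ (Labelled.value (labelled t r) k) (e k)

-- The sum over one triangle

-- Sequences are plain lists from here on: cutting them into blocks and reversing them changes no
-- types, and lengths are side conditions.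
sumL : ℕ → (List Bool → K) → K
sumL zero f = f []
sumL (suc m) f = sumL m (λ v → f (true ∷ v)) ⊕ sumL m (λ v → f (false ∷ v))

sumL-cong : ∀ m {f g : List Bool → K} → (∀ v → length v ≡ m → f v ≡ g v) → sumL m f ≡ sumL m g
sumL-cong zero h = h [] refl
sumL-cong (suc m) h = cong₂ _⊕_ (sumL-cong m λ v e → h (true ∷ v) (cong suc e))
    (sumL-cong m λ v e → h (false ∷ v) (cong suc e))

sumL-++ : ∀ m n f → sumL (m ℕ.+ n) f ≡ sumL m (λ u → sumL n (λ v → f (u ++ v)))
sumL-++ zero n f = refl
sumL-++ (suc m) n f = cong₂ _⊕_ (sumL-++ m n _) (sumL-++ m n _)

sumL-+ : ∀ m f g → sumL m (λ v → f v ⊕ g v) ≡ sumL m f ⊕ sumL m g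
sumL-+ zero f g = refl
sumL-+ (suc m) f g = trans (cong₂ _⊕_ (sumL-+ m _ _) (sumL-+ m _ _))
  (solve 4 (λ a b c d → (a :+ b) :+ (c :+ d) := (a :+ c) :+ (b :+ d)) refl (sumL m (λ v → f (true ∷ v)))
      (sumL m (λ v → g (true ∷ v))) (sumL m (λ v → f (false ∷ v))) (sumL m (λ v → g (false ∷ v))))

sumL-*ˡ : ∀ m c f → sumL m (λ v → c ⊗ f v) ≡ c ⊗ sumL m f
sumL-*ˡ zero c f = refl
sumL-*ˡ (suc m) c f = trans (cong₂ _⊕_ (sumL-*ˡ m c _) (sumL-*ˡ m c _)) (sym (distribˡ c _ _))

sumL-*ʳ : ∀ m c f → sumL m (λ v → f v ⊗ c) ≡ sumL m f ⊗ c
sumL-*ʳ m c f = trans (sumL-cong m λ v _ → *-comm (f v) c) (trans (sumL-*ˡ m c f) (*-comm c _))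

sumL-∷ʳ : ∀ m f → sumL (suc m) f ≡ sumL m (λ v → f (v ∷ʳ true)) ⊕ sumL m (λ v → f (v ∷ʳ false))
sumL-∷ʳ zero f = refl
sumL-∷ʳ (suc m) f = trans (cong₂ _⊕_ (sumL-∷ʳ m (λ v → f (true ∷ v))) (sumL-∷ʳ m (λ v → f (false ∷ v))))
  (solve 4 (λ a b c d → (a :+ b) :+ (c :+ d) := (a :+ c) :+ (b :+ d)) refl (sumL m (λ v → f (true ∷ v ∷ʳ true)))
      (sumL m (λ v → f (true ∷ v ∷ʳ false))) (sumL m (λ v → f (false ∷ v ∷ʳ true)))
      (sumL m (λ v → f (false ∷ v ∷ʳ false))))

sumL-reverse : ∀ m f → sumL m f ≡ sumL m (λ v → f (reverse v))
sumL-reverse zero f = refl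
sumL-reverse (suc m) f = trans (sumL-∷ʳ m f) (cong₂ _⊕_ (part true) (part false))
  where
  part : ∀ b → sumL m (λ v → f (v ∷ʳ b)) ≡ sumL m (λ v → f (reverse (b ∷ v)))
  part b = trans (sumL-reverse m (λ v → f (v ∷ʳ b))) (sumL-cong m λ v _ → cong f (sym (ListP.unfold-reverse b v)))

sumL-product : ∀ m n f g → sumL m (λ v → sumL n (λ w → f v ⊗ g w)) ≡ sumL m f ⊗ sumL n g
sumL-product m n f g = trans (sumL-cong m λ v _ → sumL-*ˡ n (f v) g) (sumL-*ʳ m (sumL n g) f)

sumL-product₂ : ∀ m n k (f : List Bool → K) (g : List Bool → List Bool → K) →
  sumL m (λ v → sumL n (λ w → sumL k (λ u → f v ⊗ g w u))) ≡ sumL m f ⊗ sumL n (λ w → sumL k (g w))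
sumL-product₂ m n k f g = trans (sumL-cong m λ v _ → sumL-cong n λ w _ → sumL-*ˡ k (f v) (g w))
    (sumL-product m n f (λ w → sumL k (g w)))

∏L : {A : Set} → List A → (A → K) → K
∏L [] f = 1K
∏L (x ∷ xs) f = f x ⊗ ∏L xs f

∏L-cong : ∀ {A : Set} {f g : A → K} {xs} → All (λ x → f x ≡ g x) xs → ∏L xs f ≡ ∏L xs g
∏L-cong [] = refl
∏L-cong (e ∷ es) = cong₂ _⊗_ e (∏L-cong es)

∏L-++ : ∀ {A : Set} (xs ys : List A) f → ∏L (xs ++ ys) f ≡ ∏L xs f ⊗ ∏L ys f
∏L-++ [] ys f = sym (*-identityˡ _)
∏L-++ (x ∷ xs) ys f = trans (cong (f x ⊗_) (∏L-++ xs ys f)) (sym (*-assoc _ _ _))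

∏L-* : ∀ {A : Set} (xs : List A) f g → ∏L xs (λ x → f x ⊗ g x) ≡ ∏L xs f ⊗ ∏L xs g
∏L-* [] f g = sym (*-identityˡ _)
∏L-* (x ∷ xs) f g = trans (cong (f x ⊗ g x ⊗_) (∏L-* xs f g))
  (solve 4 (λ a b c d → a :* b :* (c :* d) := a :* c :* (b :* d)) refl (f x) (g x) (∏L xs f) (∏L xs g))

∏L-const : ∀ {A : Set} (xs : List A) c → ∏L xs (λ _ → c) ≡ pow c (length xs)
∏L-const [] c = refl
∏L-const (x ∷ xs) c = cong (c ⊗_) (∏L-const xs c)

-- Surplus entries of either list count as 1; the splitting and reversal lemmas therefore assume
-- equal lengths.
Π₂ : {A B : Set} → (A → B → K) → List A → List B → K
Π₂ g (x ∷ xs) (b ∷ bs) = g x b ⊗ Π₂ g xs bs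
Π₂ g _ _ = 1K

module _ {A B : Set} where

  Π₂-cong : {g h : A → B → K} {xs : List A} → All (λ x → ∀ b → g x b ≡ h x b) xs → ∀ v → Π₂ g xs v ≡ Π₂ h xs v
  Π₂-cong [] v = refl
  Π₂-cong (e ∷ es) [] = refl
  Π₂-cong (e ∷ es) (b ∷ v) = cong₂ _⊗_ (e b) (Π₂-cong es v)

  Π₂-++ : (g : A → B → K) (xs ys : List A) (u v : List B) → length u ≡ length xs → Π₂ g (xs ++ ys) (u ++ v)
      ≡ Π₂ g xs u ⊗ Π₂ g ys v
  Π₂-++ g [] ys [] v e = sym (*-identityˡ _)
  Π₂-++ g (x ∷ xs) ys (b ∷ u) v e = trans (cong (g x b ⊗_) (Π₂-++ g xs ys u v (ℕP.suc-injective e)))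
      (sym (*-assoc _ _ _))

  Π₂-reverse : (g : A → B → K) (xs : List A) (u : List B) → length u ≡ length xs → Π₂ g (reverse xs) (reverse u)
      ≡ Π₂ g xs u
  Π₂-reverse g [] [] e = refl
  Π₂-reverse g (x ∷ xs) (b ∷ u) e rewrite ListP.unfold-reverse x xs | ListP.unfold-reverse b u =
    trans (Π₂-++ g (reverse xs) (x ∷ []) (reverse u) (b ∷ [])
        (trans (ListP.length-reverse u) (trans (ℕP.suc-injective e) (sym (ListP.length-reverse xs)))))
      (trans (*-comm _ _) (cong₂ _⊗_ (*-identityʳ _) (Π₂-reverse g xs u (ℕP.suc-injective e))))

  Π₂-* : (g h : A → B → K) (xs : List A) (u : List B) → Π₂ (λ x b → g x b ⊗ h x b) xs u ≡ Π₂ g xs u ⊗ Π₂ h xs u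
  Π₂-* g h [] u = sym (*-identityˡ _)
  Π₂-* g h (x ∷ xs) [] = sym (*-identityˡ _)
  Π₂-* g h (x ∷ xs) (b ∷ u) = trans (cong (g x b ⊗ h x b ⊗_) (Π₂-* g h xs u))
    (solve 4 (λ a b c d → a :* b :* (c :* d) := a :* c :* (b :* d)) refl (g x b) (h x b) (Π₂ g xs u) (Π₂ h xs u))

  Π₂-map : ∀ {C : Set} (f : C → A) (g : A → B → K) xs u → Π₂ g (map f xs) u ≡ Π₂ (λ x → g (f x)) xs u
  Π₂-map f g [] u = refl
  Π₂-map f g (x ∷ xs) [] = refl
  Π₂-map f g (x ∷ xs) (b ∷ u) = cong (g (f x) b ⊗_) (Π₂-map f g xs u)

∑₂ : (Bool → K) → K
∑₂ f = f true ⊕ f false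

sumL-Π₂ : ∀ {A : Set} (g : A → Bool → K) xs → sumL (length xs) (Π₂ g xs) ≡ ∏L xs (λ x → ∑₂ (g x))
sumL-Π₂ g [] = refl
sumL-Π₂ g (x ∷ xs) = trans (cong₂ _⊕_ (sumL-*ˡ (length xs) (g x true) (Π₂ g xs))
    (sumL-*ˡ (length xs) (g x false) (Π₂ g xs)))
  (trans (sym (distribʳ _ _ _)) (cong (∑₂ (g x) ⊗_) (sumL-Π₂ g xs)))

-- The entries of v meet those of u only position by position, so summing v out acts on each entry
-- of u by its own two-term transfer sum.
sumL-transfer : ∀ {A : Set} (g : A → Bool → K) (e : Bool → Bool → K) xs u → length u ≡ length xs →
  sumL (length xs) (λ v → Π₂ g xs v ⊗ Π₂ e u v) ≡ Π₂ (λ x t → ∑₂ (λ b → g x b ⊗ e t b)) xs u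
sumL-transfer g e [] [] h = *-identityˡ _
sumL-transfer g e (x ∷ xs) (t ∷ u) h = trans (cong₂ _⊕_ (part true) (part false)) (trans (sym (distribʳ _ _ _))
  (cong (∑₂ (λ b → g x b ⊗ e t b) ⊗_) (sumL-transfer g e xs u (ℕP.suc-injective h))))
  where
  part : ∀ b → sumL (length xs) (λ v → g x b ⊗ Π₂ g xs v ⊗ (e t b ⊗ Π₂ e u v)) ≡ g x b ⊗ e t b
      ⊗ sumL (length xs) (λ v → Π₂ g xs v ⊗ Π₂ e u v)
  part b = trans (sumL-cong (length xs) λ v _ → (solve 4 (λ a c d f → a :* c :* (d :* f) := a :* d :* (c :* f)) refl
      (g x b) (Π₂ g xs v) (e t b) (Π₂ e u v)))
    (sumL-*ˡ (length xs) (g x b ⊗ e t b) _)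

zeros₀ ones₀ : List Bool → ℕ
zeros₀ [] = 0
zeros₀ (true ∷ v) = zeros₀ v
zeros₀ (false ∷ v) = suc (zeros₀ v)
ones₀ [] = 0
ones₀ (true ∷ v) = suc (ones₀ v)
ones₀ (false ∷ v) = ones₀ v

-- Running off the end of a list counts as compatible; where this is compared with the condition of
-- a GCS, both lists have length at least N.
compatible : ℕ → List Bool → List Bool → Bool
compatible zero u v = true
compatible (suc N) (b ∷ u) (c ∷ v) = notOneZero b c ∧ compatible N u v
compatible (suc N) _ _ = true

compat : Bool → Bool → K
compat b c = indicator (notOneZero b c)

compatible-Π₂ : ∀ u v u′ v′ → length u ≡ length v → indicator (compatible (length u) (u ++ u′) (v ++ v′))
    ≡ Π₂ compat u v
compatible-Π₂ [] [] u′ v′ e = refl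
compatible-Π₂ (b ∷ u) (c ∷ v) u′ v′ e = trans (indicator-∧ (notOneZero b c) _)
    (cong (compat b c ⊗_) (compatible-Π₂ u v u′ v′ (ℕP.suc-injective e)))

-- Contribution of the cycle i → j → k → i to the exponent of x_i, together with the compatibility
-- of s_i and s_j.
corner : K → ℕ → ℕ → List Bool → List Bool → List Bool → List Bool → K
corner y σjk σij sj sk u v = pow y (zeros₀ sj) ⊗ pow y (ones₀ sk) ⊗ pow (inv y) σjk ⊗ indicator (compatible σij u v)

-- For d(i) < d(j) < d(k), the 3-cycle falls under the first condition when read from i, under the
-- third when read from j and under the second when read from k. This accounts for the reversals.
triangle : K → K → K → ℕ → ℕ → ℕ → List Bool → List Bool → List Bool → K
triangle xi xj xk σij σjk σki si sj sk =
  corner xi σjk σij sj sk si sj ⊗ (corner xj σki σjk sk si (reverse sj) sk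
      ⊗ corner xk σij σki si sj (reverse sk) (reverse si))

choose : K → K → Bool → K
choose y z b = if b then y else z

pow-choose : ∀ {A : Set} y z (xs : List A) v → length v ≡ length xs → pow y (ones₀ v) ⊗ pow z (zeros₀ v)
    ≡ Π₂ (λ _ → choose y z) xs v
pow-choose y z [] [] e = *-identityˡ _
pow-choose y z (x ∷ xs) (true ∷ v) e = trans (*-assoc _ _ _) (cong (y ⊗_) (pow-choose y z xs v (ℕP.suc-injective e)))
pow-choose y z (x ∷ xs) (false ∷ v) e = trans (solve 3 (λ a b c → a :* (b :* c) := b :* (a :* c)) refl
    (pow y (ones₀ v)) (z) (pow z (zeros₀ v))) (cong (z ⊗_) (pow-choose y z xs v (ℕP.suc-injective e)))

pow-Π₂ : ∀ {A : Set} y (xs : List A) (v : List Bool) → length v ≡ length xs → pow y (length xs) ≡ Π₂ (λ _ _ → y) xs v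
pow-Π₂ y [] [] e = refl
pow-Π₂ y (x ∷ xs) (b ∷ v) e = cong (y ⊗_) (pow-Π₂ y xs v (ℕP.suc-injective e))

split-list : ∀ {A : Set} m {n} (s : List A) → length s ≡ m ℕ.+ n → ∃ λ u → ∃ λ v → s ≡ u ++ v × length u ≡ m
    × length v ≡ n
split-list zero s e = [] , s , refl , refl , e
split-list (suc m) (b ∷ s) e with split-list m s (ℕP.suc-injective e)
... | u , v , refl , eu , ev = b ∷ u , v , refl , cong suc eu , ev

-- Arcs meeting the triangle p < r < q, sorted by the corners they cut: over₁ and over₂ enter
-- through {p , q} and leave through {r , q} and {p , r}; at-r enter through {p , q} and end at r;
-- from-p and to-q start at p and q; around-r cut the corner at r.
module TriangleSum (X : ℕ → ℕ → K) {p r q : ℕ} (p<r : p < r) (r<q : r < q)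
    (pos-i : Pos (X p q)) (pos-j : Pos (X r q)) (pos-k : Pos (X p r))
    (ptolemy : ∀ {a b c d} → a < b → b < c → c < d → d ≤ q → X a c ⊗ X b d ≡ X a b ⊗ X c d ⊕ X b c ⊗ X a d)
    (over₁ at-r over₂ from-p to-q : List ℕ) (around-r : List (ℕ × ℕ))
    (over₁-range : All (λ b → r < b × b < q) over₁) (at-r-range : All (_≡ r) at-r)
        (over₂-range : All (λ b → p < b × b < r) over₂)
    (from-p-range : All (λ b → r < b × b < q) from-p) (to-q-range : All (λ b → p < b × b < r) to-q)
    (around-range : All (λ e → (p < proj₁ e × proj₁ e < r) × (r < proj₂ e × proj₂ e < q)) around-r) where

  xi xj xk : K
  xi = X p q
  xj = X r q
  xk = X p r

  private
    ii ij ik : K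
    ii = inv xi
    ij = inv xj
    ik = inv xk

  φ : ℕ → ℕ → ℕ → Bool → K
  φ p q b t = choose (X b q) (X p b) t

  -- Each list names the arcs by their ends below that side, in the order of their crossings. Hence
  -- over₁ is an initial block for i and j, over₂ a final block for i and k, and around-r is final
  -- for j and, reversed, initial for k: exactly the segments that the three conditions compare.
  rays-i rays-j rays-k : List ℕ
  rays-i = over₁ ++ (at-r ++ over₂)
  rays-j = over₁ ++ (from-p ++ map proj₂ around-r)
  rays-k = reverse (map proj₁ around-r) ++ (to-q ++ over₂)

  -- All that depends on one entry of s_j or s_k: the factor of the ray, its contribution to the
  -- exponents of the two other sides (for j, a 1 counts towards x_k and a 0 towards x_i), and the
  -- prefactor 1/x_j or 1/x_k.
  gj gk : ℕ → Bool → K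
  gj b t = φ r q b t ⊗ choose xk xi t ⊗ ij
  gk b t = φ p r b t ⊗ choose xi xj t ⊗ ik

  private
    cancel : ∀ {y} → Pos y → ∀ z → y ⊗ inv y ⊗ z ≡ z
    cancel py z = trans (cong (_⊗ z) (inv-right py)) (*-identityˡ z)

    divide : ∀ {y u z} → Pos y → u ⊗ y ≡ z → inv y ⊗ z ≡ u
    divide {y} {u} {z} py e = trans (cong (inv y ⊗_) (sym e))
        (trans (solve 3 (λ i u y → i :* (u :* y) := y :* i :* u) refl (inv y) (u) (y)) (cancel py u))

    -- The two entries stand for the two products in the Ptolemy relation of p < r < c < q, and
    -- 1/x_j removes the other diagonal.
    from-p-sum : ∀ {c} → r < c → c < q → ∑₂ (gj c) ≡ X p c
    from-p-sum {c} r<c c<q = trans (solve 5 (λ u v a b i → u :* a :* i :+ v :* b :* i := i :* (a :* u :+ v :* b)) refl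
        (X c q) (X r c) (xk) (xi) (ij))
      (divide pos-j (ptolemy p<r r<c c<q ℕP.≤-refl))

    to-q-sum : ∀ {c} → p < c → c < r → ∑₂ (gk c) ≡ X c q
    to-q-sum {c} p<c c<r = trans (solve 5 (λ u v a b i → u :* a :* i :+ v :* b :* i := i :* (v :* b :+ u :* a)) refl
        (X c r) (X p c) (xi) (xj) (ik))
      (divide pos-k (trans (*-comm _ _) (ptolemy p<c c<r r<q ℕP.≤-refl)))

    drop-one : ∀ a b → a ⊗ 1K ⊕ b ⊗ 0K ≡ a
    drop-one a b = trans (cong₂ _⊕_ (*-identityʳ a) (zeroʳ b)) (+-identityʳ a)

    drop-zero : ∀ a b → a ⊗ 0K ⊕ b ⊗ 1K ≡ b
    drop-zero a b = trans (cong₂ _⊕_ (zeroʳ a) (*-identityʳ b)) (+-identityˡ b)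

    keep : ∀ a b → a ⊗ 1K ⊕ b ⊗ 1K ≡ a ⊕ b
    keep a b = cong₂ _⊕_ (*-identityʳ a) (*-identityʳ b)

    -- The factor 1/x_k is the share of this arc in the term - σ_ij of the exponent of x_k. Entry 1
    -- on i forces entry 1 on j and everything cancels; entry 0 leaves both entries, which add up as
    -- in `from-p-sum`.
    over₁-term : ∀ {b} → r < b → b < q → ∀ t → choose xj xk t ⊗ ik ⊗ ∑₂ (λ v → gj b v ⊗ compat t v) ≡ φ p q b t
    over₁-term {b} r<b b<q true = trans (cong (xj ⊗ ik ⊗_) (drop-one (gj b true) (gj b false)))
      (trans (solve 5 (λ j k u a i → j :* k :* (u :* a :* i) := j :* i :* (a :* k :* u)) refl (xj) (ik) (X b q) (xk)
          (ij)) (trans (cancel pos-j _) (cancel pos-k _)))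
    over₁-term {b} r<b b<q false = trans (cong (xk ⊗ ik ⊗_) (keep (gj b true) (gj b false)))
        (trans (cancel pos-k _) (from-p-sum r<b b<q))

    -- Mirror image of the preceding case: compatibility now runs from k to i, so entry 0 on i
    -- forces entry 0 on k, and entry 1 leaves the Ptolemy sum.
    over₂-term : ∀ {b} → p < b → b < r → ∀ t → choose xj xk t ⊗ ij ⊗ ∑₂ (λ v → gk b v ⊗ compat v t) ≡ φ p q b t
    over₂-term {b} p<b b<r true = trans (cong (xj ⊗ ij ⊗_) (keep (gk b true) (gk b false)))
        (trans (cancel pos-j _) (to-q-sum p<b b<r))
    over₂-term {b} p<b b<r false = trans (cong (xk ⊗ ij ⊗_) (drop-zero (gk b true) (gk b false)))
      (trans (solve 5 (λ k j u a i → k :* j :* (u :* a :* i) := k :* i :* (a :* j :* u)) refl (xk) (ij) (X p b) (xj)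
          (ik)) (trans (cancel pos-k _) (cancel pos-j _)))

    -- Of the four pairs of entries, those with 0 on j are summed by Ptolemy for p < c′ < r < q.
    -- Adding the surviving pair (1 , 1) gives Ptolemy for c′ < r < c < q; the factor 1/x_i comes
    -- from σ_jk.
    around-term : ∀ {c′ c} → p < c′ → c′ < r → r < c → c < q →
      ii ⊗ ∑₂ (λ v → gj c v ⊗ ∑₂ (λ w → gk c′ w ⊗ compat v w)) ≡ X c′ c
    around-term {c′} {c} p<c′ c′<r r<c c<q = trans
      (cong (ii ⊗_) (cong₂ _⊕_ (cong (gj c true ⊗_) (drop-one (gk c′ true) (gk c′ false)))
        (cong (gj c false ⊗_) (trans (keep (gk c′ true) (gk c′ false)) (to-q-sum p<c′ c′<r)))))
      (trans (solve 9 (λ ii a xk ij b xi ik d e → ii :* (a :* xk :* ij :* (b :* xi :* ik) :+ d :* xi :* ij :* e) := xi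
          :* ii :* (ij :* (xk :* ik :* (b :* a) :+ d :* e))) refl (ii) (X c q) (xk) (ij) (X c′ r) (xi) (ik) (X r c)
          (X c′ q))
        (trans (cancel pos-i _) (trans (cong (λ z → ij ⊗ (z ⊕ X r c ⊗ X c′ q)) (cancel pos-k _))
          (divide pos-j (ptolemy c′<r r<c c<q ℕP.≤-refl)))))

    at-r-term : ∀ {b} → b ≡ r → ∀ t → choose xj xk t ≡ φ p q b t
    at-r-term refl t = refl

    n₁ nₘ n₂ nₚ n_q n₀ : ℕ
    n₁ = length over₁
    nₘ = length at-r
    n₂ = length over₂
    nₚ = length from-p
    n_q = length to-q
    n₀ = length around-r

    wi : Bool → K
    wi = choose xj xk

  module _ (σij σjk σki : ℕ) (eij : σij ≡ n₁) (ejk : σjk ≡ n₀) (eki : σki ≡ n₂) where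
    private
      κ : K
      κ = pow ii n₀ ⊗ (pow ij n₂ ⊗ pow ik n₁)

      -- Separates the part depending on s_i alone, the inverse powers κ belonging to the corners,
      -- and one factor per entry of s_j and s_k.
      regroup : ∀ si sj sk → length si ≡ length rays-i → length sj ≡ length rays-j → length sk ≡ length rays-k →
        triangle xi xj xk σij σjk σki si sj sk ⊗
          (pow ij (length rays-j) ⊗ Π₂ (φ r q) rays-j sj ⊗ (pow ik (length rays-k) ⊗ Π₂ (φ p r) rays-k sk)) ≡
        Π₂ (λ _ → wi) rays-i si ⊗ κ ⊗ (Π₂ gj rays-j sj ⊗ Π₂ gk rays-k sk ⊗
          (indicator (compatible n₁ si sj) ⊗ (indicator (compatible n₀ (reverse sj) sk)
              ⊗ indicator (compatible n₂ (reverse sk) (reverse si)))))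
      regroup si sj sk li lj lk rewrite eij | ejk | eki =
        trans (solve 16 (λ a b i₀ c d e j₂ f g h k₁ l m u n v
            → a :* b :* i₀ :* c :* (d :* e :* j₂ :* f :* (g :* h :* k₁ :* l)) :* (m :* u :* (n :* v)) := e :* g :*
            (i₀ :* (j₂ :* k₁)) :* ((u :* (h :* a) :* m) :* (v :* (b :* d) :* n) :* (c :* (f :* l)))) refl
            (pow xi (zeros₀ sj)) (pow xi (ones₀ sk)) (pow ii n₀) (indicator (compatible n₁ si sj))
            (pow xj (zeros₀ sk)) (pow xj (ones₀ si)) (pow ij n₂) (indicator (compatible n₀ (reverse sj) sk))
            (pow xk (zeros₀ si)) (pow xk (ones₀ sj)) (pow ik n₁) (indicator (compatible n₂ (reverse sk) (reverse si)))
            (pow ij (length rays-j)) (Π₂ (φ r q) rays-j sj) (pow ik (length rays-k)) (Π₂ (φ p r) rays-k sk))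
        (cong₂ _⊗_ (cong (_⊗ κ) (pow-choose xj xk rays-i si li)) (cong (_⊗ _) (cong₂ _⊗_
          (weighted rays-j sj lj xk xi ij (φ r q)) (weighted rays-k sk lk xi xj ik (φ p r)))))
        where
        weighted : ∀ xs v → length v ≡ length xs → ∀ y z i g → Π₂ g xs v ⊗ (pow y (ones₀ v) ⊗ pow z (zeros₀ v))
            ⊗ pow i (length xs) ≡
          Π₂ (λ x b → g x b ⊗ choose y z b ⊗ i) xs v
        weighted xs v e y z i g = sym (trans (Π₂-* _ (λ _ _ → i) xs v)
            (cong₂ _⊗_ (trans (Π₂-* g (λ _ → choose y z) xs v)
          (cong (Π₂ g xs v ⊗_) (sym (pow-choose y z xs v e)))) (sym (pow-Π₂ i xs v e))))

      -- Reversal makes the final blocks v₀, w₂ and u₂ initial, so each compatibility factor sees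
      -- exactly the arcs cutting one corner, and all other blocks are free.
      factor : ∀ u₁ uₘ u₂ v₁ vₚ v₀ w₀ w_q w₂ → length u₁ ≡ n₁ → length uₘ ≡ nₘ → length u₂ ≡ n₂ →
        length v₁ ≡ n₁ → length vₚ ≡ nₚ → length v₀ ≡ n₀ → length w₀ ≡ n₀ → length w_q ≡ n_q → length w₂ ≡ n₂ →
        let si = u₁ ++ (uₘ ++ u₂) ; sj = v₁ ++ (vₚ ++ v₀) ; sk = w₀ ++ (w_q ++ w₂) in
        Π₂ gj rays-j sj ⊗ Π₂ gk rays-k sk ⊗
          (indicator (compatible n₁ si sj) ⊗ (indicator (compatible n₀ (reverse sj) sk)
              ⊗ indicator (compatible n₂ (reverse sk) (reverse si)))) ≡
        (Π₂ gj over₁ v₁ ⊗ Π₂ compat u₁ v₁) ⊗ (Π₂ gj from-p vₚ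
            ⊗ ((Π₂ (λ e → gj (proj₂ e)) around-r v₀ ⊗ (Π₂ gk (reverse (map proj₁ around-r)) w₀
            ⊗ Π₂ compat (reverse v₀) w₀))
          ⊗ (Π₂ gk to-q w_q ⊗ (Π₂ gk over₂ w₂ ⊗ Π₂ compat w₂ u₂))))
      factor u₁ uₘ u₂ v₁ vₚ v₀ w₀ w_q w₂ lu₁ luₘ lu₂ lv₁ lvₚ lv₀ lw₀ lw_q lw₂ =
        trans (cong₂ _⊗_ (cong₂ _⊗_
            (trans (Π₂-++ gj over₁ _ v₁ _ lv₁) (cong (Π₂ gj over₁ v₁ ⊗_) (trans (Π₂-++ gj from-p _ vₚ v₀ lvₚ)
              (cong (Π₂ gj from-p vₚ ⊗_) (Π₂-map proj₂ gj around-r v₀)))))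
            (trans (Π₂-++ gk (reverse (map proj₁ around-r)) _ w₀ _
                (trans lw₀ (sym (trans (ListP.length-reverse (map proj₁ around-r))
                (ListP.length-map proj₁ around-r)))))
              (cong (Π₂ gk (reverse (map proj₁ around-r)) w₀ ⊗_) (Π₂-++ gk to-q over₂ w_q w₂ lw_q))))
          (cong₂ _⊗_ c₁ (cong₂ _⊗_ c₀ c₂)))
        (solve 9 (λ a b c d e f u v w → a :* (b :* c) :* (d :* (e :* f)) :* (u :* (v :* w)) := (a :* u) :*
            (b :* ((c :* (d :* v)) :* (e :* (f :* w))))) refl (Π₂ gj over₁ v₁) (Π₂ gj from-p vₚ)
            (Π₂ (λ e → gj (proj₂ e)) around-r v₀) (Π₂ gk (reverse (map proj₁ around-r)) w₀) (Π₂ gk to-q w_q)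
            (Π₂ gk over₂ w₂) (Π₂ compat u₁ v₁) (Π₂ compat (reverse v₀) w₀) (Π₂ compat w₂ u₂))
        where
        reverse-++₃ : ∀ (a b c : List Bool) → reverse (a ++ (b ++ c)) ≡ reverse c ++ (reverse b ++ reverse a)
        reverse-++₃ a b c = trans (ListP.reverse-++ a (b ++ c))
            (trans (cong (_++ reverse a) (ListP.reverse-++ b c)) (ListP.++-assoc (reverse c) (reverse b) (reverse a)))
        c₁ : indicator (compatible n₁ (u₁ ++ (uₘ ++ u₂)) (v₁ ++ (vₚ ++ v₀))) ≡ Π₂ compat u₁ v₁
        c₁ = trans (cong (λ N → indicator (compatible N (u₁ ++ (uₘ ++ u₂)) (v₁ ++ (vₚ ++ v₀)))) (sym lu₁))
            (compatible-Π₂ u₁ v₁ _ _ (trans lu₁ (sym lv₁)))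
        c₀ : indicator (compatible n₀ (reverse (v₁ ++ (vₚ ++ v₀))) (w₀ ++ (w_q ++ w₂))) ≡ Π₂ compat (reverse v₀) w₀
        c₀ = trans (cong₂ (λ N s → indicator (compatible N s (w₀ ++ (w_q ++ w₂))))
            (sym (trans (ListP.length-reverse v₀) lv₀)) (reverse-++₃ v₁ vₚ v₀))
          (compatible-Π₂ (reverse v₀) w₀ _ _ (trans (ListP.length-reverse v₀) (trans lv₀ (sym lw₀))))
        c₂ : indicator (compatible n₂ (reverse (w₀ ++ (w_q ++ w₂))) (reverse (u₁ ++ (uₘ ++ u₂)))) ≡ Π₂ compat w₂ u₂
        c₂ = trans (cong₂ (λ N s → indicator (compatible N s (reverse (u₁ ++ (uₘ ++ u₂)))))
            (sym (trans (ListP.length-reverse w₂) lw₂)) (reverse-++₃ w₀ w_q w₂))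
          (trans (cong (λ s → indicator (compatible (length (reverse w₂)) (reverse w₂ ++ (reverse w_q ++ reverse w₀))
              s)) (reverse-++₃ u₁ uₘ u₂))
          (trans (compatible-Π₂ (reverse w₂) (reverse u₂) _ _
              (trans (ListP.length-reverse w₂) (trans lw₂ (sym (trans (ListP.length-reverse u₂) lu₂)))))
            (Π₂-reverse compat w₂ u₂ (trans lu₂ (sym lw₂)))))

      -- The list for k runs through the arcs around r backwards. Summing over reversed sequences
      -- aligns it with the list for j, after which every arc contributes separately.
      around-sum : sumL n₀ (λ v₀ → sumL n₀ (λ w₀ → Π₂ (λ e → gj (proj₂ e)) around-r v₀
          ⊗ (Π₂ gk (reverse (map proj₁ around-r)) w₀ ⊗ Π₂ compat (reverse v₀) w₀))) ≡
        ∏L around-r (λ e → ∑₂ (λ v → gj (proj₂ e) v ⊗ ∑₂ (λ w → gk (proj₁ e) w ⊗ compat v w)))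
      around-sum = trans (sumL-cong n₀ λ v₀ lv₀ → trans (sumL-*ˡ n₀ _ _)
          (cong (Π₂ (λ e → gj (proj₂ e)) around-r v₀ ⊗_)
          (trans (sumL-reverse n₀ _) (trans (sumL-cong n₀ λ w lw → cong₂ _⊗_
              (trans (Π₂-reverse gk (map proj₁ around-r) w (trans lw (sym (ListP.length-map proj₁ around-r))))
                  (Π₂-map proj₁ gk around-r w))
              (Π₂-reverse compat v₀ w (trans lw (sym lv₀))))
            (sumL-transfer (λ e → gk (proj₁ e)) compat around-r v₀ lv₀)))))
        (trans (sumL-cong n₀ λ v₀ _ → sym (Π₂-* (λ e → gj (proj₂ e)) _ around-r v₀)) (sumL-Π₂ _ around-r))

    abstract
      triangle-sum : ∀ si → length si ≡ length rays-i →
        sumL (length rays-j) (λ sj → sumL (length rays-k) (λ sk → triangle xi xj xk σij σjk σki si sj sk ⊗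
          (pow ij (length rays-j) ⊗ Π₂ (φ r q) rays-j sj ⊗ (pow ik (length rays-k) ⊗ Π₂ (φ p r) rays-k sk)))) ≡
        Π₂ (φ p q) rays-i si ⊗ (∏L from-p (X p) ⊗ (∏L to-q (λ c → X c q) ⊗ ∏L around-r (λ e → X (proj₁ e) (proj₂ e))))
      triangle-sum si li with split-list n₁ si (trans li (ListP.length-++ over₁))
      ... | u₁ , u′ , refl , lu₁ , lu′ with split-list nₘ u′ (trans lu′ (ListP.length-++ at-r))
      ... | uₘ , u₂ , refl , luₘ , lu₂ = begin
        sumL (length rays-j) (λ sj → sumL (length rays-k) (λ sk → triangle xi xj xk σij σjk σki si′ sj sk ⊗
          (pow ij (length rays-j) ⊗ Π₂ (φ r q) rays-j sj ⊗ (pow ik (length rays-k) ⊗ Π₂ (φ p r) rays-k sk))))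
          ≡⟨ (sumL-cong (length rays-j) λ sj lj → trans
              (sumL-cong (length rays-k) λ sk lk → regroup si′ sj sk li lj lk) (sumL-*ˡ (length rays-k) _ _)) ⟩
        sumL (length rays-j) (λ sj → Π₂ (λ _ → wi) rays-i si′ ⊗ κ ⊗ sumL (length rays-k) (summand sj))
          ≡⟨ sumL-*ˡ (length rays-j) _ _ ⟩
        Π₂ (λ _ → wi) rays-i si′ ⊗ κ ⊗ sumL (length rays-j) (λ sj → sumL (length rays-k) (summand sj))
          ≡⟨ cong (Π₂ (λ _ → wi) rays-i si′ ⊗ κ ⊗_) sums ⟩
        Π₂ (λ _ → wi) rays-i si′ ⊗ κ ⊗ (sum₁ ⊗ (∏L from-p (λ c → ∑₂ (gj c))
            ⊗ (sum₀ ⊗ (∏L to-q (λ c → ∑₂ (gk c)) ⊗ sum₂))))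
          ≡⟨ cong (λ z → z ⊗ κ ⊗ (sum₁ ⊗ (∏L from-p (λ c → ∑₂ (gj c)) ⊗ (sum₀ ⊗ (∏L to-q (λ c → ∑₂ (gk c)) ⊗ sum₂)))))
              (trans (Π₂-++ _ over₁ _ u₁ _ lu₁) (cong (Π₂ (λ _ → wi) over₁ u₁ ⊗_) (Π₂-++ _ at-r over₂ uₘ u₂ luₘ))) ⟩
        (Π₂ (λ _ → wi) over₁ u₁ ⊗ (Π₂ (λ _ → wi) at-r uₘ ⊗ Π₂ (λ _ → wi) over₂ u₂))
            ⊗ (pow ii n₀ ⊗ (pow ij n₂ ⊗ pow ik n₁)) ⊗
          (sum₁ ⊗ (∏L from-p (λ c → ∑₂ (gj c)) ⊗ (sum₀ ⊗ (∏L to-q (λ c → ∑₂ (gk c)) ⊗ sum₂))))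
          -- Each inverse power goes to the arcs of its corner: 1/x_k to over₁, 1/x_j to over₂ and
          -- 1/x_i to around-r.
          ≡⟨ (solve 11 (λ a b c i j k s f o t w → (a :* (b :* c)) :* (i :* (j :* k)) :* (s :* (f :* (o :* (t :* w))))
              := (a :* k :* s) :* (b :* (c :* j :* w)) :* (f :* (t :* (i :* o)))) refl (Π₂ (λ _ → wi) over₁ u₁)
              (Π₂ (λ _ → wi) at-r uₘ) (Π₂ (λ _ → wi) over₂ u₂) (pow ii n₀) (pow ij n₂) (pow ik n₁) (sum₁)
              (∏L from-p (λ c → ∑₂ (gj c))) (sum₀) (∏L to-q (λ c → ∑₂ (gk c))) (sum₂)) ⟩
        (Π₂ (λ _ → wi) over₁ u₁ ⊗ pow ik n₁ ⊗ sum₁) ⊗ (Π₂ (λ _ → wi) at-r uₘ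
            ⊗ (Π₂ (λ _ → wi) over₂ u₂ ⊗ pow ij n₂ ⊗ sum₂)) ⊗
          (∏L from-p (λ c → ∑₂ (gj c)) ⊗ (∏L to-q (λ c → ∑₂ (gk c)) ⊗ (pow ii n₀ ⊗ sum₀)))
          ≡⟨ cong₂ _⊗_ (cong₂ _⊗_ part₁ (cong₂ _⊗_ (Π₂-cong (All.map at-r-term at-r-range) uₘ) part₂))
               (cong₂ _⊗_ (∏L-cong (All.map (λ (x , y) → from-p-sum x y) from-p-range))
                   (cong₂ _⊗_ (∏L-cong (All.map (λ (x , y) → to-q-sum x y) to-q-range)) part₀)) ⟩
        Π₂ (φ p q) over₁ u₁ ⊗ (Π₂ (φ p q) at-r uₘ ⊗ Π₂ (φ p q) over₂ u₂)
            ⊗ (∏L from-p (X p) ⊗ (∏L to-q (λ c → X c q) ⊗ ∏L around-r (λ e → X (proj₁ e) (proj₂ e))))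
          ≡⟨ cong (_⊗ _) (sym (trans (Π₂-++ _ over₁ _ u₁ _ lu₁)
              (cong (Π₂ (φ p q) over₁ u₁ ⊗_) (Π₂-++ _ at-r over₂ uₘ u₂ luₘ)))) ⟩
        Π₂ (φ p q) rays-i si′ ⊗ (∏L from-p (X p) ⊗ (∏L to-q (λ c → X c q)
            ⊗ ∏L around-r (λ e → X (proj₁ e) (proj₂ e)))) ∎
        where
        open ≡-Reasoning
        si′ : List Bool
        si′ = u₁ ++ (uₘ ++ u₂)
        summand : List Bool → List Bool → K
        summand sj sk = Π₂ gj rays-j sj ⊗ Π₂ gk rays-k sk ⊗
          (indicator (compatible n₁ si′ sj) ⊗ (indicator (compatible n₀ (reverse sj) sk)
              ⊗ indicator (compatible n₂ (reverse sk) (reverse si′))))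
        sum₁ sum₂ sum₀ : K
        sum₁ = Π₂ (λ b t → ∑₂ (λ v → gj b v ⊗ compat t v)) over₁ u₁
        sum₂ = Π₂ (λ b t → ∑₂ (λ v → gk b v ⊗ compat v t)) over₂ u₂
        sum₀ = ∏L around-r (λ e → ∑₂ (λ v → gj (proj₂ e) v ⊗ ∑₂ (λ w → gk (proj₁ e) w ⊗ compat v w)))
        F₁ Fₚ F_q F₂ : List Bool → K
        F₁ v = Π₂ gj over₁ v ⊗ Π₂ compat u₁ v
        Fₚ v = Π₂ gj from-p v
        F_q w = Π₂ gk to-q w
        F₂ w = Π₂ gk over₂ w ⊗ Π₂ compat w u₂
        F₀ : List Bool → List Bool → K
        F₀ v w = Π₂ (λ e → gj (proj₂ e)) around-r v ⊗ (Π₂ gk (reverse (map proj₁ around-r)) w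
            ⊗ Π₂ compat (reverse v) w)
        lengths-j : length rays-j ≡ n₁ ℕ.+ (nₚ ℕ.+ n₀)
        lengths-j = trans (ListP.length-++ over₁) (cong (n₁ ℕ.+_)
            (trans (ListP.length-++ from-p) (cong (nₚ ℕ.+_) (ListP.length-map proj₂ around-r))))
        lengths-k : length rays-k ≡ n₀ ℕ.+ (n_q ℕ.+ n₂)
        lengths-k = trans (ListP.length-++ (reverse (map proj₁ around-r))) (cong₂ ℕ._+_
          (trans (ListP.length-reverse (map proj₁ around-r)) (ListP.length-map proj₁ around-r))
              (ListP.length-++ to-q))
        spread : ∀ {M} a b c f → M ≡ a ℕ.+ (b ℕ.+ c) → sumL M f
            ≡ sumL a (λ u → sumL b (λ v → sumL c (λ w → f (u ++ (v ++ w)))))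
        spread a b c f refl = trans (sumL-++ a (b ℕ.+ c) f) (sumL-cong a λ u _ → sumL-++ b c _)
        collect : ∀ v₁ vₚ v₀ → sumL n₀ (λ w₀ → sumL n_q
            (λ w_q → sumL n₂ (λ w₂ → F₁ v₁ ⊗ (Fₚ vₚ ⊗ (F₀ v₀ w₀ ⊗ (F_q w_q ⊗ F₂ w₂)))))) ≡
          F₁ v₁ ⊗ (Fₚ vₚ ⊗ (sumL n₀ (F₀ v₀) ⊗ (sumL n_q F_q ⊗ sumL n₂ F₂)))
        collect v₁ vₚ v₀ = trans
          (sumL-cong n₀ λ w₀ _ → trans (sumL-cong n_q λ w_q _ → trans
              (sumL-cong n₂ λ w₂ _ → (solve 5 (λ a b c d e → a :* (b :* (c :* (d :* e))) := (a :* b :* c :* d) :* e)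
                  refl (F₁ v₁) (Fₚ vₚ) (F₀ v₀ w₀) (F_q w_q) (F₂ w₂)))
              (trans (sumL-*ˡ n₂ (F₁ v₁ ⊗ Fₚ vₚ ⊗ F₀ v₀ w₀ ⊗ F_q w_q) F₂)
                  (solve 5 (λ a b c d e → a :* b :* c :* d :* e := (a :* b :* c :* e) :* d) refl (F₁ v₁) (Fₚ vₚ)
                  (F₀ v₀ w₀) (F_q w_q) (sumL n₂ F₂))))
            (trans (sumL-*ˡ n_q (F₁ v₁ ⊗ Fₚ vₚ ⊗ F₀ v₀ w₀ ⊗ sumL n₂ F₂) F_q)
                (solve 5 (λ a b c d e → a :* b :* c :* d :* e := (a :* b :* e :* d) :* c) refl (F₁ v₁) (Fₚ vₚ)
                (F₀ v₀ w₀) (sumL n₂ F₂) (sumL n_q F_q))))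
          (trans (sumL-*ˡ n₀ (F₁ v₁ ⊗ Fₚ vₚ ⊗ sumL n_q F_q ⊗ sumL n₂ F₂) (F₀ v₀))
            (solve 5 (λ a b c d e → a :* b :* c :* d :* e := a :* (b :* (e :* (c :* d)))) refl (F₁ v₁) (Fₚ vₚ)
                (sumL n_q F_q) (sumL n₂ F₂) (sumL n₀ (F₀ v₀))))
        compat-sums : sumL n₂ F₂ ≡ sum₂
        compat-sums = trans (sumL-cong n₂ λ w _ → cong (Π₂ gk over₂ w ⊗_) (flip-Π₂ w u₂))
            (sumL-transfer gk (λ t v → compat v t) over₂ u₂ lu₂)
          where
          flip-Π₂ : ∀ w u → Π₂ compat w u ≡ Π₂ (λ t v → compat v t) u w
          flip-Π₂ [] [] = refl
          flip-Π₂ [] (_ ∷ _) = refl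
          flip-Π₂ (_ ∷ _) [] = refl
          flip-Π₂ (b ∷ w) (c ∷ u) = cong (compat b c ⊗_) (flip-Π₂ w u)
        sums : sumL (length rays-j) (λ sj → sumL (length rays-k) (summand sj)) ≡
          sum₁ ⊗ (∏L from-p (λ c → ∑₂ (gj c)) ⊗ (sum₀ ⊗ (∏L to-q (λ c → ∑₂ (gk c)) ⊗ sum₂)))
        sums = trans (spread n₁ nₚ n₀ _ lengths-j)
          (trans (sumL-cong n₁ λ v₁ lv₁ → sumL-cong nₚ λ vₚ lvₚ → sumL-cong n₀ λ v₀ lv₀
              → trans (spread n₀ n_q n₂ _ lengths-k)
              (trans (sumL-cong n₀ λ w₀ lw₀ → sumL-cong n_q λ w_q lw_q → sumL-cong n₂ λ w₂ lw₂ →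
                  factor u₁ uₘ u₂ v₁ vₚ v₀ w₀ w_q w₂ lu₁ luₘ lu₂ lv₁ lvₚ lv₀ lw₀ lw_q lw₂)
                (collect v₁ vₚ v₀)))
          (trans (sumL-product₂ n₁ nₚ n₀ F₁ (λ vₚ v₀ → Fₚ vₚ ⊗ (sumL n₀ (F₀ v₀) ⊗ (sumL n_q F_q ⊗ sumL n₂ F₂))))
            (cong₂ _⊗_ (sumL-transfer gj compat over₁ u₁ lu₁)
              (trans (sumL-product nₚ n₀ Fₚ (λ v₀ → sumL n₀ (F₀ v₀) ⊗ (sumL n_q F_q ⊗ sumL n₂ F₂)))
                (cong₂ _⊗_ (sumL-Π₂ gj from-p) (trans (sumL-*ʳ n₀ _ (λ v₀ → sumL n₀ (F₀ v₀)))
                  (cong₂ _⊗_ around-sum (cong₂ _⊗_ (sumL-Π₂ gk to-q) compat-sums))))))))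
        part₁ : Π₂ (λ _ → wi) over₁ u₁ ⊗ pow ik n₁ ⊗ sum₁ ≡ Π₂ (φ p q) over₁ u₁
        part₁ = trans (cong (λ z → Π₂ (λ _ → wi) over₁ u₁ ⊗ z ⊗ sum₁) (pow-Π₂ ik over₁ u₁ lu₁))
          (trans (cong (_⊗ sum₁) (sym (Π₂-* (λ _ → wi) (λ _ _ → ik) over₁ u₁)))
              (trans (sym (Π₂-* (λ _ t → wi t ⊗ ik) _ over₁ u₁))
            (Π₂-cong (All.map (λ (x , y) → over₁-term x y) over₁-range) u₁)))
        part₂ : Π₂ (λ _ → wi) over₂ u₂ ⊗ pow ij n₂ ⊗ sum₂ ≡ Π₂ (φ p q) over₂ u₂
        part₂ = trans (cong (λ z → Π₂ (λ _ → wi) over₂ u₂ ⊗ z ⊗ sum₂) (pow-Π₂ ij over₂ u₂ lu₂))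
          (trans (cong (_⊗ sum₂) (sym (Π₂-* (λ _ → wi) (λ _ _ → ij) over₂ u₂)))
              (trans (sym (Π₂-* (λ _ t → wi t ⊗ ij) _ over₂ u₂))
            (Π₂-cong (All.map (λ (x , y) → over₂-term x y) over₂-range) u₂)))
        part₀ : pow ii n₀ ⊗ sum₀ ≡ ∏L around-r (λ e → X (proj₁ e) (proj₂ e))
        part₀ = trans (cong (_⊗ sum₀) (sym (∏L-const around-r ii))) (trans (sym (∏L-* around-r _ _))
          (∏L-cong (All.map (λ ((x , y) , (z , w)) → around-term x y z w) around-range)))

-- Summing over a tree of triangles

-- Here u, v, w count the arcs cutting the corners i-j, j-k, k-i, and ei, ej, ek those that enter
-- through one side and end at the opposite vertex. Such arcs at two different vertices would cross,
-- and one ending at a vertex would cross the arcs cutting it off. Hence at most one of ei, ej, ek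
-- is nonzero, and the corner opposite to that side is then empty.
Exclusive : (u v w ei ej ek : ℕ) → Set
Exclusive u v w ei ej ek = (ej ≡ 0 × ek ≡ 0 × (ei ≡ 0 ⊎ v ≡ 0))
    ⊎ ((ei ≡ 0 × ek ≡ 0 × w ≡ 0) ⊎ (ei ≡ 0 × ej ≡ 0 × u ≡ 0))

Exclusive-rotate : ∀ {u v w ei ej ek} → Exclusive u v w ei ej ek → Exclusive v w u ej ek ei
Exclusive-rotate (inj₁ (refl , refl , inj₁ refl)) = inj₁ (refl , refl , inj₁ refl)
Exclusive-rotate (inj₁ (refl , refl , inj₂ refl)) = inj₂ (inj₂ (refl , refl , refl))
Exclusive-rotate (inj₂ (inj₁ (refl , refl , refl))) = inj₁ (refl , refl , inj₂ refl)
Exclusive-rotate (inj₂ (inj₂ (refl , refl , refl))) = inj₂ (inj₁ (refl , refl , refl))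

-- σ recovers the number of arcs cutting the corner between the first two sides of a triangle.
σ-corner : ∀ u v w ei ej ek {x y z} → x ≡ u ℕ.+ w ℕ.+ ei → y ≡ u ℕ.+ v ℕ.+ ej → z ≡ v ℕ.+ w ℕ.+ ek
    → Exclusive u v w ei ej ek → σ x y z ≡ u
σ-corner u v w ei ej ek refl refl refl ex = begin
  σ x y z                            ≡⟨ cong (λ h → ⌊ h ∸ (x ∸ (y ℕ.+ z)) ∸ (y ∸ (x ℕ.+ z)) /2⌋) refl ⟩
  ⌊ (x ℕ.+ y) ∸ z ∸ (x ∸ (y ℕ.+ z)) ∸ (y ∸ (x ℕ.+ z)) /2⌋ ≡⟨ cong ⌊_/2⌋ (twice ex) ⟩
  ⌊ u ℕ.+ u /2⌋                      ≡⟨ ℕP.n≡⌊n+n/2⌋ u ⟨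
  u                                  ∎
  where
  open ≡-Reasoning
  x = u ℕ.+ w ℕ.+ ei
  y = u ℕ.+ v ℕ.+ ej
  z = v ℕ.+ w ℕ.+ ek
  minus : ∀ a b c → a ≡ c ℕ.+ b → a ∸ b ≡ c
  minus a b c refl = ℕP.m+n∸n≡m c b
  below : ∀ a b c → b ≡ c ℕ.+ a → a ∸ b ≡ 0
  below a b c refl = ℕP.m≤n⇒m∸n≡0 (ℕP.m≤n+m a c)
  assemble : ∀ a b c d k l m → (a ∸ b ≡ k ℕ.+ l ℕ.+ m) → c ≡ l → d ≡ m → a ∸ b ∸ c ∸ d ≡ k
  assemble a b c d k l m e refl refl rewrite e = trans (ℕP.∸-+-assoc (k ℕ.+ l ℕ.+ m) l m)
    (trans (cong (_∸ (l ℕ.+ m)) (ℕP.+-assoc k l m)) (ℕP.m+n∸n≡m k (l ℕ.+ m)))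
  twice : Exclusive u v w ei ej ek → (x ℕ.+ y) ∸ z ∸ (x ∸ (y ℕ.+ z)) ∸ (y ∸ (x ℕ.+ z)) ≡ u ℕ.+ u
  twice (inj₁ (refl , refl , inj₁ refl)) = assemble (x ℕ.+ y) z (x ∸ (y ℕ.+ z)) (y ∸ (x ℕ.+ z)) (u ℕ.+ u) 0 0
    (minus (x ℕ.+ y) z _ (solveℕ 3 (λ u v w → (u :+ℕ w :+ℕ conℕ 0) :+ℕ (u :+ℕ v :+ℕ conℕ 0) :=ℕ
        (u :+ℕ u :+ℕ conℕ 0 :+ℕ conℕ 0) :+ℕ (v :+ℕ w :+ℕ conℕ 0)) refl u v w))
    (below x (y ℕ.+ z) (v ℕ.+ v) (solveℕ 3 (λ u v w → (u :+ℕ v :+ℕ conℕ 0) :+ℕ (v :+ℕ w :+ℕ conℕ 0) :=ℕ (v :+ℕ v) :+ℕ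
        (u :+ℕ w :+ℕ conℕ 0)) refl u v w))
    (below y (x ℕ.+ z) (w ℕ.+ w) (solveℕ 3 (λ u v w → (u :+ℕ w :+ℕ conℕ 0) :+ℕ (v :+ℕ w :+ℕ conℕ 0) :=ℕ (w :+ℕ w) :+ℕ
        (u :+ℕ v :+ℕ conℕ 0)) refl u v w))
  twice (inj₁ (refl , refl , inj₂ refl)) = assemble (x ℕ.+ y) z (x ∸ (y ℕ.+ z)) (y ∸ (x ℕ.+ z)) (u ℕ.+ u) ei 0
    (minus (x ℕ.+ y) z _ (solveℕ 3 (λ u w e → (u :+ℕ w :+ℕ e) :+ℕ (u :+ℕ conℕ 0 :+ℕ conℕ 0) :=ℕ
        (u :+ℕ u :+ℕ e :+ℕ conℕ 0) :+ℕ (w :+ℕ conℕ 0)) refl u w ei))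
    (minus x (y ℕ.+ z) ei (solveℕ 3 (λ u w e → (u :+ℕ w :+ℕ e) :=ℕ e :+ℕ
        ((u :+ℕ conℕ 0 :+ℕ conℕ 0) :+ℕ (w :+ℕ conℕ 0))) refl u w ei))
    (below y (x ℕ.+ z) (w ℕ.+ w ℕ.+ ei) (solveℕ 3 (λ u w e
        → (u :+ℕ w :+ℕ e) :+ℕ (w :+ℕ conℕ 0) :=ℕ (w :+ℕ w :+ℕ e) :+ℕ (u :+ℕ conℕ 0 :+ℕ conℕ 0)) refl u w ei))
  twice (inj₂ (inj₁ (refl , refl , refl))) = assemble (x ℕ.+ y) z (x ∸ (y ℕ.+ z)) (y ∸ (x ℕ.+ z)) (u ℕ.+ u) 0 ej
    (minus (x ℕ.+ y) z _ (solveℕ 3 (λ u v e → (u :+ℕ conℕ 0 :+ℕ conℕ 0) :+ℕ (u :+ℕ v :+ℕ e) :=ℕ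
        (u :+ℕ u :+ℕ conℕ 0 :+ℕ e) :+ℕ (v :+ℕ conℕ 0 :+ℕ conℕ 0)) refl u v ej))
    (below x (y ℕ.+ z) (v ℕ.+ v ℕ.+ ej) (solveℕ 3 (λ u v e
        → (u :+ℕ v :+ℕ e) :+ℕ (v :+ℕ conℕ 0 :+ℕ conℕ 0) :=ℕ (v :+ℕ v :+ℕ e) :+ℕ (u :+ℕ conℕ 0 :+ℕ conℕ 0)) refl u v
        ej))
    (minus y (x ℕ.+ z) ej (solveℕ 3 (λ u v e → (u :+ℕ v :+ℕ e) :=ℕ e :+ℕ
        ((u :+ℕ conℕ 0 :+ℕ conℕ 0) :+ℕ (v :+ℕ conℕ 0 :+ℕ conℕ 0))) refl u v ej))
  twice (inj₂ (inj₂ (refl , refl , refl))) = assemble (x ℕ.+ y) z (x ∸ (y ℕ.+ z)) (y ∸ (x ℕ.+ z)) 0 0 0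
    (below (x ℕ.+ y) z ek (solveℕ 3 (λ v w e → v :+ℕ w :+ℕ e :=ℕ e :+ℕ ((w :+ℕ conℕ 0) :+ℕ (v :+ℕ conℕ 0))) refl v w
        ek))
    (below x (y ℕ.+ z) (v ℕ.+ v ℕ.+ ek) (solveℕ 3 (λ v w e
        → (v :+ℕ conℕ 0) :+ℕ (v :+ℕ w :+ℕ e) :=ℕ (v :+ℕ v :+ℕ e) :+ℕ (w :+ℕ conℕ 0)) refl v w ek))
    (below y (x ℕ.+ z) (w ℕ.+ w ℕ.+ ek) (solveℕ 3 (λ v w e
        → (w :+ℕ conℕ 0) :+ℕ (v :+ℕ w :+ℕ e) :=ℕ (w :+ℕ w :+ℕ e) :+ℕ (v :+ℕ conℕ 0)) refl v w ek))

count : {A : Set} {P : A → Set} → (∀ x → Dec (P x)) → List A → ℕ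
count P? [] = 0
count P? (x ∷ xs) = ⟦ P? x ⟧ ℕ.+ count P? xs

module _ {A : Set} {P : A → Set} (P? : ∀ x → Dec (P x)) where

  count-++ : ∀ xs ys → count P? (xs ++ ys) ≡ count P? xs ℕ.+ count P? ys
  count-++ [] ys = refl
  count-++ (x ∷ xs) ys = trans (cong (⟦ P? x ⟧ ℕ.+_) (count-++ xs ys)) (sym (ℕP.+-assoc ⟦ P? x ⟧ _ _))

  count-none : ∀ xs → (∀ {x} → x ∈ xs → ¬ P x) → count P? xs ≡ 0
  count-none [] h = refl
  count-none (x ∷ xs) h = cong₂ ℕ._+_ (⟦⟧-no (P? x) (h (here refl))) (count-none xs (h ∘ there))

  count-all : ∀ xs → (∀ {x} → x ∈ xs → P x) → count P? xs ≡ length xs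
  count-all [] h = refl
  count-all (x ∷ xs) h = cong₂ ℕ._+_ (⟦⟧-yes (P? x) (h (here refl))) (count-all xs (h ∘ there))

  count-reverse : ∀ xs → count P? (reverse xs) ≡ count P? xs
  count-reverse [] = refl
  count-reverse (x ∷ xs) = trans (cong (count P?) (ListP.unfold-reverse x xs)) (trans (count-++ (reverse xs) (x ∷ []))
    (trans (ℕP.+-comm (count P? (reverse xs)) _) (cong₂ ℕ._+_ (ℕP.+-identityʳ ⟦ P? x ⟧) (count-reverse xs))))

  count-filter : ∀ {Q : A → Set} (Q? : ∀ x → Dec (Q x)) xs → count P? xs
      ≡ count P? (filter Q? xs) ℕ.+ count P? (filter (¬? ∘ Q?) xs)
  count-filter Q? [] = refl
  count-filter Q? (x ∷ xs) with Q? x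
  ... | yes _ = trans (cong (⟦ P? x ⟧ ℕ.+_) (count-filter Q? xs)) (sym (ℕP.+-assoc ⟦ P? x ⟧ _ _))
  ... | no _ = trans (cong (⟦ P? x ⟧ ℕ.+_) (count-filter Q? xs)) (trans (sym (ℕP.+-assoc ⟦ P? x ⟧ _ _))
    (trans (cong (ℕ._+ count P? (filter (¬? ∘ Q?) xs)) (ℕP.+-comm ⟦ P? x ⟧ (count P? (filter Q? xs))))
        (ℕP.+-assoc (count P? (filter Q? xs)) _ _)))

count-map : ∀ {A B : Set} {P : A → Set} {Q : B → Set} (P? : ∀ x → Dec (P x)) (Q? : ∀ y → Dec (Q y)) (f : A → B) xs →
  (∀ {x} → x ∈ xs → P x → Q (f x)) → (∀ {x} → x ∈ xs → Q (f x) → P x) → count P? xs ≡ count Q? (map f xs)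
count-map P? Q? f [] h k = refl
count-map P? Q? f (x ∷ xs) h k = cong₂ ℕ._+_ (equal (P? x) (Q? (f x)) (h (here refl)) (k (here refl)))
    (count-map P? Q? f xs (h ∘ there) (k ∘ there))
  where
  equal : ∀ {P Q : Set} (p : Dec P) (q : Dec Q) → (P → Q) → (Q → P) → ⟦ p ⟧ ≡ ⟦ q ⟧
  equal (yes p) q f g = sym (⟦⟧-yes q (f p))
  equal (no ¬p) q f g = sym (⟦⟧-no q (¬p ∘ g))

∏L-filter : ∀ {A : Set} {Q : A → Set} (Q? : ∀ x → Dec (Q x)) xs f → ∏L xs f ≡ ∏L (filter Q? xs) f
    ⊗ ∏L (filter (¬? ∘ Q?) xs) f
∏L-filter Q? [] f = sym (*-identityˡ _)
∏L-filter Q? (x ∷ xs) f with Q? x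
... | yes _ = trans (cong (f x ⊗_) (∏L-filter Q? xs f)) (sym (*-assoc (f x) _ _))
... | no _ = trans (cong (f x ⊗_) (∏L-filter Q? xs f))
    (solve 3 (λ a b c → a :* (b :* c) := b :* (a :* c)) refl (f x) (∏L (filter Q? xs) f) (∏L (filter (¬? ∘ Q?) xs) f))

∏L-map : ∀ {A B : Set} (g : A → B) xs f → ∏L (map g xs) f ≡ ∏L xs (f ∘ g)
∏L-map g [] f = refl
∏L-map g (x ∷ xs) f = cong (f (g x) ⊗_) (∏L-map g xs f)

∏L-reverse : ∀ {A : Set} (xs : List A) f → ∏L (reverse xs) f ≡ ∏L xs f
∏L-reverse [] f = refl
∏L-reverse (x ∷ xs) f = trans (cong (λ ys → ∏L ys f) (ListP.unfold-reverse x xs))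
    (trans (∏L-++ (reverse xs) (x ∷ []) f)
  (trans (*-comm _ _) (cong₂ _⊗_ (*-identityʳ _) (∏L-reverse xs f))))

∏L-cong∈ : ∀ {A : Set} {f g : A → K} xs → (∀ {x} → x ∈ xs → f x ≡ g x) → ∏L xs f ≡ ∏L xs g
∏L-cong∈ xs h = ∏L-cong (All.tabulate h)

AllPairs-reverse : ∀ {A : Set} {R : A → A → Set} {xs} → AllPairs R xs → AllPairs (λ x y → R y x) (reverse xs)
AllPairs-reverse [] = []
AllPairs-reverse {R = R} {x ∷ xs} (h ∷ hs) = subst (AllPairs _) (sym (ListP.unfold-reverse x xs))
  (AllPairsP.++⁺ (AllPairs-reverse hs) ([] ∷ []) (All.tabulate λ m → All.lookup h (AnyP.reverse⁻ m) ∷ []))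

AllPairs-suffix : ∀ {A : Set} {R : A → A → Set} xs {ys} → AllPairs R (xs ++ ys) → AllPairs R ys
AllPairs-suffix [] h = h
AllPairs-suffix (x ∷ xs) (_ ∷ h) = AllPairs-suffix xs h

split-rays : ∀ r bs → AllPairs _≥_ bs → ∃ λ B₁ → ∃ λ Bₘ → ∃ λ B₂ → bs ≡ B₁ ++ (Bₘ ++ B₂) ×
  (∀ {b} → b ∈ B₁ → r < b) × (∀ {b} → b ∈ Bₘ → b ≡ r) × (∀ {b} → b ∈ B₂ → b < r)
split-rays r [] _ = [] , [] , [] , refl , (λ ()) , (λ ()) , (λ ())
split-rays r (b ∷ bs) (h ∷ hs) with ℕP.<-cmp r b | split-rays r bs hs
... | tri< r<b _ _ | B₁ , Bₘ , B₂ , refl , h₁ , hₘ , h₂ = b ∷ B₁ , Bₘ , B₂ , refl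
    , (λ { (here refl) → r<b ; (there m) → h₁ m }) , hₘ , h₂
... | tri≈ _ refl _ | [] , Bₘ , B₂ , refl , h₁ , hₘ , h₂ = [] , b ∷ Bₘ , B₂ , refl , (λ ())
    , (λ { (here refl) → refl ; (there m) → hₘ m }) , h₂
... | tri≈ _ refl _ | c ∷ B₁ , Bₘ , B₂ , refl , h₁ , hₘ
    , h₂ = contradiction (h₁ (here refl)) (ℕP.≤⇒≯ (All.lookup h (here refl)))
... | tri> _ _ b<r | [] , [] , B₂ , refl , h₁ , hₘ , h₂ = [] , [] , b ∷ B₂ , refl , (λ ()) , (λ ())
    , (λ { (here refl) → b<r ; (there m) → h₂ m })
... | tri> _ _ b<r | [] , c ∷ Bₘ , B₂ , refl , h₁ , hₘ
    , h₂ = contradiction (subst (_≤ b) (hₘ (here refl)) (All.lookup h (here refl))) (ℕP.<⇒≱ b<r)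
... | tri> _ _ b<r | c ∷ B₁ , Bₘ , B₂ , refl , h₁ , hₘ
    , h₂ = contradiction (ℕP.<-trans b<r (h₁ (here refl))) (ℕP.≤⇒≯ (All.lookup h (here refl)))

Nested : Diag → Diag → Set
Nested e f = proj₁ e ≤ proj₁ f × proj₂ f ≤ proj₂ e

size : Diag → ℕ
size e = proj₂ e ∸ proj₁ e

-- Arcs around r, from the outermost inwards: those ending at p or q come first, and p and q do not both occur.
split-around : ∀ p q S → AllPairs Nested S → (∀ {e} → e ∈ S → p ≤ proj₁ e × proj₂ e ≤ q × e ≢ (p , q)) →
  ∃ λ PQ → ∃ λ S₀ → S ≡ PQ ++ S₀ × ((∀ {e} → e ∈ PQ → proj₁ e ≡ p × proj₂ e < q)
      ⊎ (∀ {e} → e ∈ PQ → proj₂ e ≡ q × p < proj₁ e)) ×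
    (∀ {e} → e ∈ S₀ → p < proj₁ e × proj₂ e < q)
split-around p q [] _ h = [] , [] , refl , inj₁ (λ ()) , (λ ())
split-around p q ((u , v) ∷ S) (n ∷ ns) h with h (here refl)
... | p≤u , v≤q , ≢pq with ℕP.m≤n⇒m<n∨m≡n p≤u | ℕP.m≤n⇒m<n∨m≡n v≤q
... | inj₂ refl | inj₂ refl = contradiction refl ≢pq
... | inj₁ p<u | inj₁ v<q = [] , (u , v) ∷ S , refl , inj₁ (λ ())
    , λ { (here refl) → p<u , v<q ; (there m) → ℕP.<-≤-trans p<u (proj₁ (All.lookup n m))
    , ℕP.≤-<-trans (proj₂ (All.lookup n m)) v<q }
... | inj₂ refl | inj₁ v<q with split-around p q S ns (h ∘ there)
...   | PQ , S₀ , refl , c , h₀ = (p , v) ∷ PQ , S₀ , refl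
    , inj₁ (λ { (here refl) → refl , v<q ; (there m) → first c m }) , h₀
  where
  first : _ → ∀ {e} → e ∈ PQ → proj₁ e ≡ p × proj₂ e < q
  first (inj₁ k) m = k m
  first (inj₂ k) m = contradiction (proj₁ (k m)) (ℕP.<⇒≢ (ℕP.≤-<-trans (proj₂ (All.lookup n (∈-++⁺ˡ m))) v<q))
split-around p q ((u , v) ∷ S) (n ∷ ns) h | p≤u , v≤q , ≢pq | inj₁ p<u | inj₂ refl with split-around p q S ns
    (h ∘ there)
... | PQ , S₀ , refl , c , h₀ = (u , q) ∷ PQ , S₀ , refl
    , inj₂ (λ { (here refl) → refl , p<u ; (there m) → second c m }) , h₀
  where
  second : _ → ∀ {e} → e ∈ PQ → proj₂ e ≡ q × p < proj₁ e
  second (inj₁ k) m = contradiction (sym (proj₁ (k m))) (ℕP.<⇒≢ (ℕP.<-≤-trans p<u (proj₁ (All.lookup n (∈-++⁺ˡ m)))))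
  second (inj₂ k) m = k m

within? : ∀ (d : Diag) b → Dec (proj₁ d < b × b < proj₂ d)
within? d b = (proj₁ d <? b) ×-dec (b <? proj₂ d)

Crossing : Diag → Diag → Set
Crossing e f = proj₁ e < proj₁ f × proj₁ f < proj₂ e × proj₂ e < proj₂ f

crossing? : ∀ d e → Dec (Crossing e d ⊎ Crossing d e)
crossing? d e = cr e d ⊎-dec cr d e
  where
  cr : ∀ e f → Dec (Crossing e f)
  cr e f = (proj₁ e <? proj₁ f) ×-dec ((proj₁ f <? proj₂ e) ×-dec (proj₂ e <? proj₂ f))

-- A triangulation of the polygon p, …, q with all triangles internal, apart from ears.
data Inner {n} (D : Fin n → Diag) : Fin n → ℕ → ℕ → Set where
  ear : ∀ {i p} → D i ≡ (p , suc (suc p)) → Inner D i p (suc (suc p))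
  glue : ∀ {i j k p r q} → D i ≡ (p , q) → p < r → r < q → Inner D j r q → Inner D k p r → Inner D i p q

inner-label : ∀ {n} {D : Fin n → Diag} {i p q} → Inner D i p q → D i ≡ (p , q)
inner-label (ear e) = e
inner-label (glue e _ _ _ _) = e

module Expansion {n : ℕ} (D : Fin n → Diag) (a : Fin n → ℕ) (X : ℕ → ℕ → K) (top : ℕ)
    (X-pos : ∀ {i p q} → D i ≡ (p , q) → Pos (X p q))
    (X-boundary : ∀ {p} → p < top → X p (suc p) ≡ 1K)
    (ptolemy : ∀ {a b c d} → a < b → b < c → c < d → d ≤ top → X a c ⊗ X b d ≡ X a b ⊗ X c d ⊕ X b c ⊗ X a d) where

  -- The sum over all sequences strictly below {p , q}, with s prescribed on {p , q}. The prefactors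
  -- of the Laurent formula are charged to the diagonals below, not to the root.
  V : ∀ {i p q} → Inner D i p q → List Bool → K
  V (ear _) s = 1K
  V (glue {i} {j} {k} {p} {r} {q} _ _ _ tj tk) s = sumL (a j) λ sj → sumL (a k) λ sk →
    triangle (X p q) (X r q) (X p r) (σ3 a i j k) (σ3 a j k i) (σ3 a k i j) s sj sk ⊗
      (pow (inv (X r q)) (a j) ⊗ V tj sj ⊗ (pow (inv (X p r)) (a k) ⊗ V tk sk))

  -- bs: ends inside [p , q] of the arcs crossing {p , q}; C: the other arcs inside [p , q].
  record Arcs (p q : ℕ) (bs : List ℕ) (C : List Diag) : Set where
    field
      sorted : AllPairs _≥_ bs
      range : ∀ {b} → b ∈ bs → p < b × b < q
      within : ∀ {e} → e ∈ C → p ≤ proj₁ e × suc (proj₁ e) < proj₂ e × proj₂ e ≤ q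
      by-size : AllPairs (λ e f → size f ≤ size e) C
      uncrossed : ∀ {e f} → e ∈ C → f ∈ C → ¬ Crossing e f
      rays : ∀ {b e} → b ∈ bs → e ∈ C → ¬ (proj₁ e < b × b < proj₂ e)
      new : ∀ {e} → e ∈ C → ∀ l → e ≢ D l
      counts : ∀ l → p ≤ proj₁ (D l) → proj₂ (D l) ≤ q → a l ≡ count (within? (D l)) bs ℕ.+ count (crossing? (D l)) C

  rays-count : ∀ {i p q bs C} → D i ≡ (p , q) → Arcs p q bs C → a i ≡ length bs
  rays-count {i} {p} {q} {bs} {C} e A = trans (counts i (ℕP.≤-reflexive (sym (cong proj₁ e)))
      (ℕP.≤-reflexive (cong proj₂ e)))
      (trans (cong₂ ℕ._+_ (count-all (within? (D i)) bs λ {b} m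
          → subst (λ d → proj₁ d < b × b < proj₂ d) (sym e) (range m))
        (count-none (crossing? (D i)) C λ {f} m c → no-crossing f m (subst (λ d → Crossing f d ⊎ Crossing d f) e c)))
            (ℕP.+-identityʳ _))
    where
    open Arcs A
    no-crossing : ∀ f → f ∈ C → ¬ (Crossing f (p , q) ⊎ Crossing (p , q) f)
    no-crossing f m (inj₁ (x , _)) = ℕP.<⇒≱ x (proj₁ (within m))
    no-crossing f m (inj₂ (_ , _ , x)) = ℕP.<⇒≱ x (proj₂ (proj₂ (within m)))

  module Step {p r q bs C} (p<r : p < r) (r<q : r < q) (A : Arcs p q bs C) where
    open Arcs A
    private
      left? : ∀ (e : Diag) → Dec (proj₂ e ≤ r)
      left? e = proj₂ e ≤? r
      right? : ∀ (e : Diag) → Dec (r ≤ proj₁ e)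
      right? e = r ≤? proj₁ e

    C₁ C₂ C′ S : List Diag
    C₁ = filter left? C
    C′ = filter (¬? ∘ left?) C
    C₂ = filter right? C′
    S = filter (¬? ∘ right?) C′

    C₁-∈ : ∀ {e} → e ∈ C₁ → e ∈ C × proj₂ e ≤ r
    C₁-∈ = ∈-filter⁻ left?

    C₂-∈ : ∀ {e} → e ∈ C₂ → e ∈ C × r ≤ proj₁ e
    C₂-∈ m with ∈-filter⁻ right? {xs = C′} m
    ... | m′ , x = proj₁ (∈-filter⁻ (¬? ∘ left?) m′) , x

    S-∈ : ∀ {e} → e ∈ S → e ∈ C × proj₁ e < r × r < proj₂ e
    S-∈ m with ∈-filter⁻ (¬? ∘ right?) {xs = C′} m
    ... | m′ , x with ∈-filter⁻ (¬? ∘ left?) m′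
    ... | m″ , y = m″ , ℕP.≰⇒> x , ℕP.≰⇒> y

    -- Non-crossing arcs over a common vertex are nested, the larger around the smaller. Sorting by
    -- size once therefore orders the arcs over every r met in the recursion, since filtering
    -- preserves the order.
    S-nested : AllPairs Nested S
    S-nested = nested S (λ m → m) (AllPairsP.filter⁺ (¬? ∘ right?) (AllPairsP.filter⁺ (¬? ∘ left?) by-size))
      where
      nest : ∀ {e f} → e ∈ S → f ∈ S → size f ≤ size e → Nested e f
      nest {e} {f} me mf h with S-∈ me | S-∈ mf | ℕP.<-cmp (proj₁ e) (proj₁ f)
      ... | me′ , e<r , r<e | mf′ , f<r , r<f | tri< x _ _ = ℕP.<⇒≤ x , ℕP.≮⇒≥ λ y
          → uncrossed me′ mf′ (x , ℕP.<-trans f<r r<e , y)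
      ... | me′ , e<r , r<e | mf′ , f<r , r<f | tri≈ _ x _ = ℕP.≤-reflexive x ,
        ℕP.≮⇒≥ λ y → ℕP.<⇒≱ (ℕP.∸-monoˡ-< y (ℕP.<⇒≤ (ℕP.<-trans e<r r<e)))
            (subst (λ z → proj₂ f ∸ z ≤ size e) (sym x) h)
      ... | me′ , e<r , r<e | mf′ , f<r , r<f | tri> _ _ x = contradiction h (ℕP.<⇒≱ (ℕP.≤-<-trans
        (ℕP.∸-monoˡ-≤ (proj₁ e) (ℕP.≮⇒≥ λ y → uncrossed mf′ me′ (x , ℕP.<-trans e<r r<f , y)))
        (ℕP.∸-monoʳ-< x (ℕP.<⇒≤ (ℕP.<-trans e<r r<f)))))
      nested : ∀ xs → (∀ {e} → e ∈ xs → e ∈ S) → AllPairs (λ e f → size f ≤ size e) xs → AllPairs Nested xs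
      nested [] _ _ = []
      nested (x ∷ xs) sub (h ∷ hs) = All.tabulate (λ m → nest (sub (here refl)) (sub (there m)) (All.lookup h m))
          ∷ nested xs (sub ∘ there) hs

    ∏-C : ∀ f → ∏L C f ≡ ∏L C₁ f ⊗ (∏L C₂ f ⊗ ∏L S f)
    ∏-C f = trans (∏L-filter left? C f) (cong (∏L C₁ f ⊗_) (∏L-filter right? C′ f))

    count-C : ∀ {P : Diag → Set} (P? : ∀ e → Dec (P e)) → count P? C ≡ count P? C₁ ℕ.+ (count P? C₂ ℕ.+ count P? S)
    count-C P? = trans (count-filter P? left? C) (cong (count P? C₁ ℕ.+_) (count-filter P? right? C′))

    around-range : ∀ {e} → e ∈ S → p ≤ proj₁ e × proj₂ e ≤ q
    around-range m = proj₁ (within (proj₁ (S-∈ m))) , proj₂ (proj₂ (within (proj₁ (S-∈ m))))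

    -- Sj and Sk are the arcs over r that cross {r , q} and {p , r}. They are parameters because an
    -- arc from p crosses only the former side and an arc to q only the latter; `Sj-all` and
    -- `Sk-all` say that the omitted arcs do not affect the counts in the children.
    module Children {B₁ Bₘ B₂ Sj Sk} (bs≡ : bs ≡ B₁ ++ (Bₘ ++ B₂))
        (h₁ : ∀ {b} → b ∈ B₁ → r < b) (hₘ : ∀ {b} → b ∈ Bₘ → b ≡ r) (h₂ : ∀ {b} → b ∈ B₂ → b < r)
        (Sj-∈ : ∀ {e} → e ∈ Sj → e ∈ S × proj₂ e < q) (Sk-∈ : ∀ {e} → e ∈ Sk → e ∈ S × p < proj₁ e)
        (Sj-nested : AllPairs Nested Sj) (Sk-nested : AllPairs Nested Sk)
        (Sj-all : ∀ {P : Diag → Set} (P? : ∀ e → Dec (P e)) → (∀ {e} → P e → proj₂ e < q) → count P? S ≡ count P? Sj)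
        (Sk-all : ∀ {P : Diag → Set} (P? : ∀ e → Dec (P e)) → (∀ {e} → P e → p < proj₁ e) → count P? S ≡ count P? Sk)
            where

      B₁-∈ : ∀ {b} → b ∈ B₁ → b ∈ bs
      B₁-∈ m = subst (_ ∈_) (sym bs≡) (∈-++⁺ˡ m)
      B₂-∈ : ∀ {b} → b ∈ B₂ → b ∈ bs
      B₂-∈ m = subst (_ ∈_) (sym bs≡) (∈-++⁺ʳ B₁ (∈-++⁺ʳ Bₘ m))

      sorted′ : AllPairs _≥_ (B₁ ++ (Bₘ ++ B₂))
      sorted′ = subst (AllPairs _≥_) bs≡ sorted

      prefix : ∀ {A : Set} {R : A → A → Set} xs {ys} → AllPairs R (xs ++ ys) → AllPairs R xs
      prefix [] _ = []
      prefix (x ∷ xs) (h ∷ hs) = AllP.++⁻ˡ xs h ∷ prefix xs hs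

      count-bs : ∀ {P : ℕ → Set} (P? : ∀ b → Dec (P b)) → count P? bs ≡ count P? B₁ ℕ.+ (count P? Bₘ ℕ.+ count P? B₂)
      count-bs P? = trans (cong (count P?) bs≡) (trans (count-++ P? B₁ _)
          (cong (count P? B₁ ℕ.+_) (count-++ P? Bₘ B₂)))

      rays-j rays-k : List ℕ
      rays-j = B₁ ++ map proj₂ Sj
      rays-k = reverse (map proj₁ Sk) ++ B₂

      rays-k-∈ : ∀ {b} → b ∈ rays-k → (∃ λ e → e ∈ Sk × b ≡ proj₁ e) ⊎ b ∈ B₂
      rays-k-∈ m with ∈-++⁻ (reverse (map proj₁ Sk)) m
      ... | inj₁ x = inj₁ (∈-map⁻ proj₁ (AnyP.reverse⁻ x))
      ... | inj₂ y = inj₂ y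

      rays-j-∈ : ∀ {b} → b ∈ rays-j → b ∈ B₁ ⊎ (∃ λ e → e ∈ Sj × b ≡ proj₂ e)
      rays-j-∈ m = Sum.map₂ (∈-map⁻ proj₂) (∈-++⁻ B₁ m)

      arcs-j : Arcs r q rays-j C₂
      arcs-j = record
        { sorted = AllPairsP.++⁺ (prefix B₁ sorted′) (AllPairsP.map⁺ (AllPairs.map proj₂ Sj-nested))
            (All.tabulate λ {b} mb → All.tabulate λ mc → beyond mb (∈-map⁻ proj₂ mc))
        ; range = λ m → in-range (rays-j-∈ m)
        ; within = λ m → proj₂ (C₂-∈ m) , proj₂ (within (proj₁ (C₂-∈ m)))
        ; by-size = AllPairsP.filter⁺ right? (AllPairsP.filter⁺ (¬? ∘ left?) by-size)
        ; uncrossed = λ me mf → uncrossed (proj₁ (C₂-∈ me)) (proj₁ (C₂-∈ mf))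
        ; rays = λ mb me → no-ray (rays-j-∈ mb) me
        ; new = λ m → new (proj₁ (C₂-∈ m))
        ; counts = counts-j
        }
        where
        beyond : ∀ {b c} → b ∈ B₁ → (∃ λ e → e ∈ Sj × c ≡ proj₂ e) → b ≥ c
        beyond mb (e , me , refl) with S-∈ (proj₁ (Sj-∈ me))
        ... | mC , e<r , _ = ℕP.≮⇒≥ λ x → rays (B₁-∈ mb) mC (ℕP.<-trans e<r (h₁ mb) , x)
        in-range : ∀ {b} → b ∈ B₁ ⊎ (∃ λ e → e ∈ Sj × b ≡ proj₂ e) → r < b × b < q
        in-range (inj₁ m) = h₁ m , proj₂ (range (B₁-∈ m))
        in-range (inj₂ (e , m , refl)) = proj₂ (proj₂ (S-∈ (proj₁ (Sj-∈ m)))) , proj₂ (Sj-∈ m)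
        no-ray : ∀ {b e} → b ∈ B₁ ⊎ (∃ λ e → e ∈ Sj × b ≡ proj₂ e) → e ∈ C₂ → ¬ (proj₁ e < b × b < proj₂ e)
        no-ray (inj₁ m) me = rays (B₁-∈ m) (proj₁ (C₂-∈ me))
        no-ray (inj₂ (f , m , refl)) me (x , y) with S-∈ (proj₁ (Sj-∈ m)) | C₂-∈ me
        ... | mf , f<r , _ | me′ , r≤e = uncrossed mf me′ (ℕP.<-≤-trans f<r r≤e , x , y)
        counts-j : ∀ l → r ≤ proj₁ (D l) → proj₂ (D l) ≤ q → a l
            ≡ count (within? (D l)) rays-j ℕ.+ count (crossing? (D l)) C₂
        counts-j l r≤u v≤q = begin
          a l ≡⟨ counts l (ℕP.≤-trans (ℕP.<⇒≤ p<r) r≤u) v≤q ⟩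
          count w? bs ℕ.+ count c? C ≡⟨ cong₂ ℕ._+_ (count-bs w?) (count-C c?) ⟩
          count w? B₁ ℕ.+ (count w? Bₘ ℕ.+ count w? B₂) ℕ.+ (count c? C₁ ℕ.+ (count c? C₂ ℕ.+ count c? S))
            ≡⟨ cong₂ (λ y z → count w? B₁ ℕ.+ y ℕ.+ z)
                 (cong₂ ℕ._+_ (count-none w? Bₘ λ m (x , _) → ℕP.<⇒≱ x (subst (_≤ proj₁ (D l)) (sym (hₘ m)) r≤u))
                              (count-none w? B₂ λ m (x , _) → ℕP.<⇒≱ x (ℕP.<⇒≤ (ℕP.<-≤-trans (h₂ m) r≤u))))
                 (cong₂ ℕ._+_ (count-none c? C₁ outside) (cong (count c? C₂ ℕ.+_) around)) ⟩
          count w? B₁ ℕ.+ 0 ℕ.+ (count c? C₂ ℕ.+ count w? (map proj₂ Sj))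
            ≡⟨ cong₂ ℕ._+_ (ℕP.+-identityʳ (count w? B₁)) (ℕP.+-comm (count c? C₂) _) ⟩
          count w? B₁ ℕ.+ (count w? (map proj₂ Sj) ℕ.+ count c? C₂) ≡⟨ ℕP.+-assoc (count w? B₁) _ _ ⟨
          count w? B₁ ℕ.+ count w? (map proj₂ Sj) ℕ.+ count c? C₂
              ≡⟨ cong (ℕ._+ count c? C₂) (count-++ w? B₁ (map proj₂ Sj)) ⟨
          count w? rays-j ℕ.+ count c? C₂ ∎
          where
          open ≡-Reasoning
          w? = within? (D l)
          c? = crossing? (D l)
          outside : ∀ {e} → e ∈ C₁ → ¬ (Crossing e (D l) ⊎ Crossing (D l) e)
          outside m (inj₁ (_ , x , _)) = ℕP.<⇒≱ x (ℕP.≤-trans (proj₂ (C₁-∈ m)) r≤u)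
          outside m (inj₂ (x , y , z)) = ℕP.<⇒≱ (ℕP.<-trans x (ℕP.<-trans y z)) (ℕP.≤-trans (proj₂ (C₁-∈ m)) r≤u)
          cr? : ∀ e → Dec (proj₁ (D l) < proj₂ e × proj₂ e < proj₂ (D l))
          cr? e = w? (proj₂ e)
          -- An arc over r starts before D l, so it crosses D l exactly when its other end lies
          -- strictly within D l: crossing arcs turn into rays of the child.
          around : count c? S ≡ count w? (map proj₂ Sj)
          around = trans (trans (count-map c? cr? (λ e → e) S
              (λ { m (inj₁ (_ , x , y)) → x , y ; m (inj₂ (x , _))
                  → contradiction (ℕP.≤-<-trans r≤u x) (ℕP.<⇒≯ (proj₁ (proj₂ (S-∈ m)))) })
              (λ m (x , y) → inj₁ (ℕP.<-≤-trans (proj₁ (proj₂ (S-∈ m))) r≤u , x , y)))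
              (cong (count cr?) (ListP.map-id S)))
            (trans (Sj-all cr? (λ (_ , y) → ℕP.<-≤-trans y v≤q)) (count-map cr? w? proj₂ Sj (λ _ x → x) (λ _ x → x)))

      arcs-k : Arcs p r rays-k C₁
      arcs-k = record
        { sorted = AllPairsP.++⁺ (AllPairs-reverse (AllPairsP.map⁺ (AllPairs.map proj₁ Sk-nested)))
            (AllPairs-suffix Bₘ (AllPairs-suffix B₁ sorted′))
            (All.tabulate λ mc → All.tabulate λ {b} mb → beyond (∈-map⁻ proj₁ (AnyP.reverse⁻ mc)) mb)
        ; range = λ m → in-range (rays-k-∈ m)
        ; within = λ m → proj₁ (within (proj₁ (C₁-∈ m))) , proj₁ (proj₂ (within (proj₁ (C₁-∈ m)))) , proj₂ (C₁-∈ m)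
        ; by-size = AllPairsP.filter⁺ left? by-size
        ; uncrossed = λ me mf → uncrossed (proj₁ (C₁-∈ me)) (proj₁ (C₁-∈ mf))
        ; rays = λ mb me → no-ray (rays-k-∈ mb) me
        ; new = λ m → new (proj₁ (C₁-∈ m))
        ; counts = counts-k
        }
        where
        beyond : ∀ {b c} → (∃ λ e → e ∈ Sk × c ≡ proj₁ e) → b ∈ B₂ → c ≥ b
        beyond (e , me , refl) mb with S-∈ (proj₁ (Sk-∈ me))
        ... | mC , _ , r<e = ℕP.≮⇒≥ λ x → rays (B₂-∈ mb) mC (x , ℕP.<-trans (h₂ mb) r<e)
        in-range : ∀ {b} → (∃ λ e → e ∈ Sk × b ≡ proj₁ e) ⊎ b ∈ B₂ → p < b × b < r
        in-range (inj₁ (e , m , refl)) = proj₂ (Sk-∈ m) , proj₁ (proj₂ (S-∈ (proj₁ (Sk-∈ m))))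
        in-range (inj₂ m) = proj₁ (range (B₂-∈ m)) , h₂ m
        no-ray : ∀ {b e} → (∃ λ e → e ∈ Sk × b ≡ proj₁ e) ⊎ b ∈ B₂ → e ∈ C₁ → ¬ (proj₁ e < b × b < proj₂ e)
        no-ray (inj₂ m) me = rays (B₂-∈ m) (proj₁ (C₁-∈ me))
        no-ray (inj₁ (f , m , refl)) me (x , y) with S-∈ (proj₁ (Sk-∈ m)) | C₁-∈ me
        ... | mf , _ , r<f | me′ , e≤r = uncrossed me′ mf (x , y , ℕP.≤-<-trans e≤r r<f)
        counts-k : ∀ l → p ≤ proj₁ (D l) → proj₂ (D l) ≤ r → a l
            ≡ count (within? (D l)) rays-k ℕ.+ count (crossing? (D l)) C₁
        counts-k l p≤u v≤r = begin
          a l ≡⟨ counts l p≤u (ℕP.≤-trans v≤r (ℕP.<⇒≤ r<q)) ⟩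
          count w? bs ℕ.+ count c? C ≡⟨ cong₂ ℕ._+_ (count-bs w?) (count-C c?) ⟩
          count w? B₁ ℕ.+ (count w? Bₘ ℕ.+ count w? B₂) ℕ.+ (count c? C₁ ℕ.+ (count c? C₂ ℕ.+ count c? S))
            ≡⟨ cong₂ ℕ._+_ (cong₂ (λ y z → y ℕ.+ (z ℕ.+ count w? B₂))
                 (count-none w? B₁ λ m (_ , x) → ℕP.<⇒≱ x (ℕP.<⇒≤ (ℕP.≤-<-trans v≤r (h₁ m))))
                 (count-none w? Bₘ λ m (_ , x) → ℕP.<⇒≱ x (subst (proj₂ (D l) ≤_) (sym (hₘ m)) v≤r)))
                 (cong (count c? C₁ ℕ.+_) (cong₂ ℕ._+_ (count-none c? C₂ outside) around)) ⟩
          count w? B₂ ℕ.+ (count c? C₁ ℕ.+ count w? (reverse (map proj₁ Sk)))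
            ≡⟨ trans (cong (count w? B₂ ℕ.+_) (ℕP.+-comm (count c? C₁) _)) (sym (ℕP.+-assoc (count w? B₂) _ _)) ⟩
          count w? B₂ ℕ.+ count w? (reverse (map proj₁ Sk)) ℕ.+ count c? C₁
            ≡⟨ cong (ℕ._+ count c? C₁) (trans (ℕP.+-comm (count w? B₂) _)
                (sym (count-++ w? (reverse (map proj₁ Sk)) B₂))) ⟩
          count w? rays-k ℕ.+ count c? C₁ ∎
          where
          open ≡-Reasoning
          w? = within? (D l)
          c? = crossing? (D l)
          outside : ∀ {e} → e ∈ C₂ → ¬ (Crossing e (D l) ⊎ Crossing (D l) e)
          outside m (inj₁ (x , y , z)) = ℕP.<⇒≱ (ℕP.<-trans x (ℕP.<-trans y z)) (ℕP.≤-trans v≤r (proj₂ (C₂-∈ m)))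
          outside m (inj₂ (_ , x , _)) = ℕP.<⇒≱ x (ℕP.≤-trans v≤r (proj₂ (C₂-∈ m)))
          cr? : ∀ e → Dec (proj₁ (D l) < proj₁ e × proj₁ e < proj₂ (D l))
          cr? e = w? (proj₁ e)
          around : count c? S ≡ count w? (reverse (map proj₁ Sk))
          around = trans (trans (count-map c? cr? (λ e → e) S
              (λ { m (inj₂ (x , y , _)) → x , y ; m (inj₁ (_ , _ , y))
                  → contradiction (ℕP.<-≤-trans y v≤r) (ℕP.<⇒≯ (proj₂ (proj₂ (S-∈ m)))) })
              (λ m (x , y) → inj₂ (x , y , ℕP.≤-<-trans v≤r (proj₂ (proj₂ (S-∈ m))))))
              (cong (count cr?) (ListP.map-id S)))
            (trans (Sk-all cr? (λ (x , _) → ℕP.≤-<-trans p≤u x))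
                (trans (count-map cr? w? proj₁ Sk (λ _ x → x) (λ _ x → x)) (sym (count-reverse w? (map proj₁ Sk)))))

  ray : ℕ → ℕ → ℕ → Bool → K
  ray p q b t = choose (X b q) (X p b) t

  arc : Diag → K
  arc e = X (proj₁ e) (proj₂ e)

  record Corners (p r q : ℕ) (bs : List ℕ) (C C₁ C₂ : List Diag) : Set where
    field
      over₁ at-r over₂ from-p to-q : List ℕ
      around : List Diag
      bs≡ : bs ≡ over₁ ++ (at-r ++ over₂)
      over₁-range : ∀ {b} → b ∈ over₁ → r < b × b < q
      at-r-range : ∀ {b} → b ∈ at-r → b ≡ r
      over₂-range : ∀ {b} → b ∈ over₂ → p < b × b < r
      from-p-range : ∀ {b} → b ∈ from-p → r < b × b < q
      to-q-range : ∀ {b} → b ∈ to-q → p < b × b < r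
      around-range : ∀ {e} → e ∈ around → (p < proj₁ e × proj₁ e < r) × (r < proj₂ e × proj₂ e < q)
      exclusive : Exclusive (length over₁) (length around) (length over₂) (length at-r) (length from-p) (length to-q)
      arcs-j : Arcs r q (over₁ ++ (from-p ++ map proj₂ around)) C₂
      arcs-k : Arcs p r (reverse (map proj₁ around) ++ (to-q ++ over₂)) C₁
      product : ∏L C arc ≡ ∏L from-p (X p) ⊗ (∏L to-q (λ c → X c q) ⊗ ∏L around arc) ⊗ (∏L C₂ arc ⊗ ∏L C₁ arc)

  -- Arcs over r that start at p would cross those that end at q, so only one of the lists `from-p`
  -- and `to-q` can be nonempty; this gives the two constructions below.
  corners : ∀ {p r q bs C} (p<r : p < r) (r<q : r < q) → (∃ λ i → D i ≡ (p , q)) → (A : Arcs p q bs C) →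
    Corners p r q bs C (Step.C₁ p<r r<q A) (Step.C₂ p<r r<q A)
  corners {p} {r} {q} {bs} {C} p<r r<q (i , label) A = build (split-rays r bs sorted)
      (split-around p q S S-nested proper)
    where
    open Arcs A
    open Step p<r r<q A
    -- An arc equal to {p , q} would be an initial diagonal, which `new` excludes.
    proper : ∀ {e} → e ∈ S → p ≤ proj₁ e × proj₂ e ≤ q × e ≢ (p , q)
    proper m = proj₁ (around-range m) , proj₂ (around-range m) , λ e → new (proj₁ (S-∈ m)) i (trans e (sym label))
    rearrange : ∀ {f g h} → ∏L S arc ≡ f ⊗ (g ⊗ h) → ∏L C arc ≡ f ⊗ (g ⊗ h) ⊗ (∏L C₂ arc ⊗ ∏L C₁ arc)
    rearrange {f} {g} {h} e = trans (∏-C arc) (trans (cong (λ z → ∏L C₁ arc ⊗ (∏L C₂ arc ⊗ z)) e)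
      (solve 3 (λ a b s → a :* (b :* s) := s :* (b :* a)) refl (∏L C₁ arc) (∏L C₂ arc) (f ⊗ (g ⊗ h))))
    none : ∀ {A : Set} {xs : List A} → (∀ {x} → ¬ (x ∈ xs)) → xs ≡ []
    none {xs = []} h = refl
    none {xs = x ∷ xs} h = contradiction (here refl) h
    module _ {B₁ Bₘ B₂} (bs≡ : bs ≡ B₁ ++ (Bₘ ++ B₂))
      (h₁ : ∀ {b} → b ∈ B₁ → r < b) (hₘ : ∀ {b} → b ∈ Bₘ → b ≡ r) (h₂ : ∀ {b} → b ∈ B₂ → b < r) where
      in₁ : ∀ {b} → b ∈ B₁ → b ∈ bs
      in₁ m = subst (_ ∈_) (sym bs≡) (∈-++⁺ˡ m)
      inₘ : ∀ {b} → b ∈ Bₘ → b ∈ bs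
      inₘ m = subst (_ ∈_) (sym bs≡) (∈-++⁺ʳ B₁ (∈-++⁺ˡ m))
      in₂ : ∀ {b} → b ∈ B₂ → b ∈ bs
      in₂ m = subst (_ ∈_) (sym bs≡) (∈-++⁺ʳ B₁ (∈-++⁺ʳ Bₘ m))
      blocked : ∀ {b e} → b ∈ Bₘ → ¬ (e ∈ S)
      blocked {b} mb me with S-∈ me
      ... | mC , x , y = rays (inₘ mb) mC (subst (_ <_) (sym (hₘ mb)) x , subst (_< _) (sym (hₘ mb)) y)

      module _ {PQ S₀} (S≡ : S ≡ PQ ++ S₀) (h₀ : ∀ {e} → e ∈ S₀ → p < proj₁ e × proj₂ e < q) where
        PQ-∈ : ∀ {e} → e ∈ PQ → e ∈ S
        PQ-∈ m = subst (_ ∈_) (sym S≡) (∈-++⁺ˡ m)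
        S₀-∈ : ∀ {e} → e ∈ S₀ → e ∈ S
        S₀-∈ m = subst (_ ∈_) (sym S≡) (∈-++⁺ʳ PQ m)
        all-S : ∀ {P : Diag → Set} (P? : ∀ e → Dec (P e)) → count P? S ≡ count P? (PQ ++ S₀)
        all-S P? = cong (count P?) S≡
        inner-S : ∀ {P : Diag → Set} (P? : ∀ e → Dec (P e)) → (∀ {e} → e ∈ PQ → ¬ P e) → count P? S ≡ count P? S₀
        inner-S P? h = trans (all-S P?) (trans (count-++ P? PQ S₀) (cong (ℕ._+ count P? S₀) (count-none P? PQ h)))
        nested-S : AllPairs Nested (PQ ++ S₀)
        nested-S = subst (AllPairs Nested) S≡ S-nested
        around₀ : ∀ {e} → e ∈ S₀ → (p < proj₁ e × proj₁ e < r) × (r < proj₂ e × proj₂ e < q)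
        around₀ m with S-∈ (S₀-∈ m) | h₀ m
        ... | _ , x , y | u , v = (u , x) , (y , v)

        build-p : (∀ {e} → e ∈ PQ → proj₁ e ≡ p × proj₂ e < q) → Corners p r q bs C C₁ C₂
        build-p hp = record
          { over₁ = B₁ ; at-r = Bₘ ; over₂ = B₂ ; from-p = map proj₂ PQ ; to-q = [] ; around = S₀
          ; bs≡ = bs≡
          ; over₁-range = λ m → h₁ m , proj₂ (range (in₁ m))
          ; at-r-range = hₘ
          ; over₂-range = λ m → proj₁ (range (in₂ m)) , h₂ m
          ; from-p-range = λ m → from-p (∈-map⁻ proj₂ m)
          ; to-q-range = λ ()
          ; around-range = around₀
          ; exclusive = ex PQ (λ m → m) Bₘ (λ m → m)
          ; arcs-j = subst (λ bs → Arcs r q (B₁ ++ bs) C₂) (ListP.map-++ proj₂ PQ S₀) Ch.arcs-j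
          ; arcs-k = Ch.arcs-k
          ; product = rearrange (trans (cong (λ xs → ∏L xs arc) S≡) (trans (∏L-++ PQ S₀ arc) (cong₂ _⊗_
              (trans (∏L-cong∈ PQ λ m → cong (λ u → X u _) (proj₁ (hp m))) (sym (∏L-map proj₂ PQ (X p))))
                  (sym (*-identityˡ _)))))
          }
          where
          module Ch = Children {Sj = PQ ++ S₀} {S₀} bs≡ h₁ hₘ h₂
            (λ m → subst (_ ∈_) (sym S≡) m , [ (λ x → proj₂ (hp x)) , (λ x → proj₂ (h₀ x)) ]′ (∈-++⁻ PQ m))
                (λ m → S₀-∈ m , proj₁ (h₀ m))
            nested-S (AllPairs-suffix PQ nested-S) (λ P? _ → all-S P?)
                (λ P? h → inner-S P? λ m x → ℕP.<⇒≢ (h x) (sym (proj₁ (hp m))))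
          from-p : ∀ {b} → (∃ λ e → e ∈ PQ × b ≡ proj₂ e) → r < b × b < q
          from-p (e , m , refl) = proj₂ (proj₂ (S-∈ (PQ-∈ m))) , proj₂ (hp m)
          -- Every arc over r crosses the rays ending at r, and an arc from p to beyond r also
          -- crosses the rays ending before r; so the presence of one kind rules out the others.
          ex : ∀ xs → (∀ {e} → e ∈ xs → e ∈ PQ) → ∀ ys → (∀ {b} → b ∈ ys → b ∈ Bₘ) →
            Exclusive (length B₁) (length S₀) (length B₂) (length ys) (length (map proj₂ xs)) 0
          ex [] _ [] _ = inj₁ (refl , refl , inj₁ refl)
          ex [] _ (y ∷ ys) f = inj₁ (refl , refl , inj₂ (cong length (none λ m → blocked (f (here refl)) (S₀-∈ m))))
          ex (x ∷ xs) g (y ∷ ys) f = contradiction (PQ-∈ (g (here refl))) (blocked (f (here refl)))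
          ex (x ∷ xs) g [] f = inj₂ (inj₁ (refl , refl
              , cong length (none λ m → rays (in₂ m) (proj₁ (S-∈ (PQ-∈ (g (here refl)))))
            (subst (_< _) (sym (proj₁ (hp (g (here refl))))) (proj₁ (range (in₂ m)))
                , ℕP.<-trans (h₂ m) (proj₂ (proj₂ (S-∈ (PQ-∈ (g (here refl))))))))))

        build-q : (∀ {e} → e ∈ PQ → proj₂ e ≡ q × p < proj₁ e) → Corners p r q bs C C₁ C₂
        build-q hq = record
          { over₁ = B₁ ; at-r = Bₘ ; over₂ = B₂ ; from-p = [] ; to-q = reverse (map proj₁ PQ) ; around = S₀
          ; bs≡ = bs≡
          ; over₁-range = λ m → h₁ m , proj₂ (range (in₁ m))
          ; at-r-range = hₘ
          ; over₂-range = λ m → proj₁ (range (in₂ m)) , h₂ m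
          ; from-p-range = λ ()
          ; to-q-range = λ m → to-q (∈-map⁻ proj₁ (AnyP.reverse⁻ m))
          ; around-range = around₀
          ; exclusive = subst (Exclusive (length B₁) (length S₀) (length B₂) (length Bₘ) 0)
              (sym (trans (ListP.length-reverse (map proj₁ PQ)) (ListP.length-map proj₁ PQ)))
              (ex PQ (λ m → m) Bₘ (λ m → m))
          ; arcs-j = Ch.arcs-j
          ; arcs-k = subst (λ bs → Arcs p r bs C₁) (trans
              (cong (_++ B₂) (trans (cong reverse (ListP.map-++ proj₁ PQ S₀))
              (ListP.reverse-++ (map proj₁ PQ) (map proj₁ S₀))))
              (ListP.++-assoc (reverse (map proj₁ S₀)) (reverse (map proj₁ PQ)) B₂)) Ch.arcs-k
          ; product = rearrange (trans (cong (λ xs → ∏L xs arc) S≡)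
              (trans (∏L-++ PQ S₀ arc) (trans (cong (_⊗ ∏L S₀ arc)
              (trans (∏L-cong∈ PQ λ m → cong (X _) (proj₁ (hq m)))
                  (sym (trans (∏L-reverse (map proj₁ PQ) (λ c → X c q)) (∏L-map proj₁ PQ (λ c → X c q))))))
                  (sym (*-identityˡ _)))))
          }
          where
          module Ch = Children {Sj = S₀} {PQ ++ S₀} bs≡ h₁ hₘ h₂
            (λ m → S₀-∈ m , proj₂ (h₀ m)) (λ m → subst (_ ∈_) (sym S≡) m , [ (λ x → proj₂ (hq x))
                , (λ x → proj₁ (h₀ x)) ]′ (∈-++⁻ PQ m))
            (AllPairs-suffix PQ nested-S) nested-S (λ P? h → inner-S P? λ m x → ℕP.<⇒≢ (h x) (proj₁ (hq m)))
                (λ P? _ → all-S P?)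
          to-q : ∀ {b} → (∃ λ e → e ∈ PQ × b ≡ proj₁ e) → p < b × b < r
          to-q (e , m , refl) = proj₂ (hq m) , proj₁ (proj₂ (S-∈ (PQ-∈ m)))
          ex : ∀ xs → (∀ {e} → e ∈ xs → e ∈ PQ) → ∀ ys → (∀ {b} → b ∈ ys → b ∈ Bₘ) →
            Exclusive (length B₁) (length S₀) (length B₂) (length ys) 0 (length xs)
          ex [] _ [] _ = inj₁ (refl , refl , inj₁ refl)
          ex [] _ (y ∷ ys) f = inj₁ (refl , refl , inj₂ (cong length (none λ m → blocked (f (here refl)) (S₀-∈ m))))
          ex (x ∷ xs) g (y ∷ ys) f = contradiction (PQ-∈ (g (here refl))) (blocked (f (here refl)))
          ex (x ∷ xs) g [] f = inj₂ (inj₂ (refl , refl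
              , cong length (none λ m → rays (in₁ m) (proj₁ (S-∈ (PQ-∈ (g (here refl)))))
            (ℕP.<-trans (proj₁ (proj₂ (S-∈ (PQ-∈ (g (here refl)))))) (h₁ m)
                , subst (_ <_) (sym (proj₁ (hq (g (here refl))))) (proj₂ (range (in₁ m)))))))

    build : _ → _ → Corners p r q bs C C₁ C₂
    build (B₁ , Bₘ , B₂ , bs≡ , h₁ , hₘ , h₂) (PQ , S₀ , S≡ , inj₁ hp , h₀) = build-p bs≡ h₁ hₘ h₂ S≡ h₀ hp
    build (B₁ , Bₘ , B₂ , bs≡ , h₁ , hₘ , h₂) (PQ , S₀ , S≡ , inj₂ hq , h₀) = build-q bs≡ h₁ hₘ h₂ S≡ h₀ hq

  -- In an ear all rays end at the tip p + 1, whose two sides have length 1. The only arc that would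
  -- fit inside is D i itself, which `new` excludes.
  ear-expansion : ∀ {i p bs C} → D i ≡ (p , suc (suc p)) → suc (suc p) ≤ top → Arcs p (suc (suc p)) bs C → ∀ s →
    1K ≡ Π₂ (ray p (suc (suc p))) bs s ⊗ ∏L C arc
  ear-expansion {i} {p} {bs} {C} label h A s = sym (trans
      (cong₂ _⊗_ (trivial bs range s) (cong (λ xs → ∏L xs arc) (empty C within new))) (*-identityˡ 1K))
    where
    open Arcs A
    trivial : ∀ bs → (∀ {b} → b ∈ bs → p < b × b < suc (suc p)) → ∀ s → Π₂ (ray p (suc (suc p))) bs s ≡ 1K
    trivial [] _ s = refl
    trivial (b ∷ bs) r [] = refl
    trivial (b ∷ bs) r (t ∷ s) with ℕP.≤-antisym (ℕP.≤-pred (proj₂ (r (here refl)))) (proj₁ (r (here refl)))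
    ... | refl = trans (cong₂ _⊗_ (unit t) (trivial bs (r ∘ there) s)) (*-identityˡ 1K)
      where
      unit : ∀ t → ray p (suc (suc p)) (suc p) t ≡ 1K
      unit true = X-boundary h
      unit false = X-boundary (ℕP.<⇒≤ h)
    empty : ∀ C → (∀ {e} → e ∈ C → p ≤ proj₁ e × suc (proj₁ e) < proj₂ e × proj₂ e ≤ suc (suc p))
        → (∀ {e} → e ∈ C → ∀ l → e ≢ D l) → C ≡ []
    empty [] _ _ = refl
    empty (e ∷ C) w d with w (here refl)
    ... | x , y , z = contradiction (trans (cong₂ _,_ (ℕP.≤-antisym (ℕP.≤-pred (ℕP.≤-pred (ℕP.≤-trans y z))) x)
      (ℕP.≤-antisym z (ℕP.≤-trans (s≤s (s≤s x)) y))) (sym label)) (d (here refl) i)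

  -- The induction hypotheses turn the summand into that of `triangle-sum`. Arcs inside a child come
  -- out as constants, while those from p, to q or around r are completed in this triangle.
  expansion : ∀ {i p q} (t : Inner D i p q) → q ≤ top → ∀ {bs C} → Arcs p q bs C → ∀ s → length s ≡ length bs →
    V t s ≡ Π₂ (ray p q) bs s ⊗ ∏L C arc
  expansion (ear label) h A s e = ear-expansion label h A s
  expansion (glue {i} {j} {k} {p} {r} {q} label p<r r<q tj tk) h {bs} {C} A s e = begin
      V (glue {i = i} {j} {k} label p<r r<q tj tk) s
        ≡⟨ cong₂ (λ M N → sumL M λ sj → sumL N λ sk → weight sj sk ⊗ (pow ij M ⊗ V tj sj ⊗ (pow ik N ⊗ V tk sk))) aj
            ak ⟩
      sumL lj (λ sj → sumL lk λ sk → weight sj sk ⊗ (pow ij lj ⊗ V tj sj ⊗ (pow ik lk ⊗ V tk sk)))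
        ≡⟨ (sumL-cong lj λ sj ej → trans (sumL-cong lk λ sk ek → trans
              (cong₂ (λ y z → weight sj sk ⊗ (pow ij lj ⊗ y ⊗ (pow ik lk ⊗ z)))
                (expansion tj h (arcs-j) sj ej) (expansion tk (ℕP.≤-trans (ℕP.<⇒≤ r<q) h) arcs-k sk ek))
              (solve 7 (λ w u y c v z d → w :* (u :* (y :* c) :* (v :* (z :* d))) := w :* (u :* y :* (v :* z)) :*
                  (c :* d)) refl (weight sj sk) (pow ij lj) (Π₂ (ray r q) rays-j sj) (∏L C₂ arc) (pow ik lk)
                  (Π₂ (ray p r) rays-k sk) (∏L C₁ arc)))
            (sumL-*ʳ lk (∏L C₂ arc ⊗ ∏L C₁ arc) _)) ⟩
      sumL lj (λ sj → (sumL lk λ sk → weight sj sk ⊗ (pow ij lj ⊗ Π₂ (ray r q) rays-j sj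
          ⊗ (pow ik lk ⊗ Π₂ (ray p r) rays-k sk))) ⊗ (∏L C₂ arc ⊗ ∏L C₁ arc))
        ≡⟨ sumL-*ʳ lj (∏L C₂ arc ⊗ ∏L C₁ arc) _ ⟩
      sumL lj (λ sj → sumL lk λ sk → weight sj sk ⊗ (pow ij lj ⊗ Π₂ (ray r q) rays-j sj
          ⊗ (pow ik lk ⊗ Π₂ (ray p r) rays-k sk))) ⊗ (∏L C₂ arc ⊗ ∏L C₁ arc)
        ≡⟨ cong (_⊗ (∏L C₂ arc ⊗ ∏L C₁ arc)) (TS.triangle-sum (σ3 a i j k) (σ3 a j k i) (σ3 a k i j) σij σjk σki s
            (trans e (cong length bs≡))) ⟩
      Π₂ (ray p q) (over₁ ++ (at-r ++ over₂)) s ⊗ (∏L from-p (X p) ⊗ (∏L to-q (λ c → X c q) ⊗ ∏L around arc))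
          ⊗ (∏L C₂ arc ⊗ ∏L C₁ arc)
        ≡⟨ *-assoc _ _ _ ⟩
      Π₂ (ray p q) (over₁ ++ (at-r ++ over₂)) s ⊗ (∏L from-p (X p) ⊗ (∏L to-q (λ c → X c q) ⊗ ∏L around arc)
          ⊗ (∏L C₂ arc ⊗ ∏L C₁ arc))
        ≡⟨ cong₂ (λ xs z → Π₂ (ray p q) xs s ⊗ z) (sym bs≡) (sym product) ⟩
      Π₂ (ray p q) bs s ⊗ ∏L C arc ∎
    where
    open ≡-Reasoning
    C₁ C₂ : List Diag
    C₁ = Step.C₁ p<r r<q A
    C₂ = Step.C₂ p<r r<q A
    open Corners (corners p<r r<q (i , label) A)
    rays-j rays-k : List ℕ
    rays-j = over₁ ++ (from-p ++ map proj₂ around)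
    rays-k = reverse (map proj₁ around) ++ (to-q ++ over₂)
    lj lk : ℕ
    lj = length rays-j
    lk = length rays-k
    aj : a j ≡ lj
    aj = rays-count (inner-label tj) arcs-j
    ak : a k ≡ lk
    ak = rays-count (inner-label tk) arcs-k
    ij ik : K
    ij = inv (X r q)
    ik = inv (X p r)
    weight : List Bool → List Bool → K
    weight sj sk = triangle (X p q) (X r q) (X p r) (σ3 a i j k) (σ3 a j k i) (σ3 a k i j) s sj sk
    module TS = TriangleSum X p<r r<q (X-pos label) (X-pos (inner-label tj)) (X-pos (inner-label tk))
      (λ x y z w → ptolemy x y z (ℕP.≤-trans w h)) over₁ at-r over₂ from-p to-q around
      (All.tabulate over₁-range) (All.tabulate at-r-range) (All.tabulate over₂-range) (All.tabulate from-p-range)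
          (All.tabulate to-q-range) (All.tabulate around-range)
    u v w ei ej ek : ℕ
    u = length over₁
    v = length around
    w = length over₂
    ei = length at-r
    ej = length from-p
    ek = length to-q
    xi : a i ≡ u ℕ.+ (ei ℕ.+ w)
    xi = trans (rays-count label A) (trans (cong length bs≡)
        (trans (ListP.length-++ over₁) (cong (u ℕ.+_) (ListP.length-++ at-r))))
    xj : a j ≡ u ℕ.+ (ej ℕ.+ v)
    xj = trans aj (trans (ListP.length-++ over₁) (cong (u ℕ.+_)
        (trans (ListP.length-++ from-p) (cong (ej ℕ.+_) (ListP.length-map proj₂ around)))))
    xk : a k ≡ v ℕ.+ (ek ℕ.+ w)
    xk = trans ak (trans (ListP.length-++ (reverse (map proj₁ around))) (cong₂ ℕ._+_
      (trans (ListP.length-reverse (map proj₁ around)) (ListP.length-map proj₁ around)) (ListP.length-++ to-q)))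
    end : ∀ x y z → x ℕ.+ (y ℕ.+ z) ≡ x ℕ.+ z ℕ.+ y
    end = solveℕ 3 (λ x y z → x :+ℕ (y :+ℕ z) :=ℕ x :+ℕ z :+ℕ y) refl
    end′ : ∀ x y z → x ℕ.+ (y ℕ.+ z) ≡ z ℕ.+ x ℕ.+ y
    end′ = solveℕ 3 (λ x y z → x :+ℕ (y :+ℕ z) :=ℕ z :+ℕ x :+ℕ y) refl
    σij : σ3 a i j k ≡ u
    σij = σ-corner u v w ei ej ek (trans xi (end u ei w)) (trans xj (end u ej v)) (trans xk (end v ek w)) exclusive
    σjk : σ3 a j k i ≡ v
    σjk = σ-corner v w u ej ek ei (trans xj (end′ u ej v)) (trans xk (end v ek w)) (trans xi (end′ u ei w))
        (Exclusive-rotate exclusive)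
    σki : σ3 a k i j ≡ w
    σki = σ-corner w u v ek ei ej (trans xk (end′ v ek w)) (trans xi (end′ u ei w)) (trans xj (end u ej v))
        (Exclusive-rotate (Exclusive-rotate exclusive))

-- Oriented 3-cycles and distances

-- The three vertices, in increasing order, and sides of an oriented 3-cycle.
record Sorted3 {n} (D : Fin n → Diag) (a b c : Fin n) : Set where
  constructor sorted3
  field
    {x y z} : ℕ
    x<y : x < y
    y<z : y < z
    D-a : D a ≡ (x , z)
    D-b : D b ≡ (y , z)
    D-c : D c ≡ (x , y)

data Rotation3 {A : Set} (P : A → A → A → Set) (a b c : A) : Set where
  rot₀ : P a b c → Rotation3 P a b c
  rot₁ : P b c a → Rotation3 P a b c
  rot₂ : P c a b → Rotation3 P a b c

module Cycles {n : ℕ} {D : Fin n → Diag} (tri : IsTriangulation n D) where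
  open Arrows tri
  open Polygon tri

  Cycle : Fin n → Fin n → Fin n → Set
  Cycle a b c = Arrow D a b × Arrow D b c × Arrow D c a

  cycle? : ∀ a b c → Dec (Cycle a b c)
  cycle? a b c = arrow? a b ×-dec (arrow? b c ×-dec arrow? c a)

  -- Three arrows in a cycle might conceivably turn about a single common vertex; transitivity of
  -- the cyclic order excludes this, and so they bound a triangle.
  third-side : ∀ {a b c} → Cycle a b c → ∀ {v u w} → D a ≡ norm v u → D b ≡ norm v w → CO v u w → D c ≡ norm u w
  third-side {a} {b} {c} (_ , bc , arrow {v₂} {u₂} {w₂} ec ea co₂ ch₂) {v} {u} {w} ea₁ eb₁ co₁ with norm-injective
      (trans (sym ea) ea₁)
  ... | inj₁ (refl , refl) = contradiction (CO-trans co₁ (proj₁ (arrow-at eb₁ ec w≢u₂ bc))) (CO-asym co₂)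
    where
    w≢u₂ : w ≢ u₂
    w≢u₂ refl = CO-asym co₁ co₂
  ... | inj₂ (refl , refl) with u₂ ℕ.≟ w
  ...   | yes refl = ec
  ...   | no u₂≢w with bc
  ...     | arrow {v₃} {u₃} {w₃} eb ec′ co₃ ch₃ with norm-injective (trans (sym eb) eb₁) | norm-injective
      (trans (sym ec′) ec)
  ...       | inj₁ (e , _) | inj₁ (f , _) = contradiction (trans (sym e) f) (CO-≢₁₂ co₁)
  ...       | inj₁ (e , _) | inj₂ (f , _) = contradiction (trans (sym f) e) (CO-≢₂₃ co₂)
  ...       | inj₂ (e , _) | inj₁ (f , _) = contradiction (trans (sym f) e) (CO-≢₂₃ co₁)
  ...       | inj₂ (e , _) | inj₂ (f , _) = contradiction (trans (sym f) e) u₂≢w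

  cycle-triangle : ∀ {a b c} → Cycle a b c → Rotation3 (Sorted3 D) a b c
  cycle-triangle cyc@(arrow {v} {u} {w} ea eb co _ , _) with third-side cyc ea eb co | co
  ... | ec | case₁ (v<u , u<w) = rot₁ (sorted3 v<u u<w (trans eb (norm-< (ℕP.<-trans v<u u<w)))
      (trans ec (norm-< u<w)) (trans ea (norm-< v<u)))
  ... | ec | case₂ (u<w , w<v) = rot₀ (sorted3 u<w w<v (trans ea (trans (norm-sym v u) (norm-< (ℕP.<-trans u<w w<v))))
      (trans eb (trans (norm-sym v w) (norm-< w<v))) (trans ec (norm-< u<w)))
  ... | ec | case₃ (w<v , v<u) = rot₂ (sorted3 w<v v<u (trans ec (trans (norm-sym u w) (norm-< (ℕP.<-trans w<v v<u))))
      (trans ea (norm-< v<u)) (trans eb (trans (norm-sym v w) (norm-< w<v))))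

  D≡ : ∀ {i p q} → p < q → D i ≡ (p , q) → D i ≡ norm p q
  D≡ p<q e = trans e (sym (norm-< p<q))

  triangle-cycle : ∀ {a b c} → Sorted3 D a b c → Cycle a b c
  triangle-cycle (sorted3 {x} {y} {z} x<y y<z ea eb ec) =
    arrow (trans na (norm-sym x z)) (trans nb (norm-sym y z)) (CO-rot² xyz) (inj₂ (_ , nc)) ,
    arrow nb (trans nc (norm-sym x y)) (CO-rot xyz) (inj₂ (_ , trans na (norm-sym x z))) ,
    arrow nc na xyz (inj₂ (_ , nb))
    where
    xyz : CO x y z
    xyz = case₁ (x<y , y<z)
    na = D≡ (ℕP.<-trans x<y y<z) ea
    nb = D≡ y<z eb
    nc = D≡ x<y ec

  cycle-rotate : ∀ {a b c} → Cycle a b c → Cycle b c a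
  cycle-rotate (x , y , z) = y , z , x

  third-unique : ∀ {a b c c′} → Cycle a b c → Cycle a b c′ → c ≡ c′
  third-unique cyc@(arrow ea eb co _ , _) cyc′ = D-injective
      (trans (third-side cyc ea eb co) (sym (third-side cyc′ ea eb co)))

  module Regions where

    In : ℕ → ℕ → Fin n → Set
    In p q l = Inside p q (D l)

    straddling : ∀ {j k p r q l} → D k ≡ (p , r) → D j ≡ (r , q) → In p q l → proj₁ (D l) < r → r < proj₂ (D l) → D l
        ≡ (p , q)
    straddling {j} {k} {p} {r} {q} {l} ek ej (p≤u , v≤q) u<r r<v with ℕP.m≤n⇒m<n∨m≡n p≤u | ℕP.m≤n⇒m<n∨m≡n v≤q
    ... | inj₁ p<u | _ = contradiction (p<u , u<r , r<v) (uncrossed k l ek refl)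
    ... | inj₂ _ | inj₁ v<q = contradiction (u<r , r<v , v<q) (uncrossed l j refl ej)
    ... | inj₂ e | inj₂ f = cong₂ _,_ (sym e) f

    data Locate (i j k : Fin n) (p r q : ℕ) (l : Fin n) : Set where
      at-root : l ≡ i → Locate i j k p r q l
      in-left : In p r l → Locate i j k p r q l
      in-right : In r q l → Locate i j k p r q l

    locate : ∀ {i j k p r q l} → D i ≡ (p , q) → D k ≡ (p , r) → D j ≡ (r , q) → In p q l → Locate i j k p r q l
    locate {r = r} {l = l} ei ek ej h@(p≤u , v≤q) with proj₂ (D l) ≤? r | r ≤? proj₁ (D l)
    ... | yes v≤r | _ = in-left (p≤u , v≤r)
    ... | no _ | yes r≤u = in-right (r≤u , v≤q)
    ... | no v≰r | no r≰u = at-root (D-injective (trans (straddling ek ej h (ℕP.≰⇒> r≰u) (ℕP.≰⇒> v≰r)) (sym ei)))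

    in-ear : ∀ {i p l} → D i ≡ (p , suc (suc p)) → In p (suc (suc p)) l → l ≡ i
    in-ear {i} {p} {l} e (p≤u , v≤p+2) with isDiag l
    ... | u<v , _ , v≢ , _ = D-injective (trans (cong₂ _,_
        (ℕP.≤-antisym (ℕP.≤-pred (ℕP.≤-pred (ℕP.≤-trans (ℕP.≤∧≢⇒< u<v (v≢ ∘ sym)) v≤p+2))) p≤u)
        (ℕP.≤-antisym v≤p+2 (ℕP.≤-trans (s≤s (s≤s p≤u)) (ℕP.≤∧≢⇒< u<v (v≢ ∘ sym))))) (sym e))

    In-weaken : ∀ {p q p′ q′ l} → p′ ≤ p → q ≤ q′ → In p q l → In p′ q′ l
    In-weaken x y (u , v) = ℕP.≤-trans x u , ℕP.≤-trans v y

    In-disjoint : ∀ {p r q l} → In p r l → In r q l → ⊥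
    In-disjoint {l = l} (_ , v≤r) (r≤u , _) = ℕP.<⇒≱ (proj₁ (isDiag l)) (ℕP.≤-trans v≤r r≤u)

    In-label : ∀ {i p q} → D i ≡ (p , q) → In p q i
    In-label e = ℕP.≤-reflexive (sym (cong proj₁ e)) , ℕP.≤-reflexive (cong proj₂ e)

    root-not-left : ∀ {i p r q} → D i ≡ (p , q) → r < q → ¬ In p r i
    root-not-left e r<q (_ , v≤r) = ℕP.<⇒≱ r<q (subst (_≤ _) (cong proj₂ e) v≤r)

    root-not-right : ∀ {i p r q} → D i ≡ (p , q) → p < r → ¬ In r q i
    root-not-right e p<r (r≤u , _) = ℕP.<⇒≱ p<r (subst (_ ≤_) (cong proj₁ e) r≤u)

    In3 : ℕ → ℕ → Fin n → Fin n → Fin n → Set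
    In3 p q a b c = In p q a × In p q b × In p q c

    in3? : ∀ p q a b c → Dec (In3 p q a b c)
    in3? p q a b c = inside? p q (D a) ×-dec (inside? p q (D b) ×-dec inside? p q (D c))

    data Located3 (i j k : Fin n) (p r q : ℕ) (a b c : Fin n) : Set where
      root3 : a ≡ i → b ≡ j → c ≡ k → Located3 i j k p r q a b c
      left3 : In3 p r a b c → Located3 i j k p r q a b c
      right3 : In3 r q a b c → Located3 i j k p r q a b c

    locate3 : ∀ {i j k p r q a b c} → D i ≡ (p , q) → D k ≡ (p , r) → D j ≡ (r , q) → Sorted3 D a b c → In3 p q a b c
        → Located3 i j k p r q a b c
    locate3 {i} {j} {k} {p} {r} {q} {a} {b} {c} ei ek ej (sorted3 {x} {y} {z} x<y y<z ea eb ec) (ia , ib , ic) with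
        locate ei ek ej ia
    ... | in-left h = left3 (h , bounds eb , bounds′ ec)
      where
      p≤x : p ≤ x
      p≤x = subst (p ≤_) (cong proj₁ ea) (proj₁ h)
      z≤r : z ≤ r
      z≤r = subst (_≤ r) (cong proj₂ ea) (proj₂ h)
      bounds : ∀ {l} → D l ≡ (y , z) → In p r l
      bounds e = In-weaken (ℕP.≤-trans p≤x (ℕP.<⇒≤ x<y)) z≤r (In-label e)
      bounds′ : ∀ {l} → D l ≡ (x , y) → In p r l
      bounds′ e = In-weaken p≤x (ℕP.≤-trans (ℕP.<⇒≤ y<z) z≤r) (In-label e)
    ... | in-right h = right3 (h , bounds eb , bounds′ ec)
      where
      r≤x : r ≤ x
      r≤x = subst (r ≤_) (cong proj₁ ea) (proj₁ h)
      z≤q : z ≤ q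
      z≤q = subst (_≤ q) (cong proj₂ ea) (proj₂ h)
      bounds : ∀ {l} → D l ≡ (y , z) → In r q l
      bounds e = In-weaken (ℕP.≤-trans r≤x (ℕP.<⇒≤ x<y)) z≤q (In-label e)
      bounds′ : ∀ {l} → D l ≡ (x , y) → In r q l
      bounds′ e = In-weaken r≤x (ℕP.≤-trans (ℕP.<⇒≤ y<z) z≤q) (In-label e)
    ... | at-root refl with trans (sym ea) ei
    ...   | refl with ℕP.<-cmp y r
    ...     | tri< y<r _ _ = contradiction (x<y , y<r , r<q) (uncrossed k b ek eb)
      where
      r<q : r < q
      r<q = subst (λ e → proj₁ e < proj₂ e) ej (proj₁ (isDiag j))
    ...     | tri≈ _ refl _ = root3 refl (D-injective (trans eb (sym ej))) (D-injective (trans ec (sym ek)))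
    ...     | tri> _ _ r<y = contradiction (p<r , r<y , y<z) (uncrossed c j ec ej)
      where
      p<r : p < r
      p<r = subst (λ e → proj₁ e < proj₂ e) ek (proj₁ (isDiag k))

    no-cycle-in-ear : ∀ {i p a b c} → D i ≡ (p , suc (suc p)) → Cycle a b c → ¬ In3 p (suc (suc p)) a b c
    no-cycle-in-ear e cyc (ia , ib , ic) with in-ear e ia | in-ear e ib
    ... | refl | refl = Quads.arrow-asym tri (proj₁ cyc) (proj₁ cyc)

    nodes : ∀ {i p q} → Inner D i p q → List (Fin n)
    descendants : ∀ {i p q} → Inner D i p q → List (Fin n)
    nodes {i} t = i ∷ descendants t
    descendants (ear _) = []
    descendants (glue _ _ _ tj tk) = nodes tj ++ nodes tk

    nodes-in : ∀ {i p q l} (t : Inner D i p q) → l ∈ nodes t → In p q l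
    nodes-in t (here refl) = In-label (inner-label t)
    nodes-in (glue e p<r r<q tj tk) (there m) with ∈-++⁻ (nodes tj) m
    ... | inj₁ mj = In-weaken (ℕP.<⇒≤ p<r) ℕP.≤-refl (nodes-in tj mj)
    ... | inj₂ mk = In-weaken ℕP.≤-refl (ℕP.<⇒≤ r<q) (nodes-in tk mk)

    in-nodes : ∀ {i p q l} (t : Inner D i p q) → In p q l → l ∈ nodes t
    in-nodes (ear e) h = here (in-ear e h)
    in-nodes (glue e p<r r<q tj tk) h with locate e (inner-label tk) (inner-label tj) h
    ... | at-root refl = here refl
    ... | in-left h′ = there (∈-++⁺ʳ (nodes tj) (in-nodes tk h′))
    ... | in-right h′ = there (∈-++⁺ˡ (in-nodes tj h′))

    nodes-disjoint : ∀ {j k p r q l} (tj : Inner D j r q) (tk : Inner D k p r) → ¬ (l ∈ nodes tj × l ∈ nodes tk)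
    nodes-disjoint tj tk (x , y) = In-disjoint (nodes-in tk y) (nodes-in tj x)

    root∉ : ∀ {i j k p r q} → D i ≡ (p , q) → p < r → r < q → (tj : Inner D j r q) (tk : Inner D k p r)
        → ¬ (i ∈ nodes tj ++ nodes tk)
    root∉ e p<r r<q tj tk m with ∈-++⁻ (nodes tj) m
    ... | inj₁ x = root-not-right e p<r (nodes-in tj x)
    ... | inj₂ x = root-not-left e r<q (nodes-in tk x)

    nodes-unique : ∀ {i p q} (t : Inner D i p q) → Unique (nodes t)
    nodes-unique (ear _) = All.[] ∷ []
    nodes-unique {i} (glue e p<r r<q tj tk) =
      All.tabulate (λ { m refl → root∉ e p<r r<q tj tk m }) ∷
      UniqueP.++⁺ (nodes-unique tj) (nodes-unique tk) (nodes-disjoint tj tk)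

    -- The expected distance: the arrows i → j → k of a triangle make the step to {r , q} cost 1 and
    -- the step to {p , r} cost 2.
    depth : ∀ {i p q} → Inner D i p q → ℕ → Fin n → ℕ
    depth (ear _) δ l = δ
    depth {i} (glue {r = r} _ _ _ tj tk) δ l = if does (l Fin.≟ i) then δ else
      (if does (r ≤? proj₁ (D l)) then depth tj (1 ℕ.+ δ) l else depth tk (2 ℕ.+ δ) l)

    module _ {i j k p r q} (e : D i ≡ (p , q)) (p<r : p < r) (r<q : r < q) (tj : Inner D j r q) (tk : Inner D k p r)
        (δ : ℕ) where

      depth-root : depth (glue e p<r r<q tj tk) δ i ≡ δ
      depth-root = if-yes (i Fin.≟ i) refl

      depth-right : ∀ {l} → In r q l → depth (glue e p<r r<q tj tk) δ l ≡ depth tj (1 ℕ.+ δ) l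
      depth-right {l} h = trans (if-no (l Fin.≟ i) λ { refl → root-not-right e p<r h })
          (if-yes (r ≤? proj₁ (D l)) (proj₁ h))

      depth-left : ∀ {l} → In p r l → depth (glue e p<r r<q tj tk) δ l ≡ depth tk (2 ℕ.+ δ) l
      depth-left {l} h = trans (if-no (l Fin.≟ i) λ { refl → root-not-left e r<q h })
        (if-no (r ≤? proj₁ (D l)) λ x → ℕP.<⇒≱ (proj₁ (isDiag l)) (ℕP.≤-trans (proj₂ h) x))

    depth-top : ∀ {i p q} (t : Inner D i p q) δ → depth t δ i ≡ δ
    depth-top (ear _) δ = refl
    depth-top (glue e p<r r<q tj tk) δ = depth-root e p<r r<q tj tk δ

    Stepwise : ∀ {i p q} → Inner D i p q → ℕ → Fin n → Fin n → Fin n → Set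
    Stepwise t δ a b c = depth t δ b ≡ 1 ℕ.+ depth t δ a × depth t δ c ≡ 2 ℕ.+ depth t δ a

    stepwise : ∀ {i p q} (t : Inner D i p q) δ {a b c} → Sorted3 D a b c → In3 p q a b c → Stepwise t δ a b c
    stepwise (ear e) δ h h3 = contradiction h3 (no-cycle-in-ear e (triangle-cycle h))
    stepwise t@(glue e p<r r<q tj tk) δ h h3 with locate3 e (inner-label tk) (inner-label tj) h h3
    ... | root3 refl refl refl =
      trans (depth-right e p<r r<q tj tk δ (In-label (inner-label tj)))
          (trans (depth-top tj _) (cong suc (sym (depth-root e p<r r<q tj tk δ)))) ,
      trans (depth-left e p<r r<q tj tk δ (In-label (inner-label tk)))
          (trans (depth-top tk _) (cong (2 ℕ.+_) (sym (depth-root e p<r r<q tj tk δ))))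
    ... | left3 h′@(x , y , z) with stepwise tk (2 ℕ.+ δ) h h′
    ...   | s₁ , s₂ rewrite depth-left e p<r r<q tj tk δ x | depth-left e p<r r<q tj tk δ y | depth-left e p<r r<q tj
        tk δ z = s₁ , s₂
    stepwise t@(glue e p<r r<q tj tk) δ h h3 | right3 h′@(x , y , z) with stepwise tj (1 ℕ.+ δ) h h′
    ...   | s₁ , s₂ rewrite depth-right e p<r r<q tj tk δ x | depth-right e p<r r<q tj tk δ y | depth-right e p<r r<q
        tj tk δ z = s₁ , s₂

    -- Descending into a child shortens the interval by at least two.
    depth-bound : ∀ {i p q} (t : Inner D i p q) δ {l} → In p q l → depth t δ l ℕ.+ 2 ℕ.+ p ≤ δ ℕ.+ q
    depth-bound {p = p} (ear _) δ h = ℕP.≤-reflexive (ℕP.+-assoc δ 2 p)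
    depth-bound {p = p} {q} (glue {r = r} e p<r r<q tj tk) δ {l} h with locate e (inner-label tk) (inner-label tj) h
    ... | at-root refl rewrite depth-root e p<r r<q tj tk δ = ℕP.≤-trans (ℕP.≤-reflexive (ℕP.+-assoc δ 2 p))
        (ℕP.+-monoʳ-≤ δ (ℕP.≤-trans (s≤s p<r) r<q))
    ... | in-right h′ rewrite depth-right e p<r r<q tj tk δ h′ = ℕP.≤-pred (ℕP.≤-trans
        (subst (_≤ depth tj (1 ℕ.+ δ) l ℕ.+ 2 ℕ.+ r) (ℕP.+-suc (depth tj (1 ℕ.+ δ) l ℕ.+ 2) p)
            (ℕP.+-monoʳ-≤ (depth tj (1 ℕ.+ δ) l ℕ.+ 2) p<r))
        (depth-bound tj (1 ℕ.+ δ) h′))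
    ... | in-left h′ rewrite depth-left e p<r r<q tj tk δ h′ = ℕP.≤-trans (depth-bound tk (2 ℕ.+ δ) h′)
        (subst (_≤ δ ℕ.+ q) (trans (ℕP.+-suc δ (suc r)) (cong suc (ℕP.+-suc δ r)))
            (ℕP.+-monoʳ-≤ δ (long (inner-label tj))))
      where
      long : ∀ {j} → D j ≡ (r , q) → 2 ℕ.+ r ≤ q
      long {j} ej with subst (IsDiag m) ej (isDiag j)
      ... | a , _ , b , _ = ℕP.≤∧≢⇒< a (b ∘ sym)

-- The rooted tree of triangles and distances from its root

firstTrue-least : ∀ (p : ℕ → Bool) n d → d < n → T (p d) → (∀ l → l < d → ¬ T (p l)) → firstTrue p n ≡ d
firstTrue-least p (suc n) d d<n pd least with p 0 in eq
firstTrue-least p (suc n) zero d<n pd least | true = refl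
firstTrue-least p (suc n) (suc d) d<n pd least | true = contradiction (subst T (sym eq) tt) (least 0 (s≤s z≤n))
firstTrue-least p (suc n) zero d<n pd least | false = contradiction (subst T eq pd) λ ()
firstTrue-least p (suc n) (suc d) (s≤s d<n) pd least | false = cong suc
    (firstTrue-least (p ∘ suc) n d d<n pd (λ l l<d → least (suc l) (s≤s l<d)))

module FullTriangles {n : ℕ} {D : Fin n → Diag} (tri : IsTriangulation n D)
    (in-cycle : ∀ {i j} → Arrow D i j → ∃ λ k → Arrow D j k × Arrow D k i) where
  open Polygon tri
  open Cycles tri

  not-consecutive : ∀ {k u w} → D k ≡ norm u w → ¬ Consec m u w
  not-consecutive {k} {u} {w} ek c with norm-injective (trans (D-norm k) ek) | IsDiag⇒sides (isDiag k)
  ... | inj₁ (refl , refl) | _ , _ , xm , ym , cr = Consec-empty xm ym c cr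
  ... | inj₂ (refl , refl) | _ , _ , xm , ym , cr = Consec-empty xm ym (Consec-sym c) cr

  -- Two diagonals in a triangle give an arrow, and the 3-cycle through this arrow provides a
  -- diagonal as third side.
  no-half-triangle : ∀ {a b v u w} → D a ≡ norm v u → D b ≡ norm v w → CO v u w → ¬ Consec m u w
  no-half-triangle ea eb co c with in-cycle (arrow ea eb co (inj₁ c))
  ... | k , x , y = not-consecutive (third-side (arrow ea eb co (inj₁ c) , x , y) ea eb co) c

module Rooted {n : ℕ} {D : Fin n → Diag} (tri : IsTriangulation n D) {i₀ : Fin n} (root-label : D i₀ ≡ (0 , suc n))
    (in-cycle : ∀ {i j} → Arrow D i j → ∃ λ k → Arrow D j k × Arrow D k i) where
  open Arrows tri
  open Polygon tri
  open Cycles tri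
  open Regions
  open FullTriangles tri in-cycle

  m≡3+n : m ≡ suc (suc (suc n))
  m≡3+n = ℕP.+-comm n 3

  -- A diagonal ending at n + 2, the tip of the ear, would cross the root diagonal unless it started
  -- at 0 or n + 1, and then it would be a boundary edge.
  all-in : ∀ l → In 0 (suc n) l
  all-in l = z≤n , ℕP.≮⇒≥ outside
    where
    outside : ¬ (suc n < proj₂ (D l))
    outside h with isDiag l
    ... | u<v , v<m , v≢ , ¬top with ℕP.≤-antisym (ℕP.≤-pred (subst (proj₂ (D l) <_) m≡3+n v<m)) h
    ... | v≡ with proj₁ (D l) ℕ.≟ 0 | proj₁ (D l) <? suc n
    ... | yes e | _ = ¬top (e , trans (cong suc v≡) (sym m≡3+n))
    ... | no e | yes u<n+1 = uncrossed i₀ l root-label refl (ℕP.n≢0⇒n>0 e , u<n+1 , h)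
    ... | no e | no u≮ = v≢ (trans v≡ (cong suc (ℕP.≤-antisym (ℕP.≮⇒≥ u≮)
        (ℕP.≤-pred (subst (proj₁ (D l) <_) v≡ u<v)))))

  side-label : ∀ {a b} → b ≤ suc n → Side a b → ∃ λ j → D j ≡ (a , b)
  side-label h (inj₁ x) = x
  side-label h (inj₂ (_ , x)) = contradiction (trans (sym m≡3+n) (sym x)) λ y → ℕP.<-irrefl (sym y) (s≤s (s≤s h))

  -- A node with one leaf and one proper subtree would be a triangle with exactly two diagonal
  -- sides, so every node below the root is an ear or a full triangle.
  inner : ∀ {p q i} → D i ≡ (p , q) → q ≤ suc n → Tree Side p q → Inner D i p q
  inner {p} {q} {i} e h leaf = contradiction refl (proj₁ (proj₂ (proj₂ (subst (IsDiag m) e (isDiag i)))))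
  inner e h (node s p<r r<q leaf leaf) = ear e
  inner {p} {q} e h (node {r = r} s p<r r<q leaf (node s′ _ _ _ _)) with side-label h s′
  ... | j , ej = contradiction (inj₁ (inj₁ refl)) (no-half-triangle (trans (D≡ (ℕP.<-trans p<r r<q) e) (norm-sym p q))
        (trans (D≡ r<q ej) (norm-sym r q)) (CO-rot² (case₁ (p<r , r<q))))
  inner e h (node s p<r r<q (node s′ _ _ _ _) leaf) with side-label (ℕP.≤-trans (ℕP.<⇒≤ r<q) h) s′
  ... | k , ek = contradiction (inj₁ (inj₁ refl)) (no-half-triangle (D≡ p<r ek) (D≡ (ℕP.<-trans p<r r<q) e)
      (case₁ (p<r , r<q)))
  inner e h (node s p<r r<q t₁@(node s₁ _ _ _ _) t₂@(node s₂ _ _ _ _)) =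
    glue e p<r r<q (inner (proj₂ (side-label h s₂)) h t₂) (inner (proj₂ (side-label r≤ s₁)) r≤ t₁)
    where
    r≤ = ℕP.≤-trans (ℕP.<⇒≤ r<q) h

  abstract
    root : Inner D i₀ 0 (suc n)
    root = inner root-label ℕP.≤-refl (tree-at (s≤s z≤n) n+1<m (avoids (s≤s z≤n) n+1<m λ am bm ch →
        chords-uncrossed am bm 0<m n+1<m ch root-chord
            , chords-uncrossed am bm n+1<m 0<m ch (chord-sym {D = D} root-chord)))
      where
      n+1<m : suc n < m
      n+1<m = subst (suc n <_) (sym m≡3+n) (ℕP.n≤1+n _)
      0<m : 0 < m
      0<m = ℕP.≤-<-trans z≤n n+1<m
      root-chord : Chord D 0 (suc n)
      root-chord = inj₂ (i₀ , root-label)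

  distance : Fin n → ℕ
  distance = depth root 0

  cycle-distance : ∀ {a b c} → Sorted3 D a b c → distance b ≡ 1 ℕ.+ distance a × distance c ≡ 2 ℕ.+ distance a
  cycle-distance {a} {b} {c} h = stepwise root 0 h (all-in a , all-in b , all-in c)

  -- The arrows of a triangle raise the depth by 1, raise it by 1, and lower it by 2, and each arrow
  -- belongs to a triangle.
  arrow-distance : ∀ {a b} → Arrow D a b → distance b ≤ suc (distance a)
  arrow-distance {a} {b} x with in-cycle x
  ... | c , y , z with cycle-triangle (x , y , z)
  ...   | rot₀ h = ℕP.≤-reflexive (proj₁ (cycle-distance h))
  ...   | rot₁ h = ℕP.≤-trans (ℕP.m≤n+m _ 3) (ℕP.≤-reflexive (cong suc (sym (proj₂ (cycle-distance h)))))
  ...   | rot₂ h = ℕP.≤-reflexive (trans (proj₂ (cycle-distance h)) (cong suc (sym (proj₁ (cycle-distance h)))))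

  module _ (Q : Quiver n) (Q-arrow : ∀ i j → Q i j ≡ ⟦ arrow? i j ⟧) where

    private
      step⇒ : ∀ {i j} → T (0 <ᵇ Q i j) → Arrow D i j
      step⇒ {i} {j} t = ⟦⟧-true (arrow? i j) (subst (0 <_) (Q-arrow i j) (ℕP.<ᵇ⇒< 0 (Q i j) t))

      step⇐ : ∀ {i j} → Arrow D i j → T (0 <ᵇ Q i j)
      step⇐ {i} {j} x = ℕP.<⇒<ᵇ (subst (0 <_) (sym (trans (Q-arrow i j) (⟦⟧-yes (arrow? i j) x))) (s≤s z≤n))

      extend : ∀ l {i j} → T (pathLenB Q i₀ l i) → Arrow D i j → T (pathLenB Q i₀ (suc l) j)
      extend l {i} {j} t x = ∃⇒anyFin (λ i → pathLenB Q i₀ l i ∧ (0 <ᵇ Q i j)) i (Equivalence.from T-∧ (t , step⇐ x))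

      lower-bound : ∀ l j → T (pathLenB Q i₀ l j) → distance j ≤ l
      lower-bound zero j t with i₀ Fin.≟ j
      ... | yes refl = ℕP.≤-reflexive (depth-top root 0)
      lower-bound (suc l) j t with anyFin⇒∃ (λ i → pathLenB Q i₀ l i ∧ (0 <ᵇ Q i j)) t
      ... | i , t′ with Equivalence.to (T-∧ {pathLenB Q i₀ l i}) t′
      ...   | x , y = ℕP.≤-trans (arrow-distance (step⇒ y)) (s≤s (lower-bound l i x))

      path-down : ∀ {i p q} (t : Inner D i p q) δ → T (pathLenB Q i₀ δ i) → ∀ l → In p q l
          → T (pathLenB Q i₀ (depth t δ l) l)
      path-down (ear e) δ x l h with in-ear e h
      ... | refl = x
      path-down {i} (glue {j = j} {k} e p<r r<q tj tk) δ x l h with locate e (inner-label tk) (inner-label tj) h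
      ... | at-root refl = subst (λ d → T (pathLenB Q i₀ d i)) (sym (depth-root e p<r r<q tj tk δ)) x
      ... | in-right h′ = subst (λ d → T (pathLenB Q i₀ d l)) (sym (depth-right e p<r r<q tj tk δ h′))
            (path-down tj (suc δ) (extend δ x (proj₁ (triangle-cycle
                (sorted3 p<r r<q e (inner-label tj) (inner-label tk))))) l h′)
      ... | in-left h′ = subst (λ d → T (pathLenB Q i₀ d l)) (sym (depth-left e p<r r<q tj tk δ h′))
            (path-down tk (suc (suc δ)) (extend (suc δ) (extend δ x (proj₁ cyc)) (proj₁ (proj₂ cyc))) l h′)
        where cyc = triangle-cycle (sorted3 p<r r<q e (inner-label tj) (inner-label tk))

    -- No path is shorter, since an arrow raises the depth by at most 1, and descending the tree
    -- gives a path of this length. The search bound n is large enough by `depth-bound`.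
    dist-distance : ∀ j → dist Q i₀ j ≡ distance j
    dist-distance j = firstTrue-least (λ l → pathLenB Q i₀ l j) n (distance j) bounded
        (path-down root 0 start j (all-in j))
        λ l l<d t → ℕP.<⇒≱ l<d (lower-bound l j t)
      where
      start : T (pathLenB Q i₀ 0 i₀)
      start with i₀ Fin.≟ i₀
      ... | yes _ = tt
      ... | no h = contradiction refl h
      bounded : distance j < n
      bounded = ℕP.≤-pred (ℕP.≤-trans (ℕP.≤-reflexive (trans (sym (ℕP.+-comm (distance j) 2))
          (sym (ℕP.+-identityʳ _)))) (depth-bound root 0 (all-in j)))

-- Sums over sequences and products over 3-cycles

infixr 4 _⨾_
_⨾_ : ∀ {A : Set} {x y z : A} → x ≡ y → y ≡ z → x ≡ z
_⨾_ = trans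

-- Lengths are forgotten, so that updating one entry needs no dependent types.
Env : ℕ → Set
Env n = Fin n → List Bool

upd : ∀ {n} → Env n → Fin n → List Bool → Env n
upd s i v l = if does (i Fin.≟ l) then v else s l

upd-same : ∀ {n} (s : Env n) i v → upd s i v i ≡ v
upd-same s i v = if-yes (i Fin.≟ i) refl

upd-other : ∀ {n} (s : Env n) i l v → i ≢ l → upd s i v l ≡ s l
upd-other s i l v h = if-no (i Fin.≟ l) h

-- Environments are functions, so invariance under pointwise equality is carried as a property of
-- the summand.
Extensional : ∀ {n} → (Env n → K) → Set
Extensional F = ∀ {s s′} → (∀ l → s l ≡ s′ l) → F s ≡ F s′

sumL-swap : ∀ m n (f : List Bool → List Bool → K) → sumL m (λ v → sumL n (f v)) ≡ sumL n (λ w → sumL m (λ v → f v w))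
sumL-swap zero n f = refl
sumL-swap (suc m) n f = cong₂ _⊕_ (sumL-swap m n (λ v → f (true ∷ v))) (sumL-swap m n (λ v → f (false ∷ v)))
    ⨾ sym (sumL-+ n _ _)

module _ {n : ℕ} (a : Fin n → ℕ) (c : Fin n → K) where

  sumOver : List (Fin n) → (Env n → K) → Env n → K
  sumOver [] F s = F s
  sumOver (i ∷ is) F s = c i ⊗ sumL (a i) (λ v → sumOver is F (upd s i v))

  sumOver-cong : ∀ is {F G} → (∀ s → F s ≡ G s) → ∀ s → sumOver is F s ≡ sumOver is G s
  sumOver-cong [] h s = h s
  sumOver-cong (i ∷ is) h s = cong (c i ⊗_) (sumL-cong (a i) λ v _ → sumOver-cong is h (upd s i v))

  sumOver-ext : ∀ is {F} → Extensional F → Extensional (sumOver is F)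
  sumOver-ext [] ext h = ext h
  sumOver-ext (i ∷ is) ext {s} {s′} h = cong (c i ⊗_) (sumL-cong (a i) λ v _
      → sumOver-ext is ext (λ l → cong (λ w → if does (i Fin.≟ l) then v else w) (h l)))

  sumOver-++ : ∀ is js F s → sumOver (is ++ js) F s ≡ sumOver is (sumOver js F) s
  sumOver-++ [] js F s = refl
  sumOver-++ (i ∷ is) js F s = cong (c i ⊗_) (sumL-cong (a i) λ v _ → sumOver-++ is js F (upd s i v))

  -- Lets the enumeration of all sequences, which follows the order of `Fin n`, be replaced by one
  -- that follows the tree.
  sumOver-↭ : ∀ {is js} → is ↭ js → ∀ {F} → Extensional F → ∀ s → sumOver is F s ≡ sumOver js F s
  sumOver-↭ Perm.refl ext s = refl
  sumOver-↭ (Perm.prep i p) ext s = cong (c i ⊗_) (sumL-cong (a i) λ v _ → sumOver-↭ p ext (upd s i v))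
  sumOver-↭ (Perm.trans p q) ext s = sumOver-↭ p ext s ⨾ sumOver-↭ q ext s
  sumOver-↭ {is = i ∷ j ∷ is} {j ∷ i ∷ js} (Perm.swap i j p) {F} ext s with i Fin.≟ j
  ... | yes refl = cong (c i ⊗_) (sumL-cong (a i) λ v _ → cong (c i ⊗_) (sumL-cong (a i) λ w _ → sumOver-↭ p ext _))
  ... | no i≢j = begin
    c i ⊗ sumL (a i) (λ v → c j ⊗ sumL (a j) (λ w → sumOver is F (upd (upd s i v) j w)))
      ≡⟨ cong (c i ⊗_) (sumL-*ˡ (a i) (c j) _) ⟩
    c i ⊗ (c j ⊗ sumL (a i) (λ v → sumL (a j) (λ w → sumOver is F (upd (upd s i v) j w))))
      ≡⟨ cong (λ z → c i ⊗ (c j ⊗ z)) (sumL-swap (a i) (a j) _ ⨾ sumL-cong (a j) λ w _ → sumL-cong (a i) λ v _ →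
           sumOver-↭ p ext _ ⨾ sumOver-ext js ext (commute v w)) ⟩
    c i ⊗ (c j ⊗ sumL (a j) (λ w → sumL (a i) (λ v → sumOver js F (upd (upd s j w) i v))))
      ≡⟨ (solve 3 (λ x y z → x :* (y :* z) := y :* (x :* z)) refl (c i) (c j)
          (sumL (a j) (λ w → sumL (a i) (λ v → sumOver js F (upd (upd s j w) i v))))) ⟩
    c j ⊗ (c i ⊗ sumL (a j) (λ w → sumL (a i) (λ v → sumOver js F (upd (upd s j w) i v))))
      ≡⟨ cong (c j ⊗_) (sym (sumL-*ˡ (a j) (c i) _)) ⟩
    c j ⊗ sumL (a j) (λ w → c i ⊗ sumL (a i) (λ v → sumOver js F (upd (upd s j w) i v))) ∎
    where
    open ≡-Reasoning
    commute : ∀ v w l → upd (upd s i v) j w l ≡ upd (upd s j w) i v l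
    commute v w l with i Fin.≟ l | j Fin.≟ l
    ... | yes refl | yes refl = contradiction refl i≢j
    ... | yes _ | no _ = refl
    ... | no _ | yes _ = refl
    ... | no _ | no _ = refl

  Independent : (Env n → K) → List (Fin n) → Set
  Independent G is = ∀ {l} → l ∈ is → ∀ s v → G (upd s l v) ≡ G s

  sumOver-pull : ∀ is {G} F → Independent G is → ∀ s → sumOver is (λ s → G s ⊗ F s) s ≡ G s ⊗ sumOver is F s
  sumOver-pull [] F h s = refl
  sumOver-pull (i ∷ is) {G} F h s = cong (c i ⊗_) ((sumL-cong (a i) λ v _ → sumOver-pull is F (h ∘ there) (upd s i v)
      ⨾
      cong (_⊗ sumOver is F (upd s i v)) (h (here refl) s v)) ⨾ sumL-*ˡ (a i) (G s) _)
    ⨾ (solve 3 (λ x y z → x :* (y :* z) := y :* (x :* z)) refl (c i) (G s)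
        (sumL (a i) (λ v → sumOver is F (upd s i v))))

sumOver-suc : ∀ {n} (a : Fin (suc n) → ℕ) (c : Fin (suc n) → K) is {F} → Extensional F → ∀ s →
  sumOver a c (map suc is) F s ≡ sumOver (a ∘ suc) (c ∘ suc) is (λ s′ → F (cons (s zero) s′)) (s ∘ suc)
sumOver-suc a c [] ext s = ext λ { zero → refl ; (suc l) → refl }
sumOver-suc a c (i ∷ is) ext s = cong (c (suc i) ⊗_) (sumL-cong (a (suc i)) λ v _
    → sumOver-suc a c is ext (upd s (suc i) v))

∑-map : ∀ {A B : Set} (g : A → B) xs f → ∑ (map g xs) f ≡ ∑ xs (f ∘ g)
∑-map g [] f = refl
∑-map g (x ∷ xs) f = cong (f (g x) ⊕_) (∑-map g xs f)

∑-concatMap : ∀ {A B : Set} (g : A → List B) xs f → ∑ (concatMap g xs) f ≡ ∑ xs (λ x → ∑ (g x) f)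
∑-concatMap g [] f = refl
∑-concatMap g (x ∷ xs) f = ∑-++ (g x) (concatMap g xs) f ⨾ cong (∑ (g x) f ⊕_) (∑-concatMap g xs f)

∑-+ : ∀ {A : Set} (xs : List A) f g → ∑ xs (λ x → f x ⊕ g x) ≡ ∑ xs f ⊕ ∑ xs g
∑-+ [] f g = sym (+-identityˡ _)
∑-+ (x ∷ xs) f g = cong (f x ⊕ g x ⊕_) (∑-+ xs f g) ⨾ (solve 4
    (λ a b c d → (a :+ b) :+ (c :+ d) := (a :+ c) :+ (b :+ d)) refl (f x) (g x) (∑ xs f) (∑ xs g))

∑-allVecs : ∀ m g → ∑ (allVecs m) (g ∘ toList) ≡ sumL m g
∑-allVecs zero g = +-identityʳ _
∑-allVecs (suc m) g = ∑-concatMap (λ v → (true ∷ v) ∷ (false ∷ v) ∷ []) (allVecs m) (g ∘ toList) ⨾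
  (∑-cong (allVecs m) (λ v → cong (g (true ∷ toList v) ⊕_) (+-identityʳ _)) ⨾
  (∑-+ (allVecs m) _ _ ⨾ cong₂ _⊕_ (∑-allVecs m (g ∘ (true ∷_))) (∑-allVecs m (g ∘ (false ∷_)))))

lists : ∀ {n} {a : Fin n → ℕ} → Seq a → Env n
lists σ i = toList (σ i)

∑-allSeqs : ∀ n (a : Fin n → ℕ) c {F} → Extensional F → ∀ s → ∏ c ⊗ ∑ (allSeqs n a) (F ∘ lists)
    ≡ sumOver a c (allFin n) F s
∑-allSeqs zero a c ext s = *-identityˡ _ ⨾ (+-identityʳ _ ⨾ ext λ ())
∑-allSeqs (suc n) a c {F} ext s = begin
  c zero ⊗ ∏ c′ ⊗ ∑ (allSeqs (suc n) a) (F ∘ lists)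
    ≡⟨ cong (c zero ⊗ ∏ c′ ⊗_) (∑-concatMap (λ v → map (λ f → consSeq {a = a} v f) (allSeqs n (a ∘ suc)))
        (allVecs (a zero)) (F ∘ lists) ⨾
         (∑-cong (allVecs (a zero)) (λ v → ∑-map (λ f → consSeq {a = a} v f) (allSeqs n (a ∘ suc)) (F ∘ lists) ⨾
           ∑-cong (allSeqs n (a ∘ suc)) λ f → ext λ { zero → refl ; (suc l) → refl }) ⨾
         ∑-allVecs (a zero) (λ v → ∑ (allSeqs n (a ∘ suc)) (λ f → F (cons v (lists f)))))) ⟩
  c zero ⊗ ∏ c′ ⊗ sumL (a zero) (λ v → ∑ (allSeqs n (a ∘ suc)) (λ f → F (cons v (lists f))))
    ≡⟨ *-assoc _ _ _ ⨾ cong (c zero ⊗_) (sym (sumL-*ˡ (a zero) (∏ c′) _)) ⟩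
  c zero ⊗ sumL (a zero) (λ v → ∏ c′ ⊗ ∑ (allSeqs n (a ∘ suc)) (λ f → F (cons v (lists f))))
    ≡⟨ cong (c zero ⊗_) (sumL-cong (a zero) λ v _ →
         ∑-allSeqs n (a ∘ suc) c′ (λ h → ext λ { zero → refl ; (suc l) → h l }) (s ∘ suc)
             ⨾ sym (sumOver-suc a c (allFin n) ext (upd s zero v))) ⟩
  c zero ⊗ sumL (a zero) (λ v → sumOver a c (map suc (allFin n)) F (upd s zero v))
    ≡⟨ cong (λ is → c zero ⊗ sumL (a zero) (λ v → sumOver a c is F (upd s zero v))) (ListP.map-tabulate (λ i → i) suc)
        ⟩
  sumOver a c (allFin (suc n)) F s ∎
  where
  open ≡-Reasoning
  c′ : Fin n → K
  c′ = c ∘ suc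

∏³ : ∀ {n} → (Fin n → Fin n → Fin n → K) → K
∏³ f = ∏ λ a → ∏ λ b → ∏ λ c → f a b c

∏³-cong : ∀ {n} {f g : Fin n → Fin n → Fin n → K} → (∀ a b c → f a b c ≡ g a b c) → ∏³ f ≡ ∏³ g
∏³-cong h = ∏-cong λ a → ∏-cong λ b → ∏-cong λ c → h a b c

∏³-* : ∀ {n} (f g : Fin n → Fin n → Fin n → K) → ∏³ (λ a b c → f a b c ⊗ g a b c) ≡ ∏³ f ⊗ ∏³ g
∏³-* f g = ∏-cong (λ a → ∏-cong (λ b → ∏-* (f a b) (g a b)) ⨾ ∏-* (λ b → ∏ (f a b)) (λ b → ∏ (g a b))) ⨾
  ∏-* (λ a → ∏ λ b → ∏ (f a b)) (λ a → ∏ λ b → ∏ (g a b))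

∏³-1 : ∀ {n} {f : Fin n → Fin n → Fin n → K} → (∀ a b c → f a b c ≡ 1K) → ∏³ f ≡ 1K
∏³-1 {n} h = ∏-1′ {n} λ a → ∏-1′ {n} λ b → ∏-1′ {n} λ c → h a b c

eq3? : ∀ {n} (i j k a b c : Fin n) → Dec (a ≡ i × b ≡ j × c ≡ k)
eq3? i j k a b c = (a Fin.≟ i) ×-dec ((b Fin.≟ j) ×-dec (c Fin.≟ k))

∏³-single : ∀ {n} (h : Fin n → Fin n → Fin n → K) i j k → ∏³ (λ a b c → pow (h a b c) ⟦ eq3? i j k a b c ⟧) ≡ h i j k
∏³-single {n} h i j k =
  ∏-single {f = λ a → ∏ λ b → ∏ λ c → g a b c} i (λ a a≢i → ∏-1′ {n} λ b → ∏-1′ {n} λ c → off a b c (a≢i ∘ proj₁)) ⨾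
  (∏-single {f = λ b → ∏ λ c → g i b c} j (λ b b≢j → ∏-1′ {n} λ c → off i b c (b≢j ∘ proj₁ ∘ proj₂)) ⨾
  (∏-single {f = λ c → g i j c} k (λ c c≢k → off i j c (c≢k ∘ proj₂ ∘ proj₂)) ⨾
  (cong (pow (h i j k)) (⟦⟧-yes (eq3? i j k i j k) (refl , refl , refl)) ⨾ *-identityʳ _)))
  where
  g : _ → _ → _ → K
  g a b c = pow (h a b c) ⟦ eq3? i j k a b c ⟧
  off : ∀ a b c → ¬ (a ≡ i × b ≡ j × c ≡ k) → g a b c ≡ 1K
  off a b c ne = cong (pow (h a b c)) (⟦⟧-no (eq3? i j k a b c) ne)

module CycleProduct {n : ℕ} {D : Fin n → Diag} (triang : IsTriangulation n D) where
  open Cycles triang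
  open Regions

  treeProduct : (Fin n → Fin n → Fin n → K) → ∀ {i p q} → Inner D i p q → K
  treeProduct h (ear _) = 1K
  treeProduct h (glue {i} {j} {k} _ _ _ tj tk) = h i j k ⊗ (h j k i ⊗ h k i j) ⊗ (treeProduct h tj ⊗ treeProduct h tk)

  inside3? : ∀ p q a b c → Dec (Cycle a b c × In3 p q a b c)
  inside3? p q a b c = cycle? a b c ×-dec in3? p q a b c

  module _ (h : Fin n → Fin n → Fin n → K) where

    -- A 3-cycle inside [p , q] is one of the three rotations of the triangle at the root or lies
    -- inside one of the two children. These five possibilities exclude each other, so the exponents
    -- add up.
    cycle-product : ∀ {i p q} (t : Inner D i p q) → ∏³ (λ a b c → pow (h a b c) ⟦ inside3? p q a b c ⟧)
        ≡ treeProduct h t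
    cycle-product (ear {p = p} e) = ∏³-1 λ a b c → cong (pow (h a b c))
        (⟦⟧-no (inside3? p (suc (suc p)) a b c) λ (x , y) → no-cycle-in-ear e x y)
    cycle-product (glue {i} {j} {k} {p} {r} {q} e p<r r<q tj tk) = begin
      ∏³ (λ a b c → pow (h a b c) ⟦ inside3? p q a b c ⟧)
        ≡⟨ ∏³-cong (λ a b c → cong (pow (h a b c)) (pointwise a b c)
            ⨾ spread (h a b c) ⟦ eq3? i j k a b c ⟧ ⟦ eq3? j k i a b c ⟧ ⟦ eq3? k i j a b c ⟧ ⟦ inside3? r q a b c ⟧ ⟦
            inside3? p r a b c ⟧) ⟩
      ∏³ (λ a b c → g₁ a b c ⊗ ((g₂ a b c ⊗ g₃ a b c) ⊗ (g₄ a b c ⊗ g₅ a b c)))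
        ≡⟨ ∏³-* g₁ (λ a b c → (g₂ a b c ⊗ g₃ a b c) ⊗ (g₄ a b c ⊗ g₅ a b c)) ⨾ cong (∏³ g₁ ⊗_)
             (∏³-* (λ a b c → g₂ a b c ⊗ g₃ a b c) (λ a b c → g₄ a b c ⊗ g₅ a b c)
                 ⨾ cong₂ _⊗_ (∏³-* g₂ g₃) (∏³-* g₄ g₅)) ⟩
      ∏³ g₁ ⊗ ((∏³ g₂ ⊗ ∏³ g₃) ⊗ (∏³ g₄ ⊗ ∏³ g₅))
        ≡⟨ cong₂ _⊗_ (∏³-single h i j k) (cong₂ _⊗_ (cong₂ _⊗_ (∏³-single h j k i) (∏³-single h k i j))
            (cong₂ _⊗_ (cycle-product tj) (cycle-product tk))) ⟩
      h i j k ⊗ ((h j k i ⊗ h k i j) ⊗ (treeProduct h tj ⊗ treeProduct h tk))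
        ≡⟨ *-assoc _ _ _ ⟨
      h i j k ⊗ (h j k i ⊗ h k i j) ⊗ (treeProduct h tj ⊗ treeProduct h tk) ∎
      where
      open ≡-Reasoning
      g₁ g₂ g₃ g₄ g₅ : Fin n → Fin n → Fin n → K
      g₁ a b c = pow (h a b c) ⟦ eq3? i j k a b c ⟧
      g₂ a b c = pow (h a b c) ⟦ eq3? j k i a b c ⟧
      g₃ a b c = pow (h a b c) ⟦ eq3? k i j a b c ⟧
      g₄ a b c = pow (h a b c) ⟦ inside3? r q a b c ⟧
      g₅ a b c = pow (h a b c) ⟦ inside3? p r a b c ⟧
      spread : ∀ y u v w x z → pow y (u ℕ.+ ((v ℕ.+ w) ℕ.+ (x ℕ.+ z))) ≡ pow y u
          ⊗ ((pow y v ⊗ pow y w) ⊗ (pow y x ⊗ pow y z))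
      spread y u v w x z = pow-+ y u _ ⨾ cong (pow y u ⊗_)
          (pow-+ y (v ℕ.+ w) _ ⨾ cong₂ _⊗_ (pow-+ y v w) (pow-+ y x z))
      ek = inner-label tk
      ej = inner-label tj
      tri-ijk : Cycle i j k
      tri-ijk = triangle-cycle (sorted3 p<r r<q e ej ek)
      i-in : In p q i
      i-in = In-label e
      j-in : In p q j
      j-in = In-weaken (ℕP.<⇒≤ p<r) ℕP.≤-refl (In-label ej)
      k-in : In p q k
      k-in = In-weaken ℕP.≤-refl (ℕP.<⇒≤ r<q) (In-label ek)
      i≢j : i ≢ j
      i≢j refl = root-not-right e p<r (In-label ej)
      i≢k : i ≢ k
      i≢k refl = root-not-left e r<q (In-label ek)
      j≢k : j ≢ k
      j≢k refl = In-disjoint (In-label ek) (In-label ej)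
      module _ (a b c : Fin n) where
        E₁ = a ≡ i × b ≡ j × c ≡ k
        E₂ = a ≡ j × b ≡ k × c ≡ i
        E₃ = a ≡ k × b ≡ i × c ≡ j
        L = Cycle a b c × In3 p r a b c
        R = Cycle a b c × In3 r q a b c
        e₁? = eq3? i j k a b c
        e₂? = eq3? j k i a b c
        e₃? = eq3? k i j a b c
        forward : Cycle a b c × In3 p q a b c → E₁ ⊎ ((E₂ ⊎ E₃) ⊎ (R ⊎ L))
        forward (cyc , x , y , z) with cycle-triangle cyc
        ... | rot₀ s with locate3 e ek ej s (x , y , z)
        ...   | root3 u v w = inj₁ (u , v , w)
        ...   | left3 l = inj₂ (inj₂ (inj₂ (cyc , l)))
        ...   | right3 l = inj₂ (inj₂ (inj₁ (cyc , l)))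
        forward (cyc , x , y , z) | rot₁ s with locate3 e ek ej s (y , z , x)
        ...   | root3 u v w = inj₂ (inj₁ (inj₂ (w , u , v)))
        ...   | left3 (u , v , w) = inj₂ (inj₂ (inj₂ (cyc , w , u , v)))
        ...   | right3 (u , v , w) = inj₂ (inj₂ (inj₁ (cyc , w , u , v)))
        forward (cyc , x , y , z) | rot₂ s with locate3 e ek ej s (z , x , y)
        ...   | root3 u v w = inj₂ (inj₁ (inj₁ (v , w , u)))
        ...   | left3 (u , v , w) = inj₂ (inj₂ (inj₂ (cyc , v , w , u)))
        ...   | right3 (u , v , w) = inj₂ (inj₂ (inj₁ (cyc , v , w , u)))
        backward : E₁ ⊎ ((E₂ ⊎ E₃) ⊎ (R ⊎ L)) → Cycle a b c × In3 p q a b c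
        backward (inj₁ (refl , refl , refl)) = tri-ijk , i-in , j-in , k-in
        backward (inj₂ (inj₁ (inj₁ (refl , refl , refl)))) = cycle-rotate tri-ijk , j-in , k-in , i-in
        backward (inj₂ (inj₁ (inj₂ (refl , refl , refl)))) = cycle-rotate (cycle-rotate tri-ijk) , k-in , i-in , j-in
        backward (inj₂ (inj₂ (inj₁ (cyc , x , y , z)))) = cyc , wk x , wk y , wk z
          where
          wk : ∀ {l} → In r q l → In p q l
          wk = In-weaken (ℕP.<⇒≤ p<r) ℕP.≤-refl
        backward (inj₂ (inj₂ (inj₂ (cyc , x , y , z)))) = cyc , wk x , wk y , wk z
          where
          wk : ∀ {l} → In p r l → In p q l
          wk = In-weaken ℕP.≤-refl (ℕP.<⇒≤ r<q)
        outside : (R ⊎ L) → ∀ {l} → l ≡ i → (a ≡ l ⊎ (b ≡ l ⊎ c ≡ l)) → ⊥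
        outside (inj₁ (_ , x , y , z)) refl = [ (λ { refl → root-not-right e p<r x })
            , [ (λ { refl → root-not-right e p<r y }) , (λ { refl → root-not-right e p<r z }) ]′ ]′
        outside (inj₂ (_ , x , y , z)) refl = [ (λ { refl → root-not-left e r<q x })
            , [ (λ { refl → root-not-left e r<q y }) , (λ { refl → root-not-left e r<q z }) ]′ ]′
        pointwise : ⟦ inside3? p q a b c ⟧ ≡ ⟦ e₁? ⟧ ℕ.+
            ((⟦ e₂? ⟧ ℕ.+ ⟦ e₃? ⟧) ℕ.+ (⟦ inside3? r q a b c ⟧ ℕ.+ ⟦ inside3? p r a b c ⟧))
        pointwise = ⟦⟧-⊎ (inside3? p q a b c) e₁? rest? forward backward
            (λ { ((u , _) , inj₁ (inj₁ (v , _))) → i≢j (sym u ⨾ v) ; ((u , _) , inj₁ (inj₂ (v , _)))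
                → i≢k (sym u ⨾ v) ; ((u , _) , inj₂ x) → outside x refl (inj₁ u) }) ⨾
          cong (⟦ e₁? ⟧ ℕ.+_) (⟦⟧-⊎ rest? (e₂? ⊎-dec e₃?) (inside3? r q a b c ⊎-dec inside3? p r a b c) (λ x → x)
              (λ x → x)
              (λ { (inj₁ (_ , _ , u) , x) → outside x refl (inj₂ (inj₂ u)) ; (inj₂ (_ , u , _) , x)
                  → outside x refl (inj₂ (inj₁ u)) }) ⨾
            cong₂ ℕ._+_ (⟦⟧-⊎ (e₂? ⊎-dec e₃?) e₂? e₃? (λ x → x) (λ x → x) (λ ((u , _) , (v , _)) → j≢k (sym u ⨾ v)))
              (⟦⟧-⊎ (inside3? r q a b c ⊎-dec inside3? p r a b c) (inside3? r q a b c) (inside3? p r a b c) (λ x → x)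
                  (λ x → x)
                (λ ((_ , x , _) , (_ , y , _)) → In-disjoint y x)))
          where
          rest? = (e₂? ⊎-dec e₃?) ⊎-dec (inside3? r q a b c ⊎-dec inside3? p r a b c)

module Elimination {n : ℕ} {D : Fin n → Diag} (triang : IsTriangulation n D) (a : Fin n → ℕ) (x : Fin n → K)
    (X : ℕ → ℕ → K) (top : ℕ)
    (X-label : ∀ {i p q} → D i ≡ (p , q) → X p q ≡ x i)
    (X-pos : ∀ {i p q} → D i ≡ (p , q) → Pos (X p q))
    (X-boundary : ∀ {p} → p < top → X p (suc p) ≡ 1K)
    (ptolemy : ∀ {a b c d} → a < b → b < c → c < d → d ≤ top → X a c ⊗ X b d ≡ X a b ⊗ X c d ⊕ X b c ⊗ X a d) where
  open Cycles.Regions triang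
  open Expansion D a X top X-pos X-boundary ptolemy

  weight : Fin n → K
  weight l = pow (inv (x l)) (a l)

  private
    Σ∘ : List (Fin n) → (Env n → K) → Env n → K
    Σ∘ = sumOver a weight

  treeWeight : ∀ {i p q} → Inner D i p q → Env n → K
  treeWeight (ear _) s = 1K
  treeWeight (glue {i} {j} {k} {p} {r} {q} _ _ _ tj tk) s =
    triangle (X p q) (X r q) (X p r) (σ3 a i j k) (σ3 a j k i) (σ3 a k i j) (s i) (s j) (s k)
        ⊗ (treeWeight tj s ⊗ treeWeight tk s)

  treeWeight-ext : ∀ {i p q} (t : Inner D i p q) → Extensional (treeWeight t)
  treeWeight-ext (ear _) h = refl
  treeWeight-ext (glue {i} {j} {k} {p} {r} {q} _ _ _ tj tk) {s} {s′} h = cong₂ _⊗_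
    (cong₂ (λ u v → triangle (X p q) (X r q) (X p r) (σ3 a i j k) (σ3 a j k i) (σ3 a k i j) u v (s k)) (h i) (h j) ⨾
      cong (triangle (X p q) (X r q) (X p r) (σ3 a i j k) (σ3 a j k i) (σ3 a k i j) (s′ i) (s′ j)) (h k))
    (cong₂ _⊗_ (treeWeight-ext tj h) (treeWeight-ext tk h))

  treeWeight-local : ∀ {i p q} (t : Inner D i p q) {l} → ¬ (l ∈ nodes t) → ∀ s v → treeWeight t (upd s l v)
      ≡ treeWeight t s
  treeWeight-local (ear _) h s v = refl
  treeWeight-local (glue {i} {j} {k} {p} {r} {q} _ _ _ tj tk) {l} h s v = cong₂ _⊗_
    (cong₂ (λ u w → triangle (X p q) (X r q) (X p r) (σ3 a i j k) (σ3 a j k i) (σ3 a k i j) u w (upd s l v k))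
        (upd-other s l i v λ { refl → h (here refl) }) (upd-other s l j v λ { refl → h (there (here refl)) }) ⨾
      cong (triangle (X p q) (X r q) (X p r) (σ3 a i j k) (σ3 a j k i) (σ3 a k i j) (s i) (s j))
        (upd-other s l k v λ { refl → h (there (∈-++⁺ʳ (nodes tj) (here refl))) }))
    (cong₂ _⊗_ (treeWeight-local tj (λ m → h (there (∈-++⁺ˡ m))) s v)
        (treeWeight-local tk (λ m → h (there (∈-++⁺ʳ (nodes tj) m))) s v))

  -- The triangle at the root involves no vertex strictly below j or k, and neither subtree involves
  -- a vertex of the other, so each subtree is summed out by itself.
  eliminate : ∀ {i p q} (t : Inner D i p q) s → Σ∘ (descendants t) (treeWeight t) s ≡ V t (s i)
  eliminate (ear _) s = refl
  eliminate (glue {i} {j} {k} {p} {r} {q} e p<r r<q tj tk) s = begin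
    Σ∘ (nodes tj ++ nodes tk) (λ s → W (s i) (s j) (s k) ⊗ (treeWeight tj s ⊗ treeWeight tk s)) s
      ≡⟨ sumOver-++ a weight (nodes tj) (nodes tk) _ s ⨾ sumOver-cong a weight (nodes tj) inner-sum s ⟩
    Σ∘ (nodes tj) (λ s → R (s i) (s j) ⊗ treeWeight tj s) s
      ≡⟨ cong (weight j ⊗_) (sumL-cong (a j) λ v _ → sumOver-pull a weight (descendants tj) (treeWeight tj)
          outer-independent (upd s j v) ⨾
           cong₂ _⊗_ (cong₂ R (upd-other s j i v (i≢j ∘ sym)) (upd-same s j v))
               (eliminate tj (upd s j v) ⨾ cong (V tj) (upd-same s j v))) ⟩
    weight j ⊗ sumL (a j) (λ v → R (s i) v ⊗ V tj v)
      ≡⟨ sym (sumL-*ˡ (a j) (weight j) _) ⨾ sumL-cong (a j) (λ v _ → expand v) ⟩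
    V (glue {i = i} {j} {k} e p<r r<q tj tk) (s i) ∎
    where
    open ≡-Reasoning
    W : List Bool → List Bool → List Bool → K
    W = triangle (X p q) (X r q) (X p r) (σ3 a i j k) (σ3 a j k i) (σ3 a k i j)
    R : List Bool → List Bool → K
    R u v = weight k ⊗ sumL (a k) (λ w → W u v w ⊗ V tk w)
    ej = inner-label tj
    ek = inner-label tk
    i≢j : i ≢ j
    i≢j refl = root-not-right e p<r (In-label ej)
    i≢k : i ≢ k
    i≢k refl = root-not-left e r<q (In-label ek)
    i∉ : ¬ (i ∈ nodes tj ++ nodes tk)
    i∉ = root∉ e p<r r<q tj tk
    j∉k : ∀ {l} → l ∈ nodes tk → ¬ (l ∈ nodes tj)
    j∉k y x = nodes-disjoint tj tk (x , y)
    j∉desc : ∀ {l} → l ∈ descendants tj → l ≢ j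
    j∉desc m refl = All.lookup (AllPairs.head (nodes-unique tj)) m refl
    k∉desc : ∀ {l} → l ∈ descendants tk → l ≢ k
    k∉desc m refl = All.lookup (AllPairs.head (nodes-unique tk)) m refl
    outer-independent : Independent a weight (λ s → R (s i) (s j)) (descendants tj)
    outer-independent {l} m s v = cong₂ R (upd-other s l i v λ { refl → i∉ (∈-++⁺ˡ (there m)) })
        (upd-other s l j v (j∉desc m))
    inner-independent : Independent a weight (λ s → W (s i) (s j) (s k) ⊗ treeWeight tj s) (descendants tk)
    inner-independent {l} m s v = cong₂ _⊗_
      (cong₂ (λ u w → W u w (upd s l v k)) (upd-other s l i v λ { refl → i∉ (∈-++⁺ʳ (nodes tj) (there m)) })
          (upd-other s l j v λ { refl → j∉k (there m) (here refl) }) ⨾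
        cong (W (s i) (s j)) (upd-other s l k v (k∉desc m)))
      (treeWeight-local tj (j∉k (there m)) s v)
    inner-sum : ∀ s → Σ∘ (nodes tk) (λ s → W (s i) (s j) (s k) ⊗ (treeWeight tj s ⊗ treeWeight tk s)) s
        ≡ R (s i) (s j) ⊗ treeWeight tj s
    inner-sum s = sumOver-cong a weight (nodes tk) (λ s → sym (*-assoc _ _ _)) s ⨾
      (cong (weight k ⊗_) ((sumL-cong (a k) λ w _ → sumOver-pull a weight (descendants tk) (treeWeight tk)
          inner-independent (upd s k w) ⨾
          (cong₂ _⊗_ (cong₂ _⊗_ (cong₂ (λ u v → W u v (upd s k w k)) (upd-other s k i w (i≢k ∘ sym))
              (upd-other s k j w λ { refl → j∉k (here refl) (here refl) }) ⨾
              cong (W (s i) (s j)) (upd-same s k w)) (treeWeight-local tj (j∉k (here refl)) s w))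
            (eliminate tk (upd s k w) ⨾ cong (V tk) (upd-same s k w)) ⨾
          (solve 3 (λ x y z → x :* y :* z := (x :* z) :* y) refl (W (s i) (s j) w) (treeWeight tj s) (V tk w)))) ⨾
        sumL-*ʳ (a k) (treeWeight tj s) _) ⨾ sym (*-assoc _ _ _))
    expand : ∀ v → weight j ⊗ (R (s i) v ⊗ V tj v) ≡ sumL (a k) λ w → W (s i) v w
        ⊗ (pow (inv (X r q)) (a j) ⊗ V tj v ⊗ (pow (inv (X p r)) (a k) ⊗ V tk w))
    expand v = (solve 4 (λ x y z w → x :* (y :* z :* w) := (x :* w :* y) :* z) refl (weight j) (weight k)
        (sumL (a k) (λ w → W (s i) v w ⊗ V tk w)) (V tj v)) ⨾
      (sym (sumL-*ˡ (a k) (weight j ⊗ V tj v ⊗ weight k) _) ⨾ sumL-cong (a k) λ w _ →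
        (solve 5 (λ x y z w u → x :* y :* z :* (w :* u) := w :* (x :* y :* (z :* u))) refl (weight j) (V tj v)
            (weight k) (W (s i) v w) (V tk w)) ⨾
        cong₂ (λ y z → W (s i) v w ⊗ (pow (inv y) (a j) ⊗ V tj v ⊗ (pow (inv z) (a k) ⊗ V tk w))) (sym (X-label ej))
            (sym (X-label ek)))

  -- Every vertex occurs exactly once in the tree, so the order of summation may follow it. The
  -- empty initial environment is immaterial, being overwritten at each vertex.
  ∑-treeWeight : ∀ {i p q} (t : Inner D i p q) → (∀ l → In p q l) →
    ∏ weight ⊗ ∑ (allSeqs n a) (treeWeight t ∘ lists) ≡ weight i ⊗ sumL (a i) (V t)
  ∑-treeWeight {i} t all-in = ∑-allSeqs n a weight (treeWeight-ext t) (λ _ → []) ⨾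
    (sumOver-↭ a weight allFin↭nodes (treeWeight-ext t) (λ _ → []) ⨾
    cong (weight i ⊗_) (sumL-cong (a i) λ v _ → eliminate t (upd (λ _ → []) i v)
        ⨾ cong (V t) (upd-same (λ _ → []) i v)))
    where
    allFin↭nodes : allFin n ↭ nodes t
    allFin↭nodes = ∼bag⇒↭ (unique∧set⇒bag (UniqueP.allFin⁺ n) (nodes-unique t)
        (mk⇔ (λ _ → in-nodes t (all-in _)) (λ _ → ∈-allFin _)))

-- The exponents and compatibility conditions

nth : List Bool → ℕ → Bool
nth [] t = false
nth (b ∷ v) zero = b
nth (b ∷ v) (suc t) = nth v t

atZ-nth : ∀ {m} (v : Vec Bool m) t → atZ v t ≡ nth (toList v) t
atZ-nth [] t = refl
atZ-nth (b ∷ v) zero = refl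
atZ-nth (b ∷ v) (suc t) = atZ-nth v t

nth-∷ʳ-< : ∀ u b t → t < length u → nth (u ∷ʳ b) t ≡ nth u t
nth-∷ʳ-< (c ∷ u) b zero h = refl
nth-∷ʳ-< (c ∷ u) b (suc t) (s≤s h) = nth-∷ʳ-< u b t h

nth-∷ʳ-≡ : ∀ u b → nth (u ∷ʳ b) (length u) ≡ b
nth-∷ʳ-≡ [] b = refl
nth-∷ʳ-≡ (c ∷ u) b = nth-∷ʳ-≡ u b

nth-reverse : ∀ u t → t < length u → nth (reverse u) t ≡ nth u (length u ∸ suc t)
nth-reverse (b ∷ u) t (s≤s h) = cong (λ w → nth w t) (ListP.unfold-reverse b u) ⨾ cases (ℕP.m≤n⇒m<n∨m≡n h)
  where
  cases : t < length u ⊎ t ≡ length u → nth (reverse u ∷ʳ b) t ≡ nth (b ∷ u) (length u ∸ t)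
  cases (inj₁ t<) = nth-∷ʳ-< (reverse u) b t (subst (t <_) (sym (ListP.length-reverse u)) t<) ⨾
    (nth-reverse u t t< ⨾ cong (nth (b ∷ u)) (sym (ℕP.+-∸-assoc 1 t<)))
  cases (inj₂ refl) = cong (nth (reverse u ∷ʳ b)) (sym (ListP.length-reverse u))
      ⨾ (nth-∷ʳ-≡ (reverse u) b ⨾ cong (nth (b ∷ u)) (sym (ℕP.n∸n≡0 (length u))))

T-ext : ∀ {b c} → (T b → T c) → (T c → T b) → b ≡ c
T-ext {true} {true} f g = refl
T-ext {true} {false} f g = contradiction (f tt) λ ()
T-ext {false} {true} f g = contradiction (g tt) λ ()
T-ext {false} {false} f g = refl

compatible⇒ : ∀ N u v → N ≤ length u → N ≤ length v → T (compatible N u v) → ∀ t → t < N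
    → T (notOneZero (nth u t) (nth v t))
compatible⇒ (suc N) (b ∷ u) (c ∷ v) (s≤s h) (s≤s h′) x t t<N with Equivalence.to (T-∧ {notOneZero b c}) x
compatible⇒ (suc N) (b ∷ u) (c ∷ v) (s≤s h) (s≤s h′) x zero t<N | y , z = y
compatible⇒ (suc N) (b ∷ u) (c ∷ v) (s≤s h) (s≤s h′) x (suc t) (s≤s t<N) | y , z = compatible⇒ N u v h h′ z t t<N

compatible⇐ : ∀ N u v → (∀ t → t < N → T (notOneZero (nth u t) (nth v t))) → T (compatible N u v)
compatible⇐ zero u v h = tt
compatible⇐ (suc N) [] v h = tt
compatible⇐ (suc N) (b ∷ u) [] h = tt
compatible⇐ (suc N) (b ∷ u) (c ∷ v) h = Equivalence.from T-∧
    (h 0 (s≤s z≤n) , compatible⇐ N u v λ t t<N → h (suc t) (s≤s t<N))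

forT-compatible : ∀ N (p q : ℕ → Bool) u v → N ≤ length u → N ≤ length v →
  (∀ t → t < N → p (suc t) ≡ nth u t) → (∀ t → t < N → q (suc t) ≡ nth v t) →
  forT N (λ t → notOneZero (p t) (q t)) ≡ compatible N u v
forT-compatible N p q u v hu hv ep eq = T-ext
  (λ x → compatible⇐ N u v λ t t<N → subst₂ (λ b c → T (notOneZero b c)) (ep t t<N) (eq t t<N)
     (All.lookup (AllP.all⁺ (λ t → notOneZero (p (suc t)) (q (suc t))) (upTo N) x) (∈-upTo⁺ t<N)))
  (λ x → AllP.all⁻ (λ t → notOneZero (p (suc t)) (q (suc t))) (All.tabulate λ {t} m →
     subst₂ (λ b c → T (notOneZero b c)) (sym (ep t (∈-upTo⁻ m))) (sym (eq t (∈-upTo⁻ m)))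
         (compatible⇒ N u v hu hv x t (∈-upTo⁻ m))))

at-front : ∀ {m} (v : Vec Bool m) t → at v (suc t) ≡ nth (toList v) t
at-front v t = atZ-nth v t

-- With t counted from 0, the 1-based position m + 1 - (t + 1) from the front is the 0-based
-- position t from the back.
at-back : ∀ {m} (v : Vec Bool m) t → t < m → at v (m ℕ.+ 1 ∸ suc t) ≡ nth (reverse (toList v)) t
at-back {m} v t t<m = atZ-nth v _ ⨾ (cong (nth (toList v)) index
    ⨾ sym (nth-reverse (toList v) t (subst (t <_) (sym (VecP.length-toList v)) t<m)))
  where
  index : m ℕ.+ 1 ∸ suc t ∸ 1 ≡ length (toList v) ∸ suc t
  index rewrite VecP.length-toList v | ℕP.+-comm m 1 = ℕP.∸-+-assoc m t 1 ⨾ cong (m ∸_) (ℕP.+-comm t 1)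

half-double : ∀ {k x} → k ≤ x ℕ.+ x → ⌊ k /2⌋ ≤ x
half-double {x = x} h = ℕP.≤-trans (ℕP.⌊n/2⌋-mono h) (ℕP.≤-reflexive (sym (ℕP.n≡⌊n+n/2⌋ x)))

-- Valid for arbitrary arguments. It keeps the conditions from reading past the end of a sequence,
-- where `atZ` would return its default. When y exceeds x + z, the last subtraction removes the
-- excess.
σ-bound : ∀ x y z → σ x y z ≤ x
σ-bound x y z = half-double (ℕP.≤-trans (ℕP.∸-monoˡ-≤ (y ∸ (x ℕ.+ z)) (ℕP.m∸n≤m (x ℕ.+ y ∸ z) (x ∸ (y ℕ.+ z)))) main)
  where
  main : x ℕ.+ y ∸ z ∸ (y ∸ (x ℕ.+ z)) ≤ x ℕ.+ x
  main with ℕP.≤-total y (x ℕ.+ z)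
  ... | inj₁ h = ℕP.≤-trans (ℕP.m∸n≤m (x ℕ.+ y ∸ z) (y ∸ (x ℕ.+ z))) (ℕP.m≤n+o⇒m∸n≤o (x ℕ.+ y) z
        (subst (x ℕ.+ y ≤_) (sym (ℕP.+-assoc x x z) ⨾ ℕP.+-comm (x ℕ.+ x) z) (ℕP.+-monoʳ-≤ x h)))
  ... | inj₂ h with ℕP.m≤n⇒∃[o]m+o≡n h
  ...   | o , refl = ℕP.≤-reflexive (cong₂ _∸_ (cong (_∸ z) (rearrange x z o) ⨾ ℕP.m+n∸n≡m (x ℕ.+ x ℕ.+ o) z)
      (ℕP.m+n∸m≡n (x ℕ.+ z) o) ⨾ ℕP.m+n∸n≡m (x ℕ.+ x) o)
    where
    rearrange : ∀ x z o → x ℕ.+ (x ℕ.+ z ℕ.+ o) ≡ x ℕ.+ x ℕ.+ o ℕ.+ z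
    rearrange = solveℕ 3 (λ x z o → x :+ℕ (x :+ℕ z :+ℕ o) :=ℕ x :+ℕ x :+ℕ o :+ℕ z) refl

σ-sym : ∀ x y z → σ x y z ≡ σ y x z
σ-sym x y z = cong ⌊_/2⌋ (ℕP.∸-+-assoc (x ℕ.+ y ∸ z) (x ∸ (y ℕ.+ z)) (y ∸ (x ℕ.+ z)) ⨾
  (cong₂ _∸_ (cong (_∸ z) (ℕP.+-comm x y)) (ℕP.+-comm (x ∸ (y ℕ.+ z)) _)
      ⨾ sym (ℕP.∸-+-assoc (y ℕ.+ x ∸ z) (y ∸ (x ℕ.+ z)) (x ∸ (y ℕ.+ z)))))

σ-bound′ : ∀ x y z → σ x y z ≤ y
σ-bound′ x y z = subst (_≤ y) (σ-sym y x z) (σ-bound y x z)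

zeros-toList : ∀ {m} (v : Vec Bool m) → m ∸ ones v ≡ zeros₀ (toList v)
zeros-toList [] = refl
zeros-toList (true ∷ v) = zeros-toList v
zeros-toList (false ∷ v) = ℕP.+-∸-assoc 1 (bounded v) ⨾ cong suc (zeros-toList v)
  where
  bounded : ∀ {m} (v : Vec Bool m) → ones v ≤ m
  bounded [] = z≤n
  bounded (true ∷ v) = s≤s (bounded v)
  bounded (false ∷ v) = ℕP.m≤n⇒m≤1+n (bounded v)

ones-toList : ∀ {m} (v : Vec Bool m) → ones v ≡ ones₀ (toList v)
ones-toList [] = refl
ones-toList (true ∷ v) = cong suc (ones-toList v)
ones-toList (false ∷ v) = ones-toList v

-- The part of `isGCS` that concerns one 3-cycle. The distance d is a variable, so that the outcomes
-- of its comparisons can be rewritten.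
cycleCondition : ∀ {n} (d : Fin n → ℕ) (a : Fin n → ℕ) → Seq a → Fin n → Fin n → Fin n → Bool
cycleCondition d a s i j k = let N = σ3 a i j k in
  (not ((d i <ᵇ d j) ∧ (d j <ᵇ d k)) ∨ forT N (λ t → notOneZero (at (s i) t) (at (s j) t))) ∧
  (not ((d j <ᵇ d k) ∧ (d k <ᵇ d i)) ∨ forT N (λ t → notOneZero (at (s i) (a i ℕ.+ 1 ∸ t))
      (at (s j) (a j ℕ.+ 1 ∸ t)))) ∧
  (not ((d k <ᵇ d i) ∧ (d i <ᵇ d j)) ∨ forT N (λ t → notOneZero (at (s i) (a i ℕ.+ 1 ∸ t)) (at (s j) t)))

<⇒<ᵇ-true : ∀ {m n} → m < n → (m <ᵇ n) ≡ true
<⇒<ᵇ-true h = T-ext (λ _ → tt) (λ _ → ℕP.<⇒<ᵇ h)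

≤⇒<ᵇ-false : ∀ {m n} → n ≤ m → (m <ᵇ n) ≡ false
≤⇒<ᵇ-false {m} {n} h = T-ext (λ t → contradiction (ℕP.<ᵇ⇒< m n t) (ℕP.≤⇒≯ h)) (λ ())

module _ {n} (d a : Fin n → ℕ) (s : Seq a) {i j k : Fin n} (dj : d j ≡ 1 ℕ.+ d i) (dk : d k ≡ 2 ℕ.+ d i) where
  private
    i<j : (d i <ᵇ d j) ≡ true
    i<j = <⇒<ᵇ-true (ℕP.≤-reflexive (sym dj))
    j<k : (d j <ᵇ d k) ≡ true
    j<k = <⇒<ᵇ-true (ℕP.≤-reflexive (cong suc dj ⨾ sym dk))
    k≮i : (d k <ᵇ d i) ≡ false
    k≮i = ≤⇒<ᵇ-false (subst (d i ≤_) (sym dk) (ℕP.m≤n+m (d i) 2))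
    S : Env n
    S = lists s
    fits : ∀ l {N} → N ≤ a l → N ≤ length (S l)
    fits l = subst (_ ≤_) (sym (VecP.length-toList (s l)))
    fits-reverse : ∀ l {N} → N ≤ a l → N ≤ length (reverse (S l))
    fits-reverse l h = subst (_ ≤_) (sym (ListP.length-reverse (S l))) (fits l h)

  -- With distances d, d + 1, d + 2 exactly one of the three implications is active for each
  -- rotation of the cycle; the other two hold vacuously.
  condition-ij : cycleCondition d a s i j k ≡ compatible (σ3 a i j k) (S i) (S j)
  condition-ij rewrite i<j | j<k | k≮i = ∧-identityʳ _ ⨾
    forT-compatible (σ3 a i j k) (at (s i)) (at (s j)) (S i) (S j) (fits i (σ-bound (a i) (a j) (a k)))
        (fits j (σ-bound′ (a i) (a j) (a k)))
      (λ t _ → at-front (s i) t) (λ t _ → at-front (s j) t)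

  condition-jk : cycleCondition d a s j k i ≡ compatible (σ3 a j k i) (reverse (S j)) (S k)
  condition-jk rewrite i<j | j<k | k≮i =
    forT-compatible (σ3 a j k i) (λ t → at (s j) (a j ℕ.+ 1 ∸ t)) (at (s k)) (reverse (S j)) (S k)
      (fits-reverse j (σ-bound (a j) (a k) (a i))) (fits k (σ-bound′ (a j) (a k) (a i)))
      (λ t h → at-back (s j) t (ℕP.<-≤-trans h (σ-bound (a j) (a k) (a i)))) (λ t _ → at-front (s k) t)

  condition-ki : cycleCondition d a s k i j ≡ compatible (σ3 a k i j) (reverse (S k)) (reverse (S i))
  condition-ki rewrite i<j | j<k | k≮i = ∧-identityʳ _ ⨾
    forT-compatible (σ3 a k i j) (λ t → at (s k) (a k ℕ.+ 1 ∸ t)) (λ t → at (s i) (a i ℕ.+ 1 ∸ t)) (reverse (S k))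
        (reverse (S i))
      (fits-reverse k (σ-bound (a k) (a i) (a j))) (fits-reverse i (σ-bound′ (a k) (a i) (a j)))
      (λ t h → at-back (s k) t (ℕP.<-≤-trans h (σ-bound (a k) (a i) (a j))))
          (λ t h → at-back (s i) t (ℕP.<-≤-trans h (σ-bound′ (a k) (a i) (a j))))

indicator-allFin : ∀ {n} (p : Fin n → Bool) → indicator (allFin? p) ≡ ∏ (indicator ∘ p)
indicator-allFin p = go p (λ i → i)
  where
  go : ∀ {m n} (p : Fin n → Bool) (f : Fin m → Fin n) → indicator (all p (tabulate f)) ≡ ∏ (λ i → indicator (p (f i)))
  go {zero} p f = refl
  go {suc m} p f = indicator-∧ (p (f zero)) _ ⨾ cong (indicator (p (f zero)) ⊗_) (go p (f ∘ suc))

pow-⟦⟧ : ∀ {P : Set} (d : Dec P) b y → (T b → P) → (P → T b) → indicator (not b ∨ y) ≡ pow (indicator y) ⟦ d ⟧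
pow-⟦⟧ (yes p) true y f g = sym (*-identityʳ _)
pow-⟦⟧ (no ¬p) true y f g = contradiction (f tt) ¬p
pow-⟦⟧ (yes p) false y f g = contradiction (g p) λ ()
pow-⟦⟧ (no ¬p) false y f g = refl

pow-mul : ∀ x k l → pow x (k ℕ.* l) ≡ pow (pow x l) k
pow-mul x zero l = refl
pow-mul x (suc k) l = pow-+ x l (k ℕ.* l) ⨾ cong (pow x l ⊗_) (pow-mul x k l)

zpow-⊖ : ∀ {x} → Pos x → ∀ k l → zpow x (k ⊖ l) ≡ pow x k ⊗ pow (inv x) l
zpow-⊖ px k zero = refl
zpow-⊖ px zero (suc l) = refl
zpow-⊖ {x} px (suc k) (suc l) = cong (zpow x) (ℤP.[1+m]⊖[1+n]≡m⊖n k l) ⨾ (zpow-⊖ px k l ⨾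
  (sym (*-identityˡ _) ⨾ (cong (_⊗ (pow x k ⊗ pow (inv x) l)) (sym (inv-right px)) ⨾
  (solve 4 (λ x i a b → x :* i :* (a :* b) := x :* a :* (i :* b)) refl (x) (inv x) (pow x k) (pow (inv x) l)))))

zpow-neg : ∀ {x} k → zpow x (ℤ.- (+ k)) ≡ pow (inv x) k
zpow-neg zero = *-identityˡ _
zpow-neg (suc k) = *-identityˡ _

∏-*₃ : ∀ {n} (f g h : Fin n → Fin n → K) → ∏ (λ j → ∏ (f j)) ⊗ ∏ (λ j → ∏ (g j)) ⊗ ∏ (λ j → ∏ (h j))
    ≡ ∏ (λ j → ∏ (λ k → f j k ⊗ g j k ⊗ h j k))
∏-*₃ f g h = sym (∏-cong (λ j → ∏-* (λ k → f j k ⊗ g j k) (h j) ⨾ cong (_⊗ ∏ (h j)) (∏-* (f j) (g j))) ⨾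
  (∏-* (λ j → ∏ (f j) ⊗ ∏ (g j)) (λ j → ∏ (h j)) ⨾ cong (_⊗ ∏ (λ j → ∏ (h j))) (∏-* (λ j → ∏ (f j)) (λ j → ∏ (g j)))))

module Formula {n : ℕ} {D : Fin n → Diag} (triang : IsTriangulation n D) {i₀ : Fin n}
    (root-label : D i₀ ≡ (0 , suc n))
    (in-cycle : ∀ {i j} → Arrow D i j → ∃ λ k → Arrow D j k × Arrow D k i)
    (Q : Quiver n) (Q-arrow : ∀ i j → Q i j ≡ ⟦ Arrows.arrow? triang i j ⟧)
    (x : Fin n → K) (x-pos : ∀ i → Pos (x i)) (a : Fin n → ℕ) where
  open Arrows triang using (arrow?)
  open Cycles triang
  open Regions
  open Rooted triang root-label in-cycle
  open CycleProduct triang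
  open Evaluate x x-pos

  private
    d : Fin n → ℕ
    d = dist Q i₀

    step⇒ : ∀ {i j} → T (0 <ᵇ Q i j) → Arrow D i j
    step⇒ {i} {j} t = ⟦⟧-true (arrow? i j) (subst (0 <_) (Q-arrow i j) (ℕP.<ᵇ⇒< 0 (Q i j) t))

    step⇐ : ∀ {i j} → Arrow D i j → T (0 <ᵇ Q i j)
    step⇐ {i} {j} y = ℕP.<⇒<ᵇ (subst (0 <_) (sym (trans (Q-arrow i j) (⟦⟧-yes (arrow? i j) y))) (s≤s z≤n))

    cycle3⇒ : ∀ {i j k} → T (cycle3B Q i j k) → Cycle i j k
    cycle3⇒ {i} {j} {k} t with Equivalence.to (T-∧ {0 <ᵇ Q i j}) t
    ... | u , t′ with Equivalence.to (T-∧ {0 <ᵇ Q j k}) t′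
    ...   | v , w = step⇒ u , step⇒ v , step⇒ w

    cycle3⇐ : ∀ {i j k} → Cycle i j k → T (cycle3B Q i j k)
    cycle3⇐ (u , v , w) = Equivalence.from T-∧ (step⇐ u , Equivalence.from T-∧ (step⇐ v , step⇐ w))

    -- Every arrow lies in a 3-cycle by hypothesis, and in only one by `third-unique`. Thus the
    -- first two sums in the exponent become sums over 3-cycles like the third.
    Q-sum : ∀ i j → Q i j ≡ sumℕ (λ k → ⟦ cycle? i j k ⟧)
    Q-sum i j = Q-arrow i j ⨾ cases (arrow? i j)
      where
      cases : (y : Dec (Arrow D i j)) → ⟦ y ⟧ ≡ sumℕ (λ k → ⟦ cycle? i j k ⟧)
      cases (no h) = sym (sumℕ-0 λ k → ⟦⟧-no (cycle? i j k) (h ∘ proj₁))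
      cases (yes y) with in-cycle y
      ... | k , u , v = sym (sumℕ-single k (λ k′ ne → ⟦⟧-no (cycle? i j k′) λ c → ne (third-unique c (y , u , v)))
          ⨾ ⟦⟧-yes (cycle? i j k) (y , u , v))

    Q-sum′ : ∀ k i → Q k i ≡ sumℕ (λ j → ⟦ cycle? i j k ⟧)
    Q-sum′ k i = Q-sum k i ⨾ sumℕ-cong λ j → ⟦⟧-⇔ (cycle? k i j) (cycle? i j k) cycle-rotate
        (cycle-rotate ∘ cycle-rotate)

    Q-product : ∀ i j k → Q i j ℕ.* Q j k ℕ.* Q k i ≡ ⟦ cycle? i j k ⟧
    Q-product i j k rewrite Q-arrow i j | Q-arrow j k | Q-arrow k i = cases (arrow? i j) (arrow? j k) (arrow? k i)
        (cycle? i j k)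
      where
      cases : ∀ {A B C : Set} (u : Dec A) (v : Dec B) (w : Dec C) (y : Dec (A × B × C)) → ⟦ u ⟧ ℕ.* ⟦ v ⟧ ℕ.* ⟦ w ⟧
          ≡ ⟦ y ⟧
      cases (no h) v w y = sym (⟦⟧-no y (h ∘ proj₁))
      cases (yes p) (no h) w y = sym (⟦⟧-no y (h ∘ proj₁ ∘ proj₂))
      cases (yes p) (yes q) (no h) y = sym (⟦⟧-no y (h ∘ proj₂ ∘ proj₂))
      cases (yes p) (yes q) (yes r) y = sym (⟦⟧-yes y (p , q , r))

  module _ (s : Seq a) where
    private
      S : Env n
      S = lists s

    exponentPart : Fin n → Fin n → Fin n → K
    exponentPart i j k = pow (x i) (zeros₀ (S j)) ⊗ pow (x i) (ones₀ (S k)) ⊗ pow (inv (x i)) (σ3 a j k i)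

    cycleFactor : Fin n → Fin n → Fin n → K
    cycleFactor i j k = exponentPart i j k ⊗ indicator (cycleCondition d a s i j k)

    indicator-isGCS : indicator (isGCS Q i₀ a s) ≡ ∏³ (λ i j k
        → pow (indicator (cycleCondition d a s i j k)) ⟦ cycle? i j k ⟧)
    indicator-isGCS = indicator-allFin (λ i → allFin? λ j → allFin? λ k
        → not (cycle3B Q i j k) ∨ cycleCondition d a s i j k) ⨾
      ∏-cong λ i → indicator-allFin (λ j → allFin? λ k → not (cycle3B Q i j k) ∨ cycleCondition d a s i j k) ⨾
      ∏-cong λ j → indicator-allFin (λ k → not (cycle3B Q i j k) ∨ cycleCondition d a s i j k) ⨾
      ∏-cong λ k → pow-⟦⟧ (cycle? i j k) (cycle3B Q i j k) (cycleCondition d a s i j k) cycle3⇒ cycle3⇐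

    zpow-expo : ∀ i → zpow (x i) (expo Q a s i) ≡ ∏ (λ j → ∏ (λ k → pow (exponentPart i j k) ⟦ cycle? i j k ⟧))
    zpow-expo i = begin
      zpow y (expo Q a s i)
        ≡⟨ cong (zpow y) (ℤP.m-n≡m⊖n (A ℕ.+ B) C) ⨾ zpow-⊖ (x-pos i) (A ℕ.+ B) C ⟩
      pow y (A ℕ.+ B) ⊗ pow (inv y) C
        ≡⟨ cong (_⊗ pow (inv y) C) (pow-+ y A B) ⟩
      pow y A ⊗ pow y B ⊗ pow (inv y) C
        ≡⟨ cong₂ _⊗_ (cong₂ _⊗_ eA eB) eC ⟩
      ∏ (λ j → ∏ (fA j)) ⊗ ∏ (λ j → ∏ (fB j)) ⊗ ∏ (λ j → ∏ (fC j))
        ≡⟨ ∏-*₃ fA fB fC ⟩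
      ∏ (λ j → ∏ (λ k → fA j k ⊗ fB j k ⊗ fC j k))
        ≡⟨ ∏-cong (λ j → ∏-cong λ k → sym (pow-* (pow y (zeros₀ (S j)) ⊗ pow y (ones₀ (S k)))
            (pow (inv y) (σ3 a j k i)) ⟦ cycle? i j k ⟧ ⨾
             cong (_⊗ fC j k) (pow-* (pow y (zeros₀ (S j))) (pow y (ones₀ (S k))) ⟦ cycle? i j k ⟧))) ⟩
      ∏ (λ j → ∏ (λ k → pow (exponentPart i j k) ⟦ cycle? i j k ⟧)) ∎
      where
      open ≡-Reasoning
      y : K
      y = x i
      A B C : ℕ
      A = sumℕ (λ j → Q i j ℕ.* (a j ∸ ones (s j)))
      B = sumℕ (λ k → Q k i ℕ.* ones (s k))
      C = sumℕ (λ j → sumℕ (λ k → Q i j ℕ.* Q j k ℕ.* Q k i ℕ.* σ3 a j k i))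
      fA fB fC : Fin n → Fin n → K
      fA j k = pow (pow y (zeros₀ (S j))) ⟦ cycle? i j k ⟧
      fB j k = pow (pow y (ones₀ (S k))) ⟦ cycle? i j k ⟧
      fC j k = pow (pow (inv y) (σ3 a j k i)) ⟦ cycle? i j k ⟧
      eA : pow y A ≡ ∏ (λ j → ∏ (fA j))
      eA = pow-sumℕ y (λ j → Q i j ℕ.* (a j ∸ ones (s j))) ⨾ ∏-cong λ j → pow-mul y (Q i j) (a j ∸ ones (s j)) ⨾
        (cong₂ (λ e q → pow (pow y e) q) (zeros-toList (s j)) (Q-sum i j)
            ⨾ pow-sumℕ (pow y (zeros₀ (S j))) (λ k → ⟦ cycle? i j k ⟧))
      eB : pow y B ≡ ∏ (λ j → ∏ (fB j))
      eB = (pow-sumℕ y (λ k → Q k i ℕ.* ones (s k)) ⨾ ∏-cong λ k → pow-mul y (Q k i) (ones (s k)) ⨾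
        (cong₂ (λ e q → pow (pow y e) q) (ones-toList (s k)) (Q-sum′ k i)
            ⨾ pow-sumℕ (pow y (ones₀ (S k))) (λ j → ⟦ cycle? i j k ⟧))) ⨾
        ∏-swap (λ k j → fB j k)
      eC : pow (inv y) C ≡ ∏ (λ j → ∏ (fC j))
      eC = pow-sumℕ (inv y) (λ j → sumℕ (λ k → Q i j ℕ.* Q j k ℕ.* Q k i ℕ.* σ3 a j k i)) ⨾ ∏-cong λ j →
        pow-sumℕ (inv y) (λ k → Q i j ℕ.* Q j k ℕ.* Q k i ℕ.* σ3 a j k i) ⨾ ∏-cong λ k →
        pow-mul (inv y) (Q i j ℕ.* Q j k ℕ.* Q k i) (σ3 a j k i)
            ⨾ cong (pow (pow (inv y) (σ3 a j k i))) (Q-product i j k)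

    -- Exponents and compatibility are both indexed by oriented 3-cycles, and the latter correspond
    -- to the rotations of the triangles of the tree.
    summand : indicator (isGCS Q i₀ a s) ⊗ ∏ (λ i → zpow (x i) (expo Q a s i)) ≡ treeProduct cycleFactor root
    summand = cong₂ _⊗_ indicator-isGCS (∏-cong zpow-expo) ⨾ (*-comm _ _ ⨾
      (sym (∏³-* (λ i j k → pow (exponentPart i j k) ⟦ cycle? i j k ⟧)
          (λ i j k → pow (indicator (cycleCondition d a s i j k)) ⟦ cycle? i j k ⟧)) ⨾
      (∏³-cong (λ i j k → sym (pow-* (exponentPart i j k) (indicator (cycleCondition d a s i j k)) ⟦ cycle? i j k ⟧) ⨾
        cong (pow (cycleFactor i j k)) (⟦⟧-⇔ (cycle? i j k) (inside3? 0 (suc n) i j k)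
            (λ c → c , all-in i , all-in j , all-in k) proj₁)) ⨾
      cycle-product cycleFactor root)))

  module _ (X : ℕ → ℕ → K) (top : ℕ)
      (X-label : ∀ {i p q} → D i ≡ (p , q) → X p q ≡ x i)
      (X-pos : ∀ {i p q} → D i ≡ (p , q) → Pos (X p q))
      (X-boundary : ∀ {p} → p < top → X p (suc p) ≡ 1K)
      (ptolemy : ∀ {a b c d} → a < b → b < c → c < d → d ≤ top → X a c ⊗ X b d ≡ X a b ⊗ X c d ⊕ X b c ⊗ X a d) where
    open Elimination triang a x X top X-label X-pos X-boundary ptolemy
    open Expansion D a X top X-pos X-boundary ptolemy

    treeProduct-weight : ∀ (s : Seq a) {i p q} (t : Inner D i p q) → treeProduct (cycleFactor s) t
        ≡ treeWeight t (lists s)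
    treeProduct-weight s (ear _) = refl
    treeProduct-weight s (glue {i} {j} {k} {p} {r} {q} e p<r r<q tj tk) = cong₂ _⊗_
        (cong₂ _⊗_ (factor i j k e (condition-ij d a s dj dk))
          (cong₂ _⊗_ (factor j k i (inner-label tj) (condition-jk d a s dj dk))
              (factor k i j (inner-label tk) (condition-ki d a s dj dk))))
        (cong₂ _⊗_ (treeProduct-weight s tj) (treeProduct-weight s tk))
      where
      sorted : Sorted3 D i j k
      sorted = sorted3 p<r r<q e (inner-label tj) (inner-label tk)
      dj : d j ≡ 1 ℕ.+ d i
      dj = dist-distance Q Q-arrow j ⨾ (proj₁ (cycle-distance sorted) ⨾ cong suc (sym (dist-distance Q Q-arrow i)))
      dk : d k ≡ 2 ℕ.+ d i
      dk = dist-distance Q Q-arrow k ⨾ (proj₂ (cycle-distance sorted)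
          ⨾ cong (2 ℕ.+_) (sym (dist-distance Q Q-arrow i)))
      factor : ∀ α β γ {u v b} → D α ≡ (u , v) → cycleCondition d a s α β γ ≡ b →
        cycleFactor s α β γ ≡ pow (X u v) (zeros₀ (lists s β)) ⊗ pow (X u v) (ones₀ (lists s γ))
            ⊗ pow (inv (X u v)) (σ3 a β γ α) ⊗ indicator b
      factor α β γ eα eb = cong₂ (λ y b → pow y (zeros₀ (lists s β)) ⊗ pow y (ones₀ (lists s γ))
          ⊗ pow (inv y) (σ3 a β γ α) ⊗ indicator b) (sym (X-label eα)) eb

    -- What remains is the ear 0, n + 1, z on the far side of the root. Its other sides have length
    -- 1, so adding the two entries of a ray b and dividing by x i₀ is the Ptolemy relation of 0 < b
    -- < n + 1 < z.
    formula-value : ∀ {bs C z} → z ≡ suc (suc n) → z ≤ top → X 0 z ≡ 1K → Arcs 0 (suc n) bs C →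
      gcsFormula Q i₀ a ≐ (∏L bs (λ b → X b z) ⊗ ∏L C arc)
    formula-value {bs} {C} {z} refl z≤top X0z A = subst (gcsFormula Q i₀ a ≐_) value
      (≐-* {laurent (λ l → ℤ.- (+ a l))} {sumListF (concatMap
          (λ s → if isGCS Q i₀ a s then laurent (expo Q a s) ∷ [] else []) (allSeqs n a))}
        (≐-laurent (λ l → ℤ.- (+ a l)))
        (≐-sumList (allSeqs n a) (isGCS Q i₀ a) (λ s → laurent (expo Q a s))
            (λ s → ∏ (λ i → zpow (x i) (expo Q a s i))) (λ s → ≐-laurent (expo Q a s))))
      where
      open ≡-Reasoning
      open Arcs A
      ray-sum : ∀ {b} → b ∈ bs → inv (x i₀) ⊗ ∑₂ (ray 0 (suc n) b) ≡ X b z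
      ray-sum {b} m = *-cancelʳ-pos (x-pos i₀) ((solve 3 (λ i y u → i :* u :* y := y :* i :* u) refl (inv (x i₀))
          (x i₀) (∑₂ (ray 0 (suc n) b))) ⨾
        (cong (_⊗ ∑₂ (ray 0 (suc n) b)) (inv-right (x-pos i₀))
            ⨾ (*-identityˡ _ ⨾ (sym relation ⨾ cong (X b z ⊗_) (X-label root-label)))))
        where
        relation : X b z ⊗ X 0 (suc n) ≡ X b (suc n) ⊕ X 0 b
        relation = *-comm _ _ ⨾ (ptolemy (proj₁ (range m)) (proj₂ (range m)) (ℕP.n<1+n (suc n)) z≤top ⨾
          (cong₂ _⊕_ (cong (X 0 b ⊗_) (X-boundary z≤top) ⨾ *-identityʳ _) (cong (X b (suc n) ⊗_) X0z ⨾ *-identityʳ _)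
              ⨾ +-comm _ _))
      value : ∏ (λ l → zpow (x l) (ℤ.- (+ a l))) ⊗ ∑ (allSeqs n a)
          (λ s → indicator (isGCS Q i₀ a s) ⊗ ∏ (λ i → zpow (x i) (expo Q a s i))) ≡
        ∏L bs (λ b → X b z) ⊗ ∏L C arc
      value = begin
        ∏ (λ l → zpow (x l) (ℤ.- (+ a l))) ⊗ ∑ (allSeqs n a)
            (λ s → indicator (isGCS Q i₀ a s) ⊗ ∏ (λ i → zpow (x i) (expo Q a s i)))
          ≡⟨ cong₂ _⊗_ (∏-cong λ l → zpow-neg {x l} (a l))
              (∑-cong (allSeqs n a) λ s → summand s ⨾ treeProduct-weight s root) ⟩
        ∏ weight ⊗ ∑ (allSeqs n a) (treeWeight root ∘ lists)
          ≡⟨ ∑-treeWeight root all-in ⟩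
        weight i₀ ⊗ sumL (a i₀) (V root)
          ≡⟨ cong (λ N → pow (inv (x i₀)) N ⊗ sumL N (V root)) (rays-count root-label A) ⟩
        pow (inv (x i₀)) (length bs) ⊗ sumL (length bs) (V root)
          ≡⟨ cong (pow (inv (x i₀)) (length bs) ⊗_) ((sumL-cong (length bs) λ v e
              → expansion root (ℕP.≤-trans (ℕP.n≤1+n (suc n)) z≤top) A v e) ⨾ sumL-*ʳ (length bs) (∏L C arc) _) ⟩
        pow (inv (x i₀)) (length bs) ⊗ (sumL (length bs) (Π₂ (ray 0 (suc n)) bs) ⊗ ∏L C arc)
          ≡⟨ sym (*-assoc _ _ _) ⨾ cong (_⊗ ∏L C arc) (cong₂ _⊗_ (sym (∏L-const bs (inv (x i₀))))
              (sumL-Π₂ (ray 0 (suc n)) bs) ⨾ sym (∏L-* bs (λ _ → inv (x i₀)) (λ b → ∑₂ (ray 0 (suc n) b)))) ⟩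
        ∏L bs (λ b → inv (x i₀) ⊗ ∑₂ (ray 0 (suc n) b)) ⊗ ∏L C arc
          ≡⟨ cong (_⊗ ∏L C arc) (∏L-cong∈ bs ray-sum) ⟩
        ∏L bs (λ b → X b z) ⊗ ∏L C arc ∎

-- The arcs of a cluster monomial

-- Exponents become multiplicities: each parallel copy of an arc has its own entry in the sequence
-- of every diagonal that it crosses.
copies : ∀ {n} {A : Set} → (Fin n → A) → (Fin n → ℕ) → List A
copies {zero} E e = []
copies {suc n} E e = replicate (e zero) (E zero) ++ copies (E ∘ suc) (e ∘ suc)

module _ {A : Set} where

  ∏L-copies : ∀ {n} (E : Fin n → A) e f → ∏L (copies E e) f ≡ ∏ (λ k → pow (f (E k)) (e k))
  ∏L-copies {zero} E e f = refl
  ∏L-copies {suc n} E e f = ∏L-++ (replicate (e zero) (E zero)) _ f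
      ⨾ cong₂ _⊗_ (∏L-replicate (e zero)) (∏L-copies (E ∘ suc) (e ∘ suc) f)
    where
    ∏L-replicate : ∀ k → ∏L (replicate k (E zero)) f ≡ pow (f (E zero)) k
    ∏L-replicate zero = refl
    ∏L-replicate (suc k) = cong (f (E zero) ⊗_) (∏L-replicate k)

  count-copies : ∀ {n} {P : A → Set} (P? : ∀ x → Dec (P x)) (E : Fin n → A) e → count P? (copies E e)
      ≡ sumℕ (λ k → e k ℕ.* ⟦ P? (E k) ⟧)
  count-copies {zero} P? E e = refl
  count-copies {suc n} P? E e = count-++ P? (replicate (e zero) (E zero)) _
      ⨾ cong₂ ℕ._+_ (count-replicate (e zero)) (count-copies P? (E ∘ suc) (e ∘ suc))
    where
    count-replicate : ∀ k → count P? (replicate k (E zero)) ≡ k ℕ.* ⟦ P? (E zero) ⟧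
    count-replicate zero = refl
    count-replicate (suc k) = cong (⟦ P? (E zero) ⟧ ℕ.+_) (count-replicate k)

  ∈-copies : ∀ {n} (E : Fin n → A) e {y} → y ∈ copies E e → ∃ λ k → y ≡ E k × 0 < e k
  ∈-copies {suc n} E e m with ∈-++⁻ (replicate (e zero) (E zero)) m
  ... | inj₁ m′ = zero , ∈-replicate (e zero) m′
    where
    ∈-replicate : ∀ k {y} → y ∈ replicate k (E zero) → y ≡ E zero × 0 < k
    ∈-replicate (suc k) (here e) = e , s≤s z≤n
    ∈-replicate (suc k) (there m) = proj₁ (∈-replicate k m) , s≤s z≤n
  ... | inj₂ m′ with ∈-copies (E ∘ suc) (e ∘ suc) m′
  ...   | k , y≡ , pos = suc k , y≡ , pos

  ∏L-↭ : ∀ {xs ys : List A} f → xs ↭ ys → ∏L xs f ≡ ∏L ys f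
  ∏L-↭ f Perm.refl = refl
  ∏L-↭ f (Perm.prep x p) = cong (f x ⊗_) (∏L-↭ f p)
  ∏L-↭ {ys = _ ∷ _ ∷ ys} f (Perm.swap x y p) = cong (λ z → f x ⊗ (f y ⊗ z)) (∏L-↭ f p)
      ⨾ (solve 3 (λ x y z → x :* (y :* z) := y :* (x :* z)) refl (f x) (f y) (∏L ys f))
  ∏L-↭ f (Perm.trans p q) = ∏L-↭ f p ⨾ ∏L-↭ f q

  count-↭ : ∀ {P : A → Set} (P? : ∀ x → Dec (P x)) {xs ys} → xs ↭ ys → count P? xs ≡ count P? ys
  count-↭ P? Perm.refl = refl
  count-↭ P? (Perm.prep x p) = cong (⟦ P? x ⟧ ℕ.+_) (count-↭ P? p)
  count-↭ P? {ys = _ ∷ _ ∷ ys} (Perm.swap x y p) = cong (λ z → ⟦ P? x ⟧ ℕ.+ (⟦ P? y ⟧ ℕ.+ z)) (count-↭ P? p) ⨾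
    (sym (ℕP.+-assoc ⟦ P? x ⟧ ⟦ P? y ⟧ _) ⨾ (cong (ℕ._+ count P? ys) (ℕP.+-comm ⟦ P? x ⟧ ⟦ P? y ⟧)
        ⨾ ℕP.+-assoc ⟦ P? y ⟧ ⟦ P? x ⟧ _))
  count-↭ P? (Perm.trans p q) = count-↭ P? p ⨾ count-↭ P? q

BySize : List Diag → Set
BySize = AllPairs (λ e f → size f ≤ size e)

insert : Diag → List Diag → List Diag
insert e [] = e ∷ []
insert e (f ∷ C) with size f ≤? size e
... | yes _ = e ∷ f ∷ C
... | no _ = f ∷ insert e C

insert-↭ : ∀ e C → insert e C ↭ e ∷ C
insert-↭ e [] = Perm.refl
insert-↭ e (f ∷ C) with size f ≤? size e
... | yes _ = Perm.refl
... | no _ = Perm.trans (Perm.prep f (insert-↭ e C)) (Perm.swap f e Perm.refl)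

insert-sorted : ∀ e {C} → BySize C → BySize (insert e C)
insert-sorted e [] = [] ∷ []
insert-sorted e {f ∷ C} (h ∷ hs) with size f ≤? size e
... | yes p = (p ∷ All.map (λ q → ℕP.≤-trans q p) h) ∷ (h ∷ hs)
... | no p = All.tabulate (λ m → larger (PermP.∈-resp-↭ (insert-↭ e C) m)) ∷ insert-sorted e hs
  where
  larger : ∀ {g} → g ∈ e ∷ C → size g ≤ size f
  larger (here refl) = ℕP.<⇒≤ (ℕP.≰⇒> p)
  larger (there m) = All.lookup h m

sortBySize : List Diag → List Diag
sortBySize [] = []
sortBySize (e ∷ C) = insert e (sortBySize C)

sort-↭ : ∀ C → sortBySize C ↭ C
sort-↭ [] = Perm.refl
sort-↭ (e ∷ C) = Perm.trans (insert-↭ e (sortBySize C)) (Perm.prep e (sort-↭ C))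

sort-sorted : ∀ C → BySize (sortBySize C)
sort-sorted [] = []
sort-sorted (e ∷ C) = insert-sorted e (sort-sorted C)

crossB⇒Crossing : ∀ {e f} → T (crossB e f) → Crossing e f ⊎ Crossing f e
crossB⇒Crossing {p , q} {r , s} t with Equivalence.to (T-∨ {(p <ᵇ r) ∧ (r <ᵇ q) ∧ (q <ᵇ s)}) t
... | inj₁ h with Equivalence.to (T-∧ {p <ᵇ r}) h
...   | x , h′ with Equivalence.to (T-∧ {r <ᵇ q}) h′
...     | y , z = inj₁ (ℕP.<ᵇ⇒< p r x , ℕP.<ᵇ⇒< r q y , ℕP.<ᵇ⇒< q s z)
crossB⇒Crossing {p , q} {r , s} t | inj₂ h with Equivalence.to (T-∧ {r <ᵇ p}) h
...   | x , h′ with Equivalence.to (T-∧ {p <ᵇ s}) h′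
...     | y , z = inj₂ (ℕP.<ᵇ⇒< r p x , ℕP.<ᵇ⇒< p s y , ℕP.<ᵇ⇒< s q z)

Crossing⇒crossB : ∀ {e f} → Crossing e f ⊎ Crossing f e → T (crossB e f)
Crossing⇒crossB h = crossB-intro h

-- The rays of {0 , n + 1} are the arcs ending at the vertex n + 2 of the ear cut off by it.
module RootArcs {n : ℕ} {D E : Fin n → Diag} (triD : IsTriangulation n D) (triE : IsTriangulation n E)
    (e a : Fin n → ℕ) (X : ℕ → ℕ → K) (top : ℕ)
    (X-pos : ∀ {i p q} → D i ≡ (p , q) → Pos (X p q))
    (X-boundary : ∀ {p} → p < top → X p (suc p) ≡ 1K)
    (ptolemy : ∀ {a b c d} → a < b → b < c → c < d → d ≤ top → X a c ⊗ X b d ≡ X a b ⊗ X c d ⊕ X b c ⊗ X a d)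
    (D-inside : ∀ l → proj₂ (D l) ≤ suc n)
    (fresh : ∀ k → 0 < e k → ∀ l → E k ≢ D l)
    (a-count : ∀ l → a l ≡ sumℕ (λ k → e k ℕ.* ⟦ crossing? (D l) (E k) ⟧)) where
  open Expansion D a X top X-pos X-boundary ptolemy
  private
    module PE = Polygon triE

  z : ℕ
  z = suc (suc n)

  L C : List Diag
  L = sortBySize (copies E e)

  atz? : ∀ (f : Diag) → Dec (proj₂ f ≡ z)
  atz? f = proj₂ f ℕ.≟ z

  Lz : List Diag
  Lz = filter atz? L
  C = filter (¬? ∘ atz?) L

  rays-z : List ℕ
  rays-z = reverse (map proj₁ Lz)

  L-∈ : ∀ {f} → f ∈ L → ∃ λ k → f ≡ E k × 0 < e k
  L-∈ m = ∈-copies E e (PermP.∈-resp-↭ (sort-↭ (copies E e)) m)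

  C-∈ : ∀ {f} → f ∈ C → f ∈ L × proj₂ f ≢ z
  C-∈ = ∈-filter⁻ (¬? ∘ atz?)

  Lz-∈ : ∀ {f} → f ∈ Lz → f ∈ L × proj₂ f ≡ z
  Lz-∈ = ∈-filter⁻ atz? {xs = L}

  rays-∈ : ∀ {b} → b ∈ rays-z → (b , z) ∈ L
  rays-∈ m with ∈-map⁻ proj₁ (AnyP.reverse⁻ {xs = map proj₁ Lz} m)
  ... | f , m′ , refl = subst (λ w → (proj₁ f , w) ∈ L) (proj₂ (Lz-∈ m′)) (proj₁ (Lz-∈ m′))

  L-uncrossed : ∀ {f g} → f ∈ L → g ∈ L → ¬ Crossing f g
  L-uncrossed mf mg with L-∈ mf | L-∈ mg
  ... | k , refl , _ | l , refl , _ = PE.uncrossed k l refl refl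

  L-diag : ∀ {f} → f ∈ L → IsDiag (n ℕ.+ 3) f
  L-diag m with L-∈ m
  ... | k , refl , _ = PE.isDiag k

  m≡ : n ℕ.+ 3 ≡ suc z
  m≡ = ℕP.+-comm n 3

  rays-range : ∀ {b} → b ∈ rays-z → 0 < b × b < suc n
  rays-range {b} m with L-diag (rays-∈ m)
  ... | b<z , _ , z≢ , ¬top = ℕP.n≢0⇒n>0 (λ b≡0 → ¬top (b≡0 , sym m≡))
      , ℕP.≤∧≢⇒< (ℕP.≤-pred b<z) (λ b≡ → z≢ (cong suc (sym b≡)))

  below-z : ∀ {f} → f ∈ C → proj₂ f < z
  below-z {f} m = ℕP.≤∧≢⇒< (ℕP.≤-pred (subst (proj₂ f <_) m≡ (proj₁ (proj₂ (L-diag (proj₁ (C-∈ m)))))))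
      (proj₂ (C-∈ m))

  arcs : Arcs 0 (suc n) rays-z C
  arcs = record
    -- Arcs ending at z get shorter as their other end grows, so decreasing size lists these ends
    -- upwards; rays have to descend, whence the reversal.
    { sorted = AllPairs-reverse (AllPairsP.map⁺ (ascending-ends Lz (λ m → proj₂ (Lz-∈ m))
        (λ m → proj₁ (L-diag (proj₁ (Lz-∈ m))))
        (AllPairsP.filter⁺ atz? (sort-sorted (copies E e)))))
    ; range = rays-range
    ; within = λ m → z≤n , long (L-diag (proj₁ (C-∈ m))) , ℕP.≤-pred (below-z m)
    ; by-size = AllPairsP.filter⁺ (¬? ∘ atz?) (sort-sorted (copies E e))
    ; uncrossed = λ mf mg → L-uncrossed (proj₁ (C-∈ mf)) (proj₁ (C-∈ mg))
    ; rays = λ mb mf (x , y) → L-uncrossed (proj₁ (C-∈ mf)) (rays-∈ mb) (x , y , below-z mf)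
    ; new = new
    ; counts = λ l _ _ → a-count l ⨾ (sym (count-copies (crossing? (D l)) E e)
        ⨾ (sym (count-↭ (crossing? (D l)) (sort-↭ (copies E e))) ⨾
        (count-filter (crossing? (D l)) atz? L ⨾ cong (ℕ._+ count (crossing? (D l)) C) (ray-count l))))
    }
    where
    long : ∀ {f} → IsDiag (n ℕ.+ 3) f → suc (proj₁ f) < proj₂ f
    long (x , _ , y , _) = ℕP.≤∧≢⇒< x (y ∘ sym)
    new : ∀ {f} → f ∈ C → ∀ l → f ≢ D l
    new m with L-∈ (proj₁ (C-∈ m))
    ... | k , refl , pos = fresh k pos
    ascending-ends : ∀ fs → (∀ {f} → f ∈ fs → proj₂ f ≡ z) → (∀ {f} → f ∈ fs → proj₁ f < proj₂ f) → BySize fs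
        → AllPairs (λ f g → proj₁ f ≤ proj₁ g) fs
    ascending-ends [] _ _ _ = []
    ascending-ends (f ∷ fs) h h′ (b ∷ bs) = All.tabulate (λ {g} m → ℕP.≮⇒≥ λ x → ℕP.<⇒≱
        (subst₂ (λ u v → u ∸ proj₁ f < v ∸ proj₁ g) (sym (h (here refl))) (sym (h (there m)))
          (ℕP.∸-monoʳ-< x (ℕP.<⇒≤ (subst (proj₁ f <_) (h (here refl)) (h′ (here refl)))))) (All.lookup b m)) ∷
      ascending-ends fs (h ∘ there) (h′ ∘ there) bs
    -- D l ends before z, so an arc ending at z can cross it only by starting strictly within it.
    ray-count : ∀ l → count (crossing? (D l)) Lz ≡ count (within? (D l)) rays-z
    ray-count l = count-map (crossing? (D l)) (within? (D l)) proj₁ Lz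
        (λ { m (inj₁ (_ , _ , y)) → contradiction (subst (_< proj₂ (D l)) (proj₂ (Lz-∈ m)) y)
            (ℕP.≤⇒≯ (ℕP.m≤n⇒m≤1+n (D-inside l)))
           ; m (inj₂ (x , y , _)) → x , y })
        (λ m (x , y) → inj₂ (x , y , subst (proj₂ (D l) <_) (sym (proj₂ (Lz-∈ m))) (s≤s (D-inside l)))) ⨾
      sym (count-reverse (within? (D l)) (map proj₁ Lz))

  arcs-product : ∏L rays-z (λ b → X b z) ⊗ ∏L C arc ≡ ∏ (λ k → pow (arc (E k)) (e k))
  arcs-product = cong (_⊗ ∏L C arc) (∏L-reverse (map proj₁ Lz) (λ b → X b z) ⨾ (∏L-map proj₁ Lz (λ b → X b z) ⨾
      ∏L-cong∈ Lz (λ {f} m → cong (X (proj₁ f)) (sym (proj₂ (Lz-∈ m)))))) ⨾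
    (sym (∏L-filter atz? L arc) ⨾ (∏L-↭ arc (sort-↭ (copies E e)) ⨾ ∏L-copies E e arc))

-- Non-negativity excludes the initial variables: if tri S k = D₀ l with e k > 0, nothing else in
-- the cluster meets D₀ l, and the entry at l would be - e k. Afterwards only crossings contribute.
dVector-count : ∀ {n} {D₀ : Fin n → Diag} {S : Seed n} → IsTriangulation n (tri S) → (e a : Fin n → ℕ)
    → (∀ i → dVector D₀ S e i ≡ + a i) →
  (∀ k → 0 < e k → ∀ l → tri S k ≢ D₀ l) ×
  (∀ l → a l ≡ sumℕ (λ k → e k ℕ.* (if crossB (tri S k) (D₀ l) then 1 else 0)))
dVector-count {n} {D₀} {S} triS e a h = fresh , λ l → ℤP.+-injective
    (sym (h l) ⨾ (sumℤ-cong (term l) ⨾ sumℤ-sumℕ (λ k → e k ℕ.* (if crossB (E k) (D₀ l) then 1 else 0))))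
  where
  E : Fin n → Diag
  E = tri S
  sumℤ-cong : ∀ {n} {f g : Fin n → ℤ} → (∀ i → f i ≡ g i) → sumℤ f ≡ sumℤ g
  sumℤ-cong {zero} p = refl
  sumℤ-cong {suc n} p = cong₂ ℤ._+_ (p zero) (sumℤ-cong (p ∘ suc))
  sumℤ-sumℕ : ∀ {n} (f : Fin n → ℕ) → sumℤ (λ i → + f i) ≡ + sumℕ f
  sumℤ-sumℕ {zero} f = refl
  sumℤ-sumℕ {suc n} f = cong (ℤ._+_ (+ f zero)) (sumℤ-sumℕ (f ∘ suc))
  sumℤ-single : ∀ {n} {f : Fin n → ℤ} i → (∀ j → j ≢ i → f j ≡ 0ℤ) → sumℤ f ≡ f i
  sumℤ-single {suc n} {f} zero p = cong (ℤ._+_ (f zero))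
      (sumℤ-cong (λ j → p (suc j) λ ()) ⨾ sumℤ-sumℕ {n} (λ _ → 0) ⨾ cong +_ (sumℕ-0 {n} λ _ → refl))
      ⨾ ℤP.+-identityʳ _
  sumℤ-single {suc n} {f} (suc i) p = cong₂ ℤ._+_ (p zero λ ())
      (sumℤ-single i λ j ne → p (suc j) (ne ∘ FinP.suc-injective)) ⨾ ℤP.+-identityˡ _
  distinct : ∀ {f g} → f ≢ g → intNum f g ≡ (if crossB f g then 1ℤ else 0ℤ)
  distinct {f} {g} ne with eqDB f g in eq
  ... | true = contradiction (eqDB⇒≡ {f} {g} (subst T (sym eq) tt)) ne
  ... | false = refl
  same : ∀ {f g} → f ≡ g → intNum f g ≡ ℤ.- 1ℤ
  same {f} {g} fg with eqDB f g in eq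
  ... | true = refl
  ... | false = contradiction (subst T eq (≡⇒eqDB {f} {g} fg)) λ ()
  fresh : ∀ k → 0 < e k → ∀ l → E k ≢ D₀ l
  fresh k pos l eq with sym (h l) ⨾ sumℤ-single {f = λ k → (+ e k) ℤ.* intNum (E k) (D₀ l)} k others
      ⨾ cong ((+ e k) ℤ.*_) (same eq)
    where
    others : ∀ j → j ≢ k → (+ e j) ℤ.* intNum (E j) (D₀ l) ≡ 0ℤ
    others j ne = cong ((+ e j) ℤ.*_) (distinct (λ ej → proj₁ (proj₂ triS) j k ne (ej ⨾ sym eq)) ⨾ uncross)
        ⨾ ℤP.*-zeroʳ (+ e j)
      where
      uncross : (if crossB (E j) (D₀ l) then 1ℤ else 0ℤ) ≡ 0ℤ
      uncross with crossB (E j) (D₀ l) in cr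
      ... | true = contradiction (subst (λ d → T (crossB (E j) d)) (sym eq) (subst T (sym cr) tt))
          (T-not (proj₂ (proj₂ triS) j k))
      ... | false = refl
  ... | negative with e k
  fresh k (s≤s _) l eq | () | suc _
  term : ∀ l k → (+ e k) ℤ.* intNum (E k) (D₀ l) ≡ + (e k ℕ.* (if crossB (E k) (D₀ l) then 1 else 0))
  term l k with e k in ek
  ... | zero = refl
  ... | suc y = cong ((+ suc y) ℤ.*_) (distinct (fresh k (subst (0 <_) (sym ek) (s≤s z≤n)) l) ⨾ as-ℕ)
      ⨾ sym (ℤP.pos-* (suc y) _)
    where
    as-ℕ : (if crossB (E k) (D₀ l) then 1ℤ else 0ℤ) ≡ + (if crossB (E k) (D₀ l) then 1 else 0)
    as-ℕ with crossB (E k) (D₀ l)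
    ... | true = refl
    ... | false = refl

-- Rotating the polygon

module _ {m c : ℕ} (c≤m : c ≤ m) where

  ρ⁻¹-bound : ∀ {w} → w < m → ρ m (m ∸ c) w < m
  ρ⁻¹-bound = Rotation.ρ-bound (ℕP.m∸n≤m m c)

  ρ-inverseʳ : ∀ {w} → w < m → ρ m c (ρ m (m ∸ c) w) ≡ w
  ρ-inverseʳ {w} wm = cong (λ k → ρ m k (ρ m (m ∸ c) w)) (sym (ℕP.m∸[m∸n]≡n c≤m))
      ⨾ Rotation.ρ-inverse (ℕP.m∸n≤m m c) wm

  Consec-ρ : ∀ {u v} → u < m → v < m → u ≢ v → Consec m u v → Consec m (ρ m c u) (ρ m c v)
  Consec-ρ {u} {v} um vm u≢v k with Consec? m (ρ m c u) (ρ m c v)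
  ... | yes h = h
  ... | no h with nonconsecutive-sides (Rotation.ρ-bound c≤m um) (Rotation.ρ-bound c≤m vm)
      (u≢v ∘ Rotation.ρ-injective c≤m um vm) h
  ...   | x , y , xm , ym , p , q = contradiction k λ k → Consec-empty (ρ⁻¹-bound xm) (ρ⁻¹-bound ym) k
            (CO-ρ⁻¹ c≤m um (ρ⁻¹-bound xm) vm (subst (λ x → CO (ρ m c u) x (ρ m c v)) (sym (ρ-inverseʳ xm)) p) ,
             CO-ρ⁻¹ c≤m vm (ρ⁻¹-bound ym) um (subst (λ y → CO (ρ m c v) y (ρ m c u)) (sym (ρ-inverseʳ ym)) q))

-- The ear at a vertex of degree 2

record Ear {n} (D : Fin n → Diag) (i : Fin n) : Set where
  field
    {a b c} : ℕ
    diagonal : D i ≡ norm a c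
    abc : CO a b c
    b<m : b < n ℕ.+ 3
    ab : Consec (n ℕ.+ 3) a b
    bc : Consec (n ℕ.+ 3) b c

module _ {n : ℕ} {D : Fin n → Diag} (triang : IsTriangulation n D)
    (in-cycle : ∀ {i j} → Arrow D i j → ∃ λ k → Arrow D j k × Arrow D k i) where
  open Polygon triang
  open Quads triang
  open FullTriangles triang in-cycle

  private
    Diagonal : ℕ → ℕ → Set
    Diagonal u v = ∃ λ j → D j ≡ norm u v

    half : ∀ {i a b c d} → Quad D i a b c d → (Consec m a b × Consec m b c) ⊎ (Diagonal a b × Diagonal b c)
    half {a = a} {b} {c} Q with Quad.ab Q | Quad.bc Q
    ... | inj₁ x | inj₁ y = inj₁ (x , y)
    ... | inj₂ x | inj₂ y = inj₂ (x , y)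
    ... | inj₁ x | inj₂ (j , e) = contradiction x (no-half-triangle (trans (Quad.diagonal Q) (norm-sym a c))
        (trans e (norm-sym b c)) (CO-rot² (Quad.abc Q)))
    ... | inj₂ (j , e) | inj₁ y = contradiction y (no-half-triangle e (Quad.diagonal Q) (Quad.abc Q))

    occurs-once : ∀ {u v} → Diagonal u v → sumℕ (λ j → ⟦ D j ≟D norm u v ⟧) ≡ 1
    occurs-once {u} {v} (i , e) = sumℕ-single i (λ j j≢i → ⟦⟧-no (D j ≟D norm u v) λ f
        → j≢i (D-injective (f ⨾ sym e))) ⨾ ⟦⟧-yes (D i ≟D norm u v) e

    full-degree : ∀ {i a b c d} → Quad D i a b c d → Diagonal a b → Diagonal b c → Diagonal c d → Diagonal d a
        → degree (quiverOf D) i ≡ 4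
    full-degree {i} {a} {b} {c} {d} Q ab bc cd da =
      sumℕ-+ (quiverOf D i) (λ j → quiverOf D j i) ⨾ cong₂ ℕ._+_
        (sumℕ-cong (quiver-out Q) ⨾ (sumℕ-+ (λ j → ⟦ D j ≟D norm b c ⟧) (λ j → ⟦ D j ≟D norm d a ⟧)
            ⨾ cong₂ ℕ._+_ (occurs-once bc) (occurs-once da)))
        (sumℕ-cong (quiver-in Q) ⨾ (sumℕ-+ (λ j → ⟦ D j ≟D norm a b ⟧) (λ j → ⟦ D j ≟D norm c d ⟧)
            ⨾ cong₂ ℕ._+_ (occurs-once ab) (occurs-once cd)))

  -- On either side of D i the triangle has two boundary edges or two further diagonals. Diagonals
  -- on both sides would give degree 4.
  ear-at : ∀ i → degree (quiverOf D) i ≡ 2 → Ear D i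
  ear-at i deg with quad-at i
  ... | a , b , c , d , Q with half Q | half (quad-turn Q)
  ...   | inj₁ (x , y) | _ = record { diagonal = Quad.diagonal Q ; abc = Quad.abc Q ; b<m = Quad.b<m Q ; ab = x ; bc =
      y }
  ...   | inj₂ _ | inj₁ (x , y) = record { diagonal = Quad.diagonal (quad-turn Q) ; abc = Quad.cda Q ; b<m = Quad.d<m
      Q ; ab = x ; bc = y }
  ...   | inj₂ (x , y) | inj₂ (z , w) = contradiction (sym (full-degree Q x y z w) ⨾ deg) λ ()

module RotatedAt {n : ℕ} {D₀ : Fin n → Diag} (tri₀ : IsTriangulation n D₀) {c : ℕ} (c≤m : c ≤ n ℕ.+ 3) where
  open Polygon tri₀
  open Rotation c≤m

  D : Fin n → Diag
  D = rotate c D₀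

  rotated : IsTriangulation n D
  rotated = rotate-triangulation c≤m

  private
    module R = Polygon rotated

    back : ℕ → ℕ
    back = ρ m (m ∸ c)

    pull : ∀ {i u v} → D i ≡ norm u v → D i ≡ norm (ρ m c (back u)) (ρ m c (back v))
    pull {i} e with R.endpoints-bound {i} e
    ... | um , vm = trans e (sym (cong₂ norm (ρ-inverseʳ c≤m um) (ρ-inverseʳ c≤m vm)))

  rotate-chord : ∀ {u v} → u < m → v < m → u ≢ v → Chord D₀ u v → Chord D (ρ m c u) (ρ m c v)
  rotate-chord um vm u≢v (inj₁ k) = inj₁ (Consec-ρ c≤m um vm u≢v k)
  rotate-chord um vm u≢v (inj₂ (i , e)) = inj₂ (i , rotate-norm c≤m {i} e)

  rotate-arrow : ∀ {i j} → Arrow D₀ i j → Arrow D i j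
  rotate-arrow {i} {j} (arrow ei ej co ch) with endpoints-bound {i} ei | endpoints-bound {j} ej
  ... | vm , um | _ , wm = arrow (rotate-norm c≤m {i} ei) (rotate-norm c≤m {j} ej) (CO-ρ vm um wm co)
      (rotate-chord um wm (CO-≢₂₃ co) ch)

  rotate-arrow⁻¹ : ∀ {i j} → Arrow D i j → Arrow D₀ i j
  rotate-arrow⁻¹ {i} {j} (arrow {v} {u} {w} ei ej co ch) with R.endpoints-bound {i} ei | R.endpoints-bound {j} ej
  ... | vm , um | _ , wm = arrow (rotate-norm⁻¹ c≤m {i} (ρ⁻¹-bound c≤m vm) (ρ⁻¹-bound c≤m um) (pull {i} ei))
      (rotate-norm⁻¹ c≤m {j} (ρ⁻¹-bound c≤m vm) (ρ⁻¹-bound c≤m wm) (pull {j} ej))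
      (Rotation.CO-ρ (ℕP.m∸n≤m m c) vm um wm co)
      (rotate-chord⁻¹ c≤m (ρ⁻¹-bound c≤m um) (ρ⁻¹-bound c≤m wm) (CO-≢₂₃ (Rotation.CO-ρ (ℕP.m∸n≤m m c) vm um wm co))
        (subst₂ (Chord D) (sym (ρ-inverseʳ c≤m um)) (sym (ρ-inverseʳ c≤m wm)) ch))

  crossB-rotate : ∀ {p q r s} → p < m → q < m → r < m → s < m → p < q → r < s →
    crossB (norm (ρ m c p) (ρ m c q)) (norm (ρ m c r) (ρ m c s)) ≡ crossB (p , q) (r , s)
  crossB-rotate {p} {q} {r} {s} pm qm rm sm p<q r<s = T-ext
      (λ t → subst₂ (λ e f → T (crossB e f)) (norm-< p<q) (norm-< r<s)
        ([ (λ k → Cross⇒crossB (Cross-ρ⁻¹ c≤m pm qm rm sm k)) ,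
           (λ k → subst (λ e → T (crossB (norm p q) e)) (norm-sym s r) (Cross⇒crossB (Cross-ρ⁻¹ c≤m pm qm sm rm k)))
               ]′
          (crossB⇒Cross {ρ m c p} {ρ m c q} {ρ m c r} {ρ m c s} t)))
      (λ t → [ (λ k → Cross⇒crossB (Cross-ρ c≤m pm qm rm sm k)) ,
               (λ k → subst (λ e → T (crossB (norm (ρ m c p) (ρ m c q)) e)) (norm-sym (ρ m c s) (ρ m c r))
                   (Cross⇒crossB (Cross-ρ c≤m pm qm sm rm k))) ]′
          (crossB⇒Cross {p} {q} {r} {s} (subst₂ (λ e f → T (crossB e f)) (sym (norm-< p<q)) (sym (norm-< r<s)) t)))

  module _ {x : Fin n → K} (x-pos : ∀ i → Pos (x i)) (lam : Lambda D₀ x) where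
    open Lambda lam

    X : ℕ → ℕ → K
    X p q = Λ (norm (back p) (back q))

    private
      m≡suc : m ≡ suc (suc (suc n))
      m≡suc = ℕP.+-comm n 3

    X-rotate : ∀ {u v} → u < m → v < m → X (proj₁ (norm (ρ m c u) (ρ m c v))) (proj₂ (norm (ρ m c u) (ρ m c v)))
        ≡ Λ (norm u v)
    X-rotate {u} {v} um vm with norm (ρ m c u) (ρ m c v) | norm-view (ρ m c u) (ρ m c v)
    ... | _ | ascending _ = cong Λ (cong₂ norm (ρ-inverse um) (ρ-inverse vm))
    ... | _ | descending _ = cong Λ (cong₂ norm (ρ-inverse vm) (ρ-inverse um) ⨾ norm-sym v u)

    X-label : ∀ {i p q} → D i ≡ (p , q) → X p q ≡ x i
    X-label {i} e = cong (λ d → X (proj₁ d) (proj₂ d)) (sym e)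
        ⨾ (X-rotate (D-bound₁ i) (D-bound₂ i) ⨾ (cong Λ (D-norm i) ⨾ Λ-diagonal i))

    X-pos : ∀ {i p q} → D i ≡ (p , q) → Pos (X p q)
    X-pos {i} e = subst Pos (sym (X-label e)) (x-pos i)

    X-consecutive : ∀ {p q} → p < m → q < m → p ≢ q → Consec m p q → X p q ≡ 1K
    X-consecutive pm qm p≢q k = Λ-boundary (ρ⁻¹-bound c≤m pm) (ρ⁻¹-bound c≤m qm) (Consec-ρ (ℕP.m∸n≤m m c) pm qm p≢q k)

    X-boundary : ∀ {p} → p < suc (suc n) → X p (suc p) ≡ 1K
    X-boundary {p} h = X-consecutive (subst (p <_) (sym m≡suc) (ℕP.m≤n⇒m≤1+n h))
        (subst (suc p <_) (sym m≡suc) (s≤s h)) (ℕP.<⇒≢ (ℕP.n<1+n p)) (inj₁ (inj₁ refl))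

    X-top : X 0 (suc (suc n)) ≡ 1K
    X-top = X-consecutive (subst (0 <_) (sym m≡suc) (s≤s z≤n)) (subst (suc (suc n) <_) (sym m≡suc) ℕP.≤-refl) (λ ())
        (inj₂ (inj₁ (refl , sym m≡suc)))

    X-ptolemy : ∀ {a b c d} → a < b → b < c → c < d → d ≤ suc (suc n) → X a c ⊗ X b d ≡ X a b ⊗ X c d ⊕ X b c ⊗ X a d
    X-ptolemy {p} {q} {r} {s} pq qr rs s≤ = ptolemy (move pm qm rm (case₁ (pq , qr)))
        (move rm sm pm (case₃ (ℕP.<-trans pq qr , rs))) ⨾
        cong (λ e → X p q ⊗ X r s ⊕ X q r ⊗ Λ e) (norm-sym (back s) (back p))
      where
      sm : s < m
      sm = subst (s <_) (sym m≡suc) (s≤s s≤)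
      rm = ℕP.<-trans rs sm
      qm = ℕP.<-trans qr rm
      pm = ℕP.<-trans pq qm
      move : ∀ {u v w} → u < m → v < m → w < m → CO u v w → CO (back u) (back v) (back w)
      move = Rotation.CO-ρ (ℕP.m∸n≤m m c)

module _ {n : ℕ} {D₀ : Fin n → Diag} (tri₀ : IsTriangulation n D₀) {i₀ : Fin n} (E : Ear D₀ i₀) where
  open Polygon tri₀
  open Ear E

  ear-c≤m : c ≤ m
  ear-c≤m = ℕP.<⇒≤ (proj₂ (endpoints-bound {i₀} diagonal))

  -- Rotation takes c to 0, hence its predecessor b to n + 2 and the predecessor a of b to n + 1.
  ear-root : rotate c D₀ i₀ ≡ (0 , suc n)
  ear-root = rotate-norm ear-c≤m {i₀} diagonal ⨾ (cong₂ norm a′≡ (ρ-self m c)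
      ⨾ (norm-sym (suc n) 0 ⨾ norm-< {0} {suc n} (s≤s z≤n)))
    where
    am = proj₁ (endpoints-bound {i₀} diagonal)
    cm = proj₂ (endpoints-bound {i₀} diagonal)
    a′ b′ : ℕ
    a′ = ρ m c a
    b′ = ρ m c b
    m≡suc : m ≡ suc (suc (suc n))
    m≡suc = ℕP.+-comm n 3
    co : CO a′ b′ 0
    co = subst (CO a′ b′) (ρ-self m c) (Rotation.CO-ρ ear-c≤m am b<m cm abc)
    b′≡ : Consec m b′ 0 → b′ ≡ suc (suc n)
    b′≡ (inj₁ (inj₂ e)) with subst (λ b → CO a′ b 0) (sym e) co
    ... | case₁ (_ , ())
    ... | case₂ (() , _)
    ... | case₃ (p , q) = contradiction q (ℕP.≤⇒≯ p)
    b′≡ (inj₂ (inj₁ (_ , e))) = contradiction (e ⨾ m≡suc) λ ()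
    b′≡ (inj₂ (inj₂ (_ , e))) = ℕP.suc-injective (e ⨾ m≡suc)
    a′-cases : b′ ≡ suc (suc n) → Consec m a′ b′ → a′ ≡ suc n
    a′-cases e (inj₁ (inj₁ f)) = ℕP.suc-injective (f ⨾ e)
    a′-cases e (inj₁ (inj₂ f)) = contradiction (Rotation.ρ-bound ear-c≤m am)
        (ℕP.≤⇒≯ (ℕP.≤-reflexive (m≡suc ⨾ (cong suc (sym e) ⨾ f))))
    a′-cases e (inj₂ (inj₁ (f , _))) = contradiction f (CO-≢₁₃ co)
    a′-cases e (inj₂ (inj₂ (f , _))) = contradiction f (CO-≢₂₃ co)
    a′≡ : a′ ≡ suc n
    a′≡ = a′-cases (b′≡ (subst (Consec m b′) (ρ-self m c) (Consec-ρ ear-c≤m b<m cm (CO-≢₂₃ abc) bc)))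
        (Consec-ρ ear-c≤m am b<m (CO-≢₁₂ abc) ab)

-- Both sides of the formula at a positive point

module Expand {n : ℕ} {D₀ : Fin n → Diag} (tri₀ : IsTriangulation n D₀)
    (in-cycle : ∀ {i j} → Arrow D₀ i j → ∃ λ k → Arrow D₀ j k × Arrow D₀ k i)
    {i₀ : Fin n} (E : Ear D₀ i₀)
    {S : Seed n} (reachable : Reachable D₀ S) (e a : Fin n → ℕ) (d-vector : ∀ i → dVector D₀ S e i ≡ + a i)
    (x : Fin n → K) (x-pos : ∀ i → Pos (x i)) where
  private
    c≤m = ear-c≤m tri₀ E
    lam = Construction.lambda tri₀ x x-pos
    open Lambda lam using (Λ)
    module P = Polygon tri₀
    module R = RotatedAt tri₀ c≤m
    open R using (D)
    triS : IsTriangulation n (tri S)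
    triS = LambdaLengths.Labelled.triangulation (LambdaLengths.labelled x-pos lam tri₀ reachable)
    module PS = Polygon triS
    module RS = RotatedAt triS c≤m
    open Evaluate x x-pos

    X : ℕ → ℕ → K
    X = R.X x-pos lam

    root-label : D i₀ ≡ (0 , suc n)
    root-label = ear-root tri₀ E

    in-cycle′ : ∀ {i j} → Arrow D i j → ∃ λ k → Arrow D j k × Arrow D k i
    in-cycle′ {i} {j} y with in-cycle (R.rotate-arrow⁻¹ {i} {j} y)
    ... | k , u , v = k , R.rotate-arrow {j} {k} u , R.rotate-arrow {k} {i} v

    -- Rotation renumbers the vertices of the polygon but leaves the arrows between the diagonals
    -- unchanged, so the formula keeps the quiver of `D₀`.
    Q-arrow : ∀ i j → quiverOf D₀ i j ≡ ⟦ Arrows.arrow? R.rotated i j ⟧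
    Q-arrow i j = Arrows.quiver-≡ tri₀ i j ⨾ ⟦⟧-⇔ (Arrows.arrow? tri₀ i j) (Arrows.arrow? R.rotated i j)
        (R.rotate-arrow {i} {j}) (R.rotate-arrow⁻¹ {i} {j})

    fresh : ∀ k → 0 < e k → ∀ l → RS.D k ≢ D l
    fresh k pos l eq = proj₁ (dVector-count {S = S} triS e a d-vector) k pos l
      (sym (PS.D-norm k) ⨾ (P.norm-ρ-injective c≤m (PS.D-bound₁ k) (PS.D-bound₂ k) (P.D-bound₁ l) (P.D-bound₂ l) eq
          ⨾ P.D-norm l))

    crossing-≡ : ∀ l k → (if crossB (tri S k) (D₀ l) then 1 else 0) ≡ ⟦ crossing? (D l) (RS.D k) ⟧
    crossing-≡ l k = cong (λ b → if b then 1 else 0) (sym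
        (R.crossB-rotate (PS.D-bound₁ k) (PS.D-bound₂ k) (P.D-bound₁ l) (P.D-bound₂ l)
        (proj₁ (PS.isDiag k)) (proj₁ (P.isDiag l)))) ⨾
      ⟦⟧-⇔ (T? (crossB (RS.D k) (D l))) (crossing? (D l) (RS.D k)) (crossB⇒Crossing {RS.D k} {D l})
          (Crossing⇒crossB {RS.D k} {D l})

    a-count : ∀ l → a l ≡ sumℕ (λ k → e k ℕ.* ⟦ crossing? (D l) (RS.D k) ⟧)
    a-count l = proj₂ (dVector-count {S = S} triS e a d-vector) l ⨾ sumℕ-cong λ k → cong (e k ℕ.*_) (crossing-≡ l k)

    module F = Formula R.rotated root-label in-cycle′ (quiverOf D₀) Q-arrow x x-pos a
    module A = RootArcs R.rotated RS.rotated e a X (suc (suc n)) (R.X-pos x-pos lam) (R.X-boundary x-pos lam)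
        (R.X-ptolemy x-pos lam)
      (λ l → proj₂ (Rooted.all-in R.rotated root-label in-cycle′ l)) fresh a-count

  value : K
  value = ∏ (λ k → pow (Λ (tri S k)) (e k))

  monomial : clusterMonomial S e ≐ value
  monomial = LambdaLengths.monomial-value x-pos lam tri₀ reachable e

  abstract
    formula : gcsFormula (quiverOf D₀) i₀ a ≐ value
    formula = subst (gcsFormula (quiverOf D₀) i₀ a ≐_)
      (A.arcs-product ⨾ ∏-cong λ k → cong (λ y → pow y (e k))
          (R.X-rotate x-pos lam (PS.D-bound₁ k) (PS.D-bound₂ k) ⨾ cong Λ (PS.D-norm k)))
      (F.formula-value X (suc (suc n)) (R.X-label x-pos lam) (R.X-pos x-pos lam) (R.X-boundary x-pos lam)
          (R.X-ptolemy x-pos lam)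
        refl ℕP.≤-refl (R.X-top x-pos lam) A.arcs)

theorem4p1 : (n : ℕ) → 2 ≤ n →
    (D0 : Fin n → Diag) → IsTriangulation n D0 →
    (∀ i j → 0 < quiverOf D0 i j →
    ∃ λ k → (0 < quiverOf D0 j k) × (0 < quiverOf D0 k i)) →
    (i0 : Fin n) → degree (quiverOf D0) i0 ≡ 2 →
    (S : Seed n) → Reachable D0 S → (m : Fin n → ℕ) →
    (a : Fin n → ℕ) → (∀ i → dVector D0 S m i ≡ + a i) →
    clusterMonomial S m ≈F gcsFormula (quiverOf D0) i0 a
theorem4p1 n _ D0 triang cyclic i0 deg S reachable m a d-vector =
  ≈F-by-evaluation (clusterMonomial S m) (gcsFormula (quiverOf D0) i0 a)
    (λ x → Expand.value triang in-cycle ear₀ reachable m a d-vector (natPoint x) (λ i → pos-ι (x i)))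
    (λ x → Expand.monomial triang in-cycle ear₀ reachable m a d-vector (natPoint x) (λ i → pos-ι (x i)))
    (λ x → Expand.formula triang in-cycle ear₀ reachable m a d-vector (natPoint x) (λ i → pos-ι (x i)))
  where
  open Arrows triang
  quiver⇒ : ∀ {i j} → 0 < quiverOf D0 i j → Arrow D0 i j
  quiver⇒ {i} {j} h = ⟦⟧-true (arrow? i j) (subst (0 <_) (quiver-≡ i j) h)
  quiver⇐ : ∀ {i j} → Arrow D0 i j → 0 < quiverOf D0 i j
  quiver⇐ {i} {j} h = subst (0 <_) (sym (quiver-≡ i j ⨾ ⟦⟧-yes (arrow? i j) h)) (s≤s z≤n)
  in-cycle : ∀ {i j} → Arrow D0 i j → ∃ λ k → Arrow D0 j k × Arrow D0 k i
  in-cycle {i} {j} h with cyclic i j (quiver⇐ h)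
  ... | k , u , v = k , quiver⇒ u , quiver⇒ v
  ear₀ : Ear D0 i0
  ear₀ = ear-at triang in-cycle i0 deg
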